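{- In the bipartite agent–item setting described in the context, let $\mathcal{F}_{A,E}=(E,\mathcal{I}_A)$ be the combination of the systems $(E_{A,j},\mathcal{I}_{A,j})$, $j\in[M_A]$, where each $(E_{A,j},\mathcal{I}_{A,j})$ is a $k_j$-growth system, and let $\mathcal{F}_{B,E}=(E,\mathcal{I}_B)$ be the combination of the systems $(E_{B,j},\mathcal{I}_{B,j})$, $j\in[M_B]$, where each $(E_{B,j},\mathcal{I}_{B,j})$ is an $\ell_j$-growth system. Let $\mathcal{F}=(E,\mathcal{I})$ with $\mathcal{I}=\mathcal{I}_A\cap\mathcal{I}_B$, let $k=\max_{e\in E}\big(\sum_{j:\,e\in E_{A,j}}k_j+\sum_{j:\,e\in E_{B,j}}\ell_j\big)$, and let $\mathcal{A}$ be a $(q,\alpha)$ order-oblivious core-selecting (OOCS) algorithm for $\mathcal{F}_{B,E}$. Then, for $p=\sqrt{1-1/(k+1)}$, the Agent-arrival Free-Order Secretary algorithm (described in the context) has utility-competitive ratio at least $$\frac{\alpha(1-q)}{4}\Big(2-2\sqrt{1+\frac1k}+\frac1k\Big),\qquad\text{where}\quad \frac14\Big(2-2\sqrt{1+\frac1k}+\frac1k\Big)\;>\;\frac{1}{16k^2}-\frac{1}{32k^3}.$$ Furthermore, if all components are matroids, i.e. $(E,\mathcal{I}_A\cap\mathcal{I}_B)$ is a $k$-matchoid with all $k_j=1$ and all $\ell_j=1$ and $|\{j:e\in E_{A,j}\}|+|\{j:e\in E_{B,j}\}|\le k$ for every $e\in E$, then for $p=1-\frac{1}{2k}$ the algorithm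 has utility-competitive ratio at least $$\frac{\alpha(1-q)}{16k^2}.$$
   Context: An independence system $(S,\mathcal{I})$ is a finite set $S$ with a nonempty downward-closed family $\mathcal{I}\subseteq 2^S$ of independent sets; circuits are minimal non-independent sets; a basis of $X\subseteq S$ is a maximal independent subset of $X$. The combination of $(S_j,\mathcal{I}_j)$, $j\in[M]$, is $(S,\mathcal{I})$ with $S=\bigcup_jS_j$, $\mathcal{I}=\{I\subseteq S: I\cap S_j\in\mathcal{I}_j\ \forall j\}$. $(S,\mathcal{I})$ is a $k$-growth system ($k$ a positive integer) if for all $X\subseteq S$, $I\in\mathcal{I}$ there is a partition $(Q,Z)$ of $I\setminus X$ with $|Z|\le k|X\setminus I|$ such that $P\cup Q\in\mathcal{I}$ for every basis $P$ of $X$. (The 1-growth systems are exactly matroids.) Write $X+e=X\cup\{e\}$, $X-e=X\setminus\{e\}$, $w(X)=\sum_{x\in X}w(x)$. Setting: $G=(A\cup B,E)$ is a finite bipartite graph (agents $A$, items $B$), $w:E\to\mathbb{R}_{\ge0}$ is injective, and $\delta(v)$, $\delta(Y)$ denote the sets of edges incident to a vertex $v$, resp. to a vertex set $Y\subseteq A$. The agent-side constraint is a combination $\mathcal{F}_A$ on $A$ of systems $(A_j,\mathcal{J}_j)$, $j\in[M_A]$, and the item-side constraint is a combination $\mathcal{F}_B$ on $B$ of systems $(B_j,\mathcal{L}_j)$, $j\in[M_B]$ (so $A=\bigcup_jA_j$, $B=\bigcup_jB_j$). They are transferred to edges, treating all edges at the same agent (resp. item) as parallel copies: $E_{A,j}$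 is the set of edges incident to $A_j$, and $\mathcal{I}_{A,j}$ consists of the sets $X\subseteq E_{A,j}$ such that each agent is incident to at most one edge of $X$ and the set of agents incident to $X$ belongs to $\mathcal{J}_j$; likewise $E_{B,j}$ is the set of edges incident to $B_j$, and $\mathcal{I}_{B,j}$ consists of the $X\subseteq E_{B,j}$ such that each item is incident to at most one edge of $X$ and the set of items incident to $X$ belongs to $\mathcal{L}_j$. Graph and constraints are known; weights are hidden. In the free-order agent-arrival model the algorithm chooses which agent to reveal next; revealing $a$ reveals the weights of all edges in $\delta(a)$, and edges of $\delta(a)$ must be accepted or rejected irrevocably at that time, the accepted set always being in $\mathcal{I}$. An algorithm with random output $\mathrm{ALG}\in\mathcal{I}$ has utility-competitive ratio at least $c$ if $\mathbb{E}[w(\mathrm{ALG})]\ge c\,w(\mathrm{OPT}(E))$, where $\mathrm{OPT}(E)$ is a maximum-weight set in $\mathcal{I}$. Primitive hull and core of an independence system $(S,\mathcal{I})$: $\mathrm{PHull}(X)=X\cup\{e\in S:e\text{ belongs to some circuit contained in }X+e\}$ and $\mathrm{PCore}(X)=\{e\in X:e\notin\mathrm{PHull}(\{f\in X:w(f)>w(e)\})\}$. For a combination of $(S_j,\mathcal{I}_j)$, with primitive hulls $\mathrm{PHull}_j$ and primitive cores $\mathrm{PCore}_j$ of the components: $\mathrm{Hull}(X)=\bigcup_j\mathrm{PHull}_j(X\cap S_j)$ and $\mathrm{Core}(X)=\bigcap_j\big((X\setminus S_j)\cup\mathrm{PCore}_j(X\cap S_j)\big)$. $\mathrm{Hull}_A$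 denotes the hull of the agent-side combination $\mathcal{F}_A$ (a function on subsets of $A$). OOCS algorithms: Let $(S,\mathcal{I})$ be an independence system (given as a combination) with hidden weights. An algorithm $\mathcal{A}_r$ with internal random bits $r$ works as follows. It knows $(S,\mathcal{I})$. The true ground set is a subset $X\subseteq S$ unknown to it. It observes a random sample $Y\subseteq X$ containing each element of $X$ independently with probability $q$, with the weights, and selects none of it; then the elements of $X\setminus Y$ are presented one by one in an order $\sigma$ that may depend on $Y$ but not on $r$, and each is irrevocably accepted or rejected upon presentation, keeping the accepted set $\mathrm{ALG}$ in $\mathcal{I}$. The algorithm is $(q,\alpha)$-OOCS if for every $X\subseteq S$ and every $e\in\mathrm{Core}(X)$, with $Y$ containing each element of $X-e$ independently with probability $q$, $$\mathbb{E}_{Y\sim X-e}\Big[\min_\sigma\Pr_r[e\in\mathrm{ALG}\mid e\notin Y]\Big]\ge\alpha,$$ the minimum being over all orderings $\sigma$ of $X\setminus Y$. $\mathrm{Greedy}(X)$ for $X\subseteq E$: process the edges of $X$ in decreasing order of $w$, starting from $\emptyset$, adding an edge whenever the current set stays in $\mathcal{I}$. An edge $e\notin X$ is greedy-relevant with respect to $X$ if $e\in\mathrm{Greedy}(X+e)$. For $Y\subseteq A$ and $a\in A\setminus Y$, $\mathrm{toprel}(a,Y)$ is the heaviest edge in $\delta(a)$ that is greedy-relevant with respect to $\delta(Y)$, or $\bot$ if none exists. $\mathrm{Rel}(Y)=\{\mathrm{toprel}(a,Y): a\in A\setminus Y,\ \mathrm{toprel}(a,Y)\ne\bot\}$. Agent-arrival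 Free-Order Secretary algorithm with parameter $p$ and $(q,\alpha)$-OOCS algorithm $\mathcal{A}$ for $\mathcal{F}_{B,E}$: 1. $\mathrm{ALG}=\emptyset$, $p_1=p$, $p_2=p_1+(1-p_1)q$, $p_3=(1+p_2)/2$. Choose $t_a$ independently and uniformly from $(0,1)$ for each $a\in A$; $Y=\{a:t_a\in(0,p_1)\}$, $S_0=\{a:t_a\in[p_1,p_2)\}$, $S_1=\{a:t_a\in[p_2,p_3)\}$, $S_2=\{a:t_a\in[p_3,1]\}$. 2. Reveal, without accepting anything, all agents of $Y\cup S_0\cup S_1$. Let $U=S_2$, $E_0=\mathrm{Rel}(Y)\cap\delta(S_0)$, $E_1=\mathrm{Rel}(Y)\cap\delta(S_1)$. Run $\mathcal{A}$ on $\mathcal{F}_{B,E}$ with (unknown) true ground set $\mathrm{Rel}(Y)$ and sample $E_0$; the top-relevant edges of agents of $S_2$ are presented to $\mathcal{A}$ when those agents are revealed (edges of $E_1$ may be regarded as presented at the end). Sort $E_1$ in decreasing order of weight as $e_1,\dots,e_m$, and let $a_i$ be the agent incident to $e_i$. 3. For $j=1,\dots,m$: let $Q=U\cap\mathrm{Hull}_A(\{a_1,\dots,a_j\})$; for each $a\in Q$ in uniformly random order, remove $a$ from $U$ and reveal it; if $\mathrm{toprel}(a,Y)=\bot$ skip to the next agent; otherwise let $f=\mathrm{toprel}(a,Y)$, and if $w(f)>w(e_j)$, $\mathcal{A}$ selects $f$, and $\mathrm{ALG}+f\in\mathcal{I}_A\cap\mathcal{I}_B$, add $f$ to $\mathrm{ALG}$.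 4. For each remaining $a\in U$ in uniformly random order: if $f=\mathrm{toprel}(a,Y)\neq\bot$, $\mathcal{A}$ selects $f$, and $\mathrm{ALG}+f\in\mathcal{I}_A\cap\mathcal{I}_B$, add $f$ to $\mathrm{ALG}$. Return $\mathrm{ALG}$. -}

module Defs where

open import Level using (0ℓ)
open import Algebra.Structures using (IsCommutativeRing)
open import Data.Bool.Base using (Bool; true; false; not; _∧_; _∨_; if_then_else_)
import Data.Bool.Properties as Bool
open import Data.Fin.Base using (Fin; toℕ)
open import Data.Fin.Properties using (_≟_; any?; all?)
open import Data.Fin.Subset
  using (Subset; inside; outside; _∈_; _∉_; _⊆_; _⊂_; _∪_; _∩_; _─_; ⋃; ⋂; ⁅_⁆; ∣_∣; ⊤; ⊥)
open import Data.Fin.Subset.Properties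
  using (_∈?_; _⊆?_; _⊂?_; anySubset?; ⊥⊆; p∩q⊆p; p∩q⊆q; x∈p∩q⁺; x∈p∩q⁻; ⊆⊤; ∉⊥)
open import Data.List.Base
  using (List; []; _∷_; _++_; _∷ʳ_; map; filter; foldr; foldl; head; length; sum; allFin; cartesianProductWith)
import Data.List.Properties as List
open import Data.List.NonEmpty as List⁺ using (List⁺)
open import Data.List.Relation.Binary.Permutation.Propositional using (_↭_)
import Data.List.Sort as Sort
open import Data.Maybe.Base using (Maybe; just; nothing)
import Data.Maybe.Properties as Maybe
open import Data.Nat.Base as ℕ using (ℕ; zero; suc; _⊔_; _!)
open import Data.Product.Base using (∃; _×_; _,_; proj₁; proj₂)
open import Data.Vec.Base using (Vec; []; _∷_; tabulate)
import Data.Vec.Properties as Vec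
open import Function.Base using (_∘_)
open import Function.Definitions using (Injective)
open import Relation.Binary.Bundles using (DecTotalOrder)
import Relation.Binary.Construct.Flip.EqAndOrd as Flip
import Relation.Binary.Construct.NonStrictToStrict as Strict
import Relation.Binary.Construct.On as On
open import Relation.Binary.Definitions using (DecidableEquality)
open import Relation.Binary.PropositionalEquality using (_≡_; _≢_; _≗_; refl; sym; trans; cong; subst)
open import Relation.Binary.Structures using (IsDecTotalOrder)
open import Relation.Nullary using (¬_; Dec; yes; no; does; ¬?; _×-dec_; _→-dec_; contradiction)
open import Relation.Nullary.Decidable using (map′; decidable-stable)
open import Relation.Unary using (Pred; Decidable)

-- Axiomatised as a Dedekind-complete ordered field.
-- Classically this determines ℝ up to isomorphism; the total order is
-- decidable because the secretary algorithm compares real weights.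

record RealNumbers : Set₁ where
  infixl 6 _+_ _-_
  infixl 7 _*_ _/_
  infix  8 -_ _⁻¹
  infix  4 _≤_ _<_ _≤?_ _<?_
  field
    ℝ                 : Set
    _+_ _*_           : ℝ → ℝ → ℝ
    -_ _⁻¹            : ℝ → ℝ
    0# 1#             : ℝ
    _≤_               : ℝ → ℝ → Set
    isCommutativeRing : IsCommutativeRing _≡_ _+_ _*_ -_ 0# 1#
    0≢1               : 0# ≢ 1#
    -- The value of 0# ⁻¹ is unspecified.
    *-inverse         : ∀ x → x ≢ 0# → x * x ⁻¹ ≡ 1#
    isDecTotalOrder   : IsDecTotalOrder _≡_ _≤_
    +-monoˡ-≤         : ∀ z {x y} → x ≤ y → x + z ≤ y + z
    *-nonNeg          : ∀ {x y} → 0# ≤ x → 0# ≤ y → 0# ≤ x * y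

  UpperBound : (ℝ → Set) → ℝ → Set
  UpperBound P u = ∀ x → P x → x ≤ u

  field
    supremum : ∀ P → ∃ P → ∃ (UpperBound P) →
               ∃ λ s → UpperBound P s × (∀ u → UpperBound P u → s ≤ u)

  private module Order = IsDecTotalOrder isDecTotalOrder

  ≤-decTotalOrder : DecTotalOrder 0ℓ 0ℓ 0ℓ
  ≤-decTotalOrder = record { isDecTotalOrder = isDecTotalOrder }

  _<_ : ℝ → ℝ → Set
  _<_ = Strict._<_ _≡_ _≤_

  _≤?_ : ∀ x y → Dec (x ≤ y)
  _≤?_ = Order._≤?_

  _<?_ : ∀ x y → Dec (x < y)
  _<?_ = Strict.<-decidable _≡_ _≤_ Order._≟_ _≤?_

  _-_ _/_ : ℝ → ℝ → ℝ
  x - y = x + (- y)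
  x / y = x * y ⁻¹

  fromℕ : ℕ → ℝ
  fromℕ zero    = 0#
  fromℕ (suc n) = 1# + fromℕ n

  IsSqrt : ℝ → ℝ → Set
  IsSqrt s x = 0# ≤ s × s * s ≡ x

  min : ℝ → ℝ → ℝ
  min x y = if does (x ≤? y) then x else y

  ∑ ∏ : {I : Set} → List I → (I → ℝ) → ℝ
  ∑ xs f = foldr _+_ 0# (map f xs)
  ∏ xs f = foldr _*_ 1# (map f xs)

open RealNumbers ⦃ ... ⦄ public

comprehension : ∀ {n} {P : Pred (Fin n) 0ℓ} → Decidable P → Subset n
comprehension P? = tabulate (does ∘ P?)

elements : ∀ {n} → Subset n → List (Fin n)
elements {n} X = filter (_∈? X) (allFin n)

allSubsets : ∀ n → List (Subset n)
allSubsets zero    = [] ∷ []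
allSubsets (suc n) = cartesianProductWith _∷_ (outside ∷ inside ∷ []) (allSubsets n)

_≟ˢ_ : ∀ {n} → DecidableEquality (Subset n)
_≟ˢ_ = Vec.≡-dec Bool._≟_

insertions : {A : Set} → A → List A → List⁺ (List A)
insertions x []       = List⁺.[ x ∷ [] ]
insertions x (y ∷ ys) = (x ∷ y ∷ ys) List⁺.∷⁺ List⁺.map (y ∷_) (insertions x ys)

orderings : {A : Set} → List A → List⁺ (List A)
orderings []       = List⁺.[ [] ]
orderings (x ∷ xs) = List⁺.concatMap (insertions x) (orderings xs)

comprehension⁺ : ∀ {n} {P : Pred (Fin n) 0ℓ} (P? : Decidable P) {x} →
                 P x → x ∈ comprehension P?
comprehension⁺ P? {x} px = Vec.lookup⇒[]= x _ (trans (Vec.lookup∘tabulate (does ∘ P?) x) lem)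
  where
  lem : does (P? x) ≡ true
  lem with P? x
  ... | yes _  = refl
  ... | no ¬px = contradiction px ¬px

comprehension⁻ : ∀ {n} {P : Pred (Fin n) 0ℓ} (P? : Decidable P) {x} →
                 x ∈ comprehension P? → P x
comprehension⁻ P? {x} x∈ with P? x | trans (sym (Vec.lookup∘tabulate (does ∘ P?) x)) (Vec.[]=⇒lookup x∈)
... | yes px | _  = px
... | no _   | ()

-- The ground set is a subset of an ambient Fin n,
-- so that the components of a combination may have different ground sets.

record IndependenceSystem (n : ℕ) : Set₁ where
  field
    ground        : Subset n
    Indep         : Pred (Subset n) 0ℓ
    indep?        : Decidable Indep
    indep⊆ground  : ∀ {I} → Indep I → I ⊆ ground
    inhabited     : ∃ Indep
    downward      : ∀ {I J} → J ⊆ I → Indep I → Indep J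

  IsBasis : Subset n → Subset n → Set
  IsBasis P X = P ⊆ X × Indep P × (∀ P′ → P ⊆ P′ → P′ ⊆ X → Indep P′ → P′ ≡ P)

  IsCircuit : Subset n → Set
  IsCircuit C = C ⊆ ground × ¬ Indep C × (∀ D → D ⊂ C → Indep D)

  circuit? : Decidable IsCircuit
  circuit? C = (C ⊆? ground) ×-dec ¬? (indep? C) ×-dec
    map′ (λ ∄D D D⊂C → decidable-stable (indep? D) λ ¬iD → ∄D (D , D⊂C , ¬iD))
         (λ ∀D (D , D⊂C , ¬iD) → ¬iD (∀D D D⊂C))
         (¬? (anySubset? λ D → (D ⊂? C) ×-dec ¬? (indep? D)))

  PHull : Subset n → Subset n
  PHull X = X ∪ comprehension λ e → (e ∈? ground) ×-dec
    anySubset? λ C → circuit? C ×-dec (e ∈? C) ×-dec (C ⊆? (X ∪ ⁅ e ⁆))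

  IsGrowth : ℕ → Set
  IsGrowth k = 1 ℕ.≤ k ×
    (∀ X I → X ⊆ ground → Indep I →
      ∃ λ Q → ∃ λ Z →
        Q ∪ Z ≡ I ─ X × Q ∩ Z ≡ ⊥ ×
        ∣ Z ∣ ℕ.≤ k ℕ.* ∣ X ─ I ∣ ×
        (∀ P → IsBasis P X → Indep (P ∪ Q)))

open IndependenceSystem using (ground; Indep; indep?; PHull; IsGrowth)

record Combination (n : ℕ) : Set₁ where
  field
    size  : ℕ
    part  : Fin size → IndependenceSystem n
    cover : ∀ x → ∃ λ j → x ∈ ground (part j)

  parts∋ : Fin n → List (Fin size)
  parts∋ x = filter (λ j → x ∈? ground (part j)) (allFin size)

  combined : IndependenceSystem n
  combined = record
    { ground       = ⊤
    ; Indep        = λ I → ∀ j → Indep (part j) (I ∩ ground (part j))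
    ; indep?       = λ I → all? λ j → indep? (part j) (I ∩ ground (part j))
    ; indep⊆ground = λ _ → ⊆⊤
    ; inhabited    = ⊥ , λ j → IndependenceSystem.downward (part j)
                       (λ x∈ → contradiction (p∩q⊆p ⊥ _ x∈) ∉⊥)
                       (proj₂ (IndependenceSystem.inhabited (part j)))
    ; downward     = λ {I} {J} J⊆I iI j → IndependenceSystem.downward (part j)
                       (λ x∈ → let (x∈J , x∈S) = x∈p∩q⁻ J (ground (part j)) x∈
                               in x∈p∩q⁺ (J⊆I x∈J , x∈S))
                       (iI j)
    }

  Hull : Subset n → Subset n
  Hull X = ⋃ (map (λ j → PHull (part j) (X ∩ ground (part j))) (allFin size))

open Combination using (size; part; parts∋; combined; Hull)

image : ∀ {m n} → (Fin m → Fin n) → Subset m → Subset n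
image f X = comprehension λ v → any? λ e → (e ∈? X) ×-dec (f e ≟ v)

-- The transfer of a vertex constraint to the edges: edges e with the same
-- endpoint f e are parallel copies.
module _ {m n : ℕ} (f : Fin m → Fin n) where

  parallel : IndependenceSystem n → IndependenceSystem m
  parallel S = record
    { ground       = E
    ; Indep        = λ X → X ⊆ E ×
                       (∀ e e′ → e ∈ X → e′ ∈ X → f e ≡ f e′ → e ≡ e′) ×
                       Indep S (image f X)
    ; indep?       = λ X → (X ⊆? E) ×-dec
                       (all? λ e → all? λ e′ →
                         (e ∈? X) →-dec (e′ ∈? X) →-dec (f e ≟ f e′) →-dec (e ≟ e′)) ×-dec
                       indep? S (image f X)
    ; indep⊆ground = proj₁
    ; inhabited    = ⊥ , ⊥⊆ , (λ e _ e∈ _ _ → contradiction e∈ ∉⊥) ,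
                       IndependenceSystem.downward S
                         (λ v∈ → let (_ , e∈ , _) = comprehension⁻ (im? ⊥) v∈ in contradiction e∈ ∉⊥)
                         (proj₂ (IndependenceSystem.inhabited S))
    ; downward     = λ {I} {J} J⊆I (I⊆E , inj , iI) →
                       (λ x∈ → I⊆E (J⊆I x∈)) ,
                       (λ e e′ e∈ e′∈ → inj e e′ (J⊆I e∈) (J⊆I e′∈)) ,
                       IndependenceSystem.downward S
                         (λ v∈ → let (e , e∈ , eq) = comprehension⁻ (im? J) v∈
                                 in comprehension⁺ (im? I) (e , J⊆I e∈ , eq))
                         iI
    }
    where
    E : Subset m
    E = comprehension λ e → f e ∈? ground S
    im? : (X : Subset m) → Decidable (λ v → ∃ λ e → e ∈ X × f e ≡ v)
    im? X v = any? λ e → (e ∈? X) ×-dec (f e ≟ v)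

  parallelCombination : Combination n → Combination m
  parallelCombination F = record
    { size  = size F
    ; part  = parallel ∘ part F
    ; cover = λ e → let (j , fe∈) = Combination.cover F (f e)
                    in j , comprehension⁺ (λ e → f e ∈? ground (part F j)) fe∈
    }

record BipartiteGraph : Set where
  field
    #A #B #E : ℕ
    agent    : Fin #E → Fin #A
    item     : Fin #E → Fin #B
    simple   : ∀ e e′ → agent e ≡ agent e′ → item e ≡ item e′ → e ≡ e′

record Market : Set₁ where
  field
    graph : BipartiteGraph
  open BipartiteGraph graph public
  field
    FA : Combination #A
    FB : Combination #B

  FAE FBE : Combination #E
  FAE = parallelCombination agent FA
  FBE = parallelCombination item FB

  Feasible : Subset #E → Set
  Feasible X = Indep (combined FAE) X × Indep (combined FBE) X

  feasible? : Decidable Feasible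
  feasible? X = indep? (combined FAE) X ×-dec indep? (combined FBE) X

  load : (Fin (size FA) → ℕ) → (Fin (size FB) → ℕ) → Fin #E → ℕ
  load k ℓ e = sum (map k (parts∋ FAE e)) ℕ.+ sum (map ℓ (parts∋ FBE e))

  maxLoad : (Fin (size FA) → ℕ) → (Fin (size FB) → ℕ) → ℕ
  maxLoad k ℓ = foldr _⊔_ 0 (map (load k ℓ) (allFin #E))

module _ ⦃ ℛ : RealNumbers ⦄ where

  Weight : ℕ → Set
  Weight n = Fin n → ℝ

  Admissible : ∀ {n} → Weight n → Set
  Admissible w = (∀ e → 0# ≤ w e) × Injective _≡_ _≡_ w

  weight : ∀ {n} → Weight n → Subset n → ℝ
  weight w X = ∑ (elements X) w

  sortDecreasing : ∀ {n} → Weight n → List (Fin n) → List (Fin n)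
  sortDecreasing w = Sort.sort (On.decTotalOrder (Flip.decTotalOrder ≤-decTotalOrder) w)

  -- Events are given by their indicator functions, and ℙ is meaningful only
  -- on events.  Only finite additivity is required.
  record ProbabilitySpace : Set₁ where
    field
      Ω       : Set
      Event   : (Ω → Bool) → Set
      ℙ       : (Ω → Bool) → ℝ
      event-≗ : ∀ {F G} → F ≗ G → Event F → Event G
      event-Ω : Event (λ _ → true)
      event-∁ : ∀ {F} → Event F → Event (not ∘ F)
      event-∩ : ∀ {F G} → Event F → Event G → Event (λ ω → F ω ∧ G ω)
      ℙ-≗     : ∀ {F G} → Event F → F ≗ G → ℙ F ≡ ℙ G
      ℙ-≥0    : ∀ {F} → Event F → 0# ≤ ℙ F
      ℙ-Ω     : ℙ (λ _ → true) ≡ 1#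
      ℙ-∪     : ∀ {F G} → Event F → Event G → (∀ ω → F ω ∧ G ω ≡ false) →
                ℙ (λ ω → F ω ∨ G ω) ≡ ℙ F + ℙ G

  -- 𝔼[w(T)], summed over the finitely many values of the random subset T.
  𝔼 : ∀ {n} (S : ProbabilitySpace) → Weight n → (ProbabilitySpace.Ω S → Subset n) → ℝ
  𝔼 {n} S w T = ∑ (allSubsets n) λ X →
    ProbabilitySpace.ℙ S (λ ω → does (T ω ≟ˢ X)) * weight w X

  PCore : ∀ {n} → IndependenceSystem n → Weight n → Subset n → Subset n
  PCore S w X = comprehension λ e → (e ∈? X) ×-dec
    ¬? (e ∈? PHull S (comprehension λ f → (f ∈? X) ×-dec (w e <? w f)))

  Core : ∀ {n} → Combination n → Weight n → Subset n → Subset n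
  Core F w X = ⋂ (map (λ j → let Sⱼ = ground (part F j) in
                         (X ─ Sⱼ) ∪ PCore (part F j) w (X ∩ Sⱼ))
                      (allFin (size F)))

  Sample : ℕ → Set
  Sample n = Vec (Maybe ℝ) n

  reveal : ∀ {n} → Weight n → Subset n → Sample n
  reveal w Y = tabulate λ e → if does (e ∈? Y) then just (w e) else nothing

  -- decide r s past c: with random bits r, is the element c accepted when it
  -- is presented after the sample s and the elements past (oldest first)?
  record OnlineAlgorithm (n : ℕ) : Set₁ where
    field
      seeds : ProbabilitySpace
    open ProbabilitySpace seeds public using () renaming (Ω to Seed)
    field
      decide     : Seed → Sample n → List (Fin n × ℝ) → Fin n × ℝ → Bool
      measurable : ∀ s past c → ProbabilitySpace.Event seeds (λ r → decide r s past c)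

    accepted : Seed → Weight n → Sample n → List (Fin n × ℝ) → List (Fin n) → Subset n
    accepted r w s past []      = ⊥
    accepted r w s past (e ∷ σ) =
      (if decide r s past (e , w e) then ⁅ e ⁆ else ⊥) ∪
      accepted r w s (past ∷ʳ (e , w e)) σ

    ALG : Seed → Weight n → Subset n → List (Fin n) → Subset n
    ALG r w Y σ = accepted r w (reveal w Y) [] σ

  record IsOOCS {n} (F : Combination n) (q α : ℝ) (𝒜 : OnlineAlgorithm n) : Set where
    open OnlineAlgorithm 𝒜
    open ProbabilitySpace seeds using (ℙ)

    -- ℙ[Y] for Y containing each element of X independently with probability q.
    sampleProbability : Subset n → Subset n → ℝ
    sampleProbability X Y = ∏ (elements X) λ x → if does (x ∈? Y) then q else 1# - q

    worstCase : Weight n → Subset n → Subset n → Fin n → ℝ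
    worstCase w X Y e = List⁺.foldr₁ min
      (List⁺.map (λ σ → ℙ (λ r → does (e ∈? ALG r w Y σ))) (orderings (elements (X ─ Y))))

    field
      0≤q      : 0# ≤ q
      q≤1      : q ≤ 1#
      feasible : ∀ w → Admissible w → ∀ X Y → Y ⊆ X → ∀ σ → σ ↭ elements (X ─ Y) →
                 ∀ r → Indep (combined F) (ALG r w Y σ)
      -- Y ranges over the subsets of X - e, so e ∉ Y always holds.
      selects  : ∀ w → Admissible w → ∀ X e → e ∈ Core F w X →
                 α ≤ ∑ (filter (_⊆? (X ─ ⁅ e ⁆)) (allSubsets n)) λ Y →
                       sampleProbability (X ─ ⁅ e ⁆) Y * worstCase w X Y e

  -- Joint source of the arrival times, of one random order of the agents
  -- for each round, and of the random bits of the item-side algorithm.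
  record RandomSource (#A : ℕ) (seeds : ProbabilitySpace) : Set₁ where
    field
      space : ProbabilitySpace
    open ProbabilitySpace space public
    open ProbabilitySpace seeds using () renaming (Ω to Seed; Event to SeedEvent; ℙ to ℙₛ)
    field
      time       : Ω → Fin #A → ℝ
      order      : Ω → ℕ → List (Fin #A)
      bits       : Ω → Seed
      time-range : ∀ ω a → 0# < time ω a × time ω a < 1#
      order-perm : ∀ ω i → order ω i ↭ allFin #A

    cylinder : (lo hi : Fin #A → ℝ) {N : ℕ} → (Fin N → List (Fin #A)) → (Seed → Bool) → Ω → Bool
    cylinder lo hi ρ F ω =
      does (all? λ a → (lo a ≤? time ω a) ×-dec (time ω a <? hi a)) ∧
      does (all? λ i → List.≡-dec _≟_ (order ω (toℕ i)) (ρ i)) ∧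
      F (bits ω)

    -- Times are uniform on (0,1), orders are uniform, bits have the law of
    -- seeds, and all of these are mutually independent.
    field
      law : ∀ lo hi → (∀ a → 0# ≤ lo a × lo a ≤ hi a × hi a ≤ 1#) →
            ∀ {N} (ρ : Fin N → List (Fin #A)) → (∀ i → ρ i ↭ allFin #A) →
            ∀ F → SeedEvent F →
            Event (cylinder lo hi ρ F) ×
            ℙ (cylinder lo hi ρ F) ≡
              ∏ (allFin #A) (λ a → hi a - lo a) *
              ∏ (allFin N) (λ _ → fromℕ (#A !) ⁻¹) *
              ℙₛ F

  module _ (M : Market) where

    open Market M

    IsOPT : Weight #E → Subset #E → Set
    IsOPT w T = Feasible T × (∀ X → Feasible X → weight w X ≤ weight w T)

    δ : Subset #A → Subset #E
    δ Y = comprehension λ e → agent e ∈? Y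

    addIfFeasible : Subset #E → Fin #E → Subset #E
    addIfFeasible X e = if does (feasible? (X ∪ ⁅ e ⁆)) then X ∪ ⁅ e ⁆ else X

    Greedy : Weight #E → Subset #E → Subset #E
    Greedy w X = foldl addIfFeasible ⊥ (sortDecreasing w (elements X))

    toprel : Weight #E → Fin #A → Subset #A → Maybe (Fin #E)
    toprel w a Y = head (filter (λ e → e ∈? Greedy w (δ Y ∪ ⁅ e ⁆))
                                (sortDecreasing w (elements (δ ⁅ a ⁆))))

    Rel : Weight #E → Subset #A → Subset #E
    Rel w Y = comprehension λ e → any? λ a →
      ¬? (a ∈? Y) ×-dec Maybe.≡-dec _≟_ (toprel w a Y) (just e)

    -- unrevealed is the pool U; presented lists what 𝒜 has seen so far.
    record State : Set where
      constructor state
      field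
        unrevealed : Subset #A
        presented  : List (Fin #E × ℝ)
        chosen     : Subset #E

    module FreeOrder (p q : ℝ) (𝒜 : OnlineAlgorithm #E) (w : Weight #E)
                     (t : Fin #A → ℝ) (order : ℕ → List (Fin #A))
                     (r : OnlineAlgorithm.Seed 𝒜) where

      open OnlineAlgorithm 𝒜 using (decide)

      p₁ p₂ p₃ : ℝ
      p₁ = p
      p₂ = p₁ + (1# - p₁) * q
      p₃ = (1# + p₂) / fromℕ 2

      Y S₀ S₁ S₂ : Subset #A
      Y  = comprehension λ a → (0# <? t a) ×-dec (t a <? p₁)
      S₀ = comprehension λ a → (p₁ ≤? t a) ×-dec (t a <? p₂)
      S₁ = comprehension λ a → (p₂ ≤? t a) ×-dec (t a <? p₃)
      S₂ = comprehension λ a → (p₃ ≤? t a) ×-dec (t a ≤? 1#)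

      E₀ E₁ : Subset #E
      E₀ = Rel w Y ∩ δ S₀
      E₁ = Rel w Y ∩ δ S₁

      -- The elements of E₁, presented to 𝒜 after all agents have been
      -- visited, do not influence the output.
      visit : (Fin #E → Bool) → State → Fin #A → State
      visit heavy (state U past X) a with toprel w a Y
      ... | nothing = state (U ─ ⁅ a ⁆) past X
      ... | just f  = state (U ─ ⁅ a ⁆) (past ∷ʳ (f , w f))
        (if heavy f ∧ decide r (reveal w E₀) past (f , w f) then addIfFeasible X f else X)

      visitAll : (Fin #E → Bool) → Subset #A → ℕ → State → State
      visitAll heavy Q j s = foldl (visit heavy) s (filter (_∈? Q) (order j))

      rounds : ℕ → Subset #A → List (Fin #E) → State → State
      rounds j seen []       s = visitAll (λ _ → true) (State.unrevealed s) j s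
      rounds j seen (e ∷ es) s = rounds (suc j) seen′ es
        (visitAll (λ f → does (w e <? w f)) (State.unrevealed s ∩ Hull FA seen′) j s)
        where
        seen′ : Subset #A
        seen′ = seen ∪ ⁅ agent e ⁆

      output : Subset #E
      output = State.chosen
        (rounds 0 ⊥ (sortDecreasing w (elements E₁)) (state S₂ [] ⊥))

    HasUtilityRatio : (p q : ℝ) → OnlineAlgorithm #E → ℝ → Set₁
    HasUtilityRatio p q 𝒜 c =
      ∀ w → Admissible w → (source : RandomSource #A (OnlineAlgorithm.seeds 𝒜)) →
      let open RandomSource source
          run = λ ω → FreeOrder.output p q 𝒜 w (time ω) (order ω) (bits ω)
      in (∀ ω → Feasible (run ω)) ×
         (∀ T → IsOPT w T → c * weight w T ≤ 𝔼 space w run)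

open IndependenceSystem public
open Combination public
open Market public

{-# OPTIONS --safe #-}
module Submission where

-- An edge is top-relevant for the sampled agents Y if it is the heaviest edge
-- of its agent that the greedy algorithm on δ(Y) would still accept; this does
-- not depend on whether its own agent lies in Y.  The top-relevant edges of
-- sampled agents form the greedy solution G, those of the other agents form
-- Rel(Y), so with T the expected weight of all top-relevant edges
-- 𝔼 w(G) = p T and 𝔼 w(Rel(Y)) = (1 − p) T, while k-growth makes greedy
-- k-approximate: w(OPT) ≤ k T.  Call a top-relevant edge bad if the heavier
-- edges of Rel(Y) block it in some component.  Counting over prefixes in
-- weight order, growth bounds the bad edges of G by k w(Rel(Y)), and for
-- matroids even all bad edges.  Hence the good edges of Rel(Y), which are core
-- edges, weigh at least (1 − p)(1/k − (1 − p)/p) w(OPT) in expectation,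
-- respectively (1 − p)(1/k − (1 − p)) w(OPT) for matroids.
--
-- A good edge e with agent in S₂ is revealed when its agent enters the hull of
-- the S₁-agents seen so far.  Exchanging the roles of S₁ and S₂ shows that with
-- probability at least ½ this happens no later (in weight order) than entering
-- the hull of the other S₂-agents; then the agents accepted before do not span
-- that of e, and e is accepted whenever 𝒜 selects it.  With
-- ℙ[a ∈ S₂ | a ∉ Y] = (1 − q)/2 this gives the factor α(1 − q)/4.

-- The source of randomness is only finitely additive, and its law is known only on cylinders. A run
-- reads just the phase of every agent, the first `suc m` orders and the random bits, so the sample
-- space splits into finitely many boxes of known probability. Summed over the boxes, the uniform
-- times become three independent layers of coins, of biases p, q and ½, which settle Y, then S₀,
-- then the choice between S₁ and S₂. The average over Y is exact for the following reason: while e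
-- is top-relevant, no heavier edge of its agent is ever chosen, so moving that agent into or out of
-- Y changes nothing above e. Hence the bad weight of the sampled side, where the edges form an
-- independent set and growth applies, is p times the whole bad weight; this costs a factor 1/p. The
-- obstacle on the other side is that Rel(Y) need not be independent. In matroids the unblocked
-- edges of Rel(Y) are independent and span every blocked edge, so all bad edges can be counted
-- directly and the factor is saved. Badness refers to Rel(Y) because that is the ground set of 𝒜:
-- one notion then serves the core condition on the item side and the hull condition on the agent
-- side.

open import Defs
open import Level using (0ℓ)
open import Algebra.Bundles using (CommutativeRing)
import Algebra.Solver.Ring as RingSolver
open import Algebra.Solver.Ring.AlmostCommutativeRing
  using (AlmostCommutativeRing; fromCommutativeRing; _-Raw-AlmostCommutative⟶_)
import Algebra.Properties.Ring as RingProperties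
open import Data.Bool.Base using (Bool; true; false; not; _∧_; _∨_; if_then_else_; T)
import Data.Bool.Properties as Bool
open import Data.Empty using () renaming (⊥ to Empty; ⊥-elim to Empty-elim)
open import Data.Fin.Base using (Fin; zero; suc; toℕ; fromℕ<)
open import Data.Fin.Induction using (spo-wellFounded)
import Data.Fin.Properties as Fin
open import Data.Fin.Properties using (_≟_; any?; all?; ¬∀⟶∃¬; toℕ-fromℕ<)
open import Data.Fin.Subset
  using (Subset; inside; outside; _∈_; _∉_; _⊆_; _⊂_; _⊃_; _∪_; _∩_; _─_; ⋃; ⋂; ⁅_⁆; ∣_∣; ∁; Nonempty)
  renaming (⊥ to ∅)
open import Data.Fin.Subset.Induction using (⊂-wellFounded; ⊃-wellFounded)
open import Data.Fin.Subset.Properties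
  using (_∈?_; _⊆?_; _⊂?_; anySubset?; nonempty?; ∪-assoc; ⊆-antisym; p∩q⊆p; p∩q⊆q; x∈p∩q⁺; x∈p∩q⁻; x∈p∪q⁺; x∈p∪q⁻;
         p─q⊆p; x∈p∧x∉q⇒x∈p─q; ∉⊥; ⊥⊆; ∈⊤; x∈⁅x⁆; x∈⁅y⁆⇒x≡y; p⊆q⇒∣p∣≤∣q∣; p⊂q⇒∣p∣<∣q∣)
import Data.Integer.Base as ℤ
import Data.Integer.Properties as ℤ
open import Data.List.Base
  using (List; []; _∷_; _++_; _∷ʳ_; map; filter; foldr; foldl; head; length; allFin; cartesianProductWith; cartesianProduct; deduplicate)
open import Data.List.Membership.Propositional using (lose) renaming (_∈_ to _∈ˡ_; _∉_ to _∉ˡ_)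
import Data.List.Membership.Propositional.Properties as Mem
import Data.List.Properties as List
open import Data.List.NonEmpty as List⁺ using (List⁺)
open import Data.List.Relation.Binary.Permutation.Propositional
  using (_↭_; ↭-refl; ↭-sym; ↭-trans; ↭-prep)
import Data.List.Relation.Binary.Permutation.Propositional.Properties as Perm
open import Data.List.Relation.Unary.All as All using (All; []; _∷_)
import Data.List.Relation.Unary.All.Properties as All
open import Data.List.Relation.Unary.AllPairs as AllPairs using (AllPairs; []; _∷_)
import Data.List.Relation.Unary.AllPairs.Properties as AllPairs
open import Data.List.Relation.Unary.Any using (Any; here; there)
import Data.List.Relation.Unary.Sorted.TotalOrder.Properties as Sorted
open import Data.List.Relation.Unary.Unique.Propositional using (Unique)
import Data.List.Relation.Unary.Unique.Propositional.Properties as Unique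
import Data.List.Sort as Sort
open import Data.Maybe.Base using (Maybe; just; nothing)
import Data.Maybe.Properties as Maybe
open import Data.Nat.Base as ℕ using (ℕ; zero; suc; NonZero)
import Data.Nat.Properties as ℕ
open import Data.Product.Base using (∃; ∃₂; _×_; _,_; proj₁; proj₂)
open import Data.Sum.Base using (_⊎_; inj₁; inj₂)
open import Data.Vec.Base using (Vec; []; _∷_; tabulate; lookup; zipWith)
import Data.Vec.Base as Vec
import Data.Vec.Properties as Vec
open import Function.Base using (_∘_; id; case_of_)
open import Function.Definitions using (Injective)
open import Induction.WellFounded using (Acc; acc; WellFounded)
open import Relation.Binary.Bundles using (DecTotalOrder)
import Relation.Binary.Construct.Flip.EqAndOrd as Flip
import Relation.Binary.Construct.On as On
open import Relation.Binary.Definitions using (DecidableEquality)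
open import Relation.Binary.PropositionalEquality
  using (_≡_; _≢_; refl; sym; cong; cong₂; subst; subst₂; isEquivalence; module ≡-Reasoning) renaming (trans to infixr 5 _■_)
open import Relation.Binary.Structures using (IsDecTotalOrder)
open import Relation.Nullary using (¬_; Dec; yes; no; does; ¬?; _×-dec_; _→-dec_; contradiction)
open import Relation.Nullary.Decidable using (decidable-stable; dec-true; dec-false)
open import Relation.Unary using (Pred; Decidable)
import Data.List.NonEmpty.Properties as List⁺
import Data.List.Relation.Unary.Unique.DecPropositional.Properties as UniqueDec
import Data.List.Relation.Unary.Any as Any
import Relation.Binary.Reasoning.PartialOrder as PosetReasoning

-- Ordered fields

module _ ⦃ ℛ : RealNumbers ⦄ where

  ℝ-commutativeRing : CommutativeRing 0ℓ 0ℓ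
  ℝ-commutativeRing = record { isCommutativeRing = isCommutativeRing }

  module ℝ-Ring = CommutativeRing ℝ-commutativeRing
  module ℝ-RingProperties = RingProperties ℝ-Ring.ring

  fromℕ-+ : ∀ m n → fromℕ (m ℕ.+ n) ≡ fromℕ m + fromℕ n
  fromℕ-+ zero    n = sym (ℝ-Ring.+-identityˡ _)
  fromℕ-+ (suc m) n = cong (1# +_) (fromℕ-+ m n) ■ sym (ℝ-Ring.+-assoc _ _ _)

  fromℕ-* : ∀ m n → fromℕ (m ℕ.* n) ≡ fromℕ m * fromℕ n
  fromℕ-* zero    n = sym (ℝ-Ring.zeroˡ _)
  fromℕ-* (suc m) n = begin
    fromℕ (n ℕ.+ m ℕ.* n)              ≡⟨ fromℕ-+ n (m ℕ.* n) ⟩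
    fromℕ n + fromℕ (m ℕ.* n)          ≡⟨ cong₂ _+_ (sym (ℝ-Ring.*-identityˡ _)) (fromℕ-* m n) ⟩
    1# * fromℕ n + fromℕ m * fromℕ n   ≡⟨ ℝ-Ring.distribʳ _ _ _ ⟨
    (1# + fromℕ m) * fromℕ n           ∎
    where open ≡-Reasoning

  private
    -- fromℤ 1 is 1# on the nose, so that solver equations may mention 1#.
    fromℤ : ℤ.ℤ → ℝ
    fromℤ (ℤ.+ 1)     = 1#
    fromℤ (ℤ.+ n)     = fromℕ n
    fromℤ ℤ.-[1+ n ]  = - fromℕ (suc n)

    fromℤ-+ⁿ : ∀ n → fromℤ (ℤ.+ n) ≡ fromℕ n
    fromℤ-+ⁿ 0             = refl
    fromℤ-+ⁿ 1             = sym (ℝ-Ring.+-identityʳ 1#)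
    fromℤ-+ⁿ (suc (suc n)) = refl

    fromℤ-⊖ : ∀ m n → fromℤ (m ℤ.⊖ n) ≡ fromℕ m - fromℕ n
    fromℤ-⊖ m zero = fromℤ-+ⁿ m ■ sym (cong (fromℕ m +_) ℝ-RingProperties.-0#≈0# ■ ℝ-Ring.+-identityʳ _)
    fromℤ-⊖ zero (suc n) = sym (ℝ-Ring.+-identityˡ _)
    fromℤ-⊖ (suc m) (suc n) = begin
      fromℤ (suc m ℤ.⊖ suc n)              ≡⟨ cong fromℤ (ℤ.[1+m]⊖[1+n]≡m⊖n m n) ⟩
      fromℤ (m ℤ.⊖ n)                      ≡⟨ fromℤ-⊖ m n ⟩
      fromℕ m - fromℕ n                    ≡⟨ cong (_- fromℕ n) (ℝ-Ring.+-identityˡ _) ⟨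
      0# + fromℕ m - fromℕ n               ≡⟨ cong (λ z → z + fromℕ m - fromℕ n) (ℝ-Ring.-‿inverseʳ 1#) ⟨
      1# - 1# + fromℕ m - fromℕ n          ≡⟨ cong (_- fromℕ n) (ℝ-Ring.+-assoc _ _ _) ⟩
      1# + (- 1# + fromℕ m) - fromℕ n      ≡⟨ cong (λ z → 1# + z - fromℕ n) (ℝ-Ring.+-comm _ _) ⟩
      1# + (fromℕ m - 1#) - fromℕ n        ≡⟨ cong (_- fromℕ n) (ℝ-Ring.+-assoc _ _ _) ⟨
      1# + fromℕ m - 1# - fromℕ n          ≡⟨ ℝ-Ring.+-assoc _ _ _ ⟩
      1# + fromℕ m + (- 1# - fromℕ n)      ≡⟨ cong (1# + fromℕ m +_) (ℝ-RingProperties.-‿+-comm _ _) ⟩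
      1# + fromℕ m - (1# + fromℕ n)        ∎
      where open ≡-Reasoning

    fromℤ-+ : ∀ x y → fromℤ (x ℤ.+ y) ≡ fromℤ x + fromℤ y
    fromℤ-+ (ℤ.+ m) (ℤ.+ n) = fromℤ-+ⁿ (m ℕ.+ n) ■ fromℕ-+ m n ■ sym (cong₂ _+_ (fromℤ-+ⁿ m) (fromℤ-+ⁿ n))
    fromℤ-+ (ℤ.+ m) ℤ.-[1+ n ] = fromℤ-⊖ m (suc n) ■ sym (cong (_- fromℕ (suc n)) (fromℤ-+ⁿ m))
    fromℤ-+ ℤ.-[1+ m ] (ℤ.+ n) = fromℤ-⊖ n (suc m) ■ sym (cong (_- fromℕ (suc m)) (fromℤ-+ⁿ n)) ■ ℝ-Ring.+-comm _ _
    fromℤ-+ ℤ.-[1+ m ] ℤ.-[1+ n ] =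
      cong -_ (cong (1# +_) (cong fromℕ (sym (ℕ.+-suc m n))) ■ fromℕ-+ (suc m) (suc n))
      ■ sym (ℝ-RingProperties.-‿+-comm _ _)

    fromℤ-neg : ∀ x → fromℤ (ℤ.- x) ≡ - fromℤ x
    fromℤ-neg (ℤ.+ 0)         = sym ℝ-RingProperties.-0#≈0#
    fromℤ-neg (ℤ.+ 1)         = cong -_ (ℝ-Ring.+-identityʳ 1#)
    fromℤ-neg (ℤ.+ suc (suc n)) = refl
    fromℤ-neg ℤ.-[1+ n ]      = fromℤ-+ⁿ (suc n) ■ sym (ℝ-RingProperties.-‿involutive _)

    fromℤ-* : ∀ x y → fromℤ (x ℤ.* y) ≡ fromℤ x * fromℤ y
    fromℤ-* (ℤ.+ m) (ℤ.+ n) =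
      cong fromℤ (sym (ℤ.pos-* m n)) ■ fromℤ-+ⁿ (m ℕ.* n) ■ fromℕ-* m n ■ sym (cong₂ _*_ (fromℤ-+ⁿ m) (fromℤ-+ⁿ n))
    fromℤ-* (ℤ.+ m) ℤ.-[1+ n ] =
      cong fromℤ (sym (ℤ.neg-distribʳ-* (ℤ.+ m) (ℤ.+ suc n)))
      ■ fromℤ-neg (ℤ.+ m ℤ.* ℤ.+ suc n)
      ■ cong -_ (fromℤ-* (ℤ.+ m) (ℤ.+ suc n))
      ■ cong (λ z → - (fromℤ (ℤ.+ m) * z)) (fromℤ-+ⁿ (suc n))
      ■ ℝ-RingProperties.-‿distribʳ-* _ _
    fromℤ-* ℤ.-[1+ m ] y =
      cong fromℤ (sym (ℤ.neg-distribˡ-* (ℤ.+ suc m) y))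
      ■ fromℤ-neg (ℤ.+ suc m ℤ.* y)
      ■ cong -_ (helper y)
      ■ ℝ-RingProperties.-‿distribˡ-* _ _
      where
      helper : ∀ y → fromℤ (ℤ.+ suc m ℤ.* y) ≡ fromℕ (suc m) * fromℤ y
      helper (ℤ.+ n) =
        cong fromℤ (sym (ℤ.pos-* (suc m) n)) ■ fromℤ-+ⁿ (suc m ℕ.* n) ■ fromℕ-* (suc m) n
        ■ sym (cong (fromℕ (suc m) *_) (fromℤ-+ⁿ n))
      helper ℤ.-[1+ n ] =
        cong fromℤ (sym (ℤ.neg-distribʳ-* (ℤ.+ suc m) (ℤ.+ suc n)))
        ■ fromℤ-neg (ℤ.+ suc m ℤ.* ℤ.+ suc n)
        ■ cong -_ (cong fromℤ (sym (ℤ.pos-* (suc m) (suc n))) ■ fromℤ-+ⁿ (suc m ℕ.* suc n) ■ fromℕ-* (suc m) (suc n))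
        ■ ℝ-RingProperties.-‿distribʳ-* _ _

    ℝ-almostCommutativeRing : AlmostCommutativeRing 0ℓ 0ℓ
    ℝ-almostCommutativeRing = fromCommutativeRing ℝ-commutativeRing

    ℤ⟶ℝ : CommutativeRing.rawRing ℤ.+-*-commutativeRing -Raw-AlmostCommutative⟶ ℝ-almostCommutativeRing
    ℤ⟶ℝ = record
      { ⟦_⟧    = fromℤ
      ; +-homo = fromℤ-+
      ; *-homo = fromℤ-*
      ; -‿homo = fromℤ-neg
      ; 0-homo = refl
      ; 1-homo = refl
      }

    coefficients≟ : ∀ x y → Maybe (fromℤ x ≡ fromℤ y)
    coefficients≟ x y with x ℤ.≟ y
    ... | yes x≡y = just (cong fromℤ x≡y)
    ... | no _    = nothing

  module ℝ-Solver = RingSolver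
    (CommutativeRing.rawRing ℤ.+-*-commutativeRing) ℝ-almostCommutativeRing ℤ⟶ℝ coefficients≟

  open ℝ-Solver using (solve; con; _:+_; _:*_; _:-_; :-_; _:=_)

  private
    module ≤ = IsDecTotalOrder isDecTotalOrder

  ≤-refl : ∀ {x : ℝ} → x ≤ x
  ≤-refl = ≤.refl

  ≤-reflexive : ∀ {x y : ℝ} → x ≡ y → x ≤ y
  ≤-reflexive = ≤.reflexive

  ≤-trans : ∀ {x y z : ℝ} → x ≤ y → y ≤ z → x ≤ z
  ≤-trans = ≤.trans

  ≤-antisym : ∀ {x y : ℝ} → x ≤ y → y ≤ x → x ≡ y
  ≤-antisym = ≤.antisym

  <⇒≤ : ∀ {x y : ℝ} → x < y → x ≤ y
  <⇒≤ = proj₁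

  <-≤-trans : ∀ {x y z : ℝ} → x < y → y ≤ z → x < z
  <-≤-trans (x≤y , x≢y) y≤z = ≤-trans x≤y y≤z , λ { refl → x≢y (≤-antisym x≤y y≤z) }

  ≤-<-trans : ∀ {x y z : ℝ} → x ≤ y → y < z → x < z
  ≤-<-trans x≤y (y≤z , y≢z) = ≤-trans x≤y y≤z , λ { refl → y≢z (≤-antisym y≤z x≤y) }

  <-trans : ∀ {x y z : ℝ} → x < y → y < z → x < z
  <-trans x<y y<z = <-≤-trans x<y (<⇒≤ y<z)

  <-irrefl : ∀ {x : ℝ} → ¬ x < x
  <-irrefl (_ , x≢x) = x≢x refl

  <⇒≱ : ∀ {x y : ℝ} → x < y → ¬ y ≤ x
  <⇒≱ x<y y≤x = <-irrefl (<-≤-trans x<y y≤x)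

  ≰⇒> : ∀ {x y : ℝ} → ¬ x ≤ y → y < x
  ≰⇒> {x} {y} x≰y with ≤.total x y
  ... | inj₁ x≤y = contradiction x≤y x≰y
  ... | inj₂ y≤x = y≤x , λ { refl → x≰y ≤-refl }

  ≮⇒≥ : ∀ {x y : ℝ} → ¬ x < y → y ≤ x
  ≮⇒≥ {x} {y} x≮y with y ≤? x
  ... | yes y≤x = y≤x
  ... | no y≰x  = contradiction (≰⇒> y≰x) x≮y

  +-mono-≤ : ∀ {x y u v : ℝ} → x ≤ y → u ≤ v → x + u ≤ y + v
  +-mono-≤ {x} {y} {u} {v} x≤y u≤v =
    ≤-trans (+-monoˡ-≤ u x≤y) (subst₂ _≤_ (ℝ-Ring.+-comm _ _) (ℝ-Ring.+-comm _ _) (+-monoˡ-≤ y u≤v))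

  0≤-≤ : ∀ {x y : ℝ} → x ≤ y → 0# ≤ y - x
  0≤-≤ {x} {y} x≤y = subst (_≤ y - x) (ℝ-Ring.-‿inverseʳ x) (+-monoˡ-≤ (- x) x≤y)

  -- Inequalities are mostly proved by naming a nonnegative difference, which leaves an equation for
  -- the ring solver.
  ≤-from : ∀ {x y d : ℝ} → 0# ≤ d → y ≡ x + d → x ≤ y
  ≤-from {x} {y} {d} 0≤d y≡x+d =
    subst₂ _≤_ (ℝ-Ring.+-identityˡ x) (ℝ-Ring.+-comm d x ■ sym y≡x+d) (+-monoˡ-≤ x 0≤d)

  0≤+ : ∀ {x y : ℝ} → 0# ≤ x → 0# ≤ y → 0# ≤ x + y
  0≤+ 0≤x 0≤y = subst (_≤ _) (ℝ-Ring.+-identityˡ 0#) (+-mono-≤ 0≤x 0≤y)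

  *-monoˡ-≤ : ∀ {x y : ℝ} (z : ℝ) → 0# ≤ z → x ≤ y → z * x ≤ z * y
  *-monoˡ-≤ {x} {y} z 0≤z x≤y = ≤-from (*-nonNeg 0≤z (0≤-≤ x≤y))
    (solve 3 (λ x y z → z :* y := z :* x :+ z :* (y :- x)) refl x y z)

  *-monoʳ-≤ : ∀ {x y : ℝ} (z : ℝ) → 0# ≤ z → x ≤ y → x * z ≤ y * z
  *-monoʳ-≤ {x} {y} z 0≤z x≤y = subst₂ _≤_ (ℝ-Ring.*-comm _ _) (ℝ-Ring.*-comm _ _) (*-monoˡ-≤ z 0≤z x≤y)

  0≤x*x : ∀ (x : ℝ) → 0# ≤ x * x
  0≤x*x x with ≤.total 0# x
  ... | inj₁ 0≤x = *-nonNeg 0≤x 0≤x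
  ... | inj₂ x≤0 = subst (0# ≤_) (solve 1 (λ x → (con (ℤ.+ 0) :- x) :* (con (ℤ.+ 0) :- x) := x :* x) refl x)
                     (*-nonNeg (0≤-≤ x≤0) (0≤-≤ x≤0))

  0≤1 : 0# ≤ 1#
  0≤1 = subst (0# ≤_) (ℝ-Ring.*-identityˡ 1#) (0≤x*x 1#)

  0<1 : 0# < 1#
  0<1 = 0≤1 , 0≢1

  0≤fromℕ : ∀ n → 0# ≤ fromℕ n
  0≤fromℕ zero    = ≤-refl
  0≤fromℕ (suc n) = 0≤+ 0≤1 (0≤fromℕ n)

  fromℕ-mono-≤ : ∀ {m n} → m ℕ.≤ n → fromℕ m ≤ fromℕ n
  fromℕ-mono-≤ {n = n} ℕ.z≤n = 0≤fromℕ n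
  fromℕ-mono-≤ (ℕ.s≤s m≤n) = +-mono-≤ ≤-refl (fromℕ-mono-≤ m≤n)

  0<fromℕ : ∀ n .⦃ _ : NonZero n ⦄ → 0# < fromℕ n
  0<fromℕ (suc n) = <-≤-trans 0<1 (≤-from (0≤fromℕ n) refl)

  0<⇒≢0 : ∀ {x : ℝ} → 0# < x → x ≢ 0#
  0<⇒≢0 0<x refl = <-irrefl 0<x

  *-inverseʳ : ∀ {x : ℝ} → 0# < x → x * x ⁻¹ ≡ 1#
  *-inverseʳ 0<x = *-inverse _ (0<⇒≢0 0<x)

  *-pos : ∀ {x y : ℝ} → 0# < x → 0# < y → 0# < x * y
  *-pos {x} {y} 0<x 0<y = *-nonNeg (<⇒≤ 0<x) (<⇒≤ 0<y) , λ 0≡xy → 0<⇒≢0 0<x (begin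
    x                  ≡⟨ ℝ-Ring.*-identityʳ x ⟨
    x * 1#             ≡⟨ cong (x *_) (*-inverseʳ 0<y) ⟨
    x * (y * y ⁻¹)     ≡⟨ ℝ-Ring.*-assoc _ _ _ ⟨
    x * y * y ⁻¹       ≡⟨ cong (_* y ⁻¹) 0≡xy ⟨
    0# * y ⁻¹          ≡⟨ ℝ-Ring.zeroˡ _ ⟩
    0#                 ∎)
    where open ≡-Reasoning

  0<⁻¹ : ∀ {x : ℝ} → 0# < x → 0# < x ⁻¹
  0<⁻¹ {x} 0<x = ≰⇒> λ x⁻¹≤0 → <⇒≱ 0<1
    (subst₂ _≤_ (*-inverseʳ 0<x) (ℝ-Ring.zeroʳ x) (*-monoˡ-≤ x (<⇒≤ 0<x) x⁻¹≤0))

  *-cancelˡ-≤ : ∀ {x y z : ℝ} → 0# < z → z * x ≤ z * y → x ≤ y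
  *-cancelˡ-≤ {x} {y} {z} 0<z zx≤zy =
    subst₂ _≤_ (lem x) (lem y) (*-monoˡ-≤ (z ⁻¹) (<⇒≤ (0<⁻¹ 0<z)) zx≤zy)
    where
    lem : ∀ x → z ⁻¹ * (z * x) ≡ x
    lem x = solve 3 (λ z z⁻¹ x → z⁻¹ :* (z :* x) := (z :* z⁻¹) :* x) refl z (z ⁻¹) x
            ■ cong (_* x) (*-inverseʳ 0<z) ■ ℝ-Ring.*-identityˡ x

  <-from : ∀ {x y d : ℝ} → 0# < d → y ≡ x + d → x < y
  <-from {x} {y} {d} 0<d y≡x+d = ≤-from (<⇒≤ 0<d) y≡x+d ,
    λ { refl → 0<⇒≢0 0<d (solve 2 (λ x d → d := (x :+ d) :- x) refl x d ■ cong (_- x) (sym y≡x+d) ■ ℝ-Ring.-‿inverseʳ x) }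

  0<-< : ∀ {x y : ℝ} → x < y → 0# < y - x
  0<-< {x} {y} (x≤y , x≢y) = 0≤-≤ x≤y , λ 0≡ → x≢y
    (sym (ℝ-Ring.+-identityˡ x) ■ cong (_+ x) 0≡ ■ solve 2 (λ x y → y :- x :+ x := y) refl x y)

  +-pos-nonNeg : ∀ {x y : ℝ} → 0# < x → 0# ≤ y → 0# < x + y
  +-pos-nonNeg 0<x 0≤y = <-≤-trans 0<x (≤-from 0≤y refl)

-- Finite sums and independent coins

does⁺ : ∀ {A : Set} (d : Dec A) → A → does d ≡ true
does⁺ d a = dec-true d a

does⁻ : ∀ {A : Set} (d : Dec A) → does d ≡ true → A
does⁻ (yes a) _ = a

does-⇔ : ∀ {A B : Set} (d : Dec A) (d′ : Dec B) → (A → B) → (B → A) → does d ≡ does d′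
does-⇔ (yes a) d′ f g = sym (dec-true d′ (f a))
does-⇔ (no ¬a) d′ f g = sym (dec-false d′ (¬a ∘ g))

Bool-⇔ : ∀ {b c} → (b ≡ true → c ≡ true) → (c ≡ true → b ≡ true) → b ≡ c
Bool-⇔ {true}  {c}     f g = sym (f refl)
Bool-⇔ {false} {true}  f g = g refl
Bool-⇔ {false} {false} f g = refl

∧-true⁻ : ∀ {b c} → b ∧ c ≡ true → b ≡ true × c ≡ true
∧-true⁻ {true} {true} _ = refl , refl

module _ {n : ℕ} where

  ∈⇒lookup : ∀ {x} {X : Subset n} → x ∈ X → lookup X x ≡ true
  ∈⇒lookup = Vec.[]=⇒lookup

  lookup⇒∈ : ∀ {x} {X : Subset n} → lookup X x ≡ true → x ∈ X
  lookup⇒∈ {x} {X} = Vec.lookup⇒[]= x X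

  does-∈? : ∀ x (X : Subset n) → does (x ∈? X) ≡ lookup X x
  does-∈? x X = Bool-⇔ (∈⇒lookup ∘ does⁻ (x ∈? X)) (does⁺ (x ∈? X) ∘ lookup⇒∈)

  ∉⇒lookup : ∀ {x} {X : Subset n} → x ∉ X → lookup X x ≡ false
  ∉⇒lookup {x} {X} x∉X = sym (does-∈? x X) ■ dec-false (x ∈? X) x∉X

  subset-≡ : ∀ {X Y : Subset n} → (∀ {x} → x ∈ X → x ∈ Y) → (∀ {x} → x ∈ Y → x ∈ X) → X ≡ Y
  subset-≡ = ⊆-antisym

  ∈-─⁻ : ∀ {x} (X Y : Subset n) → x ∈ X ─ Y → x ∈ X × x ∉ Y
  ∈-─⁻ {x} X Y x∈ = p─q⊆p X Y x∈ , lem X Y x∈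
    where
    lem : ∀ {n} {x : Fin n} (X Y : Subset n) → x ∈ X ─ Y → x ∉ Y
    lem (true  ∷ X) (true ∷ Y) () Vec.here
    lem (false ∷ X) (true ∷ Y) () Vec.here
    lem (_ ∷ X) (true ∷ Y)  (Vec.there x∈) (Vec.there x∈Y) = lem X Y x∈ x∈Y
    lem (_ ∷ X) (false ∷ Y) (Vec.there x∈) (Vec.there x∈Y) = lem X Y x∈ x∈Y

  ∈-∪⁅⁆⁻ : ∀ {x y} {X : Subset n} → x ∈ X ∪ ⁅ y ⁆ → x ∈ X ⊎ x ≡ y
  ∈-∪⁅⁆⁻ {y = y} {X} x∈ with x∈p∪q⁻ X ⁅ y ⁆ x∈
  ... | inj₁ x∈X = inj₁ x∈X
  ... | inj₂ x∈y = inj₂ (x∈⁅y⁆⇒x≡y y x∈y)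

  ∈-∪⁅⁆⁺ˡ : ∀ {x y} {X : Subset n} → x ∈ X → x ∈ X ∪ ⁅ y ⁆
  ∈-∪⁅⁆⁺ˡ x∈X = x∈p∪q⁺ (inj₁ x∈X)

  ∈-∪⁅⁆⁺ʳ : ∀ {y} {X : Subset n} → y ∈ X ∪ ⁅ y ⁆
  ∈-∪⁅⁆⁺ʳ {y} = x∈p∪q⁺ (inj₂ (x∈⁅x⁆ y))

  ∪⁅⁆-mono : ∀ {X Y : Subset n} {y} → X ⊆ Y → X ∪ ⁅ y ⁆ ⊆ Y ∪ ⁅ y ⁆
  ∪⁅⁆-mono X⊆Y x∈ with ∈-∪⁅⁆⁻ x∈
  ... | inj₁ x∈X  = ∈-∪⁅⁆⁺ˡ (X⊆Y x∈X)
  ... | inj₂ refl = ∈-∪⁅⁆⁺ʳ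

  ∈-allFin : ∀ (x : Fin n) → x ∈ˡ allFin n
  ∈-allFin = Mem.∈-allFin

  ∈-elements⁺ : ∀ {x} {X : Subset n} → x ∈ X → x ∈ˡ elements X
  ∈-elements⁺ {x} {X} x∈X = Mem.∈-filter⁺ (_∈? X) (∈-allFin x) x∈X

  ∈-elements⁻ : ∀ {x} {X : Subset n} → x ∈ˡ elements X → x ∈ X
  ∈-elements⁻ {x} {X} x∈ = proj₂ (Mem.∈-filter⁻ (_∈? X) {xs = allFin n} x∈)

  elements-unique : ∀ (X : Subset n) → Unique (elements X)
  elements-unique X = Unique.filter⁺ (_∈? X) (Unique.allFin⁺ n)

∈-∁⁻ : ∀ {n} {x : Fin n} (X : Subset n) → lookup (∁ X) x ≡ not (lookup X x)
∈-∁⁻ {x = x} X = Vec.lookup-map x not X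

∈-allSubsets : ∀ {n} (X : Subset n) → X ∈ˡ allSubsets n
∈-allSubsets []      = here refl
∈-allSubsets (b ∷ X) = Mem.∈-cartesianProductWith⁺ _∷_ (lem b) (∈-allSubsets X)
  where
  lem : ∀ b → b ∈ˡ outside ∷ inside ∷ []
  lem false = here refl
  lem true  = there (here refl)

allSubsets-unique : ∀ n → Unique (allSubsets n)
allSubsets-unique zero    = [] ∷ []
allSubsets-unique (suc n) =
  Unique.cartesianProductWith⁺ _∷_ Vec.∷-injective (((λ ()) ∷ []) ∷ [] ∷ []) (allSubsets-unique n)

module _ ⦃ ℛ : RealNumbers ⦄ where
  open ℝ-Solver using (solve; con; _:+_; _:*_; _:-_; :-_; _:=_)

  𝟙 : Bool → ℝ
  𝟙 b = if b then 1# else 0#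

  0≤𝟙 : ∀ b → 0# ≤ 𝟙 b
  0≤𝟙 true  = 0≤1
  0≤𝟙 false = ≤-refl

  𝟙-∧ : ∀ b c → 𝟙 (b ∧ c) ≡ 𝟙 b * 𝟙 c
  𝟙-∧ true  c = sym (ℝ-Ring.*-identityˡ _)
  𝟙-∧ false c = sym (ℝ-Ring.zeroˡ _)

  𝟙-≤ : ∀ {b c} → (b ≡ true → c ≡ true) → 𝟙 b ≤ 𝟙 c
  𝟙-≤ {true}  {c} f = ≤-reflexive (cong 𝟙 (sym (f refl)))
  𝟙-≤ {false} {c} f = 0≤𝟙 c

  0*x+y≡y : ∀ (x y : ℝ) → 0# * x + y ≡ y
  0*x+y≡y = solve 2 (λ x y → con (ℤ.+ 0) :* x :+ y := y) refl

  module _ {I : Set} where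

    ∑-cong∈ : ∀ (xs : List I) {f g : I → ℝ} → (∀ {x} → x ∈ˡ xs → f x ≡ g x) → ∑ xs f ≡ ∑ xs g
    ∑-cong∈ []       f≡g = refl
    ∑-cong∈ (x ∷ xs) f≡g = cong₂ _+_ (f≡g (here refl)) (∑-cong∈ xs (f≡g ∘ there))

    ∑-cong : ∀ (xs : List I) {f g : I → ℝ} → (∀ x → f x ≡ g x) → ∑ xs f ≡ ∑ xs g
    ∑-cong xs f≡g = ∑-cong∈ xs λ {x} _ → f≡g x

    ∑-mono∈ : ∀ (xs : List I) {f g : I → ℝ} → (∀ {x} → x ∈ˡ xs → f x ≤ g x) → ∑ xs f ≤ ∑ xs g
    ∑-mono∈ []       f≤g = ≤-refl
    ∑-mono∈ (x ∷ xs) f≤g = +-mono-≤ (f≤g (here refl)) (∑-mono∈ xs (f≤g ∘ there))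

    ∑-mono : ∀ (xs : List I) {f g : I → ℝ} → (∀ x → f x ≤ g x) → ∑ xs f ≤ ∑ xs g
    ∑-mono xs f≤g = ∑-mono∈ xs λ {x} _ → f≤g x

    ∑-zero : ∀ (xs : List I) → ∑ xs (λ _ → 0#) ≡ 0#
    ∑-zero []       = refl
    ∑-zero (x ∷ xs) = ℝ-Ring.+-identityˡ _ ■ ∑-zero xs

    ∑-nonNeg : ∀ (xs : List I) {f : I → ℝ} → (∀ x → 0# ≤ f x) → 0# ≤ ∑ xs f
    ∑-nonNeg xs 0≤f = ≤-trans (≤-reflexive (sym (∑-zero xs))) (∑-mono xs 0≤f)

    ∑-+ : ∀ (xs : List I) (f g : I → ℝ) → ∑ xs (λ x → f x + g x) ≡ ∑ xs f + ∑ xs g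
    ∑-+ []       f g = sym (ℝ-Ring.+-identityˡ _)
    ∑-+ (x ∷ xs) f g = cong (f x + g x +_) (∑-+ xs f g)
      ■ solve 4 (λ a b c d → a :+ b :+ (c :+ d) := a :+ c :+ (b :+ d)) refl (f x) (g x) (∑ xs f) (∑ xs g)

    ∑-*ˡ : ∀ (xs : List I) (c : ℝ) (f : I → ℝ) → ∑ xs (λ x → c * f x) ≡ c * ∑ xs f
    ∑-*ˡ []       c f = sym (ℝ-Ring.zeroʳ c)
    ∑-*ˡ (x ∷ xs) c f = cong (c * f x +_) (∑-*ˡ xs c f) ■ sym (ℝ-Ring.distribˡ _ _ _)

    ∑-*ʳ : ∀ (xs : List I) (c : ℝ) (f : I → ℝ) → ∑ xs (λ x → f x * c) ≡ ∑ xs f * c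
    ∑-*ʳ xs c f = ∑-cong xs (λ x → ℝ-Ring.*-comm _ _) ■ ∑-*ˡ xs c f ■ ℝ-Ring.*-comm _ _

    ∑-- : ∀ (xs : List I) (f g : I → ℝ) → ∑ xs (λ x → f x - g x) ≡ ∑ xs f - ∑ xs g
    ∑-- []       f g = sym (ℝ-Ring.-‿inverseʳ _)
    ∑-- (x ∷ xs) f g = cong (f x - g x +_) (∑-- xs f g)
      ■ solve 4 (λ a b c d → a :- b :+ (c :- d) := a :+ c :- (b :+ d)) refl (f x) (g x) (∑ xs f) (∑ xs g)

    ∑-++ : ∀ (xs ys : List I) (f : I → ℝ) → ∑ (xs ++ ys) f ≡ ∑ xs f + ∑ ys f
    ∑-++ []       ys f = sym (ℝ-Ring.+-identityˡ _)
    ∑-++ (x ∷ xs) ys f = cong (f x +_) (∑-++ xs ys f) ■ sym (ℝ-Ring.+-assoc _ _ _)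

    ∑-filter : ∀ {P : Pred I 0ℓ} (P? : Decidable P) (xs : List I) (f : I → ℝ) →
               ∑ (filter P? xs) f ≡ ∑ xs (λ x → 𝟙 (does (P? x)) * f x)
    ∑-filter P? []       f = refl
    ∑-filter P? (x ∷ xs) f with P? x
    ... | yes _ = cong₂ _+_ (sym (ℝ-Ring.*-identityˡ _)) (∑-filter P? xs f)
    ... | no _  = ∑-filter P? xs f ■ sym (0*x+y≡y _ _)

    ∑-↭ : ∀ {xs ys : List I} (f : I → ℝ) → xs ↭ ys → ∑ xs f ≡ ∑ ys f
    ∑-↭ f _↭_.refl                  = refl
    ∑-↭ f (_↭_.prep x p)            = cong (f x +_) (∑-↭ f p)
    ∑-↭ f (_↭_.swap {xs} {ys} x y p) = cong (λ z → f x + (f y + z)) (∑-↭ f p)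
      ■ solve 3 (λ a b c → a :+ (b :+ c) := b :+ (a :+ c)) refl (f x) (f y) (∑ ys f)
    ∑-↭ f (_↭_.trans p q)           = ∑-↭ f p ■ ∑-↭ f q

    -- Read from right to left, this expands a value over a duplicate-free list of all candidates;
    -- random objects are conditioned on their values in this way.
    ∑-single : ∀ (_≟ᴵ_ : DecidableEquality I) {xs : List I} {y} (f : I → ℝ) → Unique xs → y ∈ˡ xs →
               ∑ xs (λ x → 𝟙 (does (y ≟ᴵ x)) * f x) ≡ f y
    ∑-single _≟ᴵ_ {x ∷ xs} {y} f (x∉ ∷ u) y∈ with y ≟ᴵ x
    ... | yes refl = cong₂ _+_ (ℝ-Ring.*-identityˡ _) (∑-cong∈ xs lem ■ ∑-zero xs) ■ ℝ-Ring.+-identityʳ _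
      where
      lem : ∀ {x} → x ∈ˡ xs → 𝟙 (does (y ≟ᴵ x)) * f x ≡ 0#
      lem {x} x∈ with y ≟ᴵ x
      ... | yes refl = contradiction refl (All.lookup x∉ x∈)
      ... | no _     = ℝ-Ring.zeroˡ _
    ∑-single _≟ᴵ_ {x ∷ xs} {y} f (x∉ ∷ u) (here refl) | no y≢y = contradiction refl y≢y
    ∑-single _≟ᴵ_ {x ∷ xs} {y} f (x∉ ∷ u) (there y∈)  | no _   =
      0*x+y≡y _ _ ■ ∑-single _≟ᴵ_ f u y∈

    ∏-*ˡ-cong : ∀ (xs : List I) {f g : I → ℝ} → (∀ x → f x ≡ g x) → ∏ xs f ≡ ∏ xs g
    ∏-*ˡ-cong []       f≡g = refl
    ∏-*ˡ-cong (x ∷ xs) f≡g = cong₂ _*_ (f≡g x) (∏-*ˡ-cong xs f≡g)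

    ∏-one : ∀ (xs : List I) {f : I → ℝ} → (∀ x → f x ≡ 1#) → ∏ xs f ≡ 1#
    ∏-one []       f≡1 = refl
    ∏-one (x ∷ xs) f≡1 = cong₂ _*_ (f≡1 x) (∏-one xs f≡1) ■ ℝ-Ring.*-identityˡ _

  module _ {I J : Set} where

    ∑-map : ∀ (h : I → J) xs (f : J → ℝ) → ∑ (map h xs) f ≡ ∑ xs (f ∘ h)
    ∑-map h []       f = refl
    ∑-map h (x ∷ xs) f = cong (f (h x) +_) (∑-map h xs f)

    ∑-swap : ∀ (xs : List I) (ys : List J) (f : I → J → ℝ) →
             ∑ xs (λ x → ∑ ys (f x)) ≡ ∑ ys (λ y → ∑ xs (λ x → f x y))
    ∑-swap []       ys f = sym (∑-zero ys)
    ∑-swap (x ∷ xs) ys f = cong (∑ ys (f x) +_) (∑-swap xs ys f) ■ sym (∑-+ ys (f x) _)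

    ∑-cartesianProductWith : ∀ {K : Set} (h : I → J → K) xs ys (f : K → ℝ) →
      ∑ (cartesianProductWith h xs ys) f ≡ ∑ xs (λ x → ∑ ys (λ y → f (h x y)))
    ∑-cartesianProductWith h []       ys f = refl
    ∑-cartesianProductWith h (x ∷ xs) ys f =
      ∑-++ (map (h x) ys) _ f ■ cong₂ _+_ (∑-map′ ys) (∑-cartesianProductWith h xs ys f)
      where
      ∑-map′ : ∀ ys → ∑ (map (h x) ys) f ≡ ∑ ys (λ y → f (h x y))
      ∑-map′ []       = refl
      ∑-map′ (y ∷ ys) = cong (f (h x y) +_) (∑-map′ ys)

  ∑-allFin-suc : ∀ n (f : Fin (suc n) → ℝ) → ∑ (allFin (suc n)) f ≡ f zero + ∑ (allFin n) (f ∘ suc)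
  ∑-allFin-suc n f = cong (λ xs → f zero + ∑ xs f) (sym (List.map-tabulate id suc))
    ■ cong (f zero +_) (∑-map suc (allFin n) f)

  ∏-allFin-suc : ∀ n (f : Fin (suc n) → ℝ) → ∏ (allFin (suc n)) f ≡ f zero * ∏ (allFin n) (f ∘ suc)
  ∏-allFin-suc n f = cong (λ xs → f zero * ∏ xs f) (sym (List.map-tabulate id suc))
    ■ cong (λ ys → f zero * foldr _*_ 1# ys) (sym (List.map-∘ (allFin n)))

  ∑-elements : ∀ {n} (X : Subset n) (f : Fin n → ℝ) →
               ∑ (elements X) f ≡ ∑ (allFin n) (λ x → 𝟙 (lookup X x) * f x)
  ∑-elements {n} X f = ∑-filter (_∈? X) (allFin n) f
    ■ ∑-cong (allFin n) (λ x → cong (λ b → 𝟙 b * f x) (does-∈? x X))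

  fromℕ-∣∣ : ∀ {n} (X : Subset n) → fromℕ ∣ X ∣ ≡ ∑ (allFin n) (λ x → 𝟙 (lookup X x))
  fromℕ-∣∣ {zero}  []           = refl
  fromℕ-∣∣ {suc n} (true ∷ X)  = cong (1# +_) (fromℕ-∣∣ X) ■ sym (∑-allFin-suc n _)
  fromℕ-∣∣ {suc n} (false ∷ X) = fromℕ-∣∣ X ■ sym (ℝ-Ring.+-identityˡ _) ■ sym (∑-allFin-suc n _)

  -- The expectation of a function of a random subset that contains every element independently with
  -- probability `p`; the recursion tosses the coin of `zero` first.
  Coins : ℝ → (n : ℕ) → (Subset n → ℝ) → ℝ
  Coins p zero    f = f []
  Coins p (suc n) f = p * Coins p n (f ∘ (inside ∷_)) + (1# - p) * Coins p n (f ∘ (outside ∷_))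

  Coins-cong : ∀ (p : ℝ) n {f g : Subset n → ℝ} → (∀ Y → f Y ≡ g Y) → Coins p n f ≡ Coins p n g
  Coins-cong p zero    f≡g = f≡g []
  Coins-cong p (suc n) f≡g = cong₂ (λ x y → p * x + (1# - p) * y)
    (Coins-cong p n (f≡g ∘ (inside ∷_))) (Coins-cong p n (f≡g ∘ (outside ∷_)))

  Coins-+ : ∀ (p : ℝ) n (f g : Subset n → ℝ) → Coins p n (λ Y → f Y + g Y) ≡ Coins p n f + Coins p n g
  Coins-+ p zero    f g = refl
  Coins-+ p (suc n) f g = cong₂ (λ x y → p * x + (1# - p) * y) (Coins-+ p n _ _) (Coins-+ p n _ _)
    ■ solve 5 (λ p a b c d → p :* (a :+ b) :+ (con (ℤ.+ 1) :- p) :* (c :+ d)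
                 := p :* a :+ (con (ℤ.+ 1) :- p) :* c :+ (p :* b :+ (con (ℤ.+ 1) :- p) :* d)) refl
        p (Coins p n (f ∘ (inside ∷_))) (Coins p n (g ∘ (inside ∷_)))
        (Coins p n (f ∘ (outside ∷_))) (Coins p n (g ∘ (outside ∷_)))

  Coins-*ˡ : ∀ (p : ℝ) n (c : ℝ) (f : Subset n → ℝ) → Coins p n (λ Y → c * f Y) ≡ c * Coins p n f
  Coins-*ˡ p zero    c f = refl
  Coins-*ˡ p (suc n) c f = cong₂ (λ x y → p * x + (1# - p) * y) (Coins-*ˡ p n c _) (Coins-*ˡ p n c _)
    ■ solve 4 (λ p c a b → p :* (c :* a) :+ (con (ℤ.+ 1) :- p) :* (c :* b)
                 := c :* (p :* a :+ (con (ℤ.+ 1) :- p) :* b)) refl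
        p c (Coins p n (f ∘ (inside ∷_))) (Coins p n (f ∘ (outside ∷_)))

  Coins-const : ∀ (p : ℝ) n (c : ℝ) → Coins p n (λ _ → c) ≡ c
  Coins-const p zero    c = refl
  Coins-const p (suc n) c = cong₂ (λ x y → p * x + (1# - p) * y) (Coins-const p n c) (Coins-const p n c)
    ■ solve 2 (λ p c → p :* c :+ (con (ℤ.+ 1) :- p) :* c := c) refl p c

  Coins-∑ : ∀ {I : Set} (p : ℝ) n (xs : List I) (f : I → Subset n → ℝ) →
            Coins p n (λ Y → ∑ xs (λ x → f x Y)) ≡ ∑ xs (λ x → Coins p n (f x))
  Coins-∑ p n []       f = Coins-const p n 0#
  Coins-∑ p n (x ∷ xs) f = Coins-+ p n (f x) _ ■ cong (Coins p n (f x) +_) (Coins-∑ p n xs f)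

  Coins-swap : ∀ (p : ℝ) m (q : ℝ) n (f : Subset m → Subset n → ℝ) →
               Coins p m (λ Y → Coins q n (f Y)) ≡ Coins q n (λ Z → Coins p m (λ Y → f Y Z))
  Coins-swap p zero    q n f = refl
  Coins-swap p (suc m) q n f =
    cong₂ (λ x y → p * x + (1# - p) * y) (Coins-swap p m q n _) (Coins-swap p m q n _)
    ■ cong₂ _+_ (sym (Coins-*ˡ q n p _)) (sym (Coins-*ˡ q n (1# - p) _)) ■ sym (Coins-+ q n _ _)

  module _ {p : ℝ} (0≤p : 0# ≤ p) (p≤1 : p ≤ 1#) where

    Coins-mono : ∀ n {f g : Subset n → ℝ} → (∀ Y → f Y ≤ g Y) → Coins p n f ≤ Coins p n g
    Coins-mono zero    f≤g = f≤g []
    Coins-mono (suc n) f≤g = +-mono-≤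
      (*-monoˡ-≤ p 0≤p (Coins-mono n (f≤g ∘ (inside ∷_))))
      (*-monoˡ-≤ (1# - p) (0≤-≤ p≤1) (Coins-mono n (f≤g ∘ (outside ∷_))))

    Coins-nonNeg : ∀ n {f : Subset n → ℝ} → (∀ Y → 0# ≤ f Y) → 0# ≤ Coins p n f
    Coins-nonNeg n 0≤f = ≤-trans (≤-reflexive (sym (Coins-const p n 0#))) (Coins-mono n 0≤f)

  Ignores : ∀ {n} → Fin n → (Subset n → ℝ) → Set
  Ignores a f = ∀ Y Y′ → (∀ b → b ≢ a → lookup Y b ≡ lookup Y′ b) → f Y ≡ f Y′

  -- One factor reads only the coin of `a` and the other never does, so the expectation of the
  -- product factors.
  Coins-independent : ∀ (p : ℝ) {n} (a : Fin n) (φ : Bool → ℝ) {f : Subset n → ℝ} → Ignores a f →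
    Coins p n (λ Y → φ (lookup Y a) * f Y) ≡ (p * φ true + (1# - p) * φ false) * Coins p n f
  Coins-independent p {suc n} zero φ {f} ign =
    cong₂ (λ x y → p * x + (1# - p) * y) (Coins-*ˡ p n _ _) (Coins-*ˡ p n _ _ ■ cong (φ false *_) same)
    ■ solve 4 (λ p t f c → p :* (t :* c) :+ (con (ℤ.+ 1) :- p) :* (f :* c)
         := (p :* t :+ (con (ℤ.+ 1) :- p) :* f) :* (p :* c :+ (con (ℤ.+ 1) :- p) :* c)) refl
         p (φ true) (φ false) (Coins p n (f ∘ (inside ∷_)))
    ■ cong (λ z → (p * φ true + (1# - p) * φ false) * (p * Coins p n (f ∘ (inside ∷_)) + (1# - p) * z)) (sym same)
    where
    same : Coins p n (f ∘ (outside ∷_)) ≡ Coins p n (f ∘ (inside ∷_))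
    same = Coins-cong p n λ Y → ign (outside ∷ Y) (inside ∷ Y) λ
      { zero 0≢0 → contradiction refl 0≢0 ; (suc b) _ → refl }
  Coins-independent p {suc n} (suc a) φ {f} ign =
    cong₂ (λ x y → p * x + (1# - p) * y) (Coins-independent p a φ (ign′ inside)) (Coins-independent p a φ (ign′ outside))
    ■ solve 4 (λ p c x y → p :* (c :* x) :+ (con (ℤ.+ 1) :- p) :* (c :* y)
         := c :* (p :* x :+ (con (ℤ.+ 1) :- p) :* y)) refl
         p (p * φ true + (1# - p) * φ false) (Coins p n (f ∘ (inside ∷_))) (Coins p n (f ∘ (outside ∷_)))
    where
    ign′ : ∀ s → Ignores a (f ∘ (s ∷_))
    ign′ s Y Y′ same = ign (s ∷ Y) (s ∷ Y′) λ
      { zero _ → refl ; (suc b) b≢a → same b (b≢a ∘ cong suc) }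

  Coins-∈ : ∀ (p : ℝ) {n} (a : Fin n) {f : Subset n → ℝ} → Ignores a f →
            Coins p n (λ Y → 𝟙 (lookup Y a) * f Y) ≡ p * Coins p n f
  Coins-∈ p {n} a {f} ign = Coins-independent p a 𝟙 ign
    ■ cong (_* Coins p n f) (solve 1 (λ p → p :* con (ℤ.+ 1) :+ (con (ℤ.+ 1) :- p) :* con (ℤ.+ 0) := p) refl p)

  Coins-∉ : ∀ (p : ℝ) {n} (a : Fin n) {f : Subset n → ℝ} → Ignores a f →
            Coins p n (λ Y → 𝟙 (not (lookup Y a)) * f Y) ≡ (1# - p) * Coins p n f
  Coins-∉ p {n} a {f} ign = Coins-independent p a (𝟙 ∘ not) ign
    ■ cong (_* Coins p n f)
        (solve 1 (λ p → p :* con (ℤ.+ 0) :+ (con (ℤ.+ 1) :- p) :* con (ℤ.+ 1) := con (ℤ.+ 1) :- p) refl p)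

  -- A fair coin does not notice when its two sides are renamed.
  Coins-∁ : ∀ {h : ℝ} n (f : Subset n → ℝ) → 1# - h ≡ h → Coins h n (f ∘ ∁) ≡ Coins h n f
  Coins-∁ zero    f fair = refl
  Coins-∁ {h} (suc n) f fair =
    cong₂ (λ x y → h * x + (1# - h) * y) (Coins-∁ n (f ∘ (outside ∷_)) fair) (Coins-∁ n (f ∘ (inside ∷_)) fair)
    ■ cong (λ z → h * Coins h n (f ∘ (outside ∷_)) + z * Coins h n (f ∘ (inside ∷_))) fair
    ■ ℝ-Ring.+-comm _ _
    ■ cong (λ z → h * Coins h n (f ∘ (inside ∷_)) + z * Coins h n (f ∘ (outside ∷_))) (sym fair)

  Coins-∏ : ∀ {I : Set} (p : ℝ) {n} (xs : List I) (a : I → Fin n) (φ : I → Bool → ℝ) → Unique (map a xs) →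
    Coins p n (λ Y → ∏ xs (λ x → φ x (lookup Y (a x)))) ≡ ∏ xs (λ x → p * φ x true + (1# - p) * φ x false)
  Coins-∏ p {n} [] a φ u = Coins-const p n 1#
  Coins-∏ p {n} (x ∷ xs) a φ (x∉ ∷ u) =
    Coins-independent p (a x) (φ x) (λ Y Y′ same → ign xs x∉ Y Y′ same)
    ■ cong ((p * φ x true + (1# - p) * φ x false) *_) (Coins-∏ p xs a φ u)
    where
    ign : ∀ xs → All (a x ≢_) (map a xs) → Ignores (a x) (λ Y → ∏ xs (λ x → φ x (lookup Y (a x))))
    ign []       _          Y Y′ same = refl
    ign (y ∷ ys) (x≢y ∷ x∉) Y Y′ same =
      cong₂ _*_ (cong (φ y) (same (a y) (x≢y ∘ sym))) (ign ys x∉ Y Y′ same)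

-- Finitely additive probability

-- The part of `V` lying over `Z`. With the agent map for `f`, Rel(Y) for `V` and the second layer
-- of coins for `Z`, this is the sample E₀ shown to the item-side algorithm.
restrict : ∀ {m n} → (Fin m → Fin n) → Subset m → Subset n → Subset m
restrict f V Z = tabulate λ x → lookup V x ∧ lookup Z (f x)

lookup-restrict : ∀ {m n} (f : Fin m → Fin n) V Z x → lookup (restrict f V Z) x ≡ lookup V x ∧ lookup Z (f x)
lookup-restrict f V Z x = Vec.lookup∘tabulate _ x

module _ ⦃ ℛ : RealNumbers ⦄ where
  open ℝ-Solver using (solve; con; _:+_; _:*_; _:-_; :-_; _:=_)

  ∏-𝟙 : ∀ {I : Set} (xs : List I) (b : I → Bool) {c} →
        (c ≡ true → ∀ {x} → x ∈ˡ xs → b x ≡ true) → ((∀ {x} → x ∈ˡ xs → b x ≡ true) → c ≡ true) →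
        ∏ xs (𝟙 ∘ b) ≡ 𝟙 c
  ∏-𝟙 []       b f g = cong 𝟙 (sym (g λ ()))
  ∏-𝟙 (x ∷ xs) b {c} f g with b x in bx
  ... | true  = ℝ-Ring.*-identityˡ _
    ■ ∏-𝟙 xs b (λ c≡true → f c≡true ∘ there) (λ h → g λ { (here refl) → bx ; (there x∈) → h x∈ })
  ... | false = ℝ-Ring.zeroˡ _ ■ cong 𝟙 (sym (Bool.¬-not λ c≡true → case sym bx ■ f c≡true (here refl) of λ ()))

  -- By injectivity, different elements of `V` read different coins. Sampling agents therefore
  -- samples edges independently, with the law in the definition of an OOCS algorithm.
  Coins-sample : ∀ (q : ℝ) {m n} (f : Fin m → Fin n) (V : Subset m) →
    (∀ {x y} → x ∈ V → y ∈ V → f x ≡ f y → x ≡ y) → (h : Subset m → ℝ) →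
    Coins q n (λ Z → h (restrict f V Z)) ≡
    ∑ (filter (_⊆? V) (allSubsets m)) (λ Y → ∏ (elements V) (λ x → if does (x ∈? Y) then q else 1# - q) * h Y)
  Coins-sample q {m} {n} f V f-injective h = begin
    Coins q n (λ Z → h (restrict f V Z))
      ≡⟨ Coins-cong q n (λ Z → ∑-single _≟ˢ_ h Ys-unique (restrict-∈ Z)) ⟨
    Coins q n (λ Z → ∑ Ys (λ Y → 𝟙 (does (restrict f V Z ≟ˢ Y)) * h Y))
      ≡⟨ Coins-∑ q n Ys _ ⟩
    ∑ Ys (λ Y → Coins q n (λ Z → 𝟙 (does (restrict f V Z ≟ˢ Y)) * h Y))
      ≡⟨ ∑-cong∈ Ys (λ {Y} Y∈ → Coins-cong q n (λ Z → ℝ-Ring.*-comm _ _) ■ Coins-*ˡ q n (h Y) _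
                        ■ ℝ-Ring.*-comm _ _ ■ cong (_* h Y) (law Y (proj₂ (Mem.∈-filter⁻ (_⊆? V) {xs = allSubsets m} Y∈)))) ⟩
    ∑ Ys (λ Y → ∏ (elements V) (λ x → if does (x ∈? Y) then q else 1# - q) * h Y) ∎
    where
    open ≡-Reasoning
    Ys = filter (_⊆? V) (allSubsets m)

    Ys-unique : Unique Ys
    Ys-unique = Unique.filter⁺ (_⊆? V) (allSubsets-unique m)

    restrict-∈ : ∀ Z → restrict f V Z ∈ˡ Ys
    restrict-∈ Z = Mem.∈-filter⁺ (_⊆? V) (∈-allSubsets (restrict f V Z)) λ {x} x∈ →
      lookup⇒∈ (proj₁ (∧-true⁻ (sym (lookup-restrict f V Z x) ■ ∈⇒lookup x∈)))

    map-unique : ∀ {xs} → Unique xs → (∀ {x} → x ∈ˡ xs → x ∈ V) → Unique (map f xs)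
    map-unique []       xs⊆V = []
    map-unique (x∉ ∷ u) xs⊆V =
      All.map⁺ (All.tabulate λ y∈ fx≡fy → All.lookup x∉ y∈ (f-injective (xs⊆V (here refl)) (xs⊆V (there y∈)) fx≡fy))
      ∷ map-unique u (xs⊆V ∘ there)

    weight≡ : ∀ Y x → q * 𝟙 (does (true Bool.≟ lookup Y x)) + (1# - q) * 𝟙 (does (false Bool.≟ lookup Y x))
                    ≡ (if does (x ∈? Y) then q else 1# - q)
    weight≡ Y x with lookup Y x | does-∈? x Y
    ... | true  | eq rewrite eq = solve 1 (λ q → q :* con (ℤ.+ 1) :+ (con (ℤ.+ 1) :- q) :* con (ℤ.+ 0) := q) refl q
    ... | false | eq rewrite eq =
      solve 1 (λ q → q :* con (ℤ.+ 0) :+ (con (ℤ.+ 1) :- q) :* con (ℤ.+ 1) := con (ℤ.+ 1) :- q) refl q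

    law : ∀ Y → Y ⊆ V → Coins q n (λ Z → 𝟙 (does (restrict f V Z ≟ˢ Y))) ≡
          ∏ (elements V) (λ x → if does (x ∈? Y) then q else 1# - q)
    -- The event that the sample equals `Y` is a product of conditions on single coins, one for each
    -- element of `V`.
    law Y Y⊆V =
      Coins-cong q n (λ Z → sym (∏-𝟙 (elements V) (λ x → does (lookup Z (f x) Bool.≟ lookup Y x)) (to Z) (from Z)))
      ■ Coins-∏ q (elements V) f (λ x b → 𝟙 (does (b Bool.≟ lookup Y x)))
          (map-unique (elements-unique V) ∈-elements⁻)
      ■ ∏-*ˡ-cong (elements V) (weight≡ Y)
      where
      to : ∀ Z → does (restrict f V Z ≟ˢ Y) ≡ true → ∀ {x} → x ∈ˡ elements V → does (lookup Z (f x) Bool.≟ lookup Y x) ≡ true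
      to Z eq {x} x∈ with refl ← does⁻ (restrict f V Z ≟ˢ Y) eq = does⁺ (_ Bool.≟ _)
        (sym (lookup-restrict f V Z x ■ cong (_∧ lookup Z (f x)) (∈⇒lookup (∈-elements⁻ x∈))))
      from : ∀ Z → (∀ {x} → x ∈ˡ elements V → does (lookup Z (f x) Bool.≟ lookup Y x) ≡ true) → does (restrict f V Z ≟ˢ Y) ≡ true
      from Z eqs = does⁺ (restrict f V Z ≟ˢ Y) (subset-≡
        (λ {x} x∈ → let x∈V , fx∈Z = ∧-true⁻ (sym (lookup-restrict f V Z x) ■ ∈⇒lookup x∈) in
          lookup⇒∈ (sym (does⁻ (lookup Z (f x) Bool.≟ lookup Y x) (eqs (∈-elements⁺ (lookup⇒∈ x∈V)))) ■ fx∈Z))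
        (λ {x} x∈Y → lookup⇒∈ (lookup-restrict f V Z x ■ cong₂ _∧_ (∈⇒lookup (Y⊆V x∈Y))
          (does⁻ (lookup Z (f x) Bool.≟ lookup Y x) (eqs (∈-elements⁺ (Y⊆V x∈Y))) ■ ∈⇒lookup x∈Y))))

  module Measure (S : ProbabilitySpace) where
    open ProbabilitySpace S

    event-∅ : Event (λ _ → false)
    event-∅ = event-∁ event-Ω

    event-∪ : ∀ {F G} → Event F → Event G → Event (λ ω → F ω ∨ G ω)
    event-∪ {F} {G} eF eG =
      event-≗ (λ ω → lem (F ω) (G ω)) (event-∁ (event-∩ (event-∁ eF) (event-∁ eG)))
      where
      lem : ∀ b c → not (not b ∧ not c) ≡ b ∨ c
      lem true  c     = refl
      lem false true  = refl
      lem false false = refl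

    ℙ-∅ : ℙ (λ _ → false) ≡ 0#
    ℙ-∅ = solve 1 (λ x → x := (x :+ x) :- x) refl (ℙ (λ _ → false))
      ■ cong (_- ℙ (λ _ → false)) (sym (ℙ-∪ event-∅ event-∅ (λ _ → refl))) ■ ℝ-Ring.-‿inverseʳ _

    ℙ-split : ∀ {F G} → Event F → Event G → ℙ F ≡ ℙ (λ ω → F ω ∧ G ω) + ℙ (λ ω → F ω ∧ not (G ω))
    ℙ-split {F} {G} eF eG =
      ℙ-≗ eF (λ ω → lem (F ω) (G ω)) ■ ℙ-∪ (event-∩ eF eG) (event-∩ eF (event-∁ eG)) (λ ω → disjoint (F ω) (G ω))
      where
      lem : ∀ b c → b ≡ (b ∧ c) ∨ (b ∧ not c)
      lem true  true  = refl
      lem true  false = refl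
      lem false c     = refl
      disjoint : ∀ b c → (b ∧ c) ∧ (b ∧ not c) ≡ false
      disjoint true  true  = refl
      disjoint true  false = refl
      disjoint false c     = refl

    -- From this positivity of the integral of simple functions follow its
    -- monotonicity and its independence of the representation.
    module _ {I : Set} (a : I → ℝ) (F : I → Ω → Bool) where

      simple-nonNeg : ∀ xs → (∀ {i} → i ∈ˡ xs → Event (F i)) → ∀ (c : ℝ) {H} → Event H →
        (∀ ω → H ω ≡ true → 0# ≤ c + ∑ xs (λ i → a i * 𝟙 (F i ω))) →
        0# ≤ c * ℙ H + ∑ xs (λ i → a i * ℙ (λ ω → H ω ∧ F i ω))
      simple-nonNeg [] eF c {H} eH 0≤ with 0# ≤? c
      ... | yes 0≤c = 0≤+ (*-nonNeg 0≤c (ℙ-≥0 eH)) ≤-refl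
      -- A negative constant contradicts the hypothesis at every point of `H`, so `H` is empty and
      -- has probability zero.
      ... | no 0≰c  = ≤-reflexive (sym (cong (λ z → c * z + 0#)
              (ℙ-≗ eH (λ ω → Bool.¬-not λ Hω → 0≰c (subst (0# ≤_) (ℝ-Ring.+-identityʳ c) (0≤ ω Hω))) ■ ℙ-∅)
              ■ solve 1 (λ c → c :* con (ℤ.+ 0) :+ con (ℤ.+ 0) := con (ℤ.+ 0)) refl c))
      -- `H` is cut along `F i`: inside, the constant grows by `a i`; outside, it stays. Each half
      -- has one indicator fewer.
      simple-nonNeg (i ∷ xs) eF c {H} eH 0≤ = subst (0# ≤_) (sym total) (0≤+ inside-part outside-part)
        where
        Hi = λ ω → H ω ∧ F i ω
        Ho = λ ω → H ω ∧ not (F i ω)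
        eHi : Event Hi
        eHi = event-∩ eH (eF (here refl))
        eHo : Event Ho
        eHo = event-∩ eH (event-∁ (eF (here refl)))
        rest : (Ω → Bool) → ℝ
        rest K = ∑ xs (λ j → a j * ℙ (λ ω → K ω ∧ F j ω))

        inside-part : 0# ≤ (c + a i) * ℙ Hi + rest Hi
        inside-part = simple-nonNeg xs (eF ∘ there) (c + a i) eHi λ ω Hiω → let Hω , Fω = ∧-true⁻ Hiω in
          subst (0# ≤_) (cong (λ b → c + (a i * 𝟙 b + ∑ xs (λ j → a j * 𝟙 (F j ω)))) Fω
            ■ solve 3 (λ c a r → c :+ (a :* con (ℤ.+ 1) :+ r) := c :+ a :+ r) refl c (a i) _) (0≤ ω Hω)

        outside-part : 0# ≤ c * ℙ Ho + rest Ho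
        outside-part = simple-nonNeg xs (eF ∘ there) c eHo λ ω Hoω → let Hω , ¬Fω = ∧-true⁻ Hoω in
          subst (0# ≤_) (cong (λ b → c + (a i * 𝟙 b + ∑ xs (λ j → a j * 𝟙 (F j ω)))) (Bool.not-injective ¬Fω)
            ■ solve 3 (λ c a r → c :+ (a :* con (ℤ.+ 0) :+ r) := c :+ r) refl c (a i) _) (0≤ ω Hω)

        split-term : ∀ {j} → j ∈ˡ xs → a j * ℙ (λ ω → H ω ∧ F j ω) ≡ a j * ℙ (λ ω → Hi ω ∧ F j ω) + a j * ℙ (λ ω → Ho ω ∧ F j ω)
        split-term {j} j∈ = cong (a j *_) (ℙ-split (event-∩ eH (eF (there j∈))) (eF (here refl))
            ■ cong₂ _+_ (ℙ-≗ (event-∩ (event-∩ eH (eF (there j∈))) (eF (here refl))) (λ ω → exchange (H ω) (F j ω) (F i ω)))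
                        (ℙ-≗ (event-∩ (event-∩ eH (eF (there j∈))) (event-∁ (eF (here refl)))) (λ ω → exchange (H ω) (F j ω) (not (F i ω)))))
          ■ ℝ-Ring.distribˡ _ _ _
          where
          exchange : ∀ b c d → (b ∧ c) ∧ d ≡ (b ∧ d) ∧ c
          exchange true  c d = Bool.∧-comm c d
          exchange false c d = refl

        total : c * ℙ H + (a i * ℙ Hi + rest H) ≡ (c + a i) * ℙ Hi + rest Hi + (c * ℙ Ho + rest Ho)
        total = cong₂ (λ x y → c * x + (a i * ℙ Hi + y)) (ℙ-split eH (eF (here refl)))
            (∑-cong∈ xs split-term ■ ∑-+ xs _ _)
          ■ solve 6 (λ c a hi ho ri ro → c :* (hi :+ ho) :+ (a :* hi :+ (ri :+ ro))
              := (c :+ a) :* hi :+ ri :+ (c :* ho :+ ro)) refl c (a i) (ℙ Hi) (ℙ Ho) (rest Hi) (rest Ho)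

    -- The left side is moved over as terms with negated coefficients, and positivity is applied to
    -- the difference on the whole space.
    simple-mono : ∀ {I J : Set} (xs : List I) (ys : List J) (a : I → ℝ) (b : J → ℝ) {F : I → Ω → Bool} {G : J → Ω → Bool} →
      (∀ {i} → i ∈ˡ xs → Event (F i)) → (∀ {j} → j ∈ˡ ys → Event (G j)) →
      (∀ ω → ∑ xs (λ i → a i * 𝟙 (F i ω)) ≤ ∑ ys (λ j → b j * 𝟙 (G j ω))) →
      ∑ xs (λ i → a i * ℙ (F i)) ≤ ∑ ys (λ j → b j * ℙ (G j))
    simple-mono {I} {J} xs ys a b {F} {G} eF eG F≤G = ≤-from
      (subst (0# ≤_) (ℝ-Ring.+-comm _ _ ■ ℝ-Ring.+-identityʳ _ ■ split-sum (λ K → ℙ (λ ω → true ∧ K ω)))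
        (subst (λ z → 0# ≤ z + ∑ zs (λ k → c k * ℙ (λ ω → true ∧ K k ω))) (ℝ-Ring.zeroˡ _)
          (simple-nonNeg c K zs eK 0# event-Ω λ ω _ →
            subst (0# ≤_) (sym (ℝ-Ring.+-identityˡ _ ■ split-sum (λ K → 𝟙 (K ω)))) (0≤-≤ (F≤G ω)))))
      (solve 2 (λ x y → y := x :+ (y :- x)) refl _ _)
      where
      zs : List (I ⊎ J)
      zs = map inj₁ xs ++ map inj₂ ys
      c : I ⊎ J → ℝ
      c (inj₁ i) = - a i
      c (inj₂ j) = b j
      K : I ⊎ J → Ω → Bool
      K (inj₁ i) = F i
      K (inj₂ j) = G j
      eK : ∀ {k} → k ∈ˡ zs → Event (K k)
      eK k∈ with Mem.∈-++⁻ (map inj₁ xs) k∈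
      ... | inj₁ k∈xs with _ , i∈ , refl ← Mem.∈-map⁻ inj₁ k∈xs = eF i∈
      ... | inj₂ k∈ys with _ , j∈ , refl ← Mem.∈-map⁻ inj₂ k∈ys = eG j∈

      split-sum : ∀ (μ : (Ω → Bool) → ℝ) →
        ∑ zs (λ k → c k * μ (K k)) ≡ ∑ ys (λ j → b j * μ (G j)) - ∑ xs (λ i → a i * μ (F i))
      split-sum μ = ∑-++ (map inj₁ xs) (map inj₂ ys) _
        ■ cong₂ _+_ (∑-map inj₁ xs _ ■ neg xs) (∑-map inj₂ ys _)
        ■ ℝ-Ring.+-comm _ _
        where
        neg : ∀ xs → ∑ xs (λ i → - a i * μ (F i)) ≡ - ∑ xs (λ i → a i * μ (F i))
        neg []       = sym ℝ-RingProperties.-0#≈0#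
        neg (x ∷ xs) = cong (- a x * μ (F x) +_) (neg xs)
          ■ solve 3 (λ a m r → :- a :* m :+ :- r := :- (a :* m :+ r)) refl (a x) (μ (F x)) _

    Measurable : {A : Set} → (Ω → A) → Set
    Measurable f = ∀ g → Event (g ∘ f)

    simple-≡ : ∀ {I J : Set} (xs : List I) (ys : List J) (a : I → ℝ) (b : J → ℝ) {F : I → Ω → Bool} {G : J → Ω → Bool} →
      (∀ {i} → i ∈ˡ xs → Event (F i)) → (∀ {j} → j ∈ˡ ys → Event (G j)) →
      (∀ ω → ∑ xs (λ i → a i * 𝟙 (F i ω)) ≡ ∑ ys (λ j → b j * 𝟙 (G j ω))) →
      ∑ xs (λ i → a i * ℙ (F i)) ≡ ∑ ys (λ j → b j * ℙ (G j))
    simple-≡ xs ys a b eF eG F≡G = ≤-antisym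
      (simple-mono xs ys a b eF eG (≤-reflexive ∘ F≡G)) (simple-mono ys xs b a eG eF (≤-reflexive ∘ sym ∘ F≡G))

-- Enumerations of orderings and vectors

∈-concatMap⁺ : ∀ {A B : Set} (f : A → List⁺ B) (xs : List⁺ A) {y x} →
  x ∈ˡ List⁺.toList xs → y ∈ˡ List⁺.toList (f x) → y ∈ˡ List⁺.toList (List⁺.concatMap f xs)
∈-concatMap⁺ f xs {y} x∈ y∈ = subst (y ∈ˡ_) (List⁺.toList->>= f xs)
  (Mem.∈-concat⁺′ y∈ (Mem.∈-map⁺ (List⁺.toList ∘ f) x∈))

∈-concatMap⁻ : ∀ {A B : Set} (f : A → List⁺ B) (xs : List⁺ A) {y} →
  y ∈ˡ List⁺.toList (List⁺.concatMap f xs) → ∃ λ x → x ∈ˡ List⁺.toList xs × y ∈ˡ List⁺.toList (f x)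
∈-concatMap⁻ f xs {y} y∈
  with ys , y∈ys , ys∈ ← Mem.∈-concat⁻′ (map (List⁺.toList ∘ f) (List⁺.toList xs)) (subst (y ∈ˡ_) (sym (List⁺.toList->>= f xs)) y∈)
  with x , x∈ , refl ← Mem.∈-map⁻ (List⁺.toList ∘ f) ys∈ = x , x∈ , y∈ys

module _ {A : Set} where

  ∈-insertions⁺ : ∀ (x : A) ys zs → ys ++ x ∷ zs ∈ˡ List⁺.toList (insertions x (ys ++ zs))
  ∈-insertions⁺ x []       []       = here refl
  ∈-insertions⁺ x []       (z ∷ zs) = here refl
  ∈-insertions⁺ x (y ∷ ys) zs       = there (Mem.∈-map⁺ (y ∷_) (∈-insertions⁺ x ys zs))

  ∈-insertions⁻ : ∀ (x : A) ys {zs} → zs ∈ˡ List⁺.toList (insertions x ys) → zs ↭ x ∷ ys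
  ∈-insertions⁻ x []       (here refl) = ↭-refl
  ∈-insertions⁻ x (y ∷ ys) (here refl) = ↭-refl
  ∈-insertions⁻ x (y ∷ ys) (there zs∈) with zs , zs∈ , refl ← Mem.∈-map⁻ (y ∷_) zs∈ =
    ↭-trans (↭-prep y (∈-insertions⁻ x ys zs∈)) (_↭_.swap y x ↭-refl)

  ∈-orderings⁺ : ∀ {ys} (xs : List A) → ys ↭ xs → ys ∈ˡ List⁺.toList (orderings xs)
  ∈-orderings⁺ []       ys↭[] with refl ← Perm.↭-empty-inv ys↭[] = here refl
  ∈-orderings⁺ (x ∷ xs) ys↭ with as , bs , refl ← Mem.∈-∃++ (Perm.∈-resp-↭ (↭-sym ys↭) (here refl)) =
    ∈-concatMap⁺ (insertions x) (orderings xs) (∈-orderings⁺ xs (Perm.drop-mid as [] ys↭)) (∈-insertions⁺ x as bs)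

  ∈-orderings⁻ : ∀ {ys} (xs : List A) → ys ∈ˡ List⁺.toList (orderings xs) → ys ↭ xs
  ∈-orderings⁻ []       (here refl) = ↭-refl
  ∈-orderings⁻ (x ∷ xs) ys∈ with zs , zs∈ , ys∈zs ← ∈-concatMap⁻ (insertions x) (orderings xs) ys∈ =
    ↭-trans (∈-insertions⁻ x zs ys∈zs) (↭-prep x (∈-orderings⁻ xs zs∈))

  allVecs : List A → ∀ n → List (Vec A n)
  allVecs xs zero    = [] ∷ []
  allVecs xs (suc n) = cartesianProductWith _∷_ xs (allVecs xs n)

  allVecs-unique : ∀ {xs} n → Unique xs → Unique (allVecs xs n)
  allVecs-unique zero    u = [] ∷ []
  allVecs-unique (suc n) u = Unique.cartesianProductWith⁺ _∷_ Vec.∷-injective u (allVecs-unique n u)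

  ∈-allVecs⁺ : ∀ {xs n} (v : Vec A n) → (∀ i → lookup v i ∈ˡ xs) → v ∈ˡ allVecs xs n
  ∈-allVecs⁺ []      v⊆xs = here refl
  ∈-allVecs⁺ (x ∷ v) v⊆xs = Mem.∈-cartesianProductWith⁺ _∷_ (v⊆xs zero) (∈-allVecs⁺ v (v⊆xs ∘ suc))

  ∈-allVecs⁻ : ∀ {xs n} (v : Vec A n) → v ∈ˡ allVecs xs n → ∀ i → lookup v i ∈ˡ xs
  ∈-allVecs⁻ {xs} {suc n} (x ∷ v) v∈
    with _ , _ , x∈ , v∈′ , refl ← Mem.∈-cartesianProductWith⁻ _∷_ xs (allVecs xs n) v∈ =
    λ { zero → x∈ ; (suc i) → ∈-allVecs⁻ v v∈′ i }

-- Arrival times as three layers of coins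

Phase : Set
Phase = Fin 4

pattern inY  = zero
pattern inS₀ = suc zero
pattern inS₁ = suc (suc zero)
pattern inS₂ = suc (suc (suc zero))

-- The coins decide in turn about Y, about S₀, and between S₁ and S₂. Coins after the deciding one
-- are still tossed but have no effect, which keeps the three layers independent.
phase : Bool → Bool → Bool → Phase
phase true  _     _     = inY
phase false true  _     = inS₀
phase false false true  = inS₁
phase false false false = inS₂

phases : ∀ {n} → Subset n → Subset n → Subset n → Vec Phase n
phases Y Z U = tabulate λ a → phase (lookup Y a) (lookup Z a) (lookup U a)

module _ ⦃ ℛ : RealNumbers ⦄ where
  open ℝ-Solver using (solve; con; _:+_; _:*_; _:-_; :-_; _:=_)

  ½ : ℝ
  ½ = fromℕ 2 ⁻¹

  ½+½ : ½ + ½ ≡ 1#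
  ½+½ = solve 1 (λ h → h :+ h := con (ℤ.+ 2) :* h) refl ½ ■ *-inverseʳ (0<fromℕ 2)

  0≤½ : 0# ≤ ½
  0≤½ = <⇒≤ (0<⁻¹ (0<fromℕ 2))

  1-½ : 1# - ½ ≡ ½
  1-½ = cong (_- ½) (sym ½+½) ■ solve 1 (λ h → h :+ h :- h := h) refl ½

  ½≤1 : ½ ≤ 1#
  ½≤1 = ≤-from 0≤½ (sym ½+½)

  Coins-linear : ∀ (p : ℝ) n (x y : ℝ) (f g : Subset n → ℝ) →
    Coins p n (λ Y → x * f Y + y * g Y) ≡ x * Coins p n f + y * Coins p n g
  Coins-linear p n x y f g = Coins-+ p n _ _ ■ cong₂ _+_ (Coins-*ˡ p n x f) (Coins-*ˡ p n y g)

  module Phases {p q : ℝ} (0≤p : 0# ≤ p) (p≤1 : p ≤ 1#) (0≤q : 0# ≤ q) (q≤1 : q ≤ 1#) where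

    p₂ p₃ : ℝ
    p₂ = p + (1# - p) * q
    p₃ = (1# + p₂) / fromℕ 2

    1-p₂ : 1# - p₂ ≡ (1# - p) * (1# - q)
    1-p₂ = solve 2 (λ p q → con (ℤ.+ 1) :- (p :+ (con (ℤ.+ 1) :- p) :* q)
                     := (con (ℤ.+ 1) :- p) :* (con (ℤ.+ 1) :- q)) refl p q

    -- `p₃` is the midpoint between `p₂` and one. The windows of S₁ and S₂ are thus equally long,
    -- which makes the third coin fair.
    p₃-p₂ : p₃ - p₂ ≡ ½ * (1# - p₂)
    p₃-p₂ = cong (λ z → (1# + p₂) * ½ - z) (sym (ℝ-Ring.*-identityˡ p₂) ■ cong (_* p₂) (sym ½+½))
      ■ solve 2 (λ x h → (con (ℤ.+ 1) :+ x) :* h :- (h :+ h) :* x := h :* (con (ℤ.+ 1) :- x)) refl p₂ ½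

    1-p₃ : 1# - p₃ ≡ ½ * (1# - p₂)
    1-p₃ = cong (λ z → z - (1# + p₂) * ½) (sym ½+½)
      ■ solve 2 (λ x h → h :+ h :- (con (ℤ.+ 1) :+ x) :* h := h :* (con (ℤ.+ 1) :- x)) refl p₂ ½

    p≤p₂ : p ≤ p₂
    p≤p₂ = ≤-from (*-nonNeg (0≤-≤ p≤1) 0≤q) refl

    0≤1-p₂ : 0# ≤ 1# - p₂
    0≤1-p₂ = subst (0# ≤_) (sym 1-p₂) (*-nonNeg (0≤-≤ p≤1) (0≤-≤ q≤1))

    p₂≤p₃ : p₂ ≤ p₃
    p₂≤p₃ = ≤-from (subst (0# ≤_) (sym p₃-p₂) (*-nonNeg 0≤½ 0≤1-p₂)) (solve 2 (λ x y → y := x :+ (y :- x)) refl p₂ p₃)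

    p₃≤1 : p₃ ≤ 1#
    p₃≤1 = ≤-from (subst (0# ≤_) (sym 1-p₃) (*-nonNeg 0≤½ 0≤1-p₂)) (solve 1 (λ x → con (ℤ.+ 1) := x :+ (con (ℤ.+ 1) :- x)) refl p₃)

    lo hi : Phase → ℝ
    lo inY  = 0#
    lo inS₀ = p
    lo inS₁ = p₂
    lo inS₂ = p₃
    hi inY  = p
    hi inS₀ = p₂
    hi inS₁ = p₃
    hi inS₂ = 1#

    windows : ∀ x → 0# ≤ lo x × lo x ≤ hi x × hi x ≤ 1#
    windows inY  = ≤-refl , 0≤p , p≤1
    windows inS₀ = 0≤p , p≤p₂ , ≤-trans p₂≤p₃ p₃≤1
    windows inS₁ = ≤-trans 0≤p p≤p₂ , p₂≤p₃ , p₃≤1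
    windows inS₂ = ≤-trans 0≤p (≤-trans p≤p₂ p₂≤p₃) , p₃≤1 , ≤-refl

    phaseOf : ℝ → Phase
    phaseOf t with t <? p | t <? p₂ | t <? p₃
    ... | yes _ | _     | _     = inY
    ... | no _  | yes _ | _     = inS₀
    ... | no _  | no _  | yes _ = inS₁
    ... | no _  | no _  | no _  = inS₂

    phaseOf-window : ∀ {t : ℝ} → 0# < t → t < 1# → lo (phaseOf t) ≤ t × t < hi (phaseOf t)
    phaseOf-window {t} 0<t t<1 with t <? p | t <? p₂ | t <? p₃
    ... | yes t<p | _        | _        = <⇒≤ 0<t , t<p
    ... | no t≮p  | yes t<p₂ | _        = ≮⇒≥ t≮p , t<p₂
    ... | no _    | no t≮p₂  | yes t<p₃ = ≮⇒≥ t≮p₂ , t<p₃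
    ... | no _    | no _     | no t≮p₃  = ≮⇒≥ t≮p₃ , t<1

    lo<hi⇒≤ : ∀ x y {t : ℝ} → lo x ≤ t → t < hi y → toℕ x ℕ.≤ toℕ y
    lo<hi⇒≤ x y lox≤t t<hiy = ℕ.≮⇒≥ λ y<x → <⇒≱ t<hiy (≤-trans (ordered y x y<x) lox≤t)
      where
      ordered : ∀ y x → toℕ y ℕ.< toℕ x → hi y ≤ lo x
      ordered inY  inS₀ _ = ≤-refl
      ordered inY  inS₁ _ = p≤p₂
      ordered inY  inS₂ _ = ≤-trans p≤p₂ p₂≤p₃
      ordered inS₀ inS₁ _ = ≤-refl
      ordered inS₀ inS₂ _ = p₂≤p₃
      ordered inS₁ inS₂ _ = ≤-refl
      ordered inY  inY  ()
      ordered inS₀ inY  ()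
      ordered inS₀ inS₀ (ℕ.s≤s ())
      ordered inS₁ inY  ()
      ordered inS₁ inS₀ (ℕ.s≤s ())
      ordered inS₁ inS₁ (ℕ.s≤s (ℕ.s≤s ()))
      ordered inS₂ inY  ()
      ordered inS₂ inS₀ (ℕ.s≤s ())
      ordered inS₂ inS₁ (ℕ.s≤s (ℕ.s≤s ()))
      ordered inS₂ inS₂ (ℕ.s≤s (ℕ.s≤s (ℕ.s≤s ())))

    phaseOf-unique : ∀ x {t : ℝ} → 0# < t → t < 1# → lo x ≤ t → t < hi x → phaseOf t ≡ x
    phaseOf-unique x {t} 0<t t<1 lo≤ <hi =
      let lo′≤ , <hi′ = phaseOf-window 0<t t<1 in
      Fin.toℕ-injective (ℕ.≤-antisym (lo<hi⇒≤ (phaseOf t) x lo′≤ <hi) (lo<hi⇒≤ x (phaseOf t) lo≤ <hi′))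

    -- By `law`, this is the probability that every arrival time falls into the window that `c`
    -- assigns to its agent.
    mass : ∀ {n} → Vec Phase n → ℝ
    mass {n} c = ∏ (allFin n) (λ a → hi (lookup c a) - lo (lookup c a))

    0≤mass : ∀ {n} (c : Vec Phase n) → 0# ≤ mass c
    0≤mass {n} c = go (allFin n)
      where
      go : ∀ as → 0# ≤ ∏ as (λ a → hi (lookup c a) - lo (lookup c a))
      go []       = 0≤1
      go (a ∷ as) = *-nonNeg (0≤-≤ (proj₁ (proj₂ (windows (lookup c a))))) (go as)

    mass-∷ : ∀ {n} x (c : Vec Phase n) → mass (x ∷ c) ≡ (hi x - lo x) * mass c
    mass-∷ {n} x c = ∏-allFin-suc n (λ a → hi (lookup (x ∷ c) a) - lo (lookup (x ∷ c) a))

    -- The window lengths are p, (1 - p)q, and twice ½(1 - p)(1 - q), which are the probabilities of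
    -- the four outcomes of the nested coins.
    ∑-mass : ∀ n (f : Vec Phase n → ℝ) →
      ∑ (allVecs (allFin 4) n) (λ c → mass c * f c) ≡
      Coins p n (λ Y → Coins q n (λ Z → Coins ½ n (λ U → f (phases Y Z U))))
    ∑-mass zero    f = solve 1 (λ x → con (ℤ.+ 1) :* x :+ con (ℤ.+ 0) := x) refl (f [])
    ∑-mass (suc n) f = begin
      ∑ (allVecs (allFin 4) (suc n)) (λ c → mass c * f c)
        ≡⟨ ∑-cartesianProductWith _∷_ (allFin 4) (allVecs (allFin 4) n) _ ⟩
      ∑ (allFin 4) (λ x → ∑ (allVecs (allFin 4) n) (λ c → mass (x ∷ c) * f (x ∷ c)))
        ≡⟨ ∑-cong (allFin 4) (λ x → ∑-cong (allVecs (allFin 4) n) (λ c →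
             cong (_* f (x ∷ c)) (mass-∷ x c) ■ ℝ-Ring.*-assoc (hi x - lo x) (mass c) (f (x ∷ c)))
             ■ ∑-*ˡ (allVecs (allFin 4) n) (hi x - lo x) (λ c → mass c * f (x ∷ c))
             ■ cong ((hi x - lo x) *_) (∑-mass n (f ∘ (x ∷_)))) ⟩
      ∑ (allFin 4) (λ x → (hi x - lo x) * Φ x)
        -- The length of the `inS₂` window is written with `1# - ½`, the weight of the `outside`
        -- branch of the third coin.
        ≡⟨ cong₂ (λ u v → (p - 0#) * Φ inY + ((p₂ - p) * Φ inS₀ + (u * Φ inS₁ + (v * Φ inS₂ + 0#))))
             (p₃-p₂ ■ cong (½ *_) 1-p₂) (1-p₃ ■ cong₂ _*_ (sym 1-½) 1-p₂) ⟩
      (p - 0#) * Φ inY + ((p₂ - p) * Φ inS₀ + (½ * ((1# - p) * (1# - q)) * Φ inS₁ + ((1# - ½) * ((1# - p) * (1# - q)) * Φ inS₂ + 0#)))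
        ≡⟨ solve 7 (λ p q h a b c d →
             (p :- con (ℤ.+ 0)) :* a :+ ((p :+ (con (ℤ.+ 1) :- p) :* q :- p) :* b
               :+ (h :* ((con (ℤ.+ 1) :- p) :* (con (ℤ.+ 1) :- q)) :* c
               :+ ((con (ℤ.+ 1) :- h) :* ((con (ℤ.+ 1) :- p) :* (con (ℤ.+ 1) :- q)) :* d :+ con (ℤ.+ 0))))
             := p :* (q :* (h :* a :+ (con (ℤ.+ 1) :- h) :* a) :+ (con (ℤ.+ 1) :- q) :* (h :* a :+ (con (ℤ.+ 1) :- h) :* a))
               :+ (con (ℤ.+ 1) :- p) :* (q :* (h :* b :+ (con (ℤ.+ 1) :- h) :* b) :+ (con (ℤ.+ 1) :- q) :* (h :* c :+ (con (ℤ.+ 1) :- h) :* d)))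
             refl p q ½ (Φ inY) (Φ inS₀) (Φ inS₁) (Φ inS₂) ⟩
      p * (q * (½ * Φ inY + (1# - ½) * Φ inY) + (1# - q) * (½ * Φ inY + (1# - ½) * Φ inY))
        + (1# - p) * (q * (½ * Φ inS₀ + (1# - ½) * Φ inS₀) + (1# - q) * (½ * Φ inS₁ + (1# - ½) * Φ inS₂))
        ≡⟨ cong₂ (λ u v → p * u + (1# - p) * v) (expand inY inY inY inY) (expand inS₀ inS₀ inS₁ inS₂) ⟨
      Coins p (suc n) (λ Y → Coins q (suc n) (λ Z → Coins ½ (suc n) (λ U → f (phases Y Z U)))) ∎
      where
      open ≡-Reasoning
      Φ : Phase → ℝ
      Φ x = Coins p n (λ Y → Coins q n (λ Z → Coins ½ n (λ U → f (x ∷ phases Y Z U))))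

      expand : ∀ a b c d →
        Coins p n (λ Y → q * Coins q n (λ Z → ½ * Coins ½ n (λ U → f (a ∷ phases Y Z U)) + (1# - ½) * Coins ½ n (λ U → f (b ∷ phases Y Z U)))
          + (1# - q) * Coins q n (λ Z → ½ * Coins ½ n (λ U → f (c ∷ phases Y Z U)) + (1# - ½) * Coins ½ n (λ U → f (d ∷ phases Y Z U))))
        ≡ q * (½ * Φ a + (1# - ½) * Φ b) + (1# - q) * (½ * Φ c + (1# - ½) * Φ d)
      expand a b c d = Coins-linear p n q (1# - q)
            (λ Y → Coins q n (λ Z → ½ * Coins ½ n (λ U → f (a ∷ phases Y Z U)) + (1# - ½) * Coins ½ n (λ U → f (b ∷ phases Y Z U))))
            (λ Y → Coins q n (λ Z → ½ * Coins ½ n (λ U → f (c ∷ phases Y Z U)) + (1# - ½) * Coins ½ n (λ U → f (d ∷ phases Y Z U))))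
          ■ cong₂ (λ u v → q * u + (1# - q) * v) (inner a b) (inner c d)
        where
        inner : ∀ a b → Coins p n (λ Y → Coins q n (λ Z → ½ * Coins ½ n (λ U → f (a ∷ phases Y Z U)) + (1# - ½) * Coins ½ n (λ U → f (b ∷ phases Y Z U))))
          ≡ ½ * Φ a + (1# - ½) * Φ b
        inner a b = Coins-cong p n (λ Y → Coins-linear q n ½ (1# - ½)
              (λ Z → Coins ½ n (λ U → f (a ∷ phases Y Z U))) (λ Z → Coins ½ n (λ U → f (b ∷ phases Y Z U))))
          ■ Coins-linear p n ½ (1# - ½) (λ Y → Coins q n (λ Z → Coins ½ n (λ U → f (a ∷ phases Y Z U))))
              (λ Y → Coins q n (λ Z → Coins ½ n (λ U → f (b ∷ phases Y Z U))))

-- Splitting the sample space into boxes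

some : ∀ {I : Set} → List I → (I → Bool) → Bool
some xs f = foldr _∨_ false (map f xs)

some⁺ : ∀ {I : Set} {xs : List I} (f : I → Bool) {x} → x ∈ˡ xs → f x ≡ true → some xs f ≡ true
some⁺ {xs = y ∷ ys} f (here refl) fx = cong (_∨ some ys f) fx
some⁺ {xs = y ∷ ys} f (there x∈) fx = cong (f y ∨_) (some⁺ f x∈ fx) ■ Bool.∨-zeroʳ (f y)

some⁻ : ∀ {I : Set} (xs : List I) (f : I → Bool) → some xs f ≡ true → ∃ λ x → x ∈ˡ xs × f x ≡ true
some⁻ (x ∷ xs) f eq with f x in fx
... | true  = x , here refl , fx
... | false with y , y∈ , fy ← some⁻ xs f eq = y , there y∈ , fy

module _ ⦃ ℛ : RealNumbers ⦄ where
  open ℝ-Solver using (solve; con; _:+_; _:*_; _:-_; :-_; _:=_)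

  event-some : (S : ProbabilitySpace) → let open ProbabilitySpace S in
    ∀ {I : Set} (xs : List I) {F : I → Ω → Bool} → (∀ {i} → i ∈ˡ xs → Event (F i)) → Event (λ ω → some xs (λ i → F i ω))
  event-some S []       eF = Measure.event-∅ S
  event-some S (x ∷ xs) eF = Measure.event-∪ S (eF (here refl)) (event-some S xs (eF ∘ there))

  weight-lookup : ∀ {m} (w : Weight m) X → weight w X ≡ ∑ (allFin m) (λ e → w e * 𝟙 (lookup X e))
  weight-lookup {m} w X = ∑-elements X w ■ ∑-cong (allFin m) (λ e → ℝ-Ring.*-comm _ _)

  -- A box fixes the phases of all agents and the first `N` orders and leaves only the random bits
  -- free. A random set that is determined by these data can be integrated box by box.
  module Discretise {p q : ℝ} (0≤p : 0# ≤ p) (p≤1 : p ≤ 1#) (0≤q : 0# ≤ q) (q≤1 : q ≤ 1#)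
    {n} {seeds : ProbabilitySpace} (source : RandomSource n seeds) (N : ℕ) where

    open RandomSource source
    open ProbabilitySpace seeds using () renaming (Ω to Seed; Event to SeedEvent; ℙ to ℙₛ)
    open Phases 0≤p p≤1 0≤q q≤1
    module M = Measure space
    module Mₛ = Measure seeds

    Orders : Set
    Orders = Vec (List (Fin n)) N

    _≟ᵖ_ : DecidableEquality (Vec Phase n)
    _≟ᵖ_ = Vec.≡-dec _≟_

    _≟ᵒ_ : DecidableEquality Orders
    _≟ᵒ_ = Vec.≡-dec (List.≡-dec _≟_)

    phasesAt : Ω → Vec Phase n
    phasesAt ω = tabulate (phaseOf ∘ time ω)

    ordersAt : Ω → Orders
    ordersAt ω = tabulate (order ω ∘ toℕ)

    phaseVecs : List (Vec Phase n)
    phaseVecs = allVecs (allFin 4) n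

    -- Removing duplicates supplies the uniqueness required by `∑-single` without any analysis of
    -- `orderings`.
    permutations : List (List (Fin n))
    permutations = deduplicate (List.≡-dec _≟_) (List⁺.toList (orderings (allFin n)))

    orderVecs : List Orders
    orderVecs = allVecs permutations N

    ∈-phaseVecs : ∀ ω → phasesAt ω ∈ˡ phaseVecs
    ∈-phaseVecs ω = ∈-allVecs⁺ (phasesAt ω) (λ _ → Mem.∈-allFin _)

    ∈-orderVecs : ∀ ω → ordersAt ω ∈ˡ orderVecs
    ∈-orderVecs ω = ∈-allVecs⁺ (ordersAt ω) λ i → Mem.∈-deduplicate⁺ (List.≡-dec _≟_)
      (∈-orderings⁺ (allFin n) (subst (_↭ allFin n) (sym (Vec.lookup∘tabulate (order ω ∘ toℕ) i)) (order-perm ω (toℕ i))))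

    orderVecs-↭ : ∀ {ρ} → ρ ∈ˡ orderVecs → ∀ i → lookup ρ i ↭ allFin n
    orderVecs-↭ {ρ} ρ∈ i = ∈-orderings⁻ (allFin n)
      (Mem.∈-deduplicate⁻ (List.≡-dec _≟_) (List⁺.toList (orderings (allFin n))) (∈-allVecs⁻ ρ ρ∈ i))

    phaseVecs-unique : Unique phaseVecs
    phaseVecs-unique = allVecs-unique n (Unique.allFin⁺ 4)

    orderVecs-unique : Unique orderVecs
    orderVecs-unique = allVecs-unique N
      (UniqueDec.deduplicate-! (List.≡-dec _≟_) (List⁺.toList (orderings (allFin n))))

    box : Vec Phase n → Orders → (Seed → Bool) → Ω → Bool
    box c ρ F = cylinder (lo ∘ lookup c) (hi ∘ lookup c) (lookup ρ) F

    orders-≡ : ∀ ω ρ → does (all? λ i → List.≡-dec _≟_ (order ω (toℕ i)) (lookup ρ i)) ≡ does (ordersAt ω ≟ᵒ ρ)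
    orders-≡ ω ρ = does-⇔ (all? λ i → List.≡-dec _≟_ (order ω (toℕ i)) (lookup ρ i)) (ordersAt ω ≟ᵒ ρ)
      (λ eq → Vec.tabulate-cong eq ■ Vec.tabulate∘lookup ρ)
      (λ { refl i → sym (Vec.lookup∘tabulate (order ω ∘ toℕ) i) })

    box-≡ : ∀ c ρ F ω → box c ρ F ω ≡ does (phasesAt ω ≟ᵖ c) ∧ (does (ordersAt ω ≟ᵒ ρ) ∧ F (bits ω))
    box-≡ c ρ F ω = cong₂ (λ x y → x ∧ (y ∧ F (bits ω)))
      (does-⇔ (all? λ a → (lo (lookup c a) ≤? time ω a) ×-dec (time ω a <? hi (lookup c a))) (phasesAt ω ≟ᵖ c)
        (λ inside → Vec.tabulate-cong (λ a → phaseOf-unique (lookup c a) (proj₁ (time-range ω a)) (proj₂ (time-range ω a))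
                      (proj₁ (inside a)) (proj₂ (inside a))) ■ Vec.tabulate∘lookup c)
        (λ { refl a → subst (λ x → lo x ≤ time ω a × time ω a < hi x) (sym (Vec.lookup∘tabulate (phaseOf ∘ time ω) a))
                        (phaseOf-window (proj₁ (time-range ω a)) (proj₂ (time-range ω a))) }))
      (orders-≡ ω ρ)

    K : ℝ
    K = ∏ (allFin N) (λ _ → fromℕ (n ℕ.!) ⁻¹)

    box-event : ∀ c {ρ} → ρ ∈ˡ orderVecs → ∀ {F} → SeedEvent F → Event (box c ρ F)
    box-event c {ρ} ρ∈ eF = proj₁ (law (lo ∘ lookup c) (hi ∘ lookup c) (λ a → windows (lookup c a)) (lookup ρ) (orderVecs-↭ ρ∈) _ eF)

    ℙ-box : ∀ c {ρ} → ρ ∈ˡ orderVecs → ∀ {F} → SeedEvent F → ℙ (box c ρ F) ≡ mass c * K * ℙₛ F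
    ℙ-box c {ρ} ρ∈ eF = proj₂ (law (lo ∘ lookup c) (hi ∘ lookup c) (λ a → windows (lookup c a)) (lookup ρ) (orderVecs-↭ ρ∈) _ eF)

    -- The order vectors are not counted. With unrestricted times and bits each of them is an event
    -- of probability `K`, and exactly one of these events occurs.
    ∑-K : ∑ orderVecs (λ _ → K) ≡ 1#
    ∑-K = ∑-cong∈ orderVecs (λ ρ∈ → sym (ℝ-Ring.*-identityˡ _ ■ ℙ-anytime ρ∈))
      ■ M.simple-≡ orderVecs (allFin 1) (λ _ → 1#) (λ _ → 1#)
          (λ {ρ} ρ∈ → proj₁ (law (λ _ → 0#) (λ _ → 1#) (λ _ → ≤-refl , 0≤1 , ≤-refl) (lookup ρ) (orderVecs-↭ ρ∈) _ seed-Ω))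
          (λ _ → event-Ω) pointwise
      ■ solve 1 (λ x → con (ℤ.+ 1) :* x :+ con (ℤ.+ 0) := x) refl _ ■ ℙ-Ω
      where
      seed-Ω : SeedEvent (λ _ → true)
      seed-Ω = ProbabilitySpace.event-Ω seeds

      anytime : Orders → Ω → Bool
      anytime ρ = cylinder (λ _ → 0#) (λ _ → 1#) (lookup ρ) (λ _ → true)

      ℙ-anytime : ∀ {ρ} → ρ ∈ˡ orderVecs → ℙ (anytime ρ) ≡ K
      ℙ-anytime {ρ} ρ∈ =
        proj₂ (law (λ _ → 0#) (λ _ → 1#) (λ _ → ≤-refl , 0≤1 , ≤-refl) (lookup ρ) (orderVecs-↭ ρ∈) _ seed-Ω)
        ■ cong₂ (λ x y → x * K * y)
            (∏-one (allFin n) (λ _ → solve 1 (λ x → x :- con (ℤ.+ 0) := x) refl 1#)) (ProbabilitySpace.ℙ-Ω seeds)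
        ■ solve 1 (λ k → con (ℤ.+ 1) :* k :* con (ℤ.+ 1) := k) refl K

      anytime-≡ : ∀ ρ ω → anytime ρ ω ≡ does (ordersAt ω ≟ᵒ ρ)
      anytime-≡ ρ ω = cong₂ (λ x y → x ∧ (y ∧ true))
          (dec-true (all? λ a → (0# ≤? time ω a) ×-dec (time ω a <? 1#)) (λ a → <⇒≤ (proj₁ (time-range ω a)) , proj₂ (time-range ω a)))
          (orders-≡ ω ρ)
        ■ Bool.∧-identityʳ _

      pointwise : ∀ ω → ∑ orderVecs (λ ρ → 1# * 𝟙 (anytime ρ ω)) ≡ 1# * 𝟙 true + 0#
      pointwise ω = ∑-cong orderVecs (λ ρ → ℝ-Ring.*-comm _ _ ■ cong (λ b → 𝟙 b * 1#) (anytime-≡ ρ ω))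
        ■ ∑-single _≟ᵒ_ (λ _ → 1#) orderVecs-unique (∈-orderVecs ω)
        ■ sym (ℝ-Ring.+-identityʳ _ ■ ℝ-Ring.*-identityˡ 1#)

    module _ {m} (w : Weight m) (0≤w : ∀ e → 0# ≤ w e) (T : Ω → Subset m) (R : Vec Phase n → Orders → Seed → Subset m)
      (R-measurable : ∀ c ρ → Mₛ.Measurable (R c ρ)) (T≡R : ∀ ω → T ω ≡ R (phasesAt ω) (ordersAt ω) (bits ω)) where

      -- A property of `T` holds exactly on a finite union of boxes, each intersected with an event
      -- of the random bits.
      T-measurable : M.Measurable T
      T-measurable g = event-≗ pointwise (event-some space pairs λ {cρ} cρ∈ →
          box-event (proj₁ cρ) (proj₂ (Mem.∈-cartesianProduct⁻ phaseVecs orderVecs cρ∈)) (R-measurable (proj₁ cρ) (proj₂ cρ) g))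
        where
        pairs : List (Vec Phase n × Orders)
        pairs = cartesianProduct phaseVecs orderVecs
        boxes : Ω → Vec Phase n × Orders → Bool
        boxes ω (c , ρ) = box c ρ (g ∘ R c ρ) ω

        pointwise : ∀ ω → some pairs (boxes ω) ≡ g (T ω)
        pointwise ω = Bool-⇔
          (λ eq → let (c , ρ) , _ , in-box = some⁻ pairs (boxes ω) eq
                      c≡ , rest = ∧-true⁻ (sym (box-≡ c ρ (g ∘ R c ρ) ω) ■ in-box)
                      ρ≡ , gR = ∧-true⁻ rest in
                  cong g (T≡R ω ■ cong₂ (λ c ρ → R c ρ (bits ω)) (does⁻ (phasesAt ω ≟ᵖ c) c≡) (does⁻ (ordersAt ω ≟ᵒ ρ) ρ≡)) ■ gR)
          (λ gT → some⁺ (boxes ω) (Mem.∈-cartesianProduct⁺ (∈-phaseVecs ω) (∈-orderVecs ω))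
            (box-≡ (phasesAt ω) (ordersAt ω) (g ∘ R (phasesAt ω) (ordersAt ω)) ω
             ■ cong₂ _∧_ (does⁺ (phasesAt ω ≟ᵖ phasesAt ω) refl)
                 (cong₂ _∧_ (does⁺ (ordersAt ω ≟ᵒ ordersAt ω) refl) (cong g (sym (T≡R ω)) ■ gT))))

      -- Given phases and orders, only the random bits remain. A bound `L` on the resulting
      -- selection probability that does not mention the orders therefore survives averaging over
      -- them.
      𝔼-lower : (L : Vec Phase n → Fin m → ℝ) →
        (∀ c ρ → (∀ i → lookup ρ i ↭ allFin n) → ∀ e → L c e ≤ ℙₛ (λ r → lookup (R c ρ r) e)) →
        ∑ phaseVecs (λ c → mass c * ∑ (allFin m) (λ e → w e * L c e)) ≤ 𝔼 space w T
      𝔼-lower L L≤ = ≤-trans lower (≤-trans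
        (M.simple-mono triples (allSubsets m) (λ { (c , ρ , e) → w e }) (weight w)
           {F = F} {G = λ X ω → does (T ω ≟ˢ X)} F-event (λ {X} _ → T-measurable (λ Y → does (Y ≟ˢ X)))
           (≤-reflexive ∘ pointwise))
        (≤-reflexive (∑-cong (allSubsets m) (λ X → ℝ-Ring.*-comm _ _))))
        where
        triples : List (Vec Phase n × Orders × Fin m)
        triples = cartesianProduct phaseVecs (cartesianProduct orderVecs (allFin m))

        F : Vec Phase n × Orders × Fin m → Ω → Bool
        F (c , ρ , e) = box c ρ (λ r → lookup (R c ρ r) e)

        ∑-triples : ∀ (h : Vec Phase n × Orders × Fin m → ℝ) →
          ∑ triples h ≡ ∑ phaseVecs (λ c → ∑ orderVecs (λ ρ → ∑ (allFin m) (λ e → h (c , ρ , e))))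
        ∑-triples h = ∑-cartesianProductWith _,_ phaseVecs (cartesianProduct orderVecs (allFin m)) h
          ■ ∑-cong phaseVecs (λ c → ∑-cartesianProductWith _,_ orderVecs (allFin m) (λ ρe → h (c , ρe)))

        F-event : ∀ {x} → x ∈ˡ triples → Event (F x)
        F-event {c , ρ , e} x∈ = box-event c
          (proj₁ (Mem.∈-cartesianProduct⁻ orderVecs (allFin m)
            (proj₂ (Mem.∈-cartesianProduct⁻ phaseVecs (cartesianProduct orderVecs (allFin m)) x∈))))
          (R-measurable c ρ (λ X → lookup X e))

        -- Both simple functions take the value `weight w (T ω)` at `ω`, since exactly one pair of
        -- phases and orders matches `ω`.
        pointwise : ∀ ω → ∑ triples (λ x → w (proj₂ (proj₂ x)) * 𝟙 (F x ω)) ≡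
                          ∑ (allSubsets m) (λ X → weight w X * 𝟙 (does (T ω ≟ˢ X)))
        pointwise ω = begin
          ∑ triples (λ x → w (proj₂ (proj₂ x)) * 𝟙 (F x ω))
            ≡⟨ ∑-triples _ ⟩
          ∑ phaseVecs (λ c → ∑ orderVecs (λ ρ → ∑ (allFin m) (λ e → w e * 𝟙 (F (c , ρ , e) ω))))
            ≡⟨ ∑-cong phaseVecs (λ c → ∑-cong orderVecs (λ ρ → pull c ρ) ■ ∑-*ˡ orderVecs _ _) ⟩
          ∑ phaseVecs (λ c → 𝟙 (does (phasesAt ω ≟ᵖ c)) * ∑ orderVecs (λ ρ → 𝟙 (does (ordersAt ω ≟ᵒ ρ)) * weight w (R c ρ (bits ω))))
            ≡⟨ ∑-single _≟ᵖ_ _ phaseVecs-unique (∈-phaseVecs ω) ⟩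
          ∑ orderVecs (λ ρ → 𝟙 (does (ordersAt ω ≟ᵒ ρ)) * weight w (R (phasesAt ω) ρ (bits ω)))
            ≡⟨ ∑-single _≟ᵒ_ _ orderVecs-unique (∈-orderVecs ω) ⟩
          weight w (R (phasesAt ω) (ordersAt ω) (bits ω))
            ≡⟨ cong (weight w) (T≡R ω) ⟨
          weight w (T ω)
            ≡⟨ ∑-single _≟ˢ_ (weight w) (allSubsets-unique m) (∈-allSubsets (T ω)) ⟨
          ∑ (allSubsets m) (λ X → 𝟙 (does (T ω ≟ˢ X)) * weight w X)
            ≡⟨ ∑-cong (allSubsets m) (λ X → ℝ-Ring.*-comm _ _) ⟩
          ∑ (allSubsets m) (λ X → weight w X * 𝟙 (does (T ω ≟ˢ X))) ∎
          where
          open ≡-Reasoning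
          pull : ∀ c ρ → ∑ (allFin m) (λ e → w e * 𝟙 (F (c , ρ , e) ω)) ≡
            𝟙 (does (phasesAt ω ≟ᵖ c)) * (𝟙 (does (ordersAt ω ≟ᵒ ρ)) * weight w (R c ρ (bits ω)))
          pull c ρ = ∑-cong (allFin m) (λ e →
              cong (λ b → w e * 𝟙 b) (box-≡ c ρ (λ r → lookup (R c ρ r) e) ω)
              ■ cong (w e *_) (𝟙-∧ (does (phasesAt ω ≟ᵖ c)) (does (ordersAt ω ≟ᵒ ρ) ∧ lookup (R c ρ (bits ω)) e)
                                   ■ cong (𝟙 (does (phasesAt ω ≟ᵖ c)) *_) (𝟙-∧ (does (ordersAt ω ≟ᵒ ρ)) (lookup (R c ρ (bits ω)) e)))
              ■ solve 4 (λ w x y z → w :* (x :* (y :* z)) := x :* y :* (w :* z)) refl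
                  (w e) (𝟙 (does (phasesAt ω ≟ᵖ c))) (𝟙 (does (ordersAt ω ≟ᵒ ρ))) (𝟙 (lookup (R c ρ (bits ω)) e)))
            ■ ∑-*ˡ (allFin m) (𝟙 (does (phasesAt ω ≟ᵖ c)) * 𝟙 (does (ordersAt ω ≟ᵒ ρ))) (λ e → w e * 𝟙 (lookup (R c ρ (bits ω)) e))
            ■ ℝ-Ring.*-assoc _ _ _
            ■ cong (λ z → 𝟙 (does (phasesAt ω ≟ᵖ c)) * (𝟙 (does (ordersAt ω ≟ᵒ ρ)) * z)) (sym (weight-lookup w (R c ρ (bits ω))))

        0≤K : 0# ≤ K
        0≤K = go (allFin N)
          where
          go : ∀ is → 0# ≤ ∏ is (λ _ → fromℕ (n ℕ.!) ⁻¹)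
          go []       = 0≤1
          go (_ ∷ is) = *-nonNeg (<⇒≤ (0<⁻¹ (0<fromℕ (n ℕ.!) ⦃ n ℕ.!≢0 ⦄))) (go is)

        lower : ∑ phaseVecs (λ c → mass c * ∑ (allFin m) (λ e → w e * L c e)) ≤
                ∑ triples (λ x → w (proj₂ (proj₂ x)) * ℙ (F x))
        -- By `∑-K` the mass of a phase vector is spread over all order vectors, so that every term
        -- carries the probability factor of its box.
        lower = ≤-trans (∑-mono phaseVecs λ c → ≤-trans (≤-reflexive (spread c)) (∑-mono∈ orderVecs λ {ρ} ρ∈ →
            ∑-mono (allFin m) λ e → *-monoˡ-≤ (w e) (0≤w e) (≤-trans
              (*-monoˡ-≤ (mass c * K) (*-nonNeg (0≤mass c) 0≤K) (L≤ c ρ (orderVecs-↭ ρ∈) e))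
              (≤-reflexive (sym (ℙ-box c ρ∈ (R-measurable c ρ (λ X → lookup X e))))))))
          (≤-reflexive (sym (∑-triples _)))
          where
          spread : ∀ c → mass c * ∑ (allFin m) (λ e → w e * L c e) ≡
                         ∑ orderVecs (λ ρ → ∑ (allFin m) (λ e → w e * (mass c * K * L c e)))
          spread c = sym (∑-cong orderVecs (λ ρ →
                ∑-cong (allFin m) (λ e → solve 4 (λ w m k l → w :* (m :* k :* l) := m :* k :* (w :* l)) refl (w e) (mass c) K (L c e))
                ■ ∑-*ˡ (allFin m) (mass c * K) (λ e → w e * L c e)
                ■ solve 3 (λ m k s → m :* k :* s := m :* s :* k) refl (mass c) K (∑ (allFin m) (λ e → w e * L c e)))
              ■ ∑-*ˡ orderVecs (mass c * ∑ (allFin m) (λ e → w e * L c e)) (λ _ → K)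
              ■ cong (mass c * ∑ (allFin m) (λ e → w e * L c e) *_) ∑-K ■ ℝ-Ring.*-identityʳ _)

-- Growth systems

module _ {n} (S : IndependenceSystem n) where

  -- Some independent subset of `X` becomes dependent when `e` is added. For `e` outside `X` this is
  -- membership in the primitive hull, stated without circuits so that it combines with bases and
  -- growth.
  Blocked : Subset n → Fin n → Set
  Blocked X e = e ∈ ground S × ∃ λ I → I ⊆ X × Indep S I × ¬ Indep S (I ∪ ⁅ e ⁆)

  blocked? : ∀ X e → Dec (Blocked X e)
  blocked? X e = (e ∈? ground S) ×-dec anySubset? λ I → (I ⊆? X) ×-dec indep? S I ×-dec ¬? (indep? S (I ∪ ⁅ e ⁆))

  Blocked-mono : ∀ {X Y e} → X ⊆ Y → Blocked X e → Blocked Y e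
  Blocked-mono X⊆Y (e∈ , I , I⊆X , iI , dep) = e∈ , I , (X⊆Y ∘ I⊆X) , iI , dep

  circuit⊆ : ∀ {D} → ¬ Indep S D → D ⊆ ground S → ∃ λ C → C ⊆ D × IsCircuit S C
  circuit⊆ {D} = go (⊂-wellFounded D)
    where
    go : ∀ {D} → Acc _⊂_ D → ¬ Indep S D → D ⊆ ground S → ∃ λ C → C ⊆ D × IsCircuit S C
    go {D} (acc smaller) dep D⊆ with anySubset? (λ D′ → (D′ ⊂? D) ×-dec ¬? (indep? S D′))
    ... | yes (D′ , D′⊂D , dep′) with C , C⊆D′ , circuit ← go (smaller D′⊂D) dep′ (D⊆ ∘ proj₁ D′⊂D) =
      C , (proj₁ D′⊂D ∘ C⊆D′) , circuit
    ... | no ∄D′ = D , id , D⊆ , dep , λ D′ D′⊂D → decidable-stable (indep? S D′) λ dep′ → ∄D′ (D′ , D′⊂D , dep′)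

  private
    hull? : ∀ X e → Dec (e ∈ ground S × ∃ λ C → IsCircuit S C × e ∈ C × C ⊆ (X ∪ ⁅ e ⁆))
    hull? X e = (e ∈? ground S) ×-dec anySubset? λ C → circuit? S C ×-dec (e ∈? C) ×-dec (C ⊆? (X ∪ ⁅ e ⁆))

  PHull-mono : ∀ {X Y} → X ⊆ Y → PHull S X ⊆ PHull S Y
  PHull-mono {X} {Y} X⊆Y {e} e∈ with x∈p∪q⁻ X _ e∈
  ... | inj₁ e∈X = x∈p∪q⁺ (inj₁ (X⊆Y e∈X))
  ... | inj₂ e∈C with e∈S , C , circuit , e∈C , C⊆ ← comprehension⁻ (hull? X) e∈C =
    x∈p∪q⁺ (inj₂ (comprehension⁺ (hull? Y) (e∈S , C , circuit , e∈C , λ x∈ → ∪⁅⁆-mono X⊆Y (C⊆ x∈))))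

  -- A circuit inside I + e must contain `e`, since otherwise it would lie in the independent set I.
  Blocked⇒PHull : ∀ {X e} → Blocked X e → e ∈ PHull S X
  Blocked⇒PHull {X} {e} (e∈ , I , I⊆X , iI , dep)
    with circuit⊆ dep (λ x∈ → case ∈-∪⁅⁆⁻ x∈ of λ { (inj₁ x∈I) → indep⊆ground S iI x∈I ; (inj₂ refl) → e∈ })
  ... | C , C⊆ , circuit with e ∈? C
  ... | yes e∈C = x∈p∪q⁺ (inj₂ (comprehension⁺ (hull? X) (e∈ , C , circuit , e∈C , λ x∈ → ∪⁅⁆-mono I⊆X (C⊆ x∈))))
  ... | no e∉C  = contradiction (downward S C⊆I iI) (proj₁ (proj₂ circuit))
    where
    C⊆I : C ⊆ I
    C⊆I x∈ with ∈-∪⁅⁆⁻ (C⊆ x∈)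
    ... | inj₁ x∈I  = x∈I
    ... | inj₂ refl = contradiction x∈ e∉C

  -- The circuit without `e` is the witness: it is independent by minimality and lies in `X`.
  PHull⇒Blocked : ∀ {X e} → e ∈ PHull S X → e ∉ X → Blocked X e
  PHull⇒Blocked {X} {e} e∈ e∉X with x∈p∪q⁻ X _ e∈
  ... | inj₁ e∈X = contradiction e∈X e∉X
  ... | inj₂ e∈′ with e∈S , C , (C⊆S , dep , minimal) , e∈C , C⊆ ← comprehension⁻ (hull? X) e∈′ =
    e∈S , C ─ ⁅ e ⁆ , rest⊆X , minimal _ (p─q⊆p C ⁅ e ⁆ , e , e∈C , λ e∈′ → proj₂ (∈-─⁻ C ⁅ e ⁆ e∈′) (x∈⁅x⁆ e)) ,
    λ indep → dep (downward S C⊆rest indep)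
    where
    rest⊆X : C ─ ⁅ e ⁆ ⊆ X
    rest⊆X {x} x∈ with x∈C , x∉e ← ∈-─⁻ C ⁅ e ⁆ x∈ | ∈-∪⁅⁆⁻ (C⊆ (p─q⊆p C ⁅ e ⁆ x∈))
    ... | inj₁ x∈X  = x∈X
    ... | inj₂ refl = contradiction (x∈⁅x⁆ e) x∉e
    C⊆rest : C ⊆ (C ─ ⁅ e ⁆) ∪ ⁅ e ⁆
    C⊆rest {x} x∈ with x ≟ e
    ... | yes refl = ∈-∪⁅⁆⁺ʳ
    ... | no x≢e   = ∈-∪⁅⁆⁺ˡ (x∈p∧x∉q⇒x∈p─q x∈ (x≢e ∘ x∈⁅y⁆⇒x≡y e))

  basis⊇ : ∀ {I X} → Indep S I → I ⊆ X → ∃ λ P → IsBasis S P X × I ⊆ P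
  basis⊇ {I} {X} = go (⊃-wellFounded I)
    where
    go : ∀ {I} → Acc _⊃_ I → Indep S I → I ⊆ X → ∃ λ P → IsBasis S P X × I ⊆ P
    go {I} (acc larger) iI I⊆X with anySubset? (λ J → (I ⊂? J) ×-dec (J ⊆? X) ×-dec indep? S J)
    ... | yes (J , I⊂J , J⊆X , iJ) with P , basis , J⊆P ← go (larger I⊂J) iJ J⊆X = P , basis , (J⊆P ∘ proj₁ I⊂J)
    ... | no ∄J = I , (I⊆X , iI , λ P I⊆P P⊆X iP → subset-≡ (λ {x} x∈P → decidable-stable (x ∈? I) λ x∉I →
                    ∄J (P , (I⊆P , x , x∈P , x∉I) , P⊆X , iP)) I⊆P) , id

  indep-basis : ∀ {P} → Indep S P → IsBasis S P P
  indep-basis iP = id , iP , λ P′ P⊆P′ P′⊆P _ → subset-≡ P′⊆P P⊆P′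

  -- If `t` belonged to the compatible part Q, then P + t would be independent; so all of `T` falls
  -- into the small part Z. As Q is compatible with all bases at once, every `t` may bring its own
  -- P.
  growth-count : ∀ {κ X I T} → IsGrowth S κ → X ⊆ ground S → Indep S I → T ⊆ I ─ X →
    (∀ {t} → t ∈ T → ∃ λ P → IsBasis S P X × ¬ Indep S (P ∪ ⁅ t ⁆)) → ∣ T ∣ ℕ.≤ κ ℕ.* ∣ X ─ I ∣
  growth-count {κ} {X} {I} {T} (_ , growth) X⊆ iI T⊆ dep
    with Q , Z , Q∪Z≡ , _ , ∣Z∣≤ , P∪Q-indep ← growth X I X⊆ iI = ℕ.≤-trans (p⊆q⇒∣p∣≤∣q∣ T⊆Z) ∣Z∣≤
    where
    T⊆Z : T ⊆ Z
    T⊆Z {t} t∈ with x∈p∪q⁻ Q Z (subst (t ∈_) (sym Q∪Z≡) (T⊆ t∈))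
    ... | inj₂ t∈Z = t∈Z
    ... | inj₁ t∈Q with P , basis , ¬indep ← dep t∈ = contradiction (downward S P∪t⊆ (P∪Q-indep P basis)) ¬indep
      where
      P∪t⊆ : P ∪ ⁅ t ⁆ ⊆ P ∪ Q
      P∪t⊆ x∈ with ∈-∪⁅⁆⁻ x∈
      ... | inj₁ x∈P  = x∈p∪q⁺ (inj₁ x∈P)
      ... | inj₂ refl = x∈p∪q⁺ (inj₂ t∈Q)

module _ ⦃ ℛ : RealNumbers ⦄ {n} (w : Weight n) where

  heavier-wf : WellFounded (λ f e → w e < w f)
  heavier-wf = spo-wellFounded {_≈_ = _≡_} record
    { isEquivalence = isEquivalence
    ; irrefl        = λ { refl → <-irrefl }
    ; trans         = λ f>e e>d → <-trans e>d f>e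
    ; <-resp-≈      = (λ { refl → id }) , (λ { refl → id })
    }

  lighter-wf : WellFounded (λ f e → w f < w e)
  lighter-wf = spo-wellFounded {_≈_ = _≡_} record
    { isEquivalence = isEquivalence
    ; irrefl        = λ { refl → <-irrefl }
    ; trans         = <-trans
    ; <-resp-≈      = (λ { refl → id }) , (λ { refl → id })
    }

  above : Subset n → Fin n → Subset n
  above X e = comprehension λ f → (f ∈? X) ×-dec (w e <? w f)

  ∈-above⁺ : ∀ {X e f} → f ∈ X → w e < w f → f ∈ above X e
  ∈-above⁺ {X} {e} f∈X e<f = comprehension⁺ (λ f → (f ∈? X) ×-dec (w e <? w f)) (f∈X , e<f)

  ∈-above⁻ : ∀ {X e f} → f ∈ above X e → f ∈ X × w e < w f
  ∈-above⁻ {X} {e} = comprehension⁻ (λ f → (f ∈? X) ×-dec (w e <? w f))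

  module _ (w-injective : Injective _≡_ _≡_ w) where

    ≢⇒< : ∀ {e f} → e ≢ f → ¬ w f < w e → w e < w f
    ≢⇒< e≢f f≮e = ≮⇒≥ f≮e , e≢f ∘ w-injective

    lightest : ∀ {X} → Nonempty X → ∃ λ e → e ∈ X × (∀ {f} → f ∈ X → f ≢ e → w e < w f)
    lightest {X} (e , e∈X) = go (lighter-wf e) e∈X
      where
      go : ∀ {e} → Acc (λ f e → w f < w e) e → e ∈ X → ∃ λ e → e ∈ X × (∀ {f} → f ∈ X → f ≢ e → w e < w f)
      go {e} (acc lighter) e∈X with any? (λ f → (f ∈? X) ×-dec (w f <? w e))
      ... | yes (f , f∈X , f<e) = go (lighter f<e) f∈X
      ... | no ∄f = e , e∈X , λ {f} f∈X f≢e → ≢⇒< (f≢e ∘ sym) (λ f<e → ∄f (f , f∈X , f<e))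

    module _ (S : IndependenceSystem n) (R : Subset n) where

      free? : ∀ e → Dec ((e ∈ R × e ∈ ground S) × ¬ Blocked S (above R e) e)
      free? e = ((e ∈? R) ×-dec (e ∈? ground S)) ×-dec ¬? (blocked? S (above R e) e)

      -- The elements of `R` that no heavier part of `R` blocks. In a matroid this is the greedy
      -- basis of `R`.
      free : Subset n
      free = comprehension free?

      -- The lightest element of a circuit of free elements would be blocked by the rest of the
      -- circuit, which is heavier and lies in `R`.
      free-indep : ∀ {D} → D ⊆ free → Indep S D
      free-indep {D} D⊆ = decidable-stable (indep? S D) λ dep →
        let C , C⊆D , C⊆S , C-dep , minimal = circuit⊆ S dep (λ x∈ → proj₂ (proj₁ (comprehension⁻ free? (D⊆ x∈))))
            e , e∈C , e-lightest = lightest (nonempty C C-dep)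
            (e∈R , e∈S) , unblocked = comprehension⁻ free? (D⊆ (C⊆D e∈C))
        in unblocked
          ( e∈S , C ─ ⁅ e ⁆
          , (λ x∈ → let x∈C , x∉e = ∈-─⁻ C ⁅ e ⁆ x∈ in
               ∈-above⁺ (proj₁ (proj₁ (comprehension⁻ free? (D⊆ (C⊆D x∈C))))) (e-lightest x∈C λ { refl → x∉e (x∈⁅x⁆ e) }))
          , minimal _ (p─q⊆p C ⁅ e ⁆ , e , e∈C , λ e∈′ → proj₂ (∈-─⁻ C ⁅ e ⁆ e∈′) (x∈⁅x⁆ e))
          , λ indep → C-dep (downward S (C⊆rest C e) indep) )
        where
        nonempty : ∀ C → ¬ Indep S C → Nonempty C
        nonempty C dep with nonempty? C
        ... | yes ne = ne
        ... | no em = contradiction (downward S (λ {x} x∈ → contradiction (x , x∈) em) (proj₂ (inhabited S))) dep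
        C⊆rest : ∀ C e → C ⊆ (C ─ ⁅ e ⁆) ∪ ⁅ e ⁆
        C⊆rest C e {x} x∈ with x ≟ e
        ... | yes refl = ∈-∪⁅⁆⁺ʳ
        ... | no x≢e   = ∈-∪⁅⁆⁺ˡ (x∈p∧x∉q⇒x∈p─q x∈ (x≢e ∘ x∈⁅y⁆⇒x≡y e))

      -- The growth property with k = 1 is used twice: a basis I* of the
      -- elements above f and the free elements B above f satisfy
      -- |B + f − I*| ≤ |I* − B| ≤ |B − I*|, which is absurd.
      free-spans : IsGrowth S 1 → ∀ f → Blocked S (above R f) f → ¬ Indep S (above free f ∪ ⁅ f ⁆)
      free-spans (_ , growth) f = go (heavier-wf f)
        where
        go : ∀ {f} → Acc (λ g e → w e < w g) f → Blocked S (above R f) f → ¬ Indep S (above free f ∪ ⁅ f ⁆)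
        go {f} (acc heavier) (f∈S , I , I⊆ , iI , I-dep) iBf =
          ℕ.<-irrefl refl (begin-strict
            ∣ B ─ I* ∣            <⟨ p⊂q⇒∣p∣<∣q∣ ((λ x∈ → let x∈B , x∉I* = ∈-─⁻ B I* x∈ in x∈p∧x∉q⇒x∈p─q (∈-∪⁅⁆⁺ˡ x∈B) x∉I*)
                                       , f , x∈p∧x∉q⇒x∈p─q ∈-∪⁅⁆⁺ʳ f∉I* , λ f∈ → f∉B (p─q⊆p B I* f∈)) ⟩
            ∣ (B ∪ ⁅ f ⁆) ─ I* ∣  ≤⟨ p⊆q⇒∣p∣≤∣q∣ ⊆Z₁ ⟩
            ∣ Z₁ ∣                ≤⟨ ∣Z₁∣≤ ⟩
            1 ℕ.* ∣ I* ─ (B ∪ ⁅ f ⁆) ∣ ≡⟨ ℕ.*-identityˡ _ ⟩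
            ∣ I* ─ (B ∪ ⁅ f ⁆) ∣  ≤⟨ p⊆q⇒∣p∣≤∣q∣ (λ x∈ → let x∈I* , x∉ = ∈-─⁻ I* (B ∪ ⁅ f ⁆) x∈ in
                                       x∈p∧x∉q⇒x∈p─q x∈I* (x∉ ∘ ∈-∪⁅⁆⁺ˡ)) ⟩
            ∣ I* ─ B ∣            ≤⟨ p⊆q⇒∣p∣≤∣q∣ ⊆Z₂ ⟩
            ∣ Z₂ ∣                ≤⟨ ∣Z₂∣≤ ⟩
            1 ℕ.* ∣ B ─ I* ∣      ≡⟨ ℕ.*-identityˡ _ ⟩
            ∣ B ─ I* ∣            ∎)
          where
          open ℕ.≤-Reasoning
          B = above free f
          X = above R f ∩ ground S

          I*-basis : ∃ λ P → IsBasis S P X × I ⊆ P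
          I*-basis = basis⊇ S iI (λ x∈ → x∈p∩q⁺ (I⊆ x∈ , indep⊆ground S iI x∈))
          I* = proj₁ I*-basis
          I*⊆X = proj₁ (proj₁ (proj₂ I*-basis))
          iI* = proj₁ (proj₂ (proj₁ (proj₂ I*-basis)))
          I*-maximal = proj₂ (proj₂ (proj₁ (proj₂ I*-basis)))
          I⊆I* = proj₂ (proj₂ I*-basis)

          f∉B : f ∉ B
          f∉B f∈ = <-irrefl (proj₂ (∈-above⁻ {free} f∈))
          f∉I* : f ∉ I*
          f∉I* f∈ = <-irrefl (proj₂ (∈-above⁻ {R} (p∩q⊆p (above R f) (ground S) (I*⊆X f∈))))
          B⊆X : B ⊆ X
          B⊆X x∈ = let x∈free , f<x = ∈-above⁻ {free} x∈
                       (x∈R , x∈S) , _ = comprehension⁻ free? x∈free in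
                   x∈p∩q⁺ (∈-above⁺ x∈R f<x , x∈S)

          growth₁ = growth I* (B ∪ ⁅ f ⁆) (indep⊆ground S iI*) iBf
          Q₁ = proj₁ growth₁
          Z₁ = proj₁ (proj₂ growth₁)
          Q₁∪Z₁ = proj₁ (proj₂ (proj₂ growth₁))
          ∣Z₁∣≤ = proj₁ (proj₂ (proj₂ (proj₂ (proj₂ growth₁))))
          I*∪Q₁ : Indep S (I* ∪ Q₁)
          I*∪Q₁ = proj₂ (proj₂ (proj₂ (proj₂ (proj₂ growth₁)))) I* (indep-basis S iI*)

          growth₂ = growth B I* (λ x∈ → p∩q⊆q (above R f) (ground S) (B⊆X x∈)) iI*
          Q₂ = proj₁ growth₂
          Z₂ = proj₁ (proj₂ growth₂)
          Q₂∪Z₂ = proj₁ (proj₂ (proj₂ growth₂))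
          ∣Z₂∣≤ = proj₁ (proj₂ (proj₂ (proj₂ (proj₂ growth₂))))
          B∪Q₂ : Indep S (B ∪ Q₂)
          B∪Q₂ = proj₂ (proj₂ (proj₂ (proj₂ (proj₂ growth₂)))) B (indep-basis S (downward S ∈-∪⁅⁆⁺ˡ iBf))

          add-one : ∀ {Y Q x} → Indep S (Y ∪ Q) → x ∈ Q → Indep S (Y ∪ ⁅ x ⁆)
          add-one iYQ x∈Q = downward S (λ y∈ → case ∈-∪⁅⁆⁻ y∈ of λ
            { (inj₁ y∈Y) → x∈p∪q⁺ (inj₁ y∈Y) ; (inj₂ refl) → x∈p∪q⁺ (inj₂ x∈Q) }) iYQ

          ⊆Z₁ : (B ∪ ⁅ f ⁆) ─ I* ⊆ Z₁
          ⊆Z₁ {x} x∈ = by (x∈p∪q⁻ Q₁ Z₁ (subst (x ∈_) (sym Q₁∪Z₁) x∈)) (∈-∪⁅⁆⁻ (p─q⊆p (B ∪ ⁅ f ⁆) I* x∈))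
            where
            by : x ∈ Q₁ ⊎ x ∈ Z₁ → x ∈ B ⊎ x ≡ f → x ∈ Z₁
            by (inj₂ x∈Z₁) _           = x∈Z₁
            -- `Q₁` is compatible with `I*`. It cannot contain `f`, which already conflicts with the
            -- subset `I`, nor an element of `B` outside `I*`, by maximality of the basis.
            by (inj₁ x∈Q₁) (inj₂ refl) = contradiction (downward S (∪⁅⁆-mono I⊆I*) (add-one I*∪Q₁ x∈Q₁)) I-dep
            by (inj₁ x∈Q₁) (inj₁ x∈B)  = contradiction
              (subst (x ∈_) (I*-maximal (I* ∪ ⁅ x ⁆) ∈-∪⁅⁆⁺ˡ
                (λ y∈ → case ∈-∪⁅⁆⁻ y∈ of λ { (inj₁ y∈I*) → I*⊆X y∈I* ; (inj₂ refl) → B⊆X x∈B })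
                (add-one I*∪Q₁ x∈Q₁)) ∈-∪⁅⁆⁺ʳ) (proj₂ (∈-─⁻ (B ∪ ⁅ f ⁆) I* x∈))

          ⊆Z₂ : I* ─ B ⊆ Z₂
          ⊆Z₂ {x} x∈ = by (x∈p∪q⁻ Q₂ Z₂ (subst (x ∈_) (sym Q₂∪Z₂) x∈))
            where
            x∈I* = proj₁ (∈-─⁻ I* B x∈)
            x∉B  = proj₂ (∈-─⁻ I* B x∈)
            x∈X  = x∈p∩q⁻ (above R f) (ground S) (I*⊆X x∈I*)
            x∈R  = proj₁ (∈-above⁻ {R} (proj₁ x∈X))
            f<x  = proj₂ (∈-above⁻ {R} (proj₁ x∈X))
            x-blocked : Blocked S (above R x) x
            x-blocked = decidable-stable (blocked? S (above R x) x) λ unblocked →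
              x∉B (∈-above⁺ (comprehension⁺ free? ((x∈R , proj₂ x∈X) , unblocked)) f<x)
            by : x ∈ Q₂ ⊎ x ∈ Z₂ → x ∈ Z₂
            by (inj₂ x∈Z₂) = x∈Z₂
            -- `x` lies in `R` above `f` without being free, hence it is blocked. By induction the
            -- free elements above `x` conflict with it, and they all belong to `B`.
            by (inj₁ x∈Q₂) = contradiction
              (downward S (∪⁅⁆-mono λ y∈ → let y∈free , x<y = ∈-above⁻ {free} y∈ in ∈-above⁺ y∈free (<-trans f<x x<y))
                (add-one B∪Q₂ x∈Q₂))
              (go (heavier f<x) x-blocked)

      -- Growth is applied to `free` as a basis of itself: by `free-spans` it conflicts with every
      -- blocked `t`, so at most one `t` is charged to each free element outside `I`.
      free-count : ∀ {I T} → IsGrowth S 1 → Indep S I → T ⊆ I ─ R → (∀ {t} → t ∈ T → Blocked S (above R t) t) →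
        ∣ T ∣ ℕ.≤ ∣ free ∣
      free-count {I} {T} growth iI T⊆ blocked = ℕ.≤-trans
        (growth-count S growth (λ x∈ → proj₂ (proj₁ (comprehension⁻ free? x∈))) iI
          (λ t∈ → let t∈I , t∉R = ∈-─⁻ I R (T⊆ t∈) in
             x∈p∧x∉q⇒x∈p─q t∈I (t∉R ∘ proj₁ ∘ proj₁ ∘ comprehension⁻ free?))
          (λ {t} t∈ → free , indep-basis S (free-indep id) , λ indep →
             free-spans growth t (blocked t∈) (downward S (∪⁅⁆-mono (proj₁ ∘ ∈-above⁻ {free})) indep)))
        (ℕ.≤-trans (ℕ.≤-reflexive (ℕ.*-identityˡ _)) (p⊆q⇒∣p∣≤∣q∣ (p─q⊆p free I)))

-- Greedy and top-relevant edges

Unique-resp-↭ : ∀ {A : Set} {xs ys : List A} → xs ↭ ys → Unique xs → Unique ys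
Unique-resp-↭ _↭_.refl u = u
Unique-resp-↭ (_↭_.prep x p) (x∉ ∷ u) = Perm.All-resp-↭ p x∉ ∷ Unique-resp-↭ p u
Unique-resp-↭ (_↭_.swap x y p) ((x≢y ∷ x∉) ∷ y∉ ∷ u) =
  ((x≢y ∘ sym) ∷ Perm.All-resp-↭ p y∉) ∷ Perm.All-resp-↭ p x∉ ∷ Unique-resp-↭ p u
Unique-resp-↭ (_↭_.trans p q) u = Unique-resp-↭ q (Unique-resp-↭ p u)

module _ ⦃ ℛ : RealNumbers ⦄ where

  Decreasing : ∀ {n} → Weight n → List (Fin n) → Set
  Decreasing w = AllPairs (λ x y → w y < w x)

  module _ {n} (w : Weight n) where

    sortDecreasing-↭ : ∀ xs → sortDecreasing w xs ↭ xs
    sortDecreasing-↭ = Sort.sort-↭ (On.decTotalOrder (Flip.decTotalOrder ≤-decTotalOrder) w)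

    sortDecreasing-decreasing : Injective _≡_ _≡_ w → ∀ {xs} → Unique xs → Decreasing w (sortDecreasing w xs)
    sortDecreasing-decreasing w-injective {xs} u = strict
      (Sorted.Sorted⇒AllPairs (DecTotalOrder.totalOrder O) (Sort.sort-↗ O xs))
      (Unique-resp-↭ (↭-sym (sortDecreasing-↭ xs)) u)
      where
      O = On.decTotalOrder (Flip.decTotalOrder ≤-decTotalOrder) w
      strict : ∀ {xs} → AllPairs (λ x y → w y ≤ w x) xs → Unique xs → Decreasing w xs
      strict []       []       = []
      strict (x≥ ∷ s) (x∉ ∷ u) =
        All.zipWith (λ (y≤x , x≢y) → y≤x , x≢y ∘ sym ∘ w-injective) (x≥ , x∉) ∷ strict s u

    head-filter⁻ : ∀ {P : Pred (Fin n) 0ℓ} (P? : Decidable P) {xs e} → Decreasing w xs → head (filter P? xs) ≡ just e →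
      e ∈ˡ xs × P e × (∀ {f} → f ∈ˡ xs → w e < w f → ¬ P f)
    head-filter⁻ P? {x ∷ xs} (x> ∷ d) eq with P? x
    head-filter⁻ P? {x ∷ xs} (x> ∷ d) refl | yes px = here refl , px , λ
      { (here refl) e<e → contradiction e<e <-irrefl
      ; (there f∈) e<f → contradiction (<-trans e<f (All.lookup x> f∈)) <-irrefl }
    ... | no ¬px with e∈ , pe , first ← head-filter⁻ P? d eq = there e∈ , pe , λ
      { (here refl) _ → ¬px ; (there f∈) → first f∈ }

    head-filter⁺ : ∀ {P : Pred (Fin n) 0ℓ} (P? : Decidable P) {xs e} → Decreasing w xs →
      e ∈ˡ xs → P e → (∀ {f} → f ∈ˡ xs → w e < w f → ¬ P f) → head (filter P? xs) ≡ just e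
    head-filter⁺ P? {x ∷ xs} (x> ∷ d) e∈ pe first with P? x
    head-filter⁺ P? {x ∷ xs} (x> ∷ d) (here refl) pe first | yes px = refl
    head-filter⁺ P? {x ∷ xs} (x> ∷ d) (there e∈)  pe first | yes px = contradiction px (first (here refl) (All.lookup x> e∈))
    head-filter⁺ P? {x ∷ xs} (x> ∷ d) (here refl) pe first | no ¬px = contradiction pe ¬px
    head-filter⁺ P? {x ∷ xs} (x> ∷ d) (there e∈)  pe first | no ¬px = head-filter⁺ P? d e∈ pe (first ∘ there)

    -- Summation by parts along the edges in decreasing order of weight.
    abel : Injective _≡_ _≡_ w → (∀ e → 0# ≤ w e) → (f : Fin n → ℝ) →
      (∀ t → 0# ≤ ∑ (allFin n) (λ e → 𝟙 (does (w t ≤? w e)) * f e)) → 0# ≤ ∑ (allFin n) (λ e → f e * w e)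
    abel w-injective 0≤w f prefix =
      subst (0# ≤_) (∑-↭ _ (sortDecreasing-↭ (allFin n)))
        (start (sortDecreasing w (allFin n)) (sortDecreasing-decreasing w-injective (Unique.allFin⁺ n))
          (λ t → subst (0# ≤_) (∑-↭ _ (↭-sym (sortDecreasing-↭ (allFin n)))) (prefix t)))
      where
      Prefix : List (Fin n) → Fin n → ℝ
      Prefix xs t = ∑ xs (λ e → 𝟙 (does (w t ≤? w e)) * f e)

      Prefix-head : ∀ x xs → All (λ y → w y < w x) xs → Prefix (x ∷ xs) x ≡ f x
      Prefix-head x xs x> = cong₂ _+_ (cong (λ b → 𝟙 b * f x) (does⁺ (w x ≤? w x) ≤-refl) ■ ℝ-Ring.*-identityˡ _)
          (∑-cong∈ xs (λ {e} e∈ → cong (λ b → 𝟙 b * f e) (dec-false (w x ≤? w e) (<⇒≱ (All.lookup x> e∈))) ■ ℝ-Ring.zeroˡ _)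
            ■ ∑-zero xs)
        ■ ℝ-Ring.+-identityʳ _

      Prefix-tail : ∀ x xs {t} → w t < w x → Prefix (x ∷ xs) t ≡ f x + Prefix xs t
      Prefix-tail x xs {t} t<x = cong (λ b → 𝟙 b * f x + Prefix xs t) (does⁺ (w t ≤? w x) (<⇒≤ t<x))
        ■ cong (_+ Prefix xs t) (ℝ-Ring.*-identityˡ _)

      -- `s` is the sum of `f` over the edges already passed and `b` bounds the remaining weights.
      -- Lowering `b` to the next weight loses only a nonnegative amount because `s` is nonnegative.
      go : ∀ xs → Decreasing w xs → ∀ (s b : ℝ) → 0# ≤ s → 0# ≤ b → All (λ x → w x ≤ b) xs →
        (∀ {t} → t ∈ˡ xs → 0# ≤ s + Prefix xs t) → 0# ≤ s * b + ∑ xs (λ e → f e * w e)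
      go []       _        s b 0≤s 0≤b _         _   = 0≤+ (*-nonNeg 0≤s 0≤b) ≤-refl
      go (x ∷ xs) (x> ∷ d) s b 0≤s 0≤b (x≤b ∷ _) pre = ≤-trans
        (go xs d (s + f x) (w x) (subst (λ z → 0# ≤ s + z) (Prefix-head x xs x>) (pre (here refl))) (0≤w x)
          (All.map <⇒≤ x>)
          (λ {t} t∈ → subst (0# ≤_) (cong (s +_) (Prefix-tail x xs (All.lookup x> t∈)) ■ sym (ℝ-Ring.+-assoc _ _ _)) (pre (there t∈))))
        (≤-from (*-nonNeg 0≤s (0≤-≤ x≤b))
          (solve 5 (λ s b f x r → s :* b :+ (f :* x :+ r) := (s :+ f) :* x :+ r :+ s :* (b :- x)) refl
            s b (f x) (w x) (∑ xs (λ e → f e * w e))))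
        where open ℝ-Solver using (solve; con; _:+_; _:*_; _:-_; :-_; _:=_)

      start : ∀ xs → Decreasing w xs → (∀ t → 0# ≤ Prefix xs t) → 0# ≤ ∑ xs (λ e → f e * w e)
      start []       _        _   = ≤-refl
      start (x ∷ xs) (x> ∷ d) pre = subst (0# ≤_) (ℝ-Ring.+-identityˡ _)
        (subst (λ z → 0# ≤ z + ∑ (x ∷ xs) (λ e → f e * w e)) (ℝ-Ring.zeroˡ (w x))
          (go (x ∷ xs) (x> ∷ d) 0# (w x) ≤-refl (0≤w x) (≤-refl ∷ All.map <⇒≤ x>)
            (λ {t} _ → subst (0# ≤_) (sym (ℝ-Ring.+-identityˡ _)) (pre t))))

module Adding {m : ℕ} (F : Subset m → Set) (add : Subset m → Fin m → Subset m)
  (add-view : ∀ X e → (F (X ∪ ⁅ e ⁆) × add X e ≡ X ∪ ⁅ e ⁆) ⊎ (¬ F (X ∪ ⁅ e ⁆) × add X e ≡ X)) where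

  add-F : ∀ X e → F X → F (add X e)
  add-F X e fX with add-view X e
  ... | inj₁ (fXe , eq) = subst F (sym eq) fXe
  ... | inj₂ (_ , eq)   = subst F (sym eq) fX

  add-⊇ : ∀ X e → X ⊆ add X e
  add-⊇ X e {x} x∈ with add-view X e
  ... | inj₁ (_ , eq) = subst (x ∈_) (sym eq) (∈-∪⁅⁆⁺ˡ x∈)
  ... | inj₂ (_ , eq) = subst (x ∈_) (sym eq) x∈

  add-⊆ : ∀ X e {x} → x ∈ add X e → x ∈ X ⊎ x ≡ e
  add-⊆ X e {x} x∈ with add-view X e
  ... | inj₁ (_ , eq) = ∈-∪⁅⁆⁻ (subst (x ∈_) eq x∈)
  ... | inj₂ (_ , eq) = inj₁ (subst (x ∈_) eq x∈)

  add-∈ : ∀ X e → F (X ∪ ⁅ e ⁆) → e ∈ add X e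
  add-∈ X e fXe with add-view X e
  ... | inj₁ (_ , eq)   = subst (e ∈_) (sym eq) ∈-∪⁅⁆⁺ʳ
  ... | inj₂ (¬fXe , _) = contradiction fXe ¬fXe

-- F abstracts the feasible sets of a market; for F = Feasible M the
-- definitions of module Relevance unfold to those of Defs.
record GreedySystem ⦃ ℛ : RealNumbers ⦄ (m n : ℕ) : Set₁ where
  field
    agentOf     : Fin m → Fin n
    w           : Weight m
    w-injective : Injective _≡_ _≡_ w
    0≤w         : ∀ e → 0# ≤ w e
    F           : Subset m → Set
    F?          : Decidable F
    F-mono      : ∀ {X Y} → X ⊆ Y → F Y → F X
    F-∅         : F ∅
    F-agent     : ∀ {X e f} → F X → e ∈ X → f ∈ X → agentOf e ≡ agentOf f → e ≡ f
    add         : Subset m → Fin m → Subset m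
    add-view    : ∀ X e → (F (X ∪ ⁅ e ⁆) × add X e ≡ X ∪ ⁅ e ⁆) ⊎ (¬ F (X ∪ ⁅ e ⁆) × add X e ≡ X)

module Relevance ⦃ ℛ : RealNumbers ⦄ {m n : ℕ} (𝒢 : GreedySystem m n) where

  open GreedySystem 𝒢
  open Adding F add add-view

  greedy : Subset m → Subset m
  greedy X = foldl add ∅ (sortDecreasing w (elements X))

  edgesOf : Subset n → Subset m
  edgesOf Y = comprehension λ e → agentOf e ∈? Y

  top-relevant : Fin n → Subset n → Maybe (Fin m)
  top-relevant a Y = head (filter (λ e → e ∈? greedy (edgesOf Y ∪ ⁅ e ⁆)) (sortDecreasing w (elements (edgesOf ⁅ a ⁆))))

  rel : Subset n → Subset m
  rel Y = comprehension λ e → any? λ a → ¬? (a ∈? Y) ×-dec Maybe.≡-dec _≟_ (top-relevant a Y) (just e)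

  greedyFrom : Subset m → List (Fin m) → Subset m
  greedyFrom = foldl (add)

  greedyFrom-feasible : ∀ X es → F X → F (greedyFrom X es)
  greedyFrom-feasible X []       fX = fX
  greedyFrom-feasible X (e ∷ es) fX = greedyFrom-feasible _ es (add-F X e fX)

  greedyFrom-⊇ : ∀ X es → X ⊆ greedyFrom X es
  greedyFrom-⊇ X []       = id
  greedyFrom-⊇ X (e ∷ es) x∈ = greedyFrom-⊇ (add X e) es (add-⊇ X e x∈)

  greedyFrom-⊆ : ∀ X es {x} → x ∈ greedyFrom X es → x ∈ X ⊎ x ∈ˡ es
  greedyFrom-⊆ X []       x∈ = inj₁ x∈
  greedyFrom-⊆ X (e ∷ es) x∈ with greedyFrom-⊆ (add X e) es x∈
  ... | inj₂ x∈es = inj₂ (there x∈es)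
  ... | inj₁ x∈X′ with add-⊆ X e x∈X′
  ...   | inj₁ x∈X  = inj₁ x∈X
  ...   | inj₂ refl = inj₂ (here refl)

  -- When `e` is processed, the current set consists of exactly those edges of the outcome that are
  -- heavier than `e`. Greedy is thereby characterised through its outcome alone, and later
  -- arguments need not follow the processing order.
  greedyFrom-spec : ∀ X es → Decreasing w es → (∀ {x e} → x ∈ X → e ∈ˡ es → w e < w x) → ∀ {e} → e ∈ˡ es →
    (e ∈ greedyFrom X es → F (above w (greedyFrom X es) e ∪ ⁅ e ⁆)) ×
    (F (above w (greedyFrom X es) e ∪ ⁅ e ⁆) → e ∈ greedyFrom X es)
  greedyFrom-spec X (e ∷ es) (e> ∷ d) X> (here refl) =
    (λ e∈G → F-mono (∪⁅⁆-mono above⊆X) (fXe e∈G)) ,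
    (λ f → greedyFrom-⊇ (add X e) es (add-∈ X e (F-mono
      (∪⁅⁆-mono λ x∈X → ∈-above⁺ w (greedyFrom-⊇ X (e ∷ es) x∈X) (X> x∈X (here refl))) f)))
    where
    G = greedyFrom X (e ∷ es)
    above⊆X : above w G e ⊆ X
    above⊆X x∈ with x∈G , e<x ← ∈-above⁻ w {G} x∈ with greedyFrom-⊆ X (e ∷ es) x∈G
    ... | inj₁ x∈X          = x∈X
    ... | inj₂ (here refl)  = contradiction e<x <-irrefl
    ... | inj₂ (there x∈es) = contradiction (<-trans e<x (All.lookup e> x∈es)) <-irrefl
    fXe : e ∈ G → F (X ∪ ⁅ e ⁆)
    fXe e∈G with greedyFrom-⊆ (add X e) es e∈G | add-view X e
    ... | _         | inj₁ (f , _)  = f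
    ... | inj₁ e∈X′ | inj₂ (_ , eq) = contradiction (X> (subst (e ∈_) eq e∈X′) (here refl)) <-irrefl
    ... | inj₂ e∈es | inj₂ _        = contradiction (All.lookup e> e∈es) <-irrefl
  greedyFrom-spec X (x ∷ es) (x> ∷ d) X> (there e∈) = greedyFrom-spec (add X x) es d X′> e∈
    where
    X′> : ∀ {y e} → y ∈ add X x → e ∈ˡ es → w e < w y
    X′> y∈ e∈ with add-⊆ X x y∈
    ... | inj₁ y∈X  = X> y∈X (there e∈)
    ... | inj₂ refl = All.lookup x> e∈

  module _ (X : Subset m) where
    private
      sorted = sortDecreasing w (elements X)
      sorted-decreasing = sortDecreasing-decreasing w w-injective (elements-unique X)
      ∈-sorted : ∀ {e} → e ∈ X → e ∈ˡ sorted
      ∈-sorted e∈ = Perm.∈-resp-↭ (↭-sym (sortDecreasing-↭ w (elements X))) (∈-elements⁺ e∈)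

    greedy⊆ : greedy X ⊆ X
    greedy⊆ e∈ with greedyFrom-⊆ ∅ sorted e∈
    ... | inj₁ e∈∅ = contradiction e∈∅ ∉⊥
    ... | inj₂ e∈s = ∈-elements⁻ (Perm.∈-resp-↭ (sortDecreasing-↭ w (elements X)) e∈s)

    greedy⁻ : ∀ {e} → e ∈ greedy X → F (above w (greedy X) e ∪ ⁅ e ⁆)
    greedy⁻ e∈ = proj₁ (greedyFrom-spec ∅ sorted sorted-decreasing (λ x∈ → contradiction x∈ ∉⊥) (∈-sorted (greedy⊆ e∈))) e∈

    greedy⁺ : ∀ {e} → e ∈ X → F (above w (greedy X) e ∪ ⁅ e ⁆) → e ∈ greedy X
    greedy⁺ e∈X = proj₂ (greedyFrom-spec ∅ sorted sorted-decreasing (λ x∈ → contradiction x∈ ∉⊥) (∈-sorted e∈X))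

    greedy-feasible : F (greedy X)
    greedy-feasible = greedyFrom-feasible ∅ sorted F-∅

  above-cong : ∀ {X Y e} → (∀ {f} → w e < w f → (f ∈ X → f ∈ Y) × (f ∈ Y → f ∈ X)) → above w X e ≡ above w Y e
  above-cong {X} {Y} agree = subset-≡
    (λ f∈ → let f∈X , e<f = ∈-above⁻ w {X} f∈ in ∈-above⁺ w (proj₁ (agree e<f) f∈X) e<f)
    (λ f∈ → let f∈Y , e<f = ∈-above⁻ w {Y} f∈ in ∈-above⁺ w (proj₂ (agree e<f) f∈Y) e<f)

  -- Induction from the heaviest edge down: each decision depends only on decisions about heavier
  -- edges, where the two inputs agree.
  greedy-local : ∀ {X Y e} → (∀ {f} → w e < w f → (f ∈ X → f ∈ Y) × (f ∈ Y → f ∈ X)) →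
    above w (greedy X) e ≡ above w (greedy Y) e
  greedy-local {X} {Y} {e} agree = above-cong (λ {f} → go (heavier-wf w f))
    where
    go : ∀ {f} → Acc (λ g e → w e < w g) f → w e < w f →
      (f ∈ greedy X → f ∈ greedy Y) × (f ∈ greedy Y → f ∈ greedy X)
    go {f} (acc heavier) e<f =
      (λ f∈ → greedy⁺ Y (proj₁ (agree e<f) (greedy⊆ X f∈)) (subst (λ Z → F (Z ∪ ⁅ f ⁆)) same (greedy⁻ X f∈))) ,
      (λ f∈ → greedy⁺ X (proj₂ (agree e<f) (greedy⊆ Y f∈)) (subst (λ Z → F (Z ∪ ⁅ f ⁆)) (sym same) (greedy⁻ Y f∈)))
      where
      same : above w (greedy X) f ≡ above w (greedy Y) f
      same = above-cong (λ f<g → go (heavier f<g) (<-trans e<f f<g))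

  chosenBy : Subset n → Subset m
  chosenBy Y = greedy (edgesOf Y)

  ∈-edgesOf⁺ : ∀ {Y e} → agentOf e ∈ Y → e ∈ edgesOf Y
  ∈-edgesOf⁺ {Y} = comprehension⁺ (λ e → agentOf e ∈? Y)

  ∈-edgesOf⁻ : ∀ {Y e} → e ∈ edgesOf Y → agentOf e ∈ Y
  ∈-edgesOf⁻ {Y} = comprehension⁻ (λ e → agentOf e ∈? Y)

  -- Only the greedy edges heavier than `e` are consulted, so the notion makes sense for edges of
  -- sampled agents too; for them it is membership in the greedy set.
  Relevant : Fin m → Subset n → Set
  Relevant e Y = F (above w (chosenBy Y) e ∪ ⁅ e ⁆)

  Top : Fin m → Subset n → Set
  Top e Y = Relevant e Y × (∀ f → agentOf f ≡ agentOf e → w e < w f → ¬ Relevant f Y)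

  relevant? : ∀ e Y → Dec (Relevant e Y)
  relevant? e Y = F? (above w (chosenBy Y) e ∪ ⁅ e ⁆)

  top? : ∀ e Y → Dec (Top e Y)
  top? e Y = relevant? e Y ×-dec
    all? λ f → (agentOf f ≟ agentOf e) →-dec (w e <? w f) →-dec ¬? (relevant? f Y)

  Relevant-greedy : ∀ e Y → (e ∈ greedy (edgesOf Y ∪ ⁅ e ⁆) → Relevant e Y) × (Relevant e Y → e ∈ greedy (edgesOf Y ∪ ⁅ e ⁆))
  Relevant-greedy e Y =
    (λ e∈ → subst (λ Z → F (Z ∪ ⁅ e ⁆)) same (greedy⁻ _ e∈)) ,
    (λ rel → greedy⁺ _ ∈-∪⁅⁆⁺ʳ (subst (λ Z → F (Z ∪ ⁅ e ⁆)) (sym same) rel))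
    where
    same : above w (greedy (edgesOf Y ∪ ⁅ e ⁆)) e ≡ above w (chosenBy Y) e
    same = greedy-local λ e<f →
      (λ f∈ → case ∈-∪⁅⁆⁻ f∈ of λ { (inj₁ f∈δ) → f∈δ ; (inj₂ refl) → contradiction e<f <-irrefl }) , ∈-∪⁅⁆⁺ˡ

  -- A heavier relevant edge of the same sampled agent would be chosen as well, but a feasible set
  -- has at most one edge per agent.
  chosenBy⁻ : ∀ {e Y} → e ∈ chosenBy Y → agentOf e ∈ Y × Top e Y
  chosenBy⁻ {e} {Y} e∈ = ∈-edgesOf⁻ {Y} (greedy⊆ (edgesOf Y) e∈) , greedy⁻ (edgesOf Y) e∈ , λ f f≡e e<f rel →
    let f∈ = greedy⁺ (edgesOf Y) (∈-edgesOf⁺ (subst (_∈ Y) (sym f≡e) (∈-edgesOf⁻ {Y} (greedy⊆ (edgesOf Y) e∈)))) rel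
    in <-irrefl (subst (λ z → w e < w z) (F-agent (greedy-feasible (edgesOf Y)) f∈ e∈ f≡e) e<f)

  chosenBy⁺ : ∀ {e Y} → agentOf e ∈ Y → Top e Y → e ∈ chosenBy Y
  chosenBy⁺ {Y = Y} a∈ (rel , _) = greedy⁺ (edgesOf Y) (∈-edgesOf⁺ a∈) rel

  private
    incident : Fin n → List (Fin m)
    incident a = sortDecreasing w (elements (edgesOf ⁅ a ⁆))
    ∈-incident⁺ : ∀ {a e} → agentOf e ≡ a → e ∈ˡ incident a
    ∈-incident⁺ {a} refl = Perm.∈-resp-↭ (↭-sym (sortDecreasing-↭ w (elements (edgesOf ⁅ a ⁆)))) (∈-elements⁺ (∈-edgesOf⁺ (x∈⁅x⁆ a)))
    ∈-incident⁻ : ∀ {a e} → e ∈ˡ incident a → agentOf e ≡ a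
    ∈-incident⁻ {a} e∈ = x∈⁅y⁆⇒x≡y a (∈-edgesOf⁻ (∈-elements⁻ (Perm.∈-resp-↭ (sortDecreasing-↭ w (elements (edgesOf ⁅ a ⁆))) e∈)))
    incident-decreasing : ∀ a → Decreasing w (incident a)
    incident-decreasing a = sortDecreasing-decreasing w w-injective (elements-unique (edgesOf ⁅ a ⁆))

  top-relevant⁻ : ∀ {a e Y} → top-relevant a Y ≡ just e → agentOf e ≡ a × Top e Y
  top-relevant⁻ {a} {e} {Y} eq
    with e∈ , pe , first ← head-filter⁻ w (λ e → e ∈? greedy (edgesOf Y ∪ ⁅ e ⁆)) (incident-decreasing a) eq
    with refl ← ∈-incident⁻ e∈ =
    refl , proj₁ (Relevant-greedy e Y) pe , λ f f≡e e<f rel → first (∈-incident⁺ f≡e) e<f (proj₂ (Relevant-greedy f Y) rel)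

  top-relevant⁺ : ∀ {e Y} → Top e Y → top-relevant (agentOf e) Y ≡ just e
  top-relevant⁺ {e} {Y} (rel , first) =
    head-filter⁺ w (λ e → e ∈? greedy (edgesOf Y ∪ ⁅ e ⁆)) (incident-decreasing (agentOf e)) (∈-incident⁺ refl)
      (proj₂ (Relevant-greedy e Y) rel)
      (λ {f} f∈ e<f pf → first f (∈-incident⁻ f∈) e<f (proj₁ (Relevant-greedy f Y) pf))

  Top-unique : ∀ {e f Y} → Top e Y → Top f Y → agentOf e ≡ agentOf f → e ≡ f
  Top-unique {e} {f} {Y} te tf eq = Maybe.just-injective
    (sym (top-relevant⁺ te) ■ cong (λ a → top-relevant a Y) eq ■ top-relevant⁺ tf)

  private
    rel? : ∀ Y e → Dec (∃ λ a → a ∉ Y × top-relevant a Y ≡ just e)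
    rel? Y e = any? λ a → ¬? (a ∈? Y) ×-dec Maybe.≡-dec _≟_ (top-relevant a Y) (just e)

  rel⁻ : ∀ {e Y} → e ∈ rel Y → agentOf e ∉ Y × Top e Y
  rel⁻ {e} {Y} e∈ with a , a∉Y , eq ← comprehension⁻ (rel? Y) e∈ with refl , top ← top-relevant⁻ eq = a∉Y , top

  rel⁺ : ∀ {e Y} → agentOf e ∉ Y → Top e Y → e ∈ rel Y
  rel⁺ {e} {Y} a∉Y top = comprehension⁺ (rel? Y) (agentOf e , a∉Y , top-relevant⁺ top)

  SameExcept : Fin n → Subset n → Subset n → Set
  SameExcept a Y Y′ = ∀ b → b ≢ a → lookup Y b ≡ lookup Y′ b

  module _ {a Y Y′} (same : SameExcept a Y Y′) where

    private
      move : ∀ {f} → agentOf f ≢ a → agentOf f ∈ Y → agentOf f ∈ Y′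
      move f≢a f∈ = lookup⇒∈ (sym (same _ f≢a) ■ ∈⇒lookup f∈)
      move⁻¹ : ∀ {f} → agentOf f ≢ a → agentOf f ∈ Y′ → agentOf f ∈ Y
      move⁻¹ f≢a f∈ = lookup⇒∈ (same _ f≢a ■ ∈⇒lookup f∈)

    -- Relevance is assumed to fail for the heavier edges of `a` with respect to `Y` only; in the
    -- downward induction the two greedy sets already agree above each such edge, so it fails with
    -- respect to `Y′` as well. Neither side chooses an edge of `a` above `e`, and all other agents
    -- are shared.
    chosenBy-local : ∀ {e} → (∀ f → agentOf f ≡ a → w e < w f → ¬ Relevant f Y) →
      above w (chosenBy Y) e ≡ above w (chosenBy Y′) e
    chosenBy-local {e} none = above-cong (λ {f} → go (heavier-wf w f))
      where
      go : ∀ {f} → Acc (λ g e → w e < w g) f → w e < w f →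
        (f ∈ chosenBy Y → f ∈ chosenBy Y′) × (f ∈ chosenBy Y′ → f ∈ chosenBy Y)
      go {f} (acc heavier) e<f = cases (agentOf f ≟ a)
        where
        same′ : above w (chosenBy Y) f ≡ above w (chosenBy Y′) f
        same′ = above-cong (λ f<g → go (heavier f<g) (<-trans e<f f<g))
        cases : Dec (agentOf f ≡ a) → (f ∈ chosenBy Y → f ∈ chosenBy Y′) × (f ∈ chosenBy Y′ → f ∈ chosenBy Y)
        cases (yes f≡a) =
          (λ f∈ → contradiction (greedy⁻ (edgesOf Y) f∈) (none f f≡a e<f)) ,
          (λ f∈ → contradiction (subst (λ Z → F (Z ∪ ⁅ f ⁆)) (sym same′) (greedy⁻ (edgesOf Y′) f∈)) (none f f≡a e<f))
        cases (no f≢a) =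
          (λ f∈ → greedy⁺ (edgesOf Y′) (∈-edgesOf⁺ (move f≢a (∈-edgesOf⁻ {Y} (greedy⊆ (edgesOf Y) f∈))))
                    (subst (λ Z → F (Z ∪ ⁅ f ⁆)) same′ (greedy⁻ (edgesOf Y) f∈))) ,
          (λ f∈ → greedy⁺ (edgesOf Y) (∈-edgesOf⁺ (move⁻¹ f≢a (∈-edgesOf⁻ {Y′} (greedy⊆ (edgesOf Y′) f∈))))
                    (subst (λ Z → F (Z ∪ ⁅ f ⁆)) (sym same′) (greedy⁻ (edgesOf Y′) f∈)))

    module _ {e} (e≡a : agentOf e ≡ a) (top : Top e Y) where

      private
        none : ∀ f → agentOf f ≡ a → w e < w f → ¬ Relevant f Y
        none f f≡a = proj₂ top f (f≡a ■ sym e≡a)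

      Relevant-local : ∀ {f} → ¬ w f < w e → (Relevant f Y → Relevant f Y′) × (Relevant f Y′ → Relevant f Y)
      Relevant-local {f} f≮e = subst (λ Z → F (Z ∪ ⁅ f ⁆)) eq , subst (λ Z → F (Z ∪ ⁅ f ⁆)) (sym eq)
        where
        eq : above w (chosenBy Y) f ≡ above w (chosenBy Y′) f
        eq = chosenBy-local λ g g≡a f<g → none g g≡a (≤-<-trans (≮⇒≥ f≮e) f<g)

      Top-local : Top e Y′
      Top-local = proj₁ (Relevant-local <-irrefl) (proj₁ top) ,
        λ f f≡e e<f rel → proj₂ top f f≡e e<f (proj₂ (Relevant-local (λ f<e → <-irrefl (<-trans e<f f<e))) rel)

      Top-local-above : ∀ {f} → w e < w f → Top f Y → Top f Y′
      Top-local-above {f} e<f (rel , first) =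
        proj₁ (Relevant-local (λ f<e → <-irrefl (<-trans e<f f<e))) rel ,
        λ g g≡f f<g rel′ → first g g≡f f<g (proj₂ (Relevant-local (λ g<e → <-irrefl (<-trans e<f (<-trans f<g g<e)))) rel′)

      -- No top-relevant edge heavier than `e` sits at the agent of `e`, so the heavier part of
      -- Rel(Y) does not see that agent's coin. Applied in both directions, this shows that badness
      -- ignores the coin.
      rel-local-⊆ : above w (rel Y) e ⊆ above w (rel Y′) e
      rel-local-⊆ {f} f∈ =
        let f∈R , e<f = ∈-above⁻ w {rel Y} f∈
            a∉ , topf = rel⁻ {Y = Y} f∈R in
        ∈-above⁺ w (rel⁺ (a∉ ∘ move⁻¹ λ f≡a → none f f≡a e<f (proj₁ topf)) (Top-local-above e<f topf)) e<f

-- Bad edges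

-- Whether e is top-relevant (T e), or top-relevant and bad (B e), does not
-- depend on the coin of its own agent.
module Averaging ⦃ ℛ : RealNumbers ⦄ {m n : ℕ} (agentOf : Fin m → Fin n) (w : Weight m)
  (T B : Fin m → Subset n → Bool)
  (T-ignores : ∀ e → Ignores (agentOf e) (𝟙 ∘ T e)) (B-ignores : ∀ e → Ignores (agentOf e) (𝟙 ∘ B e))
  {p : ℝ} (0≤p : 0# ≤ p) (p≤1 : p ≤ 1#) where

  open ℝ-Solver using (solve; con; _:+_; _:*_; _:-_; :-_; _:=_)

  ∈Y ∉Y : Fin m → Subset n → ℝ
  ∈Y e Y = 𝟙 (lookup Y (agentOf e))
  ∉Y e Y = 𝟙 (not (lookup Y (agentOf e)))

  ET EB : ℝ
  ET = Coins p n (λ Y → ∑ (allFin m) (λ e → w e * 𝟙 (T e Y)))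
  EB = Coins p n (λ Y → ∑ (allFin m) (λ e → w e * 𝟙 (B e Y)))

  private
    average : ∀ (c : ℝ) (φ : Bool → ℝ) (X : Fin m → Subset n → Bool) →
      (∀ e → Coins p n (λ Y → φ (lookup Y (agentOf e)) * 𝟙 (X e Y)) ≡ c * Coins p n (𝟙 ∘ X e)) →
      Coins p n (λ Y → ∑ (allFin m) (λ e → w e * (φ (lookup Y (agentOf e)) * 𝟙 (X e Y)))) ≡
      c * Coins p n (λ Y → ∑ (allFin m) (λ e → w e * 𝟙 (X e Y)))
    average c φ X one = begin
      Coins p n (λ Y → ∑ (allFin m) (λ e → w e * (φ (lookup Y (agentOf e)) * 𝟙 (X e Y))))
        ≡⟨ Coins-∑ p n (allFin m) _ ⟩
      ∑ (allFin m) (λ e → Coins p n (λ Y → w e * (φ (lookup Y (agentOf e)) * 𝟙 (X e Y))))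
        ≡⟨ ∑-cong (allFin m) (λ e → Coins-*ˡ p n (w e) _ ■ cong (w e *_) (one e)
             ■ solve 3 (λ w c x → w :* (c :* x) := c :* (w :* x)) refl (w e) c (Coins p n (𝟙 ∘ X e))
             ■ cong (c *_) (sym (Coins-*ˡ p n (w e) (𝟙 ∘ X e)))) ⟩
      ∑ (allFin m) (λ e → c * Coins p n (λ Y → w e * 𝟙 (X e Y)))
        ≡⟨ ∑-*ˡ (allFin m) c _ ⟩
      c * ∑ (allFin m) (λ e → Coins p n (λ Y → w e * 𝟙 (X e Y)))
        ≡⟨ cong (c *_) (Coins-∑ p n (allFin m) _) ⟨
      c * Coins p n (λ Y → ∑ (allFin m) (λ e → w e * 𝟙 (X e Y))) ∎
      where open ≡-Reasoning

  sampled-T : Coins p n (λ Y → ∑ (allFin m) (λ e → w e * (∈Y e Y * 𝟙 (T e Y)))) ≡ p * ET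
  sampled-T = average p 𝟙 T (λ e → Coins-∈ p (agentOf e) (T-ignores e))

  unsampled-T : Coins p n (λ Y → ∑ (allFin m) (λ e → w e * (∉Y e Y * 𝟙 (T e Y)))) ≡ (1# - p) * ET
  unsampled-T = average (1# - p) (𝟙 ∘ not) T (λ e → Coins-∉ p (agentOf e) (T-ignores e))

  sampled-B : Coins p n (λ Y → ∑ (allFin m) (λ e → w e * (∈Y e Y * 𝟙 (B e Y)))) ≡ p * EB
  sampled-B = average p 𝟙 B (λ e → Coins-∈ p (agentOf e) (B-ignores e))

  unsampled-B : Coins p n (λ Y → ∑ (allFin m) (λ e → w e * (∉Y e Y * 𝟙 (B e Y)))) ≡ (1# - p) * EB
  unsampled-B = average (1# - p) (𝟙 ∘ not) B (λ e → Coins-∉ p (agentOf e) (B-ignores e))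

  good-average : Coins p n (λ Y → ∑ (allFin m) (λ e → w e * (∉Y e Y * (𝟙 (T e Y) - 𝟙 (B e Y))))) ≡ (1# - p) * (ET - EB)
  good-average = begin
    Coins p n (λ Y → ∑ (allFin m) (λ e → w e * (∉Y e Y * (𝟙 (T e Y) - 𝟙 (B e Y)))))
      ≡⟨ Coins-cong p n (λ Y → ∑-cong (allFin m) (λ e →
           solve 4 (λ w y t b → w :* (y :* (t :- b)) := w :* (y :* t) :+ (:- con (ℤ.+ 1)) :* (w :* (y :* b))) refl
             (w e) (∉Y e Y) (𝟙 (T e Y)) (𝟙 (B e Y)))
         ■ ∑-+ (allFin m) (λ e → w e * (∉Y e Y * 𝟙 (T e Y))) (λ e → - 1# * (w e * (∉Y e Y * 𝟙 (B e Y))))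
         ■ cong (∑ (allFin m) (λ e → w e * (∉Y e Y * 𝟙 (T e Y))) +_) (∑-*ˡ (allFin m) (- 1#) (λ e → w e * (∉Y e Y * 𝟙 (B e Y))))) ⟩
    Coins p n (λ Y → ∑ (allFin m) (λ e → w e * (∉Y e Y * 𝟙 (T e Y))) + - 1# * ∑ (allFin m) (λ e → w e * (∉Y e Y * 𝟙 (B e Y))))
      ≡⟨ Coins-+ p n _ _ ■ cong₂ _+_ unsampled-T (Coins-*ˡ p n (- 1#) _ ■ cong (- 1# *_) unsampled-B) ⟩
    (1# - p) * ET + - 1# * ((1# - p) * EB)
      ≡⟨ solve 3 (λ p t b → (con (ℤ.+ 1) :- p) :* t :+ (:- con (ℤ.+ 1)) :* ((con (ℤ.+ 1) :- p) :* b)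
                   := (con (ℤ.+ 1) :- p) :* (t :- b)) refl p ET EB ⟩
    (1# - p) * (ET - EB) ∎
    where open ≡-Reasoning

  optimum-bound : ∀ (k : ℝ) (O : Subset m) →
    (∀ Y → ∑ (allFin m) (λ e → w e * (∈Y e Y * 𝟙 (lookup O e))) ≤ k * ∑ (allFin m) (λ e → w e * (∈Y e Y * 𝟙 (T e Y)))) →
    p * weight w O ≤ k * (p * ET)
  optimum-bound k O bound = subst₂ _≤_
    (average p 𝟙 (λ e _ → lookup O e) (λ e → Coins-∈ p (agentOf e) (λ _ _ _ → refl))
      ■ cong (p *_) (Coins-const p n _ ■ sym (weight-lookup w O)))
    (Coins-*ˡ p n k _ ■ cong (k *_) sampled-T)
    (Coins-mono 0≤p p≤1 n bound)

  -- Only the bad edges of sampled agents are bounded pathwise; averaging turns their weight into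
  -- the share `p * EB` of the total. The matroid version bounds `EB` itself.
  bad-bound : ∀ (k : ℝ) →
    (∀ Y → ∑ (allFin m) (λ e → w e * (∈Y e Y * 𝟙 (B e Y))) ≤ k * ∑ (allFin m) (λ e → w e * (∉Y e Y * 𝟙 (T e Y)))) →
    p * EB ≤ k * ((1# - p) * ET)
  bad-bound k bound = subst₂ _≤_ sampled-B (Coins-*ˡ p n k _ ■ cong (k *_) unsampled-T) (Coins-mono 0≤p p≤1 n bound)

  bad-bound-matroid : ∀ (k : ℝ) →
    (∀ Y → ∑ (allFin m) (λ e → w e * 𝟙 (B e Y)) ≤ k * ∑ (allFin m) (λ e → w e * (∉Y e Y * 𝟙 (T e Y)))) →
    EB ≤ k * ((1# - p) * ET)
  bad-bound-matroid k bound = subst (EB ≤_) (Coins-*ˡ p n k _ ■ cong (k *_) unsampled-T) (Coins-mono 0≤p p≤1 n bound)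

-- Charging blocked edges to components

module _ ⦃ ℛ : RealNumbers ⦄ {m : ℕ} where

  lookup-─ : ∀ (A B : Subset m) x → lookup (A ─ B) x ≡ lookup A x ∧ not (lookup B x)
  lookup-─ A B x = Bool-⇔
    (λ eq → let x∈A , x∉B = ∈-─⁻ A B (lookup⇒∈ eq) in cong₂ _∧_ (∈⇒lookup x∈A) (cong not (∉⇒lookup x∉B)))
    (λ eq → let a , ¬b = ∧-true⁻ eq in ∈⇒lookup (x∈p∧x∉q⇒x∈p─q {x = x} {p = A} {q = B} (lookup⇒∈ a) λ x∈B →
       case sym ¬b ■ cong not (∈⇒lookup x∈B) of λ ()))

  lookup-∩ : ∀ (A B : Subset m) x → lookup (A ∩ B) x ≡ lookup A x ∧ lookup B x
  lookup-∩ A B x = Vec.lookup-zipWith _∧_ x A B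

  ∣∣-mono : ∀ {A B : Subset m} → A ⊆ B → fromℕ ∣ A ∣ ≤ fromℕ ∣ B ∣
  ∣∣-mono A⊆B = fromℕ-mono-≤ (p⊆q⇒∣p∣≤∣q∣ A⊆B)

  ∣∣-split : ∀ (A B : Subset m) → fromℕ ∣ A ∣ ≡ fromℕ ∣ A ─ B ∣ + fromℕ ∣ A ∩ B ∣
  ∣∣-split A B = fromℕ-∣∣ A
    ■ ∑-cong (allFin m) (λ x → sym (cong₂ (λ b c → 𝟙 b + 𝟙 c) (lookup-─ A B x) (lookup-∩ A B x) ■ pointwise (lookup A x) (lookup B x)))
    ■ ∑-+ (allFin m) _ _
    ■ sym (cong₂ _+_ (fromℕ-∣∣ (A ─ B)) (fromℕ-∣∣ (A ∩ B)))
    where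
    pointwise : ∀ b c → 𝟙 (b ∧ not c) + 𝟙 (b ∧ c) ≡ 𝟙 b
    pointwise true  true  = ℝ-Ring.+-identityˡ _
    pointwise true  false = ℝ-Ring.+-identityʳ _
    pointwise false c     = ℝ-Ring.+-identityˡ _

  ∣∣-disjoint : ∀ {A B C : Subset m} → A ⊆ C → B ⊆ C → (∀ {x} → x ∈ A → x ∉ B) →
    fromℕ ∣ A ∣ + fromℕ ∣ B ∣ ≤ fromℕ ∣ C ∣
  ∣∣-disjoint {A} {B} {C} A⊆C B⊆C disjoint = ≤-trans
    (≤-reflexive (cong₂ _+_ (fromℕ-∣∣ A) (fromℕ-∣∣ B) ■ sym (∑-+ (allFin m) _ _)))
    (≤-trans (∑-mono (allFin m) pointwise) (≤-reflexive (sym (fromℕ-∣∣ C))))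
    where
    pointwise : ∀ x → 𝟙 (lookup A x) + 𝟙 (lookup B x) ≤ 𝟙 (lookup C x)
    pointwise x with lookup A x in a | lookup B x in b
    ... | true  | true  = contradiction (lookup⇒∈ b) (disjoint (lookup⇒∈ a))
    ... | true  | false = ≤-reflexive (ℝ-Ring.+-identityʳ _ ■ cong 𝟙 (sym (∈⇒lookup (A⊆C (lookup⇒∈ a)))))
    ... | false | true  = ≤-reflexive (ℝ-Ring.+-identityˡ _ ■ cong 𝟙 (sym (∈⇒lookup (B⊆C (lookup⇒∈ b)))))
    ... | false | false = ≤-trans (≤-reflexive (ℝ-Ring.+-identityˡ _)) (0≤𝟙 (lookup C x))

  module _ (w : Weight m) where

    upper : Subset m → Fin m → Subset m
    upper X t = comprehension λ e → (e ∈? X) ×-dec (w t ≤? w e)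

    ∈-upper⁺ : ∀ {X t e} → e ∈ X → w t ≤ w e → e ∈ upper X t
    ∈-upper⁺ {X} {t} e∈ t≤e = comprehension⁺ (λ e → (e ∈? X) ×-dec (w t ≤? w e)) (e∈ , t≤e)

    ∈-upper⁻ : ∀ {X t e} → e ∈ upper X t → e ∈ X × w t ≤ w e
    ∈-upper⁻ {X} {t} = comprehension⁻ (λ e → (e ∈? X) ×-dec (w t ≤? w e))

    upper-⊆ : ∀ {X t} → upper X t ⊆ X
    upper-⊆ {X} e∈ = proj₁ (∈-upper⁻ {X} e∈)

    above⊆upper : ∀ {X t e} → w t ≤ w e → above w X e ⊆ above w (upper X t) e
    above⊆upper {X} t≤e f∈ = let f∈X , e<f = ∈-above⁻ w {X} f∈ in
      ∈-above⁺ w (∈-upper⁺ f∈X (≤-trans t≤e (<⇒≤ e<f))) e<f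

    -- Growth compares only cardinalities. A comparison at every weight threshold becomes a
    -- comparison of weights by summation by parts.
    weight-dominates : Injective _≡_ _≡_ w → (∀ e → 0# ≤ w e) → ∀ (k : ℝ) (T X : Subset m) →
      (∀ t → fromℕ ∣ upper T t ∣ ≤ k * fromℕ ∣ upper X t ∣) → weight w T ≤ k * weight w X
    weight-dominates w-injective 0≤w k T X prefix = ≤-from
      (subst (0# ≤_) total (abel w w-injective 0≤w (λ e → k * 𝟙 (lookup X e) - 𝟙 (lookup T e)) λ t →
        subst (0# ≤_) (sym (partial t)) (0≤-≤ (prefix t))))
      (solve 2 (λ x y → y := x :+ (y :- x)) refl (weight w T) (k * weight w X))
      where
      open ℝ-Solver using (solve; con; _:+_; _:*_; _:-_; :-_; _:=_)

      total : ∑ (allFin m) (λ e → (k * 𝟙 (lookup X e) - 𝟙 (lookup T e)) * w e) ≡ k * weight w X - weight w T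
      total = ∑-cong (allFin m) (λ e → solve 4 (λ k x t w → (k :* x :- t) :* w := k :* (w :* x) :- w :* t) refl
                k (𝟙 (lookup X e)) (𝟙 (lookup T e)) (w e))
        ■ ∑-- (allFin m) _ _
        ■ cong₂ _-_ (∑-*ˡ (allFin m) k _ ■ cong (k *_) (sym (weight-lookup w X))) (sym (weight-lookup w T))

      lookup-upper : ∀ X t e → lookup (upper X t) e ≡ does (w t ≤? w e) ∧ lookup X e
      lookup-upper X t e = Bool-⇔
        (λ eq → let e∈X , t≤e = ∈-upper⁻ {X} (lookup⇒∈ eq) in cong₂ _∧_ (does⁺ (w t ≤? w e) t≤e) (∈⇒lookup e∈X))
        (λ eq → let t≤e , e∈X = ∧-true⁻ eq in ∈⇒lookup (∈-upper⁺ (lookup⇒∈ e∈X) (does⁻ (w t ≤? w e) t≤e)))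

      ∣upper∣ : ∀ X t → fromℕ ∣ upper X t ∣ ≡ ∑ (allFin m) (λ e → 𝟙 (does (w t ≤? w e)) * 𝟙 (lookup X e))
      ∣upper∣ X t = fromℕ-∣∣ (upper X t) ■ ∑-cong (allFin m) (λ e → cong 𝟙 (lookup-upper X t e) ■ 𝟙-∧ (does (w t ≤? w e)) (lookup X e))

      partial : ∀ t → ∑ (allFin m) (λ e → 𝟙 (does (w t ≤? w e)) * (k * 𝟙 (lookup X e) - 𝟙 (lookup T e))) ≡
                      k * fromℕ (∣ upper X t ∣) - fromℕ (∣ upper T t ∣)
      partial t = ∑-cong (allFin m) (λ e → solve 4 (λ b k x y → b :* (k :* x :- y) := k :* (b :* x) :- b :* y) refl
                (𝟙 (does (w t ≤? w e))) k (𝟙 (lookup X e)) (𝟙 (lookup T e)))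
        ■ ∑-- (allFin m) _ _
        ■ cong₂ _-_ (∑-*ˡ (allFin m) k _ ■ cong (k *_) (sym (∣upper∣ X t))) (sym (∣upper∣ T t))

  module Charging {J : Set} (js : List J) (sys : J → IndependenceSystem m) (κ : J → ℕ) (k : ℕ)
    (load≤k : ∀ e → ∑ js (λ j → 𝟙 (lookup (ground (sys j)) e) * fromℕ (κ j)) ≤ fromℕ k) where

    open ℝ-Solver using (solve; con; _:+_; _:*_; _:-_; :-_; _:=_)

    -- Double counting. Every edge of `T` is charged to some component, and component j charges each
    -- of its edges in `X` at most κⱼ times on average; an edge of `X` thus pays at most its load,
    -- which is bounded by `k`.
    charge : ∀ {T X} (Tⱼ Xⱼ : J → Subset m) → (∀ {e} → e ∈ T → Any (λ j → e ∈ Tⱼ j) js) →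
      (∀ j → Xⱼ j ⊆ X ∩ ground (sys j)) → (∀ j → fromℕ ∣ Tⱼ j ∣ ≤ fromℕ (κ j) * fromℕ ∣ Xⱼ j ∣) →
      fromℕ ∣ T ∣ ≤ fromℕ k * fromℕ ∣ X ∣
    charge {T} {X} Tⱼ Xⱼ cover Xⱼ⊆ Tⱼ≤ = begin
      fromℕ ∣ T ∣                                              ≡⟨ fromℕ-∣∣ T ⟩
      ∑ (allFin m) (λ e → 𝟙 (lookup T e))                      ≤⟨ ∑-mono (allFin m) covered ⟩
      ∑ (allFin m) (λ e → ∑ js (λ j → 𝟙 (lookup (Tⱼ j) e)))    ≡⟨ ∑-swap (allFin m) js _ ⟩
      ∑ js (λ j → ∑ (allFin m) (λ e → 𝟙 (lookup (Tⱼ j) e)))    ≡⟨ ∑-cong js (λ j → fromℕ-∣∣ (Tⱼ j)) ⟨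
      ∑ js (λ j → fromℕ ∣ Tⱼ j ∣)                              ≤⟨ ∑-mono js (λ j → ≤-trans (Tⱼ≤ j) (*-monoˡ-≤ _ (0≤fromℕ (κ j)) (∣∣-mono (Xⱼ⊆ j)))) ⟩
      ∑ js (λ j → fromℕ (κ j) * fromℕ ∣ X ∩ ground (sys j) ∣)  ≡⟨ ∑-cong js expand ⟩
      ∑ js (λ j → ∑ (allFin m) (λ e → 𝟙 (lookup X e) * (𝟙 (lookup (ground (sys j)) e) * fromℕ (κ j))))
                                                               ≡⟨ ∑-swap js (allFin m) _ ⟩
      ∑ (allFin m) (λ e → ∑ js (λ j → 𝟙 (lookup X e) * (𝟙 (lookup (ground (sys j)) e) * fromℕ (κ j))))
                                                               ≡⟨ ∑-cong (allFin m) (λ e → ∑-*ˡ js (𝟙 (lookup X e)) _) ⟩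
      ∑ (allFin m) (λ e → 𝟙 (lookup X e) * ∑ js (λ j → 𝟙 (lookup (ground (sys j)) e) * fromℕ (κ j)))
                                                               ≤⟨ ∑-mono (allFin m) (λ e → *-monoˡ-≤ _ (0≤𝟙 (lookup X e)) (load≤k e)) ⟩
      ∑ (allFin m) (λ e → 𝟙 (lookup X e) * fromℕ k)            ≡⟨ ∑-*ʳ (allFin m) (fromℕ k) _ ⟩
      ∑ (allFin m) (λ e → 𝟙 (lookup X e)) * fromℕ k            ≡⟨ cong (_* fromℕ k) (fromℕ-∣∣ X) ⟨
      fromℕ ∣ X ∣ * fromℕ k                                    ≡⟨ ℝ-Ring.*-comm _ _ ⟩
      fromℕ k * fromℕ ∣ X ∣                                    ∎
      where
      open PosetReasoning (DecTotalOrder.poset ≤-decTotalOrder) using (begin_; step-≡-⟩; step-≡-⟨; step-≤; _∎)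
      covered : ∀ e → 𝟙 (lookup T e) ≤ ∑ js (λ j → 𝟙 (lookup (Tⱼ j) e))
      covered e with lookup T e in eq
      ... | false = ∑-nonNeg js (λ j → 0≤𝟙 (lookup (Tⱼ j) e))
      ... | true  = found (cover (lookup⇒∈ eq))
        where
        found : ∀ {js} → Any (λ j → e ∈ Tⱼ j) js → 1# ≤ ∑ js (λ j → 𝟙 (lookup (Tⱼ j) e))
        found {j ∷ js} (here e∈) = ≤-trans (≤-reflexive (cong 𝟙 (sym (∈⇒lookup e∈))))
          (≤-from (∑-nonNeg js (λ j → 0≤𝟙 (lookup (Tⱼ j) e))) refl)
        found {j ∷ js} (there any) = ≤-trans (found any) (≤-from (0≤𝟙 (lookup (Tⱼ j) e)) (ℝ-Ring.+-comm _ _))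

      expand : ∀ j → fromℕ (κ j) * fromℕ ∣ X ∩ ground (sys j) ∣ ≡
        ∑ (allFin m) (λ e → 𝟙 (lookup X e) * (𝟙 (lookup (ground (sys j)) e) * fromℕ (κ j)))
      expand j = cong (fromℕ (κ j) *_) (fromℕ-∣∣ (X ∩ ground (sys j)))
        ■ sym (∑-*ˡ (allFin m) (fromℕ (κ j)) _)
        ■ ∑-cong (allFin m) (λ e → cong (λ b → fromℕ (κ j) * 𝟙 b) (lookup-∩ X (ground (sys j)) e)
            ■ cong (fromℕ (κ j) *_) (𝟙-∧ (lookup X e) _)
            ■ solve 3 (λ k x g → k :* (x :* g) := x :* (g :* k)) refl (fromℕ (κ j)) (𝟙 (lookup X e)) (𝟙 (lookup (ground (sys j)) e)))

    -- Each component is charged the edges of `T` that it blocks. The independent witness of a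
    -- blocking extends to a basis of the component's part of `X`, which is the conflict that
    -- `growth-count` asks for.
    charge-growth : (∀ j → IsGrowth (sys j) (κ j)) → ∀ {T X I} → (∀ j → Indep (sys j) (I ∩ ground (sys j))) →
      T ⊆ I ─ X → (∀ {e} → e ∈ T → Any (λ j → Blocked (sys j) X e) js) → fromℕ ∣ T ∣ ≤ fromℕ k * fromℕ ∣ X ─ I ∣
    charge-growth growth {T} {X} {I} iI T⊆ blocked =
      charge Tⱼ Xⱼ (λ e∈ → Any.map (λ {j} b → comprehension⁺ (in-part? j) (e∈ , b)) (blocked e∈)) Xⱼ⊆
        λ j → ≤-trans (fromℕ-mono-≤ (growth-count (sys j) (growth j) (p∩q⊆q X (ground (sys j))) (iI j) (Tⱼ⊆ j) (spanned j)))
          (≤-reflexive (fromℕ-* (κ j) _))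
      where
      in-part? : ∀ j → Decidable (λ e → e ∈ T × Blocked (sys j) X e)
      in-part? j e = (e ∈? T) ×-dec blocked? (sys j) X e
      Tⱼ Xⱼ : J → Subset m
      Tⱼ j = comprehension (in-part? j)
      Xⱼ j = (X ∩ ground (sys j)) ─ (I ∩ ground (sys j))

      Xⱼ⊆ : ∀ j → Xⱼ j ⊆ (X ─ I) ∩ ground (sys j)
      Xⱼ⊆ j x∈ with x∈XS , x∉IS ← ∈-─⁻ (X ∩ ground (sys j)) (I ∩ ground (sys j)) x∈
        with x∈X , x∈S ← x∈p∩q⁻ X (ground (sys j)) x∈XS =
        x∈p∩q⁺ (x∈p∧x∉q⇒x∈p─q x∈X (λ x∈I → x∉IS (x∈p∩q⁺ (x∈I , x∈S))) , x∈S)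

      Tⱼ⊆ : ∀ j → Tⱼ j ⊆ (I ∩ ground (sys j)) ─ (X ∩ ground (sys j))
      Tⱼ⊆ j e∈ with e∈T , e∈S , _ ← comprehension⁻ (in-part? j) e∈ with e∈I , e∉X ← ∈-─⁻ I X (T⊆ e∈T) =
        x∈p∧x∉q⇒x∈p─q (x∈p∩q⁺ (e∈I , e∈S)) (e∉X ∘ p∩q⊆p X (ground (sys j)))

      spanned : ∀ j {t} → t ∈ Tⱼ j → ∃ λ P → IsBasis (sys j) P (X ∩ ground (sys j)) × ¬ Indep (sys j) (P ∪ ⁅ t ⁆)
      spanned j t∈ with _ , _ , I₀ , I₀⊆X , iI₀ , dep ← comprehension⁻ (in-part? j) t∈
        with P , basis , I₀⊆P ← basis⊇ (sys j) iI₀ (λ x∈ → x∈p∩q⁺ (I₀⊆X x∈ , indep⊆ground (sys j) iI₀ x∈)) =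
        P , basis , λ iP → dep (downward (sys j) (∪⁅⁆-mono I₀⊆P) iP)

record GrowthComponents ⦃ ℛ : RealNumbers ⦄ {m n : ℕ} (𝒢 : GreedySystem m n) : Set₁ where
  open GreedySystem 𝒢
  field
    {J}     : Set
    js      : List J
    sys     : J → IndependenceSystem m
    κ       : J → ℕ
    k       : ℕ
    1≤k     : 1 ℕ.≤ k
    growth  : ∀ j → IsGrowth (sys j) (κ j)
    F⇒indep : ∀ {X} → F X → ∀ j → Indep (sys j) (X ∩ ground (sys j))
    ¬F⇒dep  : ∀ {X} → ¬ F X → Any (λ j → ¬ Indep (sys j) (X ∩ ground (sys j))) js
    load≤k  : ∀ e → ∑ js (λ j → 𝟙 (lookup (ground (sys j)) e) * fromℕ (κ j)) ≤ fromℕ k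

module Pathwise ⦃ ℛ : RealNumbers ⦄ {m n : ℕ} (𝒢 : GreedySystem m n) (𝒞 : GrowthComponents 𝒢) where

  open GreedySystem 𝒢
  open GrowthComponents 𝒞
  open Relevance 𝒢
  open Charging js sys κ k load≤k

  Bad : Fin m → Subset n → Set
  Bad e Y = Any (λ j → Blocked (sys j) (above w (rel Y) e) e) js

  bad? : ∀ e Y → Dec (Bad e Y)
  bad? e Y = Any.any? (λ j → blocked? (sys j) (above w (rel Y) e) e) js

  badChosen badTop : Subset n → Subset m
  badChosen Y = comprehension λ e → (e ∈? chosenBy Y) ×-dec bad? e Y
  badTop Y = comprehension λ e → top? e Y ×-dec bad? e Y

  private
    restrict-indep : ∀ {X Y} → X ⊆ Y → F Y → ∀ j → Indep (sys j) (X ∩ ground (sys j))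
    restrict-indep X⊆Y fY = F⇒indep (F-mono X⊆Y fY)

    rejected⇒blocked : ∀ {X e} → F X → ¬ F (X ∪ ⁅ e ⁆) → Any (λ j → Blocked (sys j) X e) js
    rejected⇒blocked {X} {e} fX ¬fXe = Any.map (λ {j} → blocked j) (¬F⇒dep ¬fXe)
      where
      blocked : ∀ j → ¬ Indep (sys j) ((X ∪ ⁅ e ⁆) ∩ ground (sys j)) → Blocked (sys j) X e
      blocked j dep = decidable-stable (e ∈? S) (λ e∉S → dep (downward (sys j) (without e∉S) (F⇒indep fX j))) ,
        X ∩ S , p∩q⊆p X S , F⇒indep fX j , λ indep → dep (downward (sys j) with-e indep)
        where
        S = ground (sys j)
        without : e ∉ S → (X ∪ ⁅ e ⁆) ∩ S ⊆ X ∩ S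
        without e∉S x∈ with x∈Xe , x∈S ← x∈p∩q⁻ (X ∪ ⁅ e ⁆) S x∈ with ∈-∪⁅⁆⁻ x∈Xe
        ... | inj₁ x∈X  = x∈p∩q⁺ (x∈X , x∈S)
        ... | inj₂ refl = contradiction x∈S e∉S
        with-e : (X ∪ ⁅ e ⁆) ∩ S ⊆ (X ∩ S) ∪ ⁅ e ⁆
        with-e x∈ with x∈Xe , x∈S ← x∈p∩q⁻ (X ∪ ⁅ e ⁆) S x∈ with ∈-∪⁅⁆⁻ x∈Xe
        ... | inj₁ x∈X  = ∈-∪⁅⁆⁺ˡ (x∈p∩q⁺ (x∈X , x∈S))
        ... | inj₂ refl = ∈-∪⁅⁆⁺ʳ

  -- At every threshold, an edge of `O` missing from the greedy set conflicts with heavier greedy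
  -- edges and is charged to greedy edges outside `O`. The common edges pay for themselves because k
  -- is at least one.
  greedy-approximates : ∀ O Y → F O → weight w (O ∩ edgesOf Y) ≤ fromℕ k * weight w (chosenBy Y)
  greedy-approximates O Y fO = weight-dominates w w-injective 0≤w (fromℕ k) (O ∩ edgesOf Y) (chosenBy Y) λ t → prefix t
    where
    prefix : ∀ t → fromℕ ∣ upper w (O ∩ edgesOf Y) t ∣ ≤ fromℕ k * fromℕ ∣ upper w (chosenBy Y) t ∣
    prefix t = subst₂ _≤_ (sym (∣∣-split Oₜ Gₜ))
        (sym (ℝ-Ring.distribˡ _ _ _) ■ cong (fromℕ k *_) (cong (fromℕ (∣ Gₜ ─ Oₜ ∣) +_) (cong (fromℕ ∘ ∣_∣) (∩-comm Oₜ Gₜ)) ■ sym (∣∣-split Gₜ Oₜ)))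
        (+-mono-≤ (charge-growth growth (restrict-indep (p∩q⊆p O (edgesOf Y) ∘ upper-⊆ w) fO) id blocked)
          (≤-trans (≤-reflexive (sym (ℝ-Ring.*-identityˡ _)))
            (*-monoʳ-≤ _ (0≤fromℕ ∣ Oₜ ∩ Gₜ ∣) (≤-trans (≤-reflexive (sym (ℝ-Ring.+-identityʳ 1#))) (fromℕ-mono-≤ 1≤k)))))
      where
      Oₜ = upper w (O ∩ edgesOf Y) t
      Gₜ = upper w (chosenBy Y) t
      ∩-comm : ∀ (A B : Subset m) → A ∩ B ≡ B ∩ A
      ∩-comm A B = subset-≡ (λ x∈ → let a , b = x∈p∩q⁻ A B x∈ in x∈p∩q⁺ (b , a)) (λ x∈ → let b , a = x∈p∩q⁻ B A x∈ in x∈p∩q⁺ (a , b))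

      blocked : ∀ {e} → e ∈ Oₜ ─ Gₜ → Any (λ j → Blocked (sys j) Gₜ e) js
      blocked {e} e∈ with e∈Oₜ , e∉Gₜ ← ∈-─⁻ Oₜ Gₜ e∈ with e∈Oδ , t≤e ← ∈-upper⁻ w {O ∩ edgesOf Y} e∈Oₜ =
        rejected⇒blocked (F-mono (upper-⊆ w) (greedy-feasible (edgesOf Y))) λ f →
          e∉Gₜ (∈-upper⁺ w (greedy⁺ (edgesOf Y) (p∩q⊆q O (edgesOf Y) e∈Oδ)
            (F-mono (∪⁅⁆-mono (proj₁ ∘ ∈-above⁻ w {Gₜ} ∘ above⊆upper w t≤e)) f)) t≤e)

  -- The greedy set is feasible and disjoint from Rel(Y), so its bad edges can serve as the
  -- independent side of the growth property, with Rel(Y) as the blocking side.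
  bad-chosen-bound : ∀ Y → weight w (badChosen Y) ≤ fromℕ k * weight w (rel Y)
  bad-chosen-bound Y = weight-dominates w w-injective 0≤w (fromℕ k) (badChosen Y) (rel Y) λ t →
    ≤-trans (charge-growth growth (restrict-indep (upper-⊆ w) (greedy-feasible (edgesOf Y))) (⊆ t) (blocked t))
      (*-monoˡ-≤ _ (0≤fromℕ k) (∣∣-mono {A = upper w (rel Y) t ─ upper w (chosenBy Y) t} (p─q⊆p (upper w (rel Y) t) (upper w (chosenBy Y) t))))
    where
    ⊆ : ∀ t → upper w (badChosen Y) t ⊆ upper w (chosenBy Y) t ─ upper w (rel Y) t
    ⊆ t e∈ =
      let e∈B , t≤e = ∈-upper⁻ w {badChosen Y} e∈
          e∈G , _ = comprehension⁻ (λ e → (e ∈? chosenBy Y) ×-dec bad? e Y) e∈B in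
      x∈p∧x∉q⇒x∈p─q (∈-upper⁺ w e∈G t≤e) λ e∈R → proj₁ (rel⁻ {Y = Y} (upper-⊆ w e∈R)) (proj₁ (chosenBy⁻ {Y = Y} e∈G))
    blocked : ∀ t {e} → e ∈ upper w (badChosen Y) t → Any (λ j → Blocked (sys j) (upper w (rel Y) t) e) js
    blocked t e∈ =
      let e∈B , t≤e = ∈-upper⁻ w {badChosen Y} e∈
          _ , bad = comprehension⁻ (λ e → (e ∈? chosenBy Y) ×-dec bad? e Y) e∈B in
      Any.map (λ {j} → Blocked-mono (sys j) (proj₁ ∘ ∈-above⁻ w {upper w (rel Y) t} ∘ above⊆upper w t≤e)) bad

  -- Per threshold and component, the blocked edges outside Rel(Y) number at most the free edges of
  -- Rel(Y), by `free-count`. The blocked edges inside Rel(Y) are disjoint from the free ones, so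
  -- together both kinds number at most the component's edges in Rel(Y).
  bad-top-bound : (∀ j → κ j ≡ 1) → ∀ Y → weight w (badTop Y) ≤ fromℕ k * weight w (rel Y)
  bad-top-bound κ≡1 Y = weight-dominates w w-injective 0≤w (fromℕ k) (badTop Y) (rel Y) prefix
    where
    prefix : ∀ t → fromℕ ∣ upper w (badTop Y) t ∣ ≤ fromℕ k * fromℕ ∣ upper w (rel Y) t ∣
    prefix t = charge Tⱼ (λ j → Rₜ ∩ ground (sys j)) covering (λ _ → id) bound
      where
      Rₜ = upper w (rel Y) t
      Gₜ = upper w (chosenBy Y) t

      in-part? : ∀ j → Decidable (λ e → e ∈ upper w (badTop Y) t × Blocked (sys j) (above w (rel Y) e) e)
      in-part? j e = (e ∈? upper w (badTop Y) t) ×-dec blocked? (sys j) (above w (rel Y) e) e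

      Tⱼ : J → Subset m
      Tⱼ j = comprehension (in-part? j)

      covering : ∀ {e} → e ∈ upper w (badTop Y) t → Any (λ j → e ∈ Tⱼ j) js
      covering {e} e∈ = Any.map (λ {j} b → comprehension⁺ (in-part? j) (e∈ , b))
        (proj₂ (comprehension⁻ (λ e → top? e Y ×-dec bad? e Y) (upper-⊆ w e∈)))

      blockedₜ : ∀ j {e} → e ∈ Tⱼ j → Blocked (sys j) (above w Rₜ e) e
      blockedₜ j e∈ = let e∈T , b = comprehension⁻ (in-part? j) e∈ in
        Blocked-mono (sys j) (above⊆upper w (proj₂ (∈-upper⁻ w {badTop Y} e∈T))) b

      -- A top-relevant edge that is not in Rel(Y) has a sampled agent and is therefore a greedy
      -- edge; this supplies the independent set for `free-count`.
      chosen : ∀ j {e} → e ∈ Tⱼ j ─ Rₜ → e ∈ (Gₜ ∩ ground (sys j)) ─ Rₜ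
      chosen j {e} e∈ =
        let e∈Tⱼ , e∉R = ∈-─⁻ (Tⱼ j) Rₜ e∈
            e∈T , (e∈S , _) = comprehension⁻ (in-part? j) e∈Tⱼ
            e∈B , t≤e = ∈-upper⁻ w {badTop Y} e∈T
            top , _ = comprehension⁻ (λ e → top? e Y ×-dec bad? e Y) e∈B in
        x∈p∧x∉q⇒x∈p─q (x∈p∩q⁺ (∈-upper⁺ w (chosenBy⁺ (decidable-stable (agentOf e ∈? Y)
          (λ a∉Y → e∉R (∈-upper⁺ w (rel⁺ a∉Y top) t≤e))) top) t≤e , e∈S)) e∉R

      bound : ∀ j → fromℕ ∣ Tⱼ j ∣ ≤ fromℕ (κ j) * fromℕ ∣ Rₜ ∩ ground (sys j) ∣
      bound j = ≤-trans (≤-reflexive (∣∣-split (Tⱼ j) Rₜ))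
        (≤-trans (+-mono-≤ (fromℕ-mono-≤ (free-count w w-injective (sys j) Rₜ (subst (IsGrowth (sys j)) (κ≡1 j) (growth j))
                      (restrict-indep (upper-⊆ w) (greedy-feasible (edgesOf Y)) j) (chosen j)
                      (λ e∈ → blockedₜ j (p─q⊆p (Tⱼ j) Rₜ e∈)))) ≤-refl)
          (≤-trans (∣∣-disjoint {A = free w w-injective (sys j) Rₜ} {B = Tⱼ j ∩ Rₜ} {C = Rₜ ∩ ground (sys j)}
              (λ e∈ → x∈p∩q⁺ (proj₁ (comprehension⁻ (free? w w-injective (sys j) Rₜ) e∈)))
              (λ e∈ → let e∈Tⱼ , e∈R = x∈p∩q⁻ (Tⱼ j) Rₜ e∈ in x∈p∩q⁺ (e∈R , proj₁ (blockedₜ j e∈Tⱼ)))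
              (λ e∈free e∈ → proj₂ (comprehension⁻ (free? w w-injective (sys j) Rₜ) e∈free)
                (blockedₜ j (p∩q⊆p (Tⱼ j) Rₜ e∈))))
            (≤-reflexive (sym (cong (λ z → fromℕ z * fromℕ ∣ Rₜ ∩ ground (sys j) ∣) (κ≡1 j)
              ■ cong (_* fromℕ ∣ Rₜ ∩ ground (sys j) ∣) (ℝ-Ring.+-identityʳ 1#) ■ ℝ-Ring.*-identityˡ _)))))

  good? : ∀ e Y → Dec ((agentOf e ∉ Y × Top e Y) × ¬ Bad e Y)
  good? e Y = (¬? (agentOf e ∈? Y) ×-dec top? e Y) ×-dec ¬? (bad? e Y)

  module _ {p : ℝ} (0≤p : 0# ≤ p) (p≤1 : p ≤ 1#) where

    private
      isTop isBad : Fin m → Subset n → Bool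
      isTop e Y = does (top? e Y)
      isBad e Y = does (top? e Y ×-dec bad? e Y)

      symmetric : ∀ {a} Y Y′ → SameExcept a Y Y′ → SameExcept a Y′ Y
      symmetric Y Y′ same b b≢a = sym (same b b≢a)

      top-ignores : ∀ e → Ignores (agentOf e) (𝟙 ∘ isTop e)
      top-ignores e Y Y′ same = cong 𝟙 (does-⇔ (top? e Y) (top? e Y′) (Top-local {Y = Y} {Y′} same refl) (Top-local {Y = Y′} {Y} (symmetric Y Y′ same) refl))

      bad-ignores : ∀ e → Ignores (agentOf e) (𝟙 ∘ isBad e)
      bad-ignores e Y Y′ same = cong 𝟙 (does-⇔ (top? e Y ×-dec bad? e Y) (top? e Y′ ×-dec bad? e Y′)
        (transport Y Y′ same) (transport Y′ Y (symmetric Y Y′ same)))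
        where
        transport : ∀ Y Y′ → SameExcept (agentOf e) Y Y′ → Top e Y × Bad e Y → Top e Y′ × Bad e Y′
        transport Y Y′ same (top , bad) = Top-local {Y = Y} {Y′} same refl top ,
          Any.map (λ {j} → Blocked-mono (sys j) (rel-local-⊆ {Y = Y} {Y′} same refl top)) bad

    open Averaging agentOf w isTop isBad top-ignores bad-ignores 0≤p p≤1 public using (ET; EB)

    private
      module Av = Averaging agentOf w isTop isBad top-ignores bad-ignores 0≤p p≤1

      lookup-chosenBy : ∀ Y e → lookup (chosenBy Y) e ≡ lookup Y (agentOf e) ∧ isTop e Y
      lookup-chosenBy Y e = Bool-⇔
        (λ eq → let a∈ , top = chosenBy⁻ {Y = Y} (lookup⇒∈ eq) in cong₂ _∧_ (∈⇒lookup a∈) (does⁺ (top? e Y) top))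
        (λ eq → let a∈ , top = ∧-true⁻ eq in ∈⇒lookup (chosenBy⁺ (lookup⇒∈ a∈) (does⁻ (top? e Y) top)))

      lookup-rel : ∀ Y e → lookup (rel Y) e ≡ not (lookup Y (agentOf e)) ∧ isTop e Y
      lookup-rel Y e = Bool-⇔
        (λ eq → let a∉ , top = rel⁻ {Y = Y} (lookup⇒∈ eq) in cong₂ _∧_ (cong not (∉⇒lookup a∉)) (does⁺ (top? e Y) top))
        (λ eq → let a∉ , top = ∧-true⁻ eq in ∈⇒lookup (rel⁺ (λ a∈ → case sym a∉ ■ cong not (∈⇒lookup a∈) of λ ())
                  (does⁻ (top? e Y) top)))

      weight-∧ : ∀ X (b c : Fin m → Bool) → (∀ e → lookup X e ≡ b e ∧ c e) →
        weight w X ≡ ∑ (allFin m) (λ e → w e * (𝟙 (b e) * 𝟙 (c e)))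
      weight-∧ X b c eq = weight-lookup w X ■ ∑-cong (allFin m) (λ e → cong (w e *_) (cong 𝟙 (eq e) ■ 𝟙-∧ (b e) (c e)))

      weight-chosenBy : ∀ Y → weight w (chosenBy Y) ≡ ∑ (allFin m) (λ e → w e * (Av.∈Y e Y * 𝟙 (isTop e Y)))
      weight-chosenBy Y = weight-∧ (chosenBy Y) (λ e → lookup Y (agentOf e)) (λ e → isTop e Y) (lookup-chosenBy Y)

      weight-rel : ∀ Y → weight w (rel Y) ≡ ∑ (allFin m) (λ e → w e * (Av.∉Y e Y * 𝟙 (isTop e Y)))
      weight-rel Y = weight-∧ (rel Y) (λ e → not (lookup Y (agentOf e))) (λ e → isTop e Y) (lookup-rel Y)

    good-weight : Coins p n (λ Y → ∑ (allFin m) (λ e → w e * 𝟙 (does (good? e Y)))) ≡ (1# - p) * (ET - EB)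
    good-weight = Coins-cong p n (λ Y → ∑-cong (allFin m) λ e → cong (w e *_)
        (cong (λ b → 𝟙 ((not b ∧ isTop e Y) ∧ not (does (bad? e Y)))) (does-∈? (agentOf e) Y)
          ■ 𝟙-∧ (not (lookup Y (agentOf e)) ∧ isTop e Y) _
          ■ cong (_* 𝟙 (not (does (bad? e Y)))) (𝟙-∧ (not (lookup Y (agentOf e))) (isTop e Y))
          ■ ℝ-Ring.*-assoc _ _ _
          ■ cong (Av.∉Y e Y *_) (difference (isTop e Y) (does (bad? e Y)))))
      ■ Av.good-average
      where
      difference : ∀ b c → 𝟙 b * 𝟙 (not c) ≡ 𝟙 b - 𝟙 (b ∧ c)
      difference true  true  = ℝ-Ring.zeroʳ 1# ■ sym (ℝ-Ring.-‿inverseʳ 1#)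
      difference true  false = ℝ-Ring.*-identityʳ 1# ■ sym (cong (1# +_) ℝ-RingProperties.-0#≈0# ■ ℝ-Ring.+-identityʳ 1#)
      difference false c     = ℝ-Ring.zeroˡ _ ■ sym (ℝ-Ring.-‿inverseʳ 0#)

    optimum-average : ∀ O → F O → p * weight w O ≤ fromℕ k * (p * ET)
    optimum-average O fO = Av.optimum-bound (fromℕ k) O λ Y →
      subst₂ _≤_
        (weight-∧ (O ∩ edgesOf Y) (λ e → lookup Y (agentOf e)) (lookup O) (λ e →
          lookup-∩ O (edgesOf Y) e ■ cong (lookup O e ∧_) (Vec.lookup∘tabulate _ e ■ does-∈? (agentOf e) Y) ■ Bool.∧-comm (lookup O e) _))
        (cong (fromℕ k *_) (weight-chosenBy Y))
        (greedy-approximates O Y fO)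

    bad-average : p * EB ≤ fromℕ k * ((1# - p) * ET)
    bad-average = Av.bad-bound (fromℕ k) λ Y →
      subst₂ _≤_
        (weight-∧ (badChosen Y) (λ e → lookup Y (agentOf e)) (λ e → isBad e Y) (lookup-badChosen Y))
        (cong (fromℕ k *_) (weight-rel Y))
        (bad-chosen-bound Y)
      where
      lookup-badChosen : ∀ Y e → lookup (badChosen Y) e ≡ lookup Y (agentOf e) ∧ (isTop e Y ∧ does (bad? e Y))
      lookup-badChosen Y e = Vec.lookup∘tabulate _ e
        ■ cong (_∧ does (bad? e Y)) (does-∈? e (chosenBy Y) ■ lookup-chosenBy Y e) ■ Bool.∧-assoc (lookup Y (agentOf e)) _ _

    bad-average-matroid : (∀ j → κ j ≡ 1) → EB ≤ fromℕ k * ((1# - p) * ET)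
    bad-average-matroid κ≡1 = Av.bad-bound-matroid (fromℕ k) λ Y →
      subst₂ _≤_
        (weight-lookup w (badTop Y) ■ ∑-cong (allFin m) (λ e → cong (λ b → w e * 𝟙 b) (Vec.lookup∘tabulate _ e)))
        (cong (fromℕ k *_) (weight-rel Y))
        (bad-top-bound κ≡1 Y)

-- Hulls

∈-⋃⁺ : ∀ {n} {Xs : List (Subset n)} {X x} → X ∈ˡ Xs → x ∈ X → x ∈ ⋃ Xs
∈-⋃⁺ (here refl) x∈ = x∈p∪q⁺ (inj₁ x∈)
∈-⋃⁺ (there X∈)  x∈ = x∈p∪q⁺ (inj₂ (∈-⋃⁺ X∈ x∈))

∈-⋃⁻ : ∀ {n} (Xs : List (Subset n)) {x} → x ∈ ⋃ Xs → ∃ λ X → X ∈ˡ Xs × x ∈ X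
∈-⋃⁻ []       x∈ = contradiction x∈ ∉⊥
∈-⋃⁻ (X ∷ Xs) x∈ with x∈p∪q⁻ X (⋃ Xs) x∈
... | inj₁ x∈X = X , here refl , x∈X
... | inj₂ x∈⋃ with Y , Y∈ , x∈Y ← ∈-⋃⁻ Xs x∈⋃ = Y , there Y∈ , x∈Y

∈-⋂⁺ : ∀ {n} (Xs : List (Subset n)) {x} → (∀ {X} → X ∈ˡ Xs → x ∈ X) → x ∈ ⋂ Xs
∈-⋂⁺ []       x∈ = ∈⊤
∈-⋂⁺ (X ∷ Xs) x∈ = x∈p∩q⁺ (x∈ (here refl) , ∈-⋂⁺ Xs (x∈ ∘ there))

∩-monoˡ : ∀ {n} {X Y : Subset n} (S : Subset n) → X ⊆ Y → X ∩ S ⊆ Y ∩ S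
∩-monoˡ {X = X} S X⊆Y x∈ with x∈X , x∈S ← x∈p∩q⁻ X S x∈ = x∈p∩q⁺ (X⊆Y x∈X , x∈S)

module _ {n} (C : Combination n) where

  ∈-Hull⁺ : ∀ {X x} j → x ∈ PHull (part C j) (X ∩ ground (part C j)) → x ∈ Hull C X
  ∈-Hull⁺ {X} j = ∈-⋃⁺ (Mem.∈-map⁺ (λ j → PHull (part C j) (X ∩ ground (part C j))) (Mem.∈-allFin j))

  ∈-Hull⁻ : ∀ {X x} → x ∈ Hull C X → ∃ λ j → x ∈ PHull (part C j) (X ∩ ground (part C j))
  ∈-Hull⁻ {X} x∈
    with H , H∈ , x∈H ← ∈-⋃⁻ (map (λ j → PHull (part C j) (X ∩ ground (part C j))) (allFin (size C))) x∈
    with j , _ , refl ← Mem.∈-map⁻ (λ j → PHull (part C j) (X ∩ ground (part C j))) H∈ = j , x∈H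

  Hull-mono : ∀ {X Y} → X ⊆ Y → Hull C X ⊆ Hull C Y
  Hull-mono X⊆Y x∈ with j , x∈ⱼ ← ∈-Hull⁻ x∈ = ∈-Hull⁺ j (PHull-mono (part C j) (∩-monoˡ (ground (part C j)) X⊆Y) x∈ⱼ)

  Hull⇒Blocked : ∀ {X x} → x ∈ Hull C X → x ∉ X → ∃ λ j → Blocked (part C j) (X ∩ ground (part C j)) x
  Hull⇒Blocked {X} x∈ x∉X with j , x∈ⱼ ← ∈-Hull⁻ x∈ =
    j , PHull⇒Blocked (part C j) x∈ⱼ (x∉X ∘ p∩q⊆p X (ground (part C j)))

  -- The primitive core of a component looks only at heavier edges inside its own ground set, so its
  -- hull is contained in the hull of the combination by monotonicity.
  Core⁺ : ⦃ ℛ : RealNumbers ⦄ (w : Weight n) → ∀ {X e} → e ∈ X → e ∉ Hull C (above w X e) → e ∈ Core C w X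
  Core⁺ w {X} {e} e∈X e∉Hull = ∈-⋂⁺ (map component (allFin (size C))) λ X∈ →
    let j , _ , eq = Mem.∈-map⁻ component X∈ in subst (e ∈_) (sym eq) (in-component j)
    where
    component : Fin (size C) → Subset n
    component j = (X ─ ground (part C j)) ∪ PCore (part C j) w (X ∩ ground (part C j))
    in-component : ∀ j → e ∈ component j
    in-component j with e ∈? ground (part C j)
    ... | no e∉S  = x∈p∪q⁺ (inj₁ (x∈p∧x∉q⇒x∈p─q e∈X e∉S))
    ... | yes e∈S = x∈p∪q⁺ (inj₂ (comprehension⁺
      (λ e → (e ∈? (X ∩ ground (part C j))) ×-dec ¬? (e ∈? PHull (part C j) (above w (X ∩ ground (part C j)) e)))
      (x∈p∩q⁺ (e∈X , e∈S) , λ e∈H → e∉Hull (∈-Hull⁺ j (PHull-mono (part C j) shrink e∈H)))))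
      where
      shrink : above w (X ∩ ground (part C j)) e ⊆ above w X e ∩ ground (part C j)
      shrink f∈ with f∈XS , e<f ← ∈-above⁻ w {X ∩ ground (part C j)} f∈
        with f∈X , f∈S ← x∈p∩q⁻ X (ground (part C j)) f∈XS = x∈p∩q⁺ (∈-above⁺ w f∈X e<f , f∈S)

module _ {m n} (f : Fin m → Fin n) where

  private
    image? : ∀ X v → Dec (∃ λ e → e ∈ X × f e ≡ v)
    image? X v = any? λ e → (e ∈? X) ×-dec (f e ≟ v)

  ∈-image⁺ : ∀ {X e} → e ∈ X → f e ∈ image f X
  ∈-image⁺ {X} {e} e∈ = comprehension⁺ (image? X) (e , e∈ , refl)

  ∈-image⁻ : ∀ {X v} → v ∈ image f X → ∃ λ e → e ∈ X × f e ≡ v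
  ∈-image⁻ {X} = comprehension⁻ (image? X)

  image-mono : ∀ {X Y} → X ⊆ Y → image f X ⊆ image f Y
  image-mono X⊆Y v∈ with e , e∈ , refl ← ∈-image⁻ v∈ = ∈-image⁺ (X⊆Y e∈)

  module _ (C : Combination n) where

    private
      PC = parallelCombination f C

      ∈-ground⁺ : ∀ j {e} → f e ∈ ground (part C j) → e ∈ ground (part PC j)
      ∈-ground⁺ j = comprehension⁺ (λ e → f e ∈? ground (part C j))
      ∈-ground⁻ : ∀ j {e} → e ∈ ground (part PC j) → f e ∈ ground (part C j)
      ∈-ground⁻ j = comprehension⁻ (λ e → f e ∈? ground (part C j))

    -- The blocking set of agents is lifted to the edges of `X` above it. As `f` is injective on
    -- `X`, no two parallel copies meet, so the lifted set stays independent.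
    lift-Blocked : ∀ {X e} → (∀ {x y} → x ∈ X → y ∈ X → f x ≡ f y → x ≡ y) → ∀ j →
      Blocked (part C j) (image f X ∩ ground (part C j)) (f e) → Blocked (part PC j) X e
    lift-Blocked {X} {e} injective j (a∈S , I , I⊆ , iI , dep) =
      ∈-ground⁺ j a∈S , I′ , (λ x∈ → proj₁ (comprehension⁻ lift? x∈)) ,
      ((λ x∈ → ∈-ground⁺ j (indep⊆ground (part C j) iI (proj₂ (comprehension⁻ lift? x∈)))) ,
       (λ x y x∈ y∈ → injective (proj₁ (comprehension⁻ lift? x∈)) (proj₁ (comprehension⁻ lift? y∈))) ,
       downward (part C j) image⊆I iI) ,
      λ (_ , _ , indep) → dep (downward (part C j) I∪⊆ indep)
      where
      lift? : Decidable (λ x → x ∈ X × f x ∈ I)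
      lift? x = (x ∈? X) ×-dec (f x ∈? I)
      I′ = comprehension lift?
      image⊆I : image f I′ ⊆ I
      image⊆I v∈ with x , x∈ , refl ← ∈-image⁻ v∈ = proj₂ (comprehension⁻ lift? x∈)
      I∪⊆ : I ∪ ⁅ f e ⁆ ⊆ image f (I′ ∪ ⁅ e ⁆)
      I∪⊆ v∈ with ∈-∪⁅⁆⁻ v∈
      ... | inj₂ refl = ∈-image⁺ ∈-∪⁅⁆⁺ʳ
      ... | inj₁ v∈I with x , x∈X , refl ← ∈-image⁻ (p∩q⊆p (image f X) (ground (part C j)) (I⊆ v∈I)) =
        ∈-image⁺ (∈-∪⁅⁆⁺ˡ (comprehension⁺ lift? (x∈X , v∈I)))

    Hull-lift : ∀ {X e} → (∀ {x y} → x ∈ X → y ∈ X → f x ≡ f y → x ≡ y) → f e ∉ image f X →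
      f e ∈ Hull C (image f X) → ∃ λ j → Blocked (part PC j) X e
    Hull-lift {X} {e} injective fe∉ fe∈Hull = let j , blocked = Hull⇒Blocked C fe∈Hull fe∉ in j , lift-Blocked injective j blocked

    -- If some component rejected X + e although the agent of `e` is fresh, then the agents of `X`
    -- in that component would block the agent of `e`, placing it in the hull.
    parallel-extend : ∀ {X e} → Indep (combined PC) X → (∀ {x} → x ∈ X → f x ≢ f e) → f e ∉ Hull C (image f X) →
      Indep (combined PC) (X ∪ ⁅ e ⁆)
    parallel-extend {X} {e} iX fresh fe∉Hull j with e ∈? ground (part PC j)
    ... | no e∉S = downward (part PC j) shrink (iX j)
      where
      shrink : (X ∪ ⁅ e ⁆) ∩ ground (part PC j) ⊆ X ∩ ground (part PC j)
      shrink x∈ with x∈Xe , x∈S ← x∈p∩q⁻ (X ∪ ⁅ e ⁆) (ground (part PC j)) x∈ with ∈-∪⁅⁆⁻ x∈Xe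
      ... | inj₁ x∈X  = x∈p∩q⁺ (x∈X , x∈S)
      ... | inj₂ refl = contradiction x∈S e∉S
    ... | yes e∈S = p∩q⊆q (X ∪ ⁅ e ⁆) (ground (part PC j)) , injective , independent
      where
      S = ground (part PC j)
      split : ∀ {x} → x ∈ (X ∪ ⁅ e ⁆) ∩ S → x ∈ X ∩ S ⊎ x ≡ e
      split x∈ with x∈Xe , x∈S ← x∈p∩q⁻ (X ∪ ⁅ e ⁆) S x∈ with ∈-∪⁅⁆⁻ x∈Xe
      ... | inj₁ x∈X  = inj₁ (x∈p∩q⁺ (x∈X , x∈S))
      ... | inj₂ x≡e = inj₂ x≡e

      injective : ∀ x y → x ∈ (X ∪ ⁅ e ⁆) ∩ S → y ∈ (X ∪ ⁅ e ⁆) ∩ S → f x ≡ f y → x ≡ y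
      injective x y x∈ y∈ fx≡fy with split x∈ | split y∈
      ... | inj₁ x∈X  | inj₁ y∈X  = proj₁ (proj₂ (iX j)) x y x∈X y∈X fx≡fy
      ... | inj₁ x∈X  | inj₂ refl = contradiction fx≡fy (fresh (p∩q⊆p X S x∈X))
      ... | inj₂ refl | inj₁ y∈X  = contradiction (sym fx≡fy) (fresh (p∩q⊆p X S y∈X))
      ... | inj₂ refl | inj₂ refl = refl

      independent : Indep (part C j) (image f ((X ∪ ⁅ e ⁆) ∩ S))
      independent = decidable-stable (indep? (part C j) _) λ dep → fe∉Hull (∈-Hull⁺ C j (Blocked⇒PHull (part C j)
        (∈-ground⁻ j e∈S , image f (X ∩ S) , image⊆ , proj₂ (proj₂ (iX j)) , λ indep → dep (downward (part C j) ⊆image indep))))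
        where
        image⊆ : image f (X ∩ S) ⊆ image f X ∩ ground (part C j)
        image⊆ v∈ with x , x∈ , refl ← ∈-image⁻ v∈ with x∈X , x∈S ← x∈p∩q⁻ X S x∈ = x∈p∩q⁺ (∈-image⁺ x∈X , ∈-ground⁻ j x∈S)
        ⊆image : image f ((X ∪ ⁅ e ⁆) ∩ S) ⊆ image f (X ∩ S) ∪ ⁅ f e ⁆
        ⊆image v∈ with x , x∈ , refl ← ∈-image⁻ v∈ with split x∈
        ... | inj₁ x∈X  = ∈-∪⁅⁆⁺ˡ (∈-image⁺ x∈X)
        ... | inj₂ refl = ∈-∪⁅⁆⁺ʳ

    -- An agent in the hull of the empty set is a loop and has no independent edge. Agents of
    -- relevant edges thus start outside the hull and have a well-defined moment of entry.
    indep⇒∉Hull∅ : ∀ {e} → Indep (combined PC) ⁅ e ⁆ → f e ∉ Hull C ∅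
    indep⇒∉Hull∅ {e} ie fe∈ = let j , a∈S , I , I⊆ , _ , dep = Hull⇒Blocked C fe∈ ∉⊥ in
      dep (downward (part C j) (I∪⊆ j a∈S I⊆) (proj₂ (proj₂ (ie j))))
      where
      I∪⊆ : ∀ j {I} → f e ∈ ground (part C j) → I ⊆ ∅ ∩ ground (part C j) → I ∪ ⁅ f e ⁆ ⊆ image f (⁅ e ⁆ ∩ ground (part PC j))
      I∪⊆ j a∈S I⊆ v∈ = case ∈-∪⁅⁆⁻ v∈ of λ
        { (inj₁ v∈I)  → contradiction (p∩q⊆p ∅ (ground (part C j)) (I⊆ v∈I)) ∉⊥
        ; (inj₂ refl) → ∈-image⁺ (x∈p∩q⁺ (x∈⁅x⁆ e , ∈-ground⁺ j a∈S)) }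

-- The run of the algorithm

-- A visit carries the threshold edge of its round; nothing marks the final
-- round, which has no threshold.
module Schedule {m n : ℕ} (agentOf : Fin m → Fin n) (hull : Subset n → Subset n) where

  Visit : Set
  Visit = Fin n × Maybe (Fin m)

  tag : Maybe (Fin m) → Fin n → Visit
  tag τ a = a , τ

  removeAll : Subset n → List (Fin n) → Subset n
  removeAll = foldl (λ U a → U ─ ⁅ a ⁆)

  ∈-removeAll⁺ : ∀ {U a} as → a ∈ U → a ∉ˡ as → a ∈ removeAll U as
  ∈-removeAll⁺ []       a∈ a∉ = a∈
  ∈-removeAll⁺ (b ∷ as) a∈ a∉ = ∈-removeAll⁺ as (x∈p∧x∉q⇒x∈p─q a∈ (a∉ ∘ here ∘ x∈⁅y⁆⇒x≡y b)) (a∉ ∘ there)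

  ∈-removeAll⁻ : ∀ {U a} as → a ∈ removeAll U as → a ∈ U × a ∉ˡ as
  ∈-removeAll⁻ []           a∈ = a∈ , λ ()
  ∈-removeAll⁻ {U} (b ∷ as) a∈ with a∈Ub , a∉as ← ∈-removeAll⁻ {U ─ ⁅ b ⁆} as a∈
    with a∈U , a∉b ← ∈-─⁻ U ⁅ b ⁆ a∈Ub = a∈U , λ { (here refl) → a∉b (x∈⁅x⁆ b) ; (there a∈as) → a∉as a∈as }

  see : Subset n → Fin m → Subset n
  see seen e = seen ∪ ⁅ agentOf e ⁆

  batch : Subset n → List (Fin n) → List (Fin n)
  batch Q = filter (_∈? Q)

  schedule : (ℕ → List (Fin n)) → ℕ → Subset n → List (Fin m) → Subset n → List Visit
  schedule ord j seen []       U = map (tag nothing) (batch U (ord j))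
  schedule ord j seen (e ∷ es) U = map (tag (just e)) (batch (U ∩ hull (see seen e)) (ord j)) ++
    schedule ord (suc j) (see seen e) es (removeAll U (batch (U ∩ hull (see seen e)) (ord j)))

  -- The last round comes after all threshold rounds and reads the order with index `j + length es`,
  -- hence the inclusive bound.
  schedule-cong : ∀ {ord ord′} j seen es U → (∀ i → i ℕ.≤ j ℕ.+ length es → ord i ≡ ord′ i) →
    schedule ord j seen es U ≡ schedule ord′ j seen es U
  schedule-cong j seen []       U same = cong (λ as → map (tag nothing) (batch U as)) (same j (ℕ.≤-reflexive (sym (ℕ.+-identityʳ j))))
  schedule-cong {ord} {ord′} j seen (e ∷ es) U same rewrite same j (ℕ.m≤m+n j (suc (length es))) =
    cong (map (tag (just e)) (batch (U ∩ hull (see seen e)) (ord′ j)) ++_)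
      (schedule-cong (suc j) (see seen e) es _ λ i i≤ → same i (subst (i ℕ.≤_) (sym (ℕ.+-suc j (length es))) i≤))

  module _ {ord : ℕ → List (Fin n)} (ord-perm : ∀ j → ord j ↭ allFin n) where

    private
      ∈-batch⁺ : ∀ {Q a} j → a ∈ Q → a ∈ˡ batch Q (ord j)
      ∈-batch⁺ {Q} {a} j a∈ = Mem.∈-filter⁺ (_∈? Q) (Perm.∈-resp-↭ (↭-sym (ord-perm j)) (Mem.∈-allFin a)) a∈

      ∈-batch⁻ : ∀ {Q a} j → a ∈ˡ batch Q (ord j) → a ∈ Q
      ∈-batch⁻ {Q} j a∈ = proj₂ (Mem.∈-filter⁻ (_∈? Q) {xs = ord j} a∈)

      batch-unique : ∀ Q j → Unique (batch Q (ord j))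
      batch-unique Q j = Unique.filter⁺ (_∈? Q) (Unique-resp-↭ (↭-sym (ord-perm j)) (Unique.allFin⁺ n))

      agents-map : ∀ (τ : Maybe (Fin m)) as → map proj₁ (map (tag τ) as) ≡ as
      agents-map τ as = sym (List.map-∘ as) ■ List.map-id as

    visited : ℕ → Subset n → List (Fin m) → Subset n → List (Fin n)
    visited j seen es U = map proj₁ (schedule ord j seen es U)

    visited-∷ : ∀ j seen e es U → visited j seen (e ∷ es) U ≡ batch (U ∩ hull (see seen e)) (ord j) ++
      visited (suc j) (see seen e) es (removeAll U (batch (U ∩ hull (see seen e)) (ord j)))
    visited-∷ j seen e es U = List.map-++ proj₁ (map (tag (just e)) (batch (U ∩ hull (see seen e)) (ord j))) _
      ■ cong (_++ visited (suc j) (see seen e) es (removeAll U (batch (U ∩ hull (see seen e)) (ord j)))) (agents-map (just e) _)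

    visited⊆ : ∀ j seen es U {a} → a ∈ˡ visited j seen es U → a ∈ U
    visited⊆ j seen []       U {a} a∈ = ∈-batch⁻ j (subst (a ∈ˡ_) (agents-map nothing _) a∈)
    visited⊆ j seen (e ∷ es) U {a} a∈
      with Mem.∈-++⁻ (batch (U ∩ hull (see seen e)) (ord j)) (subst (a ∈ˡ_) (visited-∷ j seen e es U) a∈)
    ... | inj₁ now   = p∩q⊆p U _ (∈-batch⁻ j now)
    ... | inj₂ later = proj₁ (∈-removeAll⁻ (batch (U ∩ hull (see seen e)) (ord j)) (visited⊆ (suc j) _ es _ later))

    visited⊇ : ∀ j seen es U {a} → a ∈ U → a ∈ˡ visited j seen es U
    visited⊇ j seen []       U {a} a∈ = subst (a ∈ˡ_) (sym (agents-map nothing _)) (∈-batch⁺ j a∈)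
    visited⊇ j seen (e ∷ es) U {a} a∈ = subst (a ∈ˡ_) (sym (visited-∷ j seen e es U)) (cases (a ∈? hull (see seen e)))
      where
      now = batch (U ∩ hull (see seen e)) (ord j)
      cases : Dec (a ∈ hull (see seen e)) → a ∈ˡ now ++ visited (suc j) (see seen e) es (removeAll U now)
      cases (yes a∈h) = Mem.∈-++⁺ˡ (∈-batch⁺ j (x∈p∩q⁺ (a∈ , a∈h)))
      cases (no a∉h)  = Mem.∈-++⁺ʳ now (visited⊇ (suc j) _ es _
        (∈-removeAll⁺ now a∈ (a∉h ∘ p∩q⊆q U (hull (see seen e)) ∘ ∈-batch⁻ j)))

    visited-unique : ∀ j seen es U → Unique (visited j seen es U)
    visited-unique j seen []       U = subst Unique (sym (agents-map nothing _)) (batch-unique U j)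
    visited-unique j seen (e ∷ es) U = subst Unique (sym (visited-∷ j seen e es U))
      (Unique.++⁺ (batch-unique _ j) (visited-unique (suc j) _ es _) λ (now , later) →
        proj₂ (∈-removeAll⁻ (batch (U ∩ hull (see seen e)) (ord j)) (visited⊆ (suc j) _ es _ later)) now)

    -- An agent is visited in the round in which it first enters the hull.
    Located : Fin n → Subset n → List (Fin m) → List Visit → Maybe (Fin m) → Set
    Located a seen es pre nothing  = a ∉ hull (foldl see seen es)
    Located a seen es pre (just x) = ∃₂ λ es₁ es₂ → es ≡ es₁ ++ x ∷ es₂ ×
      a ∉ hull (foldl see seen es₁) × a ∈ hull (foldl see seen (es₁ ++ x ∷ [])) ×
      (∀ {b τ} → (b , τ) ∈ˡ pre → ∃ λ y → τ ≡ just y × y ∈ˡ es₁ ++ x ∷ [])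

    locate : ∀ j seen es U {a} → a ∈ U → a ∉ hull seen →
      ∃₂ λ pre τ → ∃ λ post → schedule ord j seen es U ≡ pre ++ (a , τ) ∷ post × Located a seen es pre τ
    locate j seen [] U {a} a∈ a∉
      with as , bs , eq ← Mem.∈-∃++ (∈-batch⁺ {U} j a∈) =
      map (tag nothing) as , nothing , map (tag nothing) bs ,
      (cong (map (tag nothing)) eq ■ List.map-++ (tag nothing) as (a ∷ bs)) , a∉
    locate j seen (e ∷ es) U {a} a∈ a∉ with a ∈? hull (see seen e)
    ... | yes a∈h with as , bs , eq ← Mem.∈-∃++ (∈-batch⁺ {U ∩ hull (see seen e)} j (x∈p∩q⁺ (a∈ , a∈h))) =
      map (tag (just e)) as , just e , map (tag (just e)) bs ++ later ,
      (cong (λ now → map (tag (just e)) now ++ later) eq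
        ■ cong (_++ later) (List.map-++ (tag (just e)) as (a ∷ bs)) ■ List.++-assoc (map (tag (just e)) as) _ later) ,
      [] , es , refl , a∉ , a∈h , λ v∈ → let _ , _ , eq = Mem.∈-map⁻ (tag (just e)) v∈ in e , cong proj₂ eq , here refl
      where later = schedule ord (suc j) (see seen e) es (removeAll U (batch (U ∩ hull (see seen e)) (ord j)))
    ... | no a∉h with pre , τ , post , eq , located ← locate (suc j) (see seen e) es
                        (removeAll U (batch (U ∩ hull (see seen e)) (ord j)))
                        (∈-removeAll⁺ _ a∈ (a∉h ∘ p∩q⊆q U (hull (see seen e)) ∘ ∈-batch⁻ j)) a∉h =
      now ++ pre , τ , post , (cong (now ++_) eq ■ sym (List.++-assoc now pre ((a , τ) ∷ post))) , extend τ located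
      where
      now = map (tag (just e)) (batch (U ∩ hull (see seen e)) (ord j))
      extend : ∀ τ → Located a (see seen e) es pre τ → Located a seen (e ∷ es) (now ++ pre) τ
      extend nothing  a∉ = a∉
      extend (just x) (es₁ , es₂ , refl , a∉ , a∈ , earlier) = e ∷ es₁ , es₂ , refl , a∉ , a∈ , λ v∈ →
        case Mem.∈-++⁻ now v∈ of λ
          { (inj₁ v∈now) → let _ , _ , eq = Mem.∈-map⁻ (tag (just e)) v∈now in e , cong proj₂ eq , here refl
          ; (inj₂ v∈pre) → let y , τ≡ , y∈ = earlier v∈pre in y , τ≡ , there y∈ }

-- Processing the presented edges

module Process ⦃ ℛ : RealNumbers ⦄ {m n : ℕ} (agentOf : Fin m → Fin n) (w : Weight m)
  (F : Subset m → Set) (add : Subset m → Fin m → Subset m)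
  (add-view : ∀ X e → (F (X ∪ ⁅ e ⁆) × add X e ≡ X ∪ ⁅ e ⁆) ⊎ (¬ F (X ∪ ⁅ e ⁆) × add X e ≡ X)) where

  open Adding F add add-view

  passes : Maybe (Fin m) → Fin m → Bool
  passes nothing  f = true
  passes (just e) f = does (w e <? w f)

  present₁ : Maybe (Fin m) → Maybe (Fin m) → List (Fin m × Bool)
  present₁ nothing  τ = []
  present₁ (just f) τ = (f , passes τ f) ∷ []

  present : (Fin n → Maybe (Fin m)) → List (Fin n × Maybe (Fin m)) → List (Fin m × Bool)
  present top []            = []
  present top ((a , τ) ∷ s) = present₁ (top a) τ ++ present top s

  -- The Boolean of an edge records whether it beats the threshold of its round. The history grows
  -- by every edge, accepted or not, because the item-side algorithm sees all of them.
  process : (List (Fin m × ℝ) → Fin m × ℝ → Bool) → List (Fin m × ℝ) → Subset m → List (Fin m × Bool) → Subset m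
  process dec past X []             = X
  process dec past X ((f , h) ∷ fs) =
    process dec (past ∷ʳ (f , w f)) (if h ∧ dec past (f , w f) then add X f else X) fs

  module _ (top : Fin n → Maybe (Fin m)) where

    present-++ : ∀ xs ys → present top (xs ++ ys) ≡ present top xs ++ present top ys
    present-++ []             ys = refl
    present-++ ((a , τ) ∷ xs) ys = cong (present₁ (top a) τ ++_) (present-++ xs ys) ■ sym (List.++-assoc (present₁ (top a) τ) _ _)

    ∈-present⁻ : ∀ s {f h} → (f , h) ∈ˡ present top s → ∃₂ λ a τ → (a , τ) ∈ˡ s × top a ≡ just f × h ≡ passes τ f
    ∈-present⁻ ((a , τ) ∷ s) f∈ with top a in eq
    ∈-present⁻ ((a , τ) ∷ s) f∈          | nothing with b , τ′ , v∈ , rest ← ∈-present⁻ s f∈ = b , τ′ , there v∈ , rest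
    ∈-present⁻ ((a , τ) ∷ s) (here refl) | just f  = a , τ , here refl , eq , refl
    ∈-present⁻ ((a , τ) ∷ s) (there f∈)  | just f  with b , τ′ , v∈ , rest ← ∈-present⁻ s f∈ = b , τ′ , there v∈ , rest

    ∈-presented⁻ : ∀ s {f} → f ∈ˡ map proj₁ (present top s) → ∃ λ a → a ∈ˡ map proj₁ s × top a ≡ just f
    ∈-presented⁻ s f∈ with (f , h) , fh∈ , refl ← Mem.∈-map⁻ proj₁ f∈ with a , τ , v∈ , eq , _ ← ∈-present⁻ s fh∈ =
      a , Mem.∈-map⁺ proj₁ v∈ , eq

    ∈-presented⁺ : ∀ s {a f} → a ∈ˡ map proj₁ s → top a ≡ just f → f ∈ˡ map proj₁ (present top s)
    ∈-presented⁺ ((a , τ) ∷ s) (here refl) eq rewrite eq = here refl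
    ∈-presented⁺ ((a , τ) ∷ s) (there a∈)  eq with top a
    ... | nothing = ∈-presented⁺ s a∈ eq
    ... | just _  = there (∈-presented⁺ s a∈ eq)

    presented-unique : (∀ {a f} → top a ≡ just f → agentOf f ≡ a) → ∀ s → Unique (map proj₁ s) → Unique (map proj₁ (present top s))
    presented-unique top-agent []            u = []
    presented-unique top-agent ((a , τ) ∷ s) (a∉ ∷ u) with top a in eq
    ... | nothing = presented-unique top-agent s u
    ... | just f  = All.tabulate (λ {g} g∈ f≡g → let b , b∈ , eq′ = ∈-presented⁻ s g∈ in
                      All.lookup a∉ b∈ (sym (top-agent eq) ■ cong agentOf f≡g ■ top-agent eq′))
                    ∷ presented-unique top-agent s u

  module _ (dec : List (Fin m × ℝ) → Fin m × ℝ → Bool) where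

    process-F : ∀ past X fs → F X → F (process dec past X fs)
    process-F past X []             fX = fX
    process-F past X ((f , h) ∷ fs) fX with h ∧ dec past (f , w f)
    ... | true  = process-F _ _ fs (add-F X f fX)
    ... | false = process-F _ _ fs fX

    process-⊇ : ∀ past X fs → X ⊆ process dec past X fs
    process-⊇ past X []             x∈ = x∈
    process-⊇ past X ((f , h) ∷ fs) x∈ with h ∧ dec past (f , w f)
    ... | true  = process-⊇ _ _ fs (add-⊇ X f x∈)
    ... | false = process-⊇ _ _ fs x∈

    process-++ : ∀ past X fs gs →
      process dec past X (fs ++ gs) ≡ process dec (past ++ map (λ fh → proj₁ fh , w (proj₁ fh)) fs) (process dec past X fs) gs
    process-++ past X []             gs = cong (λ past → process dec past X gs) (sym (List.++-identityʳ past))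
    process-++ past X ((f , h) ∷ fs) gs = process-++ (past ∷ʳ (f , w f)) _ fs gs
      ■ cong (λ past → process dec past (process dec _ (if h ∧ dec _ (f , w f) then add X f else X) fs) gs) (List.++-assoc past ((f , w f) ∷ []) _)

    process-heavy : ∀ past X fs {x} → x ∈ process dec past X fs → x ∈ X ⊎ (x , true) ∈ˡ fs
    process-heavy past X []                 x∈ = inj₁ x∈
    process-heavy past X ((f , false) ∷ fs) x∈ with process-heavy _ _ fs x∈
    ... | inj₁ x∈X  = inj₁ x∈X
    ... | inj₂ x∈fs = inj₂ (there x∈fs)
    process-heavy past X ((f , true) ∷ fs)  x∈ with dec past (f , w f) | process-heavy _ _ fs x∈
    ... | _     | inj₂ x∈fs = inj₂ (there x∈fs)
    ... | false | inj₁ x∈X  = inj₁ x∈X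
    ... | true  | inj₁ x∈X′ with add-⊆ X f x∈X′
    ...   | inj₁ x∈X  = inj₁ x∈X
    ...   | inj₂ refl = inj₂ (here refl)

  process-measurable : (seeds : ProbabilitySpace) → let open ProbabilitySpace seeds in
    (dec : Ω → List (Fin m × ℝ) → Fin m × ℝ → Bool) → (∀ past c → Event (λ r → dec r past c)) →
    ∀ fs past {X : Ω → Subset m} → Measure.Measurable seeds X → Measure.Measurable seeds (λ r → process (dec r) past (X r) fs)
  process-measurable seeds dec dec-event []                 past X-meas = X-meas
  process-measurable seeds dec dec-event ((f , false) ∷ fs) past X-meas = process-measurable seeds dec dec-event fs _ X-meas
  process-measurable seeds dec dec-event ((f , true) ∷ fs)  past {X} X-meas =
    process-measurable seeds dec dec-event fs _ {λ r → if dec r past (f , w f) then add (X r) f else X r} λ g →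
      event-≗ (λ r → branch (dec r past (f , w f)) g (X r))
        (Measure.event-∪ seeds (event-∩ (dec-event past (f , w f)) (X-meas (λ X → g (add X f))))
                               (event-∩ (event-∁ (dec-event past (f , w f))) (X-meas g)))
    where
    open ProbabilitySpace seeds using (event-≗; event-∩; event-∁)
    branch : ∀ b g (X : Subset m) → (b ∧ g (add X f)) ∨ (not b ∧ g X) ≡ g (if b then add X f else X)
    branch true  g X = Bool.∨-identityʳ _
    branch false g X = refl

  module _ (𝒜 : OnlineAlgorithm m) (r : OnlineAlgorithm.Seed 𝒜) (s : Sample m) where

    open OnlineAlgorithm 𝒜 using (decide; accepted)

    accepted-⊆ : ∀ past σ {x} → x ∈ accepted r w s past σ → x ∈ˡ σ
    accepted-⊆ past []      x∈ = contradiction x∈ ∉⊥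
    accepted-⊆ past (e ∷ σ) x∈ with decide r s past (e , w e)
    ... | false with x∈p∪q⁻ ∅ _ x∈
    ...   | inj₁ x∈∅ = contradiction x∈∅ ∉⊥
    ...   | inj₂ x∈σ = there (accepted-⊆ _ σ x∈σ)
    accepted-⊆ past (e ∷ σ) x∈ | true with x∈p∪q⁻ ⁅ e ⁆ _ x∈
    ...   | inj₁ x∈e = here (x∈⁅y⁆⇒x≡y e x∈e)
    ...   | inj₂ x∈σ = there (accepted-⊆ _ σ x∈σ)

    accepted-++ : ∀ past σ τ → accepted r w s past (σ ++ τ) ≡
      accepted r w s past σ ∪ accepted r w s (past ++ map (λ e → e , w e) σ) τ
    accepted-++ past []      τ = cong (λ past → accepted r w s past τ) (sym (List.++-identityʳ past))
      ■ sym (subset-≡ (λ x∈ → case x∈p∪q⁻ ∅ _ x∈ of λ { (inj₁ x∈∅) → contradiction x∈∅ ∉⊥ ; (inj₂ x∈) → x∈ }) (x∈p∪q⁺ ∘ inj₂))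
    accepted-++ past (e ∷ σ) τ = cong (first ∪_) (accepted-++ (past ∷ʳ (e , w e)) σ τ
        ■ cong (λ past → accepted r w s _ σ ∪ accepted r w s past τ) (List.++-assoc past ((e , w e) ∷ []) _))
      ■ sym (∪-assoc first _ _)
      where first = if decide r s past (e , w e) then ⁅ e ⁆ else ∅

    -- Every edge taken was accepted by the item-side algorithm on the same presentation, so
    -- item-side independence of the output is inherited from it.
    process-⊆accepted : ∀ past X fs {x} → x ∈ process (decide r s) past X fs → x ∈ X ⊎ x ∈ accepted r w s past (map proj₁ fs)
    process-⊆accepted past X []             x∈ = inj₁ x∈
    process-⊆accepted past X ((f , h) ∷ fs) x∈ with decide r s past (f , w f) | h | process-⊆accepted _ _ fs x∈
    ... | _     | _     | inj₂ x∈fs = inj₂ (x∈p∪q⁺ (inj₂ x∈fs))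
    ... | false | false | inj₁ x∈X  = inj₁ x∈X
    ... | false | true  | inj₁ x∈X  = inj₁ x∈X
    ... | true  | false | inj₁ x∈X  = inj₁ x∈X
    ... | true  | true  | inj₁ x∈X′ with add-⊆ X f x∈X′
    ...   | inj₁ x∈X  = inj₁ x∈X
    ...   | inj₂ refl = inj₂ (x∈p∪q⁺ (inj₁ (x∈⁅x⁆ f)))

    -- The presentation has no duplicates, so `𝒜` can have accepted `e` only at its own position,
    -- where the run asks the same question with the same history. It remains that `e` fits the
    -- edges taken before. `rest` holds edges presented after the run.
    select : ∀ pre e post rest → F ∅ → Unique (map proj₁ (pre ++ (e , true) ∷ post) ++ rest) →
      (∀ {X} → F X → (∀ {x} → x ∈ X → (x , true) ∈ˡ pre) →
        (∀ {x} → x ∈ X → x ∈ accepted r w s [] (map proj₁ (pre ++ (e , true) ∷ post) ++ rest)) → F (X ∪ ⁅ e ⁆)) →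
      e ∈ accepted r w s [] (map proj₁ (pre ++ (e , true) ∷ post) ++ rest) →
      e ∈ process (decide r s) [] ∅ (pre ++ (e , true) ∷ post)
    select pre e post rest F-∅ unique extends e∈ =
      subst (e ∈_) (sym (process-++ (decide r s) [] ∅ pre ((e , true) ∷ post)))
        (subst (λ b → e ∈ process (decide r s) (past ∷ʳ (e , w e)) (if b then add X e else X) post) (sym chosen)
          (process-⊇ (decide r s) _ _ post (add-∈ X e (extends (process-F (decide r s) [] ∅ pre F-∅) heavy X⊆accepted))))
      where
      past = map (λ fh → proj₁ fh , w (proj₁ fh)) pre
      X = process (decide r s) [] ∅ pre
      σ₁ = map proj₁ pre
      σ₂ = map proj₁ post ++ rest

      σ≡ : map proj₁ (pre ++ (e , true) ∷ post) ++ rest ≡ σ₁ ++ e ∷ σ₂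
      σ≡ = cong (_++ rest) (List.map-++ proj₁ pre ((e , true) ∷ post)) ■ List.++-assoc σ₁ _ rest

      accepted≡ : accepted r w s [] (map proj₁ (pre ++ (e , true) ∷ post) ++ rest) ≡
        accepted r w s [] σ₁ ∪ accepted r w s past (e ∷ σ₂)
      accepted≡ = cong (accepted r w s []) σ≡ ■ accepted-++ [] σ₁ (e ∷ σ₂)
        ■ cong (λ past → accepted r w s [] σ₁ ∪ accepted r w s past (e ∷ σ₂)) (sym (List.map-∘ pre))

      apart : ∀ σ₁ → Unique (σ₁ ++ e ∷ σ₂) → e ∉ˡ σ₁ × e ∉ˡ σ₂
      apart []       (e∉ ∷ u) = (λ ()) , λ e∈ → All.lookup e∉ e∈ refl
      apart (x ∷ σ₁) (x∉ ∷ u) with e∉₁ , e∉₂ ← apart σ₁ u =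
        (λ { (here refl) → All.lookup x∉ (Mem.∈-++⁺ʳ σ₁ (here refl)) refl ; (there e∈) → e∉₁ e∈ }) , e∉₂

      e∉ = apart σ₁ (subst Unique σ≡ unique)

      chosen : decide r s past (e , w e) ≡ true
      chosen with x∈p∪q⁻ (accepted r w s [] σ₁) _ (subst (e ∈_) accepted≡ e∈)
      ... | inj₁ e∈₁ = contradiction (accepted-⊆ [] σ₁ e∈₁) (proj₁ e∉)
      ... | inj₂ e∈₂ with decide r s past (e , w e)
      ...   | true  = refl
      ...   | false with x∈p∪q⁻ ∅ _ e∈₂
      ...     | inj₁ e∈∅ = contradiction e∈∅ ∉⊥
      ...     | inj₂ e∈σ = contradiction (accepted-⊆ _ σ₂ e∈σ) (proj₂ e∉)

      heavy : ∀ {x} → x ∈ X → (x , true) ∈ˡ pre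
      heavy x∈ with process-heavy (decide r s) [] ∅ pre x∈
      ... | inj₁ x∈∅ = contradiction x∈∅ ∉⊥
      ... | inj₂ x∈pre = x∈pre

      X⊆accepted : ∀ {x} → x ∈ X → x ∈ accepted r w s [] (map proj₁ (pre ++ (e , true) ∷ post) ++ rest)
      X⊆accepted {x} x∈ with process-⊆accepted [] ∅ pre x∈
      ... | inj₁ x∈∅ = contradiction x∈∅ ∉⊥
      ... | inj₂ x∈₁ = subst (x ∈_) (sym accepted≡) (x∈p∪q⁺ (inj₁ x∈₁))

unique-↭ : ∀ {A : Set} {xs ys : List A} → Unique xs → Unique ys →
  (∀ {x} → x ∈ˡ xs → x ∈ˡ ys) → (∀ {x} → x ∈ˡ ys → x ∈ˡ xs) → xs ↭ ys
unique-↭ {xs = []}     {[]}     _ _ _ _ = ↭-refl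
unique-↭ {xs = []}     {y ∷ ys} _ _ _ ⊇ = case ⊇ (here refl) of λ ()
unique-↭ {xs = x ∷ xs} (x∉ ∷ u) v ⊆ ⊇ with as , bs , refl ← Mem.∈-∃++ (⊆ (here refl)) =
  ↭-trans (↭-prep x (unique-↭ u (AllPairs.tail v′) sub sup)) (↭-sym (Perm.shift x as bs))
  where
  v′ : Unique (x ∷ as ++ bs)
  v′ = Unique-resp-↭ (Perm.shift x as bs) v
  sub : ∀ {y} → y ∈ˡ xs → y ∈ˡ as ++ bs
  sub {y} y∈ with Perm.∈-resp-↭ (Perm.shift x as bs) (⊆ (there y∈))
  ... | here refl = contradiction refl (All.lookup x∉ y∈)
  ... | there y∈′ = y∈′
  sup : ∀ {y} → y ∈ˡ as ++ bs → y ∈ˡ xs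
  sup {y} y∈ with ⊇ (Perm.∈-resp-↭ (↭-sym (Perm.shift x as bs)) (there y∈))
  ... | here refl = contradiction refl (All.lookup (AllPairs.head v′) y∈)
  ... | there y∈′ = y∈′

unique-key : ∀ {A B : Set} (xs : List (A × B)) {a b ys} → Unique (map proj₁ (xs ++ (a , b) ∷ ys)) → ∀ {c} → (a , c) ∉ˡ xs
unique-key (_ ∷ xs) (x∉ ∷ u) (here refl) = All.lookup x∉ (Mem.∈-map⁺ proj₁ (Mem.∈-++⁺ʳ xs (here refl))) refl
unique-key (_ ∷ xs) (x∉ ∷ u) (there ∈xs) = unique-key xs u ∈xs

record HullSystem ⦃ ℛ : RealNumbers ⦄ {m n : ℕ} (𝒢 : GreedySystem m n) : Set₁ where
  open GreedySystem 𝒢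
  field
    hull      : Subset n → Subset n
    hull-mono : ∀ {X Y} → X ⊆ Y → hull X ⊆ hull Y
    hull-∅    : ∀ {e} → F ⁅ e ⁆ → agentOf e ∉ hull ∅
    Item      : Subset m → Set
    Item-mono : ∀ {X Y} → X ⊆ Y → Item Y → Item X
    extend    : ∀ {X e} → F X → Item (X ∪ ⁅ e ⁆) → (∀ {x} → x ∈ X → agentOf x ≢ agentOf e) →
                agentOf e ∉ hull (image agentOf X) → F (X ∪ ⁅ e ⁆)

-- Acceptance of a good edge

module Selection ⦃ ℛ : RealNumbers ⦄ {m n : ℕ} (𝒢 : GreedySystem m n) (ℋ : HullSystem 𝒢) where

  open GreedySystem 𝒢
  open HullSystem ℋ
  open Relevance 𝒢
  open Schedule agentOf hull
  open Process agentOf w F add add-view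

  Enters : Fin n → Subset m → Set
  Enters a X = a ∈ hull (image agentOf X)

  enters-mono : ∀ {a X Y} → X ⊆ Y → Enters a X → Enters a Y
  enters-mono X⊆Y = hull-mono (image-mono agentOf X⊆Y)

  -- In decreasing order of weight, a enters the hull of P no later than
  -- the hull of Q.
  Precedes : Fin n → Subset m → Subset m → Set
  Precedes a P Q = (Enters a Q → Enters a P) × (∀ t → Enters a (above w Q t) → Enters a (above w P t))

  precedes? : ∀ a P Q → Dec (Precedes a P Q)
  precedes? a P Q = ((a ∈? hull (image agentOf Q)) →-dec (a ∈? hull (image agentOf P))) ×-dec
    all? λ t → (a ∈? hull (image agentOf (above w Q t))) →-dec (a ∈? hull (image agentOf (above w P t)))

  -- If at threshold t only Q has been entered, then any threshold at which P has been entered is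
  -- strictly lower than t, and by then Q has been entered too.
  precedes-total : ∀ a P Q → Precedes a P Q ⊎ Precedes a Q P
  precedes-total a P Q with a ∈? hull (image agentOf P)
  ... | no a∉P = inj₂ ((λ a∈P → contradiction a∈P a∉P) ,
                       (λ t a∈Pt → contradiction (enters-mono {a} (proj₁ ∘ ∈-above⁻ w {P}) a∈Pt) a∉P))
  ... | yes a∈P with all? (λ t → (a ∈? hull (image agentOf (above w Q t))) →-dec (a ∈? hull (image agentOf (above w P t))))
  ...   | yes all = inj₁ ((λ _ → a∈P) , all)
  ...   | no ¬all with t , fails ← ¬∀⟶∃¬ m _ (λ t → (a ∈? hull (image agentOf (above w Q t))) →-dec (a ∈? hull (image agentOf (above w P t)))) ¬all =
    inj₂ ((λ _ → enters-mono {a} (proj₁ ∘ ∈-above⁻ w {Q}) a∈Qt) , later)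
    where
    a∈Qt : Enters a (above w Q t)
    a∈Qt = decidable-stable (a ∈? hull (image agentOf (above w Q t))) λ a∉ → fails λ a∈ → contradiction a∈ a∉
    later : ∀ s → Enters a (above w P s) → Enters a (above w Q s)
    later s a∈Ps = enters-mono {a} (λ f∈ → let f∈Q , t<f = ∈-above⁻ w {Q} f∈ in ∈-above⁺ w f∈Q (<-trans s<t t<f)) a∈Qt
      where
      s<t : w s < w t
      s<t = ≰⇒> λ t≤s → fails λ _ →
        enters-mono {a} (λ f∈ → let f∈P , s<f = ∈-above⁻ w {P} f∈ in ∈-above⁺ w f∈P (≤-<-trans t≤s s<f)) a∈Ps

  foldl-see⁺ : ∀ S es {y} → y ∈ˡ es → agentOf y ∈ foldl see S es
  foldl-see⁺ S (e ∷ es) (here refl) = keep (see S e) es ∈-∪⁅⁆⁺ʳ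
    where
    keep : ∀ S es → S ⊆ foldl see S es
    keep S []       a∈ = a∈
    keep S (e ∷ es) a∈ = keep (see S e) es (∈-∪⁅⁆⁺ˡ a∈)
  foldl-see⁺ S (e ∷ es) (there y∈) = foldl-see⁺ (see S e) es y∈

  foldl-see⁻ : ∀ S es {a} → a ∈ foldl see S es → a ∈ S ⊎ ∃ λ y → y ∈ˡ es × a ≡ agentOf y
  foldl-see⁻ S []       a∈ = inj₁ a∈
  foldl-see⁻ S (e ∷ es) a∈ with foldl-see⁻ (see S e) es a∈
  ... | inj₂ (y , y∈ , a≡) = inj₂ (y , there y∈ , a≡)
  ... | inj₁ a∈Se with ∈-∪⁅⁆⁻ a∈Se
  ...   | inj₁ a∈S = inj₁ a∈S
  ...   | inj₂ a≡e = inj₂ (e , here refl , a≡e)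

  module _ (Y S₁ S₂ : Subset n) (S₂∌Y : ∀ {a} → a ∈ S₂ → a ∉ Y) (S₂∌S₁ : ∀ {a} → a ∈ S₂ → a ∉ S₁)
    {ord : ℕ → List (Fin n)} (ord-perm : ∀ j → ord j ↭ allFin n) where

    top : Fin n → Maybe (Fin m)
    top a = top-relevant a Y

    E₁ : Subset m
    E₁ = rel Y ∩ edgesOf S₁

    es : List (Fin m)
    es = sortDecreasing w (elements E₁)

    visits : List Visit
    visits = schedule ord 0 ∅ es S₂

    presented : List (Fin m × Bool)
    presented = present top visits

    ∈-es⁺ : ∀ {e} → e ∈ E₁ → e ∈ˡ es
    ∈-es⁺ e∈ = Perm.∈-resp-↭ (↭-sym (sortDecreasing-↭ w (elements E₁))) (∈-elements⁺ e∈)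

    ∈-es⁻ : ∀ {e} → e ∈ˡ es → e ∈ E₁
    ∈-es⁻ e∈ = ∈-elements⁻ (Perm.∈-resp-↭ (sortDecreasing-↭ w (elements E₁)) e∈)

    es-decreasing : Decreasing w es
    es-decreasing = sortDecreasing-decreasing w w-injective (elements-unique E₁)

    presented⁻ : ∀ {f} → f ∈ˡ map proj₁ presented → agentOf f ∈ S₂ × f ∈ rel Y
    presented⁻ {f} f∈ with a , a∈ , eq ← ∈-presented⁻ top visits f∈ with refl , topf ← top-relevant⁻ {Y = Y} eq =
      a∈S₂ , rel⁺ (S₂∌Y a∈S₂) topf
      where a∈S₂ = visited⊆ ord-perm 0 ∅ es S₂ a∈

    presented⁺ : ∀ {f} → agentOf f ∈ S₂ → f ∈ rel Y → f ∈ˡ map proj₁ presented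
    presented⁺ a∈ f∈ = ∈-presented⁺ top visits (visited⊇ ord-perm 0 ∅ es S₂ a∈) (top-relevant⁺ (proj₂ (rel⁻ {Y = Y} f∈)))

    presentation : List (Fin m)
    presentation = map proj₁ presented ++ elements E₁

    presentation-unique : Unique presentation
    presentation-unique = Unique.++⁺
      (presented-unique top (λ {a} eq → proj₁ (top-relevant⁻ {a} {Y = Y} eq)) visits (visited-unique ord-perm 0 ∅ es S₂))
      (elements-unique E₁)
      λ (f∈₂ , f∈₁) → S₂∌S₁ (proj₁ (presented⁻ f∈₂)) (∈-edgesOf⁻ (p∩q⊆q (rel Y) (edgesOf S₁) (∈-elements⁻ f∈₁)))

    presentation-↭ : ∀ {S₀} → (∀ {a} → a ∉ Y → a ∈ S₀ ⊎ a ∈ S₁ ⊎ a ∈ S₂) → (∀ {a} → a ∈ S₁ → a ∉ S₀) → (∀ {a} → a ∈ S₂ → a ∉ S₀) →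
      presentation ↭ elements (rel Y ─ (rel Y ∩ edgesOf S₀))
    presentation-↭ {S₀} covers S₁∌S₀ S₂∌S₀ = unique-↭ presentation-unique (elements-unique _) to from
      where
      E₀ = rel Y ∩ edgesOf S₀
      outside-E₀ : ∀ {f} → f ∈ rel Y → agentOf f ∉ S₀ → f ∈ˡ elements (rel Y ─ E₀)
      outside-E₀ f∈ a∉ = ∈-elements⁺ (x∈p∧x∉q⇒x∈p─q f∈ λ f∈E₀ → a∉ (∈-edgesOf⁻ (p∩q⊆q (rel Y) (edgesOf S₀) f∈E₀)))
      to : ∀ {f} → f ∈ˡ presentation → f ∈ˡ elements (rel Y ─ E₀)
      to f∈ with Mem.∈-++⁻ (map proj₁ presented) f∈
      ... | inj₁ f∈₂ = let a∈ , f∈rel = presented⁻ f∈₂ in outside-E₀ f∈rel (S₂∌S₀ a∈)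
      ... | inj₂ f∈₁ = let f∈rel , f∈δ = x∈p∩q⁻ (rel Y) (edgesOf S₁) (∈-elements⁻ f∈₁) in outside-E₀ f∈rel (S₁∌S₀ (∈-edgesOf⁻ f∈δ))
      from : ∀ {f} → f ∈ˡ elements (rel Y ─ E₀) → f ∈ˡ presentation
      from {f} f∈ = let f∈rel , f∉E₀ = ∈-─⁻ (rel Y) E₀ (∈-elements⁻ f∈) in
        cases f∈rel f∉E₀ (covers (proj₁ (rel⁻ {Y = Y} f∈rel)))
        where
        cases : f ∈ rel Y → f ∉ E₀ → agentOf f ∈ S₀ ⊎ agentOf f ∈ S₁ ⊎ agentOf f ∈ S₂ → f ∈ˡ presentation
        cases f∈rel f∉E₀ (inj₁ a∈S₀)        = contradiction (x∈p∩q⁺ (f∈rel , ∈-edgesOf⁺ a∈S₀)) f∉E₀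
        cases f∈rel f∉E₀ (inj₂ (inj₁ a∈S₁)) = Mem.∈-++⁺ʳ (map proj₁ presented) (∈-elements⁺ (x∈p∩q⁺ (f∈rel , ∈-edgesOf⁺ a∈S₁)))
        cases f∈rel f∉E₀ (inj₂ (inj₂ a∈S₂)) = Mem.∈-++⁺ˡ (presented⁺ a∈S₂ f∈rel)

    -- `P` stands for the relevant edges of S₁ and `Q` for those of the other agents of S₂. They are
    -- kept separate from S₁ and S₂ because the comparison must not read the coins of the agent of
    -- `e`.
    module _ {e} (e∈S₂ : agentOf e ∈ S₂) (e∈rel : e ∈ rel Y) (unblocked : ¬ Enters (agentOf e) (above w (rel Y) e))
      {P Q : Subset m} (P⊆E₁ : P ⊆ E₁) (⊆Q : ∀ {f} → f ∈ rel Y → agentOf f ∈ S₂ → agentOf f ≢ agentOf e → f ∈ Q)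
      (precedes : Precedes (agentOf e) P Q)
      (𝒜 : OnlineAlgorithm m) (r : OnlineAlgorithm.Seed 𝒜) (s : Sample m)
      (accepted-Item : Item (OnlineAlgorithm.accepted 𝒜 r w s [] presentation)) where

      open OnlineAlgorithm 𝒜 using (decide; accepted)

      private
        a = agentOf e

        a∉hull∅ : a ∉ hull ∅
        a∉hull∅ = hull-∅ (F-mono (λ x∈ → subst (_∈ above w (chosenBy Y) e ∪ ⁅ e ⁆) (sym (x∈⁅y⁆⇒x≡y e x∈)) ∈-∪⁅⁆⁺ʳ)
          (proj₁ (proj₂ (rel⁻ {Y = Y} e∈rel))))

        decreasing-split : ∀ es₁ {x es₂} → Decreasing w (es₁ ++ x ∷ es₂) → ∀ {y} →
          (y ∈ˡ es₁ ++ x ∷ [] → w x ≤ w y) × (y ∈ˡ x ∷ es₂ → w y ≤ w x)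
        decreasing-split []        (x> ∷ d) = (λ { (here refl) → ≤-refl }) ,
          (λ { (here refl) → ≤-refl ; (there y∈) → <⇒≤ (All.lookup x> y∈) })
        decreasing-split (z ∷ es₁) (z> ∷ d) =
          (λ { (here refl) → <⇒≤ (All.lookup z> (Mem.∈-++⁺ʳ es₁ (here refl))) ; (there y∈) → proj₁ (decreasing-split es₁ d) y∈ }) ,
          (λ y∈ → proj₂ (decreasing-split es₁ d) y∈)

        -- Were the threshold edge at least as heavy as `e`, all S₁-edges seen so far would be
        -- heavier than `e`, and their agents have `a` in their hull, contrary to `unblocked`.
        passed : ∀ {pre} τ → Located ord-perm a ∅ es pre τ → passes τ e ≡ true
        passed nothing  _ = refl
        passed (just x) (es₁ , es₂ , eq , _ , a∈ , _) = does⁺ (w x <? w e) (≰⇒> λ e≤x → unblocked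
          (hull-mono (λ b∈ → case foldl-see⁻ ∅ (es₁ ++ x ∷ []) b∈ of λ
            { (inj₁ b∈∅) → contradiction b∈∅ ∉⊥
            ; (inj₂ (y , y∈ , refl)) → ∈-image⁺ agentOf (∈-above⁺ w (p∩q⊆p (rel Y) _ (in-E₁ y∈))
                (e<x e≤x (proj₁ (decreasing-split es₁ (subst (Decreasing w) eq es-decreasing)) y∈) y∈)) }) a∈))
          where
          in-E₁ : ∀ {y} → y ∈ˡ es₁ ++ x ∷ [] → y ∈ E₁
          in-E₁ {y} y∈ = ∈-es⁻ (subst (y ∈ˡ_) (List.++-assoc es₁ (x ∷ []) es₂ ■ sym eq) (Mem.∈-++⁺ˡ y∈))
          e<x : w e ≤ w x → ∀ {y} → w x ≤ w y → y ∈ˡ es₁ ++ x ∷ [] → w e < w y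
          e<x e≤x x≤y y∈ = ≤-trans e≤x x≤y , λ e≡y → S₂∌S₁ e∈S₂
            (subst (λ e → agentOf e ∈ S₁) (sym (w-injective e≡y)) (∈-edgesOf⁻ (p∩q⊆q (rel Y) _ (in-E₁ y∈))))

        extends : ∀ pre τ post → visits ≡ pre ++ (a , τ) ∷ post → Located ord-perm a ∅ es pre τ →
          ∀ {X} → F X → (∀ {x} → x ∈ X → (x , true) ∈ˡ present top pre) →
          (∀ {x} → x ∈ X → x ∈ accepted r w s [] presentation) → e ∈ accepted r w s [] presentation → F (X ∪ ⁅ e ⁆)
        extends pre τ post visits≡ located {X} fX heavy X⊆ e∈ =
          extend fX
            (Item-mono (λ x∈ → case ∈-∪⁅⁆⁻ x∈ of λ { (inj₁ x∈X) → X⊆ x∈X ; (inj₂ refl) → e∈ }) accepted-Item)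
            fresh (hull-contradiction τ located X⊆Q)
          where
          earlier : ∀ {x} → x ∈ X → ∃ λ τ′ → (agentOf x , τ′) ∈ˡ pre × x ∈ rel Y × agentOf x ∈ S₂ × passes τ′ x ≡ true
          earlier x∈ =
            let b , τ′ , v∈ , eq , true≡ = ∈-present⁻ top pre (heavy x∈)
                x≡b , topx = top-relevant⁻ {Y = Y} eq
                v∈pre = subst (λ b → (b , τ′) ∈ˡ pre) (sym x≡b) v∈
                x∈S₂ = pre⊆S₂ v∈pre
            in τ′ , v∈pre , rel⁺ (S₂∌Y x∈S₂) topx , x∈S₂ , sym true≡
            where
            pre⊆S₂ : ∀ {v} → v ∈ˡ pre → proj₁ v ∈ S₂
            pre⊆S₂ {v} v∈ = visited⊆ ord-perm 0 ∅ es S₂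
              (subst (λ vs → proj₁ v ∈ˡ map proj₁ vs) (sym visits≡) (Mem.∈-map⁺ proj₁ (Mem.∈-++⁺ˡ v∈)))

          fresh : ∀ {x} → x ∈ X → agentOf x ≢ a
          fresh x∈ x≡a = let τ′ , v∈ , _ = earlier x∈ in
            unique-key pre (subst (Unique ∘ map proj₁) visits≡ (visited-unique ord-perm 0 ∅ es S₂))
              (subst (λ b → (b , τ′) ∈ˡ pre) x≡a v∈)

          X⊆Q : ∀ {x} → x ∈ X → x ∈ Q
          X⊆Q x∈ = let _ , _ , x∈rel , x∈S₂ , _ = earlier x∈ in ⊆Q x∈rel x∈S₂ (fresh x∈)

          -- Edges accepted so far beat the threshold x of the current round, because earlier
          -- thresholds are heavier. If their agents spanned `a`, then by `precedes` so would the
          -- S₁-edges heavier than x; but those belong to earlier rounds, in which `a` had not yet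
          -- entered the hull. In the last round there is no x, and all S₁-edges fail to span `a`.
          hull-contradiction : ∀ τ → Located ord-perm a ∅ es pre τ → X ⊆ Q → ¬ Enters a X
          hull-contradiction nothing a∉ X⊆Q a∈ = a∉ (hull-mono
            (λ b∈ → let y , y∈ , eq = ∈-image⁻ agentOf b∈ in
              subst (_∈ foldl see ∅ es) eq (foldl-see⁺ ∅ es (∈-es⁺ (P⊆E₁ y∈))))
            (proj₁ precedes (enters-mono {a} X⊆Q a∈)))
          hull-contradiction (just x) (es₁ , es₂ , es≡ , a∉ , _ , rounds) X⊆Q a∈ = a∉ (hull-mono
            (λ b∈ → let y , y∈ , eq = ∈-image⁻ agentOf b∈
                        y∈P , x<y = ∈-above⁻ w {P} y∈ in
              subst (_∈ foldl see ∅ es₁) eq (foldl-see⁺ ∅ es₁ (before x<y (Mem.∈-++⁻ es₁ (subst (y ∈ˡ_) es≡ (∈-es⁺ (P⊆E₁ y∈P)))))))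
            (proj₂ precedes x (enters-mono {a} (λ z∈ → ∈-above⁺ w (X⊆Q z∈) (x< z∈)) a∈)))
            where
            order = decreasing-split es₁ (subst (Decreasing w) es≡ es-decreasing)
            before : ∀ {y} → w x < w y → y ∈ˡ es₁ ⊎ y ∈ˡ x ∷ es₂ → y ∈ˡ es₁
            before x<y (inj₁ y∈) = y∈
            before x<y (inj₂ y∈) = contradiction (proj₂ order y∈) (<⇒≱ x<y)
            x< : ∀ {z} → z ∈ X → w x < w z
            x< {z} z∈ =
              let _ , v∈ , _ , _ , passed = earlier z∈
                  y , τ≡ , y∈ = rounds v∈ in
              ≤-<-trans (proj₁ order y∈) (does⁻ (w y <? w z) (subst (λ τ → passes τ z ≡ true) τ≡ passed))

        select-at : ∀ pre τ post → visits ≡ pre ++ (a , τ) ∷ post → Located ord-perm a ∅ es pre τ →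
          e ∈ accepted r w s [] presentation → e ∈ process (decide r s) [] ∅ presented
        select-at pre τ post visits≡ located e∈ = conclude presented presented≡ presentation-unique
          (extends pre τ post visits≡ located) e∈
          where
          presented≡ : presented ≡ present top pre ++ (e , true) ∷ present top post
          presented≡ = cong (present top) visits≡ ■ present-++ top pre ((a , τ) ∷ post)
            ■ cong (present top pre ++_) (cong (λ t → present₁ t τ ++ present top post) (top-relevant⁺ (proj₂ (rel⁻ {Y = Y} e∈rel)))
              ■ cong (λ b → (e , b) ∷ present top post) (passed τ located))

          conclude : ∀ fs → fs ≡ present top pre ++ (e , true) ∷ present top post → Unique (map proj₁ fs ++ elements E₁) →
            (∀ {X} → F X → (∀ {x} → x ∈ X → (x , true) ∈ˡ present top pre) →
              (∀ {x} → x ∈ X → x ∈ accepted r w s [] (map proj₁ fs ++ elements E₁)) →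
              e ∈ accepted r w s [] (map proj₁ fs ++ elements E₁) → F (X ∪ ⁅ e ⁆)) →
            e ∈ accepted r w s [] (map proj₁ fs ++ elements E₁) → e ∈ process (decide r s) [] ∅ fs
          conclude _ refl unique grows e∈ = select 𝒜 r s (present top pre) e (present top post) (elements E₁) F-∅ unique
            (λ fX heavy X⊆ → grows fX heavy X⊆ e∈) e∈

      select-good : e ∈ accepted r w s [] presentation → e ∈ process (decide r s) [] ∅ presented
      select-good = let pre , τ , post , visits≡ , located = locate ord-perm 0 ∅ es S₂ e∈S₂ a∉hull∅ in
        select-at pre τ post visits≡ located

module _ {A : Set} (c : A → A → A) where

  fold : A → List A → A
  fold y []       = y
  fold y (z ∷ zs) = c y (fold z zs)

  -- List⁺.foldr₁ recurses through a local function that also carries the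
  -- original list; abstracting y ∷ zs frees that argument, and the left-hand
  -- side of foldr₁-tail is inferred to be the local function.
  mutual
    foldr₁-∷ : ∀ x y zs → List⁺.foldr₁ c (x List⁺.∷ y ∷ zs) ≡ c x (fold y zs)
    foldr₁-∷ x y zs with y ∷ zs
    ... | ys = cong (c x) (foldr₁-tail x ys y zs)

    foldr₁-tail : ∀ x ys y zs → _ ≡ fold y zs
    foldr₁-tail x ys y []       = refl
    foldr₁-tail x ys y (z ∷ zs) = cong (c y) (foldr₁-tail x ys z zs)

  foldr₁-fold : ∀ x xs → List⁺.foldr₁ c (x List⁺.∷ xs) ≡ fold x xs
  foldr₁-fold x []       = refl
  foldr₁-fold x (y ∷ ys) = foldr₁-∷ x y ys

module _ ⦃ ℛ : RealNumbers ⦄ where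
  open ℝ-Solver using (solve; con; _:+_; _:*_; _:-_; :-_; _:=_)

  ℙ-mono : (S : ProbabilitySpace) → let open ProbabilitySpace S in
    ∀ {G H} → Event G → Event H → (∀ ω → G ω ≡ true → H ω ≡ true) → ℙ G ≤ ℙ H
  ℙ-mono S {G} {H} eG eH G⊆H = ≤-from (ℙ-≥0 (event-∩ eH (event-∁ eG)))
    (Measure.ℙ-split S eH eG ■ cong (_+ ℙ (λ ω → H ω ∧ not (G ω))) (ℙ-≗ (event-∩ eH eG) λ ω →
      Bool-⇔ (proj₂ ∘ ∧-true⁻) (λ Gω → cong₂ _∧_ (G⊆H ω Gω) Gω)))
    where open ProbabilitySpace S

  accepted-measurable : ∀ {m} (𝒜 : OnlineAlgorithm m) (w : Weight m) s past σ →
    Measure.Measurable (OnlineAlgorithm.seeds 𝒜) (λ r → OnlineAlgorithm.accepted 𝒜 r w s past σ)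
  accepted-measurable {m} 𝒜 w s past [] g = constant (g ∅)
    where
    open ProbabilitySpace (OnlineAlgorithm.seeds 𝒜)
    constant : ∀ b → Event (λ _ → b)
    constant true  = event-Ω
    constant false = Measure.event-∅ (OnlineAlgorithm.seeds 𝒜)
  accepted-measurable {m} 𝒜 w s past (e ∷ σ) g =
    event-≗ (λ r → branch (decide r s past (e , w e)) (accepted r w s (past ∷ʳ (e , w e)) σ))
      (Measure.event-∪ seeds
        (event-∩ (measurable s past (e , w e)) (accepted-measurable 𝒜 w s (past ∷ʳ (e , w e)) σ (λ X → g (⁅ e ⁆ ∪ X))))
        (event-∩ (event-∁ (measurable s past (e , w e))) (accepted-measurable 𝒜 w s (past ∷ʳ (e , w e)) σ (λ X → g (∅ ∪ X)))))
    where
    open OnlineAlgorithm 𝒜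
    open ProbabilitySpace seeds using (event-≗; event-∩; event-∁)
    branch : ∀ b (X : Subset m) → (b ∧ g (⁅ e ⁆ ∪ X)) ∨ (not b ∧ g (∅ ∪ X)) ≡ g ((if b then ⁅ e ⁆ else ∅) ∪ X)
    branch true  X = Bool.∨-identityʳ _
    branch false X = refl

  min≤ : ∀ (x y : ℝ) → min x y ≤ x × min x y ≤ y
  min≤ x y with x ≤? y
  ... | yes x≤y = ≤-refl , x≤y
  ... | no x≰y  = <⇒≤ (≰⇒> x≰y) , ≤-refl

  module _ {A : Set} (g : A → ℝ) where

    private
      minimum : A → List A → ℝ
      minimum x []       = g x
      minimum x (y ∷ ys) = min (g x) (minimum y ys)

      foldr₁-min : ∀ x xs → List⁺.foldr₁ min (List⁺.map g (x List⁺.∷ xs)) ≡ minimum x xs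
      foldr₁-min x xs = foldr₁-fold min (g x) (map g xs) ■ fold-map x xs
        where
        fold-map : ∀ x xs → fold min (g x) (map g xs) ≡ minimum x xs
        fold-map x []       = refl
        fold-map x (y ∷ ys) = cong (min (g x)) (fold-map y ys)

    foldr₁-min≤ : ∀ xs {x} → x ∈ˡ List⁺.toList xs → List⁺.foldr₁ min (List⁺.map g xs) ≤ g x
    foldr₁-min≤ (x List⁺.∷ xs) z∈ = subst (_≤ g _) (sym (foldr₁-min x xs)) (go x xs z∈)
      where
      go : ∀ x xs {z} → z ∈ˡ x ∷ xs → minimum x xs ≤ g z
      go x []       (here refl) = ≤-refl
      go x (y ∷ ys) (here refl) = proj₁ (min≤ (g x) (minimum y ys))
      go x (y ∷ ys) (there z∈)  = ≤-trans (proj₂ (min≤ (g x) (minimum y ys))) (go y ys z∈)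

    0≤foldr₁-min : ∀ xs → (∀ x → 0# ≤ g x) → 0# ≤ List⁺.foldr₁ min (List⁺.map g xs)
    0≤foldr₁-min (x List⁺.∷ xs) 0≤g = subst (0# ≤_) (sym (foldr₁-min x xs)) (go x xs)
      where
      go : ∀ x xs → 0# ≤ minimum x xs
      go x []       = 0≤g x
      go x (y ∷ ys) with g x ≤? minimum y ys
      ... | yes _ = 0≤g x
      ... | no _  = go y ys

  -- The chance that e lands in S₂, that the S₁-threshold comes no later
  -- than the S₂-threshold, and that 𝒜 selects e.  The middle factor ½ is
  -- the symmetry U ↦ ∁ U between S₁ and S₂.
  chance : ∀ {m n} (agentOf : Fin m → Fin n) {q α : ℝ} → 0# ≤ q → q ≤ 1# → ∀ X e →
    (∀ {x y} → x ∈ X → y ∈ X → agentOf x ≡ agentOf y → x ≡ y) → e ∈ X →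
    (h : Subset m → ℝ) → (∀ Z → 0# ≤ h Z) →
    α ≤ ∑ (filter (_⊆? (X ─ ⁅ e ⁆)) (allSubsets m))
          (λ Y → ∏ (elements (X ─ ⁅ e ⁆)) (λ x → if does (x ∈? Y) then q else 1# - q) * h Y) →
    (g : Subset n → Subset n → Bool) → (∀ Z → Ignores (agentOf e) (𝟙 ∘ g Z)) →
    (∀ Z U → g Z U ≡ true ⊎ g Z (∁ U) ≡ true) →
    (1# - q) * (½ * ½) * α ≤ Coins q n (λ Z → Coins ½ n (λ U →
      𝟙 (not (lookup Z (agentOf e))) * (𝟙 (not (lookup U (agentOf e))) * 𝟙 (g Z U)) * h (restrict agentOf X Z)))
  chance {m} {n} agentOf {q} {α} 0≤q q≤1 X e injective e∈X h 0≤h α≤ g g-ignores g-or-∁ = ≤-trans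
    (≤-trans (≤-reflexive (solve 3 (λ q h a → (con (ℤ.+ 1) :- q) :* (h :* h) :* a := h :* h :* ((con (ℤ.+ 1) :- q) :* a)) refl q ½ α))
      (*-monoˡ-≤ (½ * ½) (*-nonNeg 0≤½ 0≤½) sampling))
    (≤-trans (≤-reflexive (sym (Coins-*ˡ q n (½ * ½) _))) (Coins-mono 0≤q q≤1 n split))
    where
    a = agentOf e
    V = X ─ ⁅ e ⁆

    -- Of `U` and its complement at least one satisfies `g Z`, and both have the same law, so the
    -- probability is at least one half.
    half≤ : ∀ Z → ½ ≤ Coins ½ n (𝟙 ∘ g Z)
    half≤ Z = subst₂ _≤_ (ℝ-Ring.*-identityʳ ½)
      (cong (½ *_) (cong (Coins ½ n (𝟙 ∘ g Z) +_) (Coins-∁ n (𝟙 ∘ g Z) 1-½))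
        ■ solve 2 (λ h c → h :* (c :+ c) := (h :+ h) :* c) refl ½ (Coins ½ n (𝟙 ∘ g Z))
        ■ cong (_* Coins ½ n (𝟙 ∘ g Z)) ½+½ ■ ℝ-Ring.*-identityˡ _)
      (*-monoˡ-≤ ½ 0≤½ (subst₂ _≤_ (Coins-const ½ n 1#) (Coins-+ ½ n (𝟙 ∘ g Z) (λ U → 𝟙 (g Z (∁ U))))
        (Coins-mono 0≤½ ½≤1 n λ U → one≤ (g Z U) (g Z (∁ U)) (g-or-∁ Z U))))
      where
      one≤ : ∀ b c → b ≡ true ⊎ c ≡ true → 1# ≤ 𝟙 b + 𝟙 c
      one≤ true  c    _ = ≤-from (0≤𝟙 c) refl
      one≤ false true _ = ≤-reflexive (sym (ℝ-Ring.+-identityˡ 1#))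
      one≤ false false (inj₁ ())
      one≤ false false (inj₂ ())

    split : ∀ Z → ½ * ½ * (𝟙 (not (lookup Z a)) * h (restrict agentOf X Z)) ≤ Coins ½ n (λ U →
      𝟙 (not (lookup Z a)) * (𝟙 (not (lookup U a)) * 𝟙 (g Z U)) * h (restrict agentOf X Z))
    split Z = subst₂ _≤_
      (solve 2 (λ z h → z :* (h :* h) := h :* h :* z) refl z ½)
      (cong (z *_) (cong (_* Coins ½ n (𝟙 ∘ g Z)) (sym 1-½) ■ sym (Coins-∉ ½ a (g-ignores Z)))
        ■ sym (Coins-*ˡ ½ n z _)
        ■ Coins-cong ½ n (λ U → solve 4 (λ z u g h → z :* h :* (u :* g) := z :* (u :* g) :* h) refl
            (𝟙 (not (lookup Z a))) (𝟙 (not (lookup U a))) (𝟙 (g Z U)) (h (restrict agentOf X Z))))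
      (*-monoˡ-≤ z (*-nonNeg (0≤𝟙 _) (0≤h _)) (*-monoˡ-≤ ½ 0≤½ (half≤ Z)))
      where z = 𝟙 (not (lookup Z a)) * h (restrict agentOf X Z)

    V⊆X : V ⊆ X
    V⊆X = p─q⊆p X ⁅ e ⁆

    V∌a : ∀ {x} → x ∈ V → agentOf x ≢ a
    V∌a x∈ x≡a = let x∈X , x∉e = ∈-─⁻ X ⁅ e ⁆ x∈ in x∉e (subst (_∈ ⁅ e ⁆) (sym (injective x∈X e∈X x≡a)) (x∈⁅x⁆ e))

    -- The OOCS guarantee samples from X - e, the run from X. The two samples coincide once the
    -- agent of `e` is known not to be sampled.
    restrict-V : ∀ Z → lookup Z a ≡ false → restrict agentOf X Z ≡ restrict agentOf V Z
    restrict-V Z a∉Z = Vec.tabulate-cong λ x → pointwise x (x ≟ e)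
      where
      pointwise : ∀ x → Dec (x ≡ e) → lookup X x ∧ lookup Z (agentOf x) ≡ lookup V x ∧ lookup Z (agentOf x)
      pointwise x (yes refl) = cong (lookup X e ∧_) a∉Z ■ Bool.∧-zeroʳ _ ■ sym (cong (lookup V e ∧_) a∉Z ■ Bool.∧-zeroʳ _)
      pointwise x (no x≢e)   = cong (_∧ lookup Z (agentOf x)) (Bool-⇔
        (λ x∈X → ∈⇒lookup (x∈p∧x∉q⇒x∈p─q {p = X} {q = ⁅ e ⁆} (lookup⇒∈ x∈X) (x≢e ∘ x∈⁅y⁆⇒x≡y e)))
        (λ x∈V → ∈⇒lookup (V⊆X (lookup⇒∈ x∈V))))

    sampling : (1# - q) * α ≤ Coins q n (λ Z → 𝟙 (not (lookup Z a)) * h (restrict agentOf X Z))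
    sampling = ≤-trans (*-monoˡ-≤ (1# - q) (0≤-≤ q≤1) α≤) (≤-reflexive
      (cong ((1# - q) *_) (sym (Coins-sample q agentOf V (λ x∈ y∈ → injective (V⊆X x∈) (V⊆X y∈)) h))
        ■ sym (Coins-∉ q a (λ Z Z′ same → cong h (Vec.tabulate-cong λ x → ignores Z Z′ same x)))
        ■ Coins-cong q n (λ Z → avoid Z (lookup Z a) refl)))
      -- No other edge of X shares the agent of `e`, so the sample from X - e ignores that agent's
      -- coin and the factor 1 - q splits off.
      where
      ignores : ∀ Z Z′ → (∀ b → b ≢ a → lookup Z b ≡ lookup Z′ b) → ∀ x →
        lookup V x ∧ lookup Z (agentOf x) ≡ lookup V x ∧ lookup Z′ (agentOf x)
      ignores Z Z′ same x with lookup V x in x∈V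
      ... | true  = same (agentOf x) (V∌a (lookup⇒∈ x∈V))
      ... | false = refl
      avoid : ∀ Z b → lookup Z a ≡ b → 𝟙 (not (lookup Z a)) * h (restrict agentOf V Z) ≡ 𝟙 (not (lookup Z a)) * h (restrict agentOf X Z)
      avoid Z true  eq = cong (λ b → 𝟙 (not b) * h (restrict agentOf V Z)) eq ■ ℝ-Ring.zeroˡ _
        ■ sym (cong (λ b → 𝟙 (not b) * h (restrict agentOf X Z)) eq ■ ℝ-Ring.zeroˡ _)
      avoid Z false eq = cong (λ Y → 𝟙 (not (lookup Z a)) * h Y) (sym (restrict-V Z eq))

-- The algorithm of a market as a schedule and a process

module _ ⦃ ℛ : RealNumbers ⦄ (M : Market) where

  Feasible-mono : ∀ {X Y} → X ⊆ Y → Feasible M Y → Feasible M X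
  Feasible-mono X⊆Y (iA , iB) = downward (combined (FAE M)) X⊆Y iA , downward (combined (FBE M)) X⊆Y iB

  -- Some component covers the agent, and there its edges are parallel copies.
  Feasible-agent : ∀ {X e f} → Feasible M X → e ∈ X → f ∈ X → agent M e ≡ agent M f → e ≡ f
  Feasible-agent {X} {e} {f} (iA , _) e∈ f∈ e≡f =
    let j , a∈ = Combination.cover (FA M) (agent M e)
        in-part = comprehension⁺ (λ e → agent M e ∈? ground (part (FA M) j))
    in proj₁ (proj₂ (iA j)) e f (x∈p∩q⁺ (e∈ , in-part a∈))
         (x∈p∩q⁺ (f∈ , in-part (subst (_∈ ground (part (FA M) j)) e≡f a∈))) e≡f

  ∅-feasible : Feasible M ∅
  ∅-feasible = downward (combined (FAE M)) ⊥⊆ (proj₂ (inhabited (combined (FAE M)))) ,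
               downward (combined (FBE M)) ⊥⊆ (proj₂ (inhabited (combined (FBE M))))

  addIfFeasible-view : ∀ X e →
    (Feasible M (X ∪ ⁅ e ⁆) × addIfFeasible M X e ≡ X ∪ ⁅ e ⁆) ⊎ (¬ Feasible M (X ∪ ⁅ e ⁆) × addIfFeasible M X e ≡ X)
  addIfFeasible-view X e = view (feasible? M (X ∪ ⁅ e ⁆))
    where
    view : (d : Dec (Feasible M (X ∪ ⁅ e ⁆))) →
      (Feasible M (X ∪ ⁅ e ⁆) × (if does d then X ∪ ⁅ e ⁆ else X) ≡ X ∪ ⁅ e ⁆) ⊎
      (¬ Feasible M (X ∪ ⁅ e ⁆) × (if does d then X ∪ ⁅ e ⁆ else X) ≡ X)
    view (yes f) = inj₁ (f , refl)
    view (no ¬f) = inj₂ (¬f , refl)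

  module _ (p q : ℝ) (𝒜 : OnlineAlgorithm (#E M)) (w : Weight (#E M)) (t : Fin (#A M) → ℝ)
    (order : ℕ → List (Fin (#A M))) (r : OnlineAlgorithm.Seed 𝒜) where

    private
      module Run = FreeOrder M p q 𝒜 w t order r
      open Process (agent M) w (Feasible M) (addIfFeasible M) addIfFeasible-view
      open Schedule (agent M) (Hull (FA M))

      dec : List (Fin (#E M) × ℝ) → Fin (#E M) × ℝ → Bool
      dec = OnlineAlgorithm.decide 𝒜 r (reveal w Run.E₀)

      top : Fin (#A M) → Maybe (Fin (#E M))
      top a = toprel M w a Run.Y

      continue : State M → List (Fin (#A M) × Maybe (Fin (#E M))) → Subset (#E M)
      continue s vs = process dec (State.presented s) (State.chosen s) (present top vs)

      -- `visit` with the top-relevant edge as an explicit argument, so that a whole fold can be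
      -- analysed by cases on that edge.
      step : Maybe (Fin (#E M)) → Maybe (Fin (#E M)) → Fin (#A M) → State M → State M
      step τ nothing  a (state U past X) = state (U ─ ⁅ a ⁆) past X
      step τ (just f) a (state U past X) = state (U ─ ⁅ a ⁆) (past ∷ʳ (f , w f))
        (if passes τ f ∧ dec past (f , w f) then addIfFeasible M X f else X)

      visit≡step : ∀ τ s a → Run.visit (passes τ) s a ≡ step τ (top a) a s
      visit≡step τ (state U past X) a with toprel M w a Run.Y
      ... | nothing = refl
      ... | just f  = refl

      visit-all : ∀ τ as s → let s′ = foldl (Run.visit (passes τ)) s as in
        State.unrevealed s′ ≡ removeAll (State.unrevealed s) as ×
        (∀ vs → continue s (map (tag τ) as ++ vs) ≡ continue s′ vs)
      visit-all τ []       s = refl , λ _ → refl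
      visit-all τ (a ∷ as) s = subst (λ s₁ → After s (top a) (foldl (Run.visit (passes τ)) s₁ as)) (sym (visit≡step τ s a)) (after s (top a))
        where
        After : State M → Maybe (Fin (#E M)) → State M → Set
        After s t s′ = State.unrevealed s′ ≡ removeAll (State.unrevealed s ─ ⁅ a ⁆) as ×
          (∀ vs → process dec (State.presented s) (State.chosen s) (present₁ t τ ++ present top (map (tag τ) as ++ vs)) ≡ continue s′ vs)
        after : ∀ s t → After s t (foldl (Run.visit (passes τ)) (step τ t a s) as)
        after (state U past X) nothing  = visit-all τ as (state (U ─ ⁅ a ⁆) past X)
        after (state U past X) (just f) = visit-all τ as (step τ (just f) a (state U past X))

      all-rounds : ∀ j seen es s → State.chosen (Run.rounds j seen es s) ≡ continue s (schedule order j seen es (State.unrevealed s))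
      all-rounds j seen []       s = sym (
        cong (continue s) (sym (List.++-identityʳ (map (tag nothing) (batch (State.unrevealed s) (order j)))))
        ■ proj₂ (visit-all nothing (batch (State.unrevealed s) (order j)) s) [])
      all-rounds j seen (e ∷ es) s =
        let as = batch (State.unrevealed s ∩ Hull (FA M) (see seen e)) (order j)
            s′ = foldl (Run.visit (passes (just e))) s as
            removed , same = visit-all (just e) as s in
        all-rounds (suc j) (see seen e) es s′
        ■ cong (λ U → continue s′ (schedule order (suc j) (see seen e) es U)) removed
        ■ sym (same (schedule order (suc j) (see seen e) es (removeAll (State.unrevealed s) as)))

    output≡process : Run.output ≡ process dec [] ∅ (present top
      (schedule order 0 ∅ (sortDecreasing w (elements Run.E₁)) Run.S₂))
    output≡process = all-rounds 0 ∅ (sortDecreasing w (elements Run.E₁)) (state Run.S₂ [] ∅)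

    output-feasible : Feasible M Run.output
    output-feasible = subst (Feasible M) (sym output≡process)
      (process-F dec [] ∅ (present top (schedule order 0 ∅ (sortDecreasing w (elements Run.E₁)) Run.S₂)) ∅-feasible)

-- Expected utility

at : ∀ {n} → Phase → Vec Phase n → Subset n
at x c = comprehension λ a → lookup c a ≟ x

∈-at⁺ : ∀ {n} {x} {c : Vec Phase n} {a} → lookup c a ≡ x → a ∈ at x c
∈-at⁺ {x = x} {c} = comprehension⁺ (λ a → lookup c a ≟ x)

∈-at⁻ : ∀ {n} {x} {c : Vec Phase n} {a} → a ∈ at x c → lookup c a ≡ x
∈-at⁻ {x = x} {c} = comprehension⁻ (λ a → lookup c a ≟ x)

at-disjoint : ∀ {n} {x y} (c : Vec Phase n) {a} → x ≢ y → a ∈ at x c → a ∉ at y c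
at-disjoint c x≢y a∈x a∈y = x≢y (sym (∈-at⁻ {c = c} a∈x) ■ ∈-at⁻ {c = c} a∈y)

lookup-phases : ∀ {n} (Y Z U : Subset n) a → lookup (phases Y Z U) a ≡ phase (lookup Y a) (lookup Z a) (lookup U a)
lookup-phases Y Z U a = Vec.lookup∘tabulate _ a

at-inY : ∀ {n} (Y Z U : Subset n) → at inY (phases Y Z U) ≡ Y
at-inY Y Z U = Vec.tabulate-cong (λ a → cong (λ x → does (x ≟ inY)) (lookup-phases Y Z U a) ■ is-inY (lookup Y a) (lookup Z a) (lookup U a))
  ■ Vec.tabulate∘lookup Y
  where
  is-inY : ∀ y z u → does (phase y z u ≟ inY) ≡ y
  is-inY true  z     u     = refl
  is-inY false true  u     = refl
  is-inY false false true  = refl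
  is-inY false false false = refl

record ItemAlgorithm ⦃ ℛ : RealNumbers ⦄ {m n : ℕ} (𝒢 : GreedySystem m n) (ℋ : HullSystem 𝒢) : Set₁ where
  open GreedySystem 𝒢
  open HullSystem ℋ
  field
    𝒜           : OnlineAlgorithm m
    accepted-Item : ∀ X Y → Y ⊆ X → ∀ σ → σ ↭ elements (X ─ Y) → ∀ r → Item (OnlineAlgorithm.ALG 𝒜 r w Y σ)
    worst       : Subset m → Subset m → Fin m → ℝ
    0≤worst     : ∀ X Y e → 0# ≤ worst X Y e
    worst≤      : ∀ X Y e σ → σ ↭ elements (X ─ Y) →
      worst X Y e ≤ ProbabilitySpace.ℙ (OnlineAlgorithm.seeds 𝒜) (λ r → does (e ∈? OnlineAlgorithm.ALG 𝒜 r w Y σ))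

module Utility ⦃ ℛ : RealNumbers ⦄ {m n : ℕ} (𝒢 : GreedySystem m n) (ℋ : HullSystem 𝒢) (𝒪 : ItemAlgorithm 𝒢 ℋ) where

  open ℝ-Solver using (solve; con; _:+_; _:*_; _:-_; :-_; _:=_)
  open GreedySystem 𝒢
  open HullSystem ℋ
  open ItemAlgorithm 𝒪
  open Relevance 𝒢
  open Schedule agentOf hull
  open Process agentOf w F add add-view
  open Selection 𝒢 ℋ
    using (Enters; Precedes; precedes?; precedes-total; presentation; presentation-↭; presented; select-good)
  open OnlineAlgorithm 𝒜 using (seeds; Seed; decide; ALG)

  E₀ : Vec Phase n → Subset m
  E₀ c = rel (at inY c) ∩ edgesOf (at inS₀ c)

  plan : Vec Phase n → (ℕ → List (Fin n)) → List (Fin m × Bool)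
  plan c ord = present (λ a → top-relevant a (at inY c))
    (schedule ord 0 ∅ (sortDecreasing w (elements (rel (at inY c) ∩ edgesOf (at inS₁ c)))) (at inS₂ c))

  run : Vec Phase n → (ℕ → List (Fin n)) → Seed → Subset m
  run c ord r = process (decide r (reveal w (E₀ c))) [] ∅ (plan c ord)

  -- There are at most `m` threshold rounds and one last round, so `suc m` orders determine a run.
  -- The default beyond them is again a permutation, as the schedule lemmas require of every round.
  orderOf : Vec (List (Fin n)) (suc m) → ℕ → List (Fin n)
  orderOf ρ i with i ℕ.<? suc m
  ... | yes i<N = lookup ρ (fromℕ< i<N)
  ... | no _    = allFin n

  orderOf-↭ : ∀ {ρ} → (∀ i → lookup ρ i ↭ allFin n) → ∀ i → orderOf ρ i ↭ allFin n
  orderOf-↭ ρ-perm i with i ℕ.<? suc m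
  ... | yes i<N = ρ-perm (fromℕ< i<N)
  ... | no _    = ↭-refl

  orderOf-tabulate : ∀ (ord : ℕ → List (Fin n)) i → i ℕ.≤ m → orderOf (tabulate (ord ∘ toℕ)) i ≡ ord i
  orderOf-tabulate ord i i≤m with i ℕ.<? suc m
  ... | yes i<N = Vec.lookup∘tabulate (ord ∘ toℕ) (fromℕ< i<N) ■ cong ord (toℕ-fromℕ< i<N)
  ... | no i≮N  = contradiction (ℕ.s≤s i≤m) i≮N

  plan-cong : ∀ c {ord ord′} → (∀ i → i ℕ.≤ m → ord i ≡ ord′ i) → plan c ord ≡ plan c ord′
  plan-cong c same = cong (present _) (schedule-cong 0 ∅ sorted (at inS₂ c) λ i i≤ → same i (ℕ.≤-trans i≤ short))
    where
    E₁ = rel (at inY c) ∩ edgesOf (at inS₁ c)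
    sorted = sortDecreasing w (elements E₁)
    short : length sorted ℕ.≤ m
    short = ℕ.≤-trans (ℕ.≤-reflexive (Perm.↭-length (sortDecreasing-↭ w (elements E₁))))
      (ℕ.≤-trans (List.length-filter (_∈? E₁) (allFin m)) (ℕ.≤-reflexive (List.length-tabulate id)))

  -- The agent of `e` is left out so that the comparison of the two sides is independent of the coin
  -- placing that agent in S₁ or S₂.
  side : Phase → Vec Phase n → Fin m → Subset m
  side x c e = comprehension λ f → (f ∈? rel (at inY c)) ×-dec ¬? (agentOf f ≟ agentOf e) ×-dec (lookup c (agentOf f) ≟ x)

  ∈-side⁺ : ∀ {x c e f} → f ∈ rel (at inY c) → agentOf f ≢ agentOf e → lookup c (agentOf f) ≡ x → f ∈ side x c e
  ∈-side⁺ {x} {c} {e} f∈ f≢e eq = comprehension⁺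
    (λ f → (f ∈? rel (at inY c)) ×-dec ¬? (agentOf f ≟ agentOf e) ×-dec (lookup c (agentOf f) ≟ x)) (f∈ , f≢e , eq)

  ∈-side⁻ : ∀ {x c e f} → f ∈ side x c e → f ∈ rel (at inY c) × agentOf f ≢ agentOf e × lookup c (agentOf f) ≡ x
  ∈-side⁻ {x} {c} {e} = comprehension⁻
    (λ f → (f ∈? rel (at inY c)) ×-dec ¬? (agentOf f ≟ agentOf e) ×-dec (lookup c (agentOf f) ≟ x))

  side-⊆ : ∀ {x x′ c c′ e} → at inY c ≡ at inY c′ →
    (∀ a → a ≢ agentOf e → lookup c a ≡ x → lookup c′ a ≡ x′) → side x c e ⊆ side x′ c′ e
  side-⊆ {x} {x′} {c} {c′} {e} sameY move f∈ = let f∈rel , f≢e , eq = ∈-side⁻ {x} {c} {e} f∈ in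
    ∈-side⁺ {x′} {c′} (subst (λ Y → _ ∈ rel Y) sameY f∈rel) f≢e (move _ f≢e eq)

  early : Vec Phase n → Fin m → Bool
  early c e = does (precedes? (agentOf e) (side inS₁ c e) (side inS₂ c e))

  module _ {p q α : ℝ} (0≤p : 0# ≤ p) (p≤1 : p ≤ 1#) (0≤q : 0# ≤ q) (q≤1 : q ≤ 1#)
    (G : Fin m → Subset n → Set) (G? : ∀ e Y → Dec (G e Y))
    (G⇒rel : ∀ {e Y} → G e Y → e ∈ rel Y) (G⇒unblocked : ∀ {e Y} → G e Y → ¬ Enters (agentOf e) (above w (rel Y) e))
    (α≤ : ∀ {e Y} → G e Y → α ≤ ∑ (filter (_⊆? (rel Y ─ ⁅ e ⁆)) (allSubsets m))
      (λ Y′ → ∏ (elements (rel Y ─ ⁅ e ⁆)) (λ x → if does (x ∈? Y′) then q else 1# - q) * worst (rel Y) Y′ e))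
    (source : RandomSource n seeds) where

    open RandomSource source using (Ω; space; order; bits)
    open Discretise 0≤p p≤1 0≤q q≤1 source (suc m)
    open Phases 0≤p p≤1 0≤q q≤1 using (mass; ∑-mass)
    open ProbabilitySpace seeds using () renaming (ℙ to ℙₛ; Event to SeedEvent)

    -- A lower bound, given the phases, for the probability that a good edge `e` is selected: its
    -- agent must be in S₂ and its S₁-side must come first, and then the worst-case guarantee of 𝒜
    -- applies.
    chanceOf : Vec Phase n → Fin m → ℝ
    chanceOf c e = 𝟙 (does (lookup c (agentOf e) ≟ inS₂)) * 𝟙 (early c e) * worst (rel (at inY c)) (E₀ c) e

    lower : Vec Phase n → Fin m → ℝ
    lower c e = if does (G? e (at inY c)) then chanceOf c e else 0#

    0≤chanceOf : ∀ c e → 0# ≤ chanceOf c e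
    0≤chanceOf c e = *-nonNeg (*-nonNeg (0≤𝟙 (does (lookup c (agentOf e) ≟ inS₂))) (0≤𝟙 (early c e))) (0≤worst _ _ e)

    0≤lower : ∀ c e → 0# ≤ lower c e
    0≤lower c e = gated (does (G? e (at inY c)))
      where
      gated : ∀ b → 0# ≤ (if b then chanceOf c e else 0#)
      gated true  = 0≤chanceOf c e
      gated false = ≤-refl

    run-measurable : ∀ c ord → Measure.Measurable seeds (run c ord)
    run-measurable c ord = process-measurable seeds (λ r → decide r (reveal w (E₀ c)))
      (OnlineAlgorithm.measurable 𝒜 (reveal w (E₀ c))) (plan c ord) [] (λ g → accepted-measurable 𝒜 w (reveal w ∅) [] [] g)

    -- The order of presentation is fixed by phases and visiting orders and never depends on the
    -- random bits, so the worst case over orders is a valid bound. Given the side conditions,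
    -- acceptance by 𝒜 already implies selection.
    lower≤ℙ : ∀ c {ord} → (∀ j → ord j ↭ allFin n) → ∀ e → lower c e ≤ ℙₛ (λ r → lookup (run c ord r) e)
    lower≤ℙ c {ord} ord-perm e =
      gate (does (G? e (at inY c))) (does (lookup c (agentOf e) ≟ inS₂)) (early c e)
        (ProbabilitySpace.ℙ-≥0 seeds (run-measurable c ord (λ X → lookup X e))) λ g? ₂? pr? →
        ≤-trans (worst≤ (rel (at inY c)) (E₀ c) e σ σ-perm)
          (ℙ-mono seeds (accepted-measurable 𝒜 w (reveal w (E₀ c)) [] σ (λ X → does (e ∈? X))) (run-measurable c ord (λ X → lookup X e))
            λ r e∈ → ∈⇒lookup (selected (does⁻ (G? e (at inY c)) g?) (does⁻ (lookup c (agentOf e) ≟ inS₂) ₂?)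
              (does⁻ (precedes? (agentOf e) (side inS₁ c e) (side inS₂ c e)) pr?) r (does⁻ (e ∈? ALG r w (E₀ c) σ) e∈)))
      where
      gate : ∀ b₁ b₂ b₃ {v x : ℝ} → 0# ≤ x → (b₁ ≡ true → b₂ ≡ true → b₃ ≡ true → v ≤ x) →
        (if b₁ then 𝟙 b₂ * 𝟙 b₃ * v else 0#) ≤ x
      gate false _     _     0≤x _ = 0≤x
      gate true  false b₃    0≤x _ = ≤-trans (≤-reflexive (solve 2 (λ b v → con (ℤ.+ 0) :* b :* v := con (ℤ.+ 0)) refl (𝟙 b₃) _)) 0≤x
      gate true  true  false 0≤x _ = ≤-trans (≤-reflexive (solve 1 (λ v → con (ℤ.+ 1) :* con (ℤ.+ 0) :* v := con (ℤ.+ 0)) refl _)) 0≤x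
      gate true  true  true  0≤x v≤x = ≤-trans (≤-reflexive (solve 1 (λ v → con (ℤ.+ 1) :* con (ℤ.+ 1) :* v := v) refl _)) (v≤x refl refl refl)
      2∌Y : ∀ {a} → a ∈ at inS₂ c → a ∉ at inY c
      2∌Y = at-disjoint c λ ()
      2∌1 : ∀ {a} → a ∈ at inS₂ c → a ∉ at inS₁ c
      2∌1 = at-disjoint c λ ()
      σ = presentation (at inY c) (at inS₁ c) (at inS₂ c) 2∌Y 2∌1 ord-perm
      covers : ∀ {a} → a ∉ at inY c → a ∈ at inS₀ c ⊎ a ∈ at inS₁ c ⊎ a ∈ at inS₂ c
      covers {a} a∉Y = by (lookup c a) refl
        where
        by : ∀ x → lookup c a ≡ x → a ∈ at inS₀ c ⊎ a ∈ at inS₁ c ⊎ a ∈ at inS₂ c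
        by inY  eq = contradiction (∈-at⁺ {c = c} eq) a∉Y
        by inS₀ eq = inj₁ (∈-at⁺ {c = c} eq)
        by inS₁ eq = inj₂ (inj₁ (∈-at⁺ {c = c} eq))
        by inS₂ eq = inj₂ (inj₂ (∈-at⁺ {c = c} eq))
      σ-perm : σ ↭ elements (rel (at inY c) ─ E₀ c)
      σ-perm = presentation-↭ (at inY c) (at inS₁ c) (at inS₂ c) 2∌Y 2∌1 ord-perm covers
        (at-disjoint c λ ()) (at-disjoint c λ ())
      selected : G e (at inY c) → lookup c (agentOf e) ≡ inS₂ → Precedes (agentOf e) (side inS₁ c e) (side inS₂ c e) →
        ∀ r → e ∈ ALG r w (E₀ c) σ → e ∈ run c ord r
      selected g a≡₂ pr r = select-good (at inY c) (at inS₁ c) (at inS₂ c) 2∌Y 2∌1 ord-perm (∈-at⁺ {c = c} a≡₂) (G⇒rel g) (G⇒unblocked g)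
        (λ f∈ → let f∈rel , _ , eq = ∈-side⁻ {inS₁} {c} {e} f∈ in x∈p∩q⁺ (f∈rel , ∈-edgesOf⁺ (∈-at⁺ {c = c} eq)))
        (λ f∈rel a∈₂ f≢e → ∈-side⁺ {inS₂} {c} f∈rel f≢e (∈-at⁻ {c = c} a∈₂))
        pr 𝒜 r (reveal w (E₀ c)) (accepted-Item (rel (at inY c)) (E₀ c) (p∩q⊆p _ _) σ σ-perm r)

    c₀ : ℝ
    c₀ = (1# - q) * (½ * ½) * α

    good-edge-bound : ∀ Y e → does (G? e Y) ≡ true → c₀ * 1# ≤ Coins q n (λ Z → Coins ½ n (λ U → lower (phases Y Z U) e))
    good-edge-bound Y e g? = ≤-trans (≤-reflexive (ℝ-Ring.*-identityʳ c₀)) (≤-trans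
        (chance agentOf 0≤q q≤1 (rel Y) e rel-injective (G⇒rel g) (λ Y′ → worst (rel Y) Y′ e) (λ Y′ → 0≤worst (rel Y) Y′ e) (α≤ g)
          (λ Z U → early (phases Y Z U) e) ignores either)
        (≤-reflexive (Coins-cong q n λ Z → Coins-cong ½ n λ U → integrand Z U)))
      where
      g : G e Y
      g = does⁻ (G? e Y) g?
      a = agentOf e
      a∉Y : lookup Y a ≡ false
      a∉Y = ∉⇒lookup (proj₁ (rel⁻ {Y = Y} (G⇒rel g)))

      rel-injective : ∀ {x y} → x ∈ rel Y → y ∈ rel Y → agentOf x ≡ agentOf y → x ≡ y
      rel-injective x∈ y∈ = Top-unique {Y = Y} (proj₂ (rel⁻ {Y = Y} x∈)) (proj₂ (rel⁻ {Y = Y} y∈))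

      sameY : ∀ Z U U′ → at inY (phases Y Z U) ≡ at inY (phases Y Z U′)
      sameY Z U U′ = at-inY Y Z U ■ sym (at-inY Y Z U′)

      ignores : ∀ Z → Ignores a (λ U → 𝟙 (early (phases Y Z U) e))
      ignores Z U U′ same = cong 𝟙 (cong₂ (λ P Q → does (precedes? a P Q)) (side-≡ inS₁) (side-≡ inS₂))
        where
        move : ∀ U U′ → (∀ b → b ≢ a → lookup U b ≡ lookup U′ b) → ∀ x b → b ≢ a →
          lookup (phases Y Z U) b ≡ x → lookup (phases Y Z U′) b ≡ x
        move U U′ same x b b≢a eq = lookup-phases Y Z U′ b
          ■ cong (phase (lookup Y b) (lookup Z b)) (sym (same b b≢a)) ■ sym (lookup-phases Y Z U b) ■ eq
        side-≡ : ∀ x → side x (phases Y Z U) e ≡ side x (phases Y Z U′) e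
        side-≡ x = subset-≡ (side-⊆ {c = phases Y Z U} {phases Y Z U′} (sameY Z U U′) (move U U′ same x))
          (side-⊆ {c = phases Y Z U′} {phases Y Z U} (sameY Z U′ U) (move U′ U (λ b b≢a → sym (same b b≢a)) x))

      flip₁₂ : ∀ y z u → phase y z (not u) ≡ inS₁ → phase y z u ≡ inS₂
      flip₁₂ false false false _ = refl
      flip₁₂ true  z     u     ()
      flip₁₂ false true  u     ()
      flip₁₂ false false true  ()
      flip₂₁ : ∀ y z u → phase y z (not u) ≡ inS₂ → phase y z u ≡ inS₁
      flip₂₁ false false true  _ = refl
      flip₂₁ true  z     u     ()
      flip₂₁ false true  u     ()
      flip₂₁ false false false ()

      lookup-∁ : ∀ Z U b → lookup (phases Y Z (∁ U)) b ≡ phase (lookup Y b) (lookup Z b) (not (lookup U b))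
      lookup-∁ Z U b = lookup-phases Y Z (∁ U) b ■ cong (phase (lookup Y b) (lookup Z b)) (∈-∁⁻ U)

      either : ∀ Z U → early (phases Y Z U) e ≡ true ⊎ early (phases Y Z (∁ U)) e ≡ true
      either Z U = by (precedes-total a (side inS₁ (phases Y Z U) e) (side inS₂ (phases Y Z U) e))
        where
        -- Complementing `U` exchanges S₁ and S₂ and leaves the other phases alone, so the two sides
        -- swap roles.
        side₁ : side inS₁ (phases Y Z (∁ U)) e ≡ side inS₂ (phases Y Z U) e
        side₁ = subset-≡
          (side-⊆ {c = phases Y Z (∁ U)} {phases Y Z U} (sameY Z (∁ U) U) λ b _ eq →
            lookup-phases Y Z U b ■ flip₁₂ (lookup Y b) (lookup Z b) (lookup U b) (sym (lookup-∁ Z U b) ■ eq))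
          (side-⊆ {c = phases Y Z U} {phases Y Z (∁ U)} (sameY Z U (∁ U)) λ b _ eq →
            lookup-∁ Z U b ■ flip₂₁ (lookup Y b) (lookup Z b) (not (lookup U b))
              (cong (phase (lookup Y b) (lookup Z b)) (Bool.not-involutive _) ■ sym (lookup-phases Y Z U b) ■ eq))
        side₂ : side inS₂ (phases Y Z (∁ U)) e ≡ side inS₁ (phases Y Z U) e
        side₂ = subset-≡
          (side-⊆ {c = phases Y Z (∁ U)} {phases Y Z U} (sameY Z (∁ U) U) λ b _ eq →
            lookup-phases Y Z U b ■ flip₂₁ (lookup Y b) (lookup Z b) (lookup U b) (sym (lookup-∁ Z U b) ■ eq))
          (side-⊆ {c = phases Y Z U} {phases Y Z (∁ U)} (sameY Z U (∁ U)) λ b _ eq →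
            lookup-∁ Z U b ■ flip₁₂ (lookup Y b) (lookup Z b) (not (lookup U b))
              (cong (phase (lookup Y b) (lookup Z b)) (Bool.not-involutive _) ■ sym (lookup-phases Y Z U b) ■ eq))

        by : Precedes a (side inS₁ (phases Y Z U) e) (side inS₂ (phases Y Z U) e) ⊎
             Precedes a (side inS₂ (phases Y Z U) e) (side inS₁ (phases Y Z U) e) →
             early (phases Y Z U) e ≡ true ⊎ early (phases Y Z (∁ U)) e ≡ true
        by (inj₁ pr) = inj₁ (does⁺ (precedes? a (side inS₁ (phases Y Z U) e) (side inS₂ (phases Y Z U) e)) pr)
        by (inj₂ pr) = inj₂ (does⁺ (precedes? a (side inS₁ (phases Y Z (∁ U)) e) (side inS₂ (phases Y Z (∁ U)) e))
          (subst₂ (Precedes a) (sym side₁) (sym side₂) pr))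

      -- Agents of edges in Rel(Y) lie outside Y, so for them the second coin alone decides about
      -- S₀.
      E₀-≡ : ∀ Z U → E₀ (phases Y Z U) ≡ restrict agentOf (rel Y) Z
      E₀-≡ Z U = cong (λ Y′ → rel Y′ ∩ edgesOf (at inS₀ c)) (at-inY Y Z U) ■ subset-≡
        (λ {x} x∈ → let x∈rel , x∈δ = x∈p∩q⁻ (rel Y) (edgesOf (at inS₀ c)) x∈ in
          lookup⇒∈ (lookup-restrict agentOf (rel Y) Z x ■ cong₂ _∧_ (∈⇒lookup x∈rel)
            (sampled _ _ _ (sym (lookup-phases Y Z U (agentOf x)) ■ ∈-at⁻ {c = c} (∈-edgesOf⁻ x∈δ)))))
        (λ {x} x∈ → let x∈rel , a∈Z = ∧-true⁻ (sym (lookup-restrict agentOf (rel Y) Z x) ■ ∈⇒lookup x∈) in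
          x∈p∩q⁺ (lookup⇒∈ x∈rel , ∈-edgesOf⁺ (∈-at⁺ {c = c} (lookup-phases Y Z U (agentOf x)
            ■ cong₂ (λ y z → phase y z (lookup U (agentOf x))) (∉⇒lookup (proj₁ (rel⁻ {Y = Y} (lookup⇒∈ x∈rel)))) a∈Z))))
        where
        c = phases Y Z U
        sampled : ∀ y z u → phase y z u ≡ inS₀ → z ≡ true
        sampled false true  u     _  = refl
        sampled true  z     u     ()
        sampled false false true  ()
        sampled false false false ()

      last-phase : ∀ Z U → does (lookup (phases Y Z U) a ≟ inS₂) ≡ not (lookup Z a) ∧ not (lookup U a)
      last-phase Z U = cong (λ x → does (x ≟ inS₂)) (lookup-phases Y Z U a ■ cong (λ y → phase y (lookup Z a) (lookup U a)) a∉Y)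
        ■ table (lookup Z a) (lookup U a)
        where
        table : ∀ z u → does (phase false z u ≟ inS₂) ≡ not z ∧ not u
        table true  u     = refl
        table false true  = refl
        table false false = refl

      integrand : ∀ Z U → 𝟙 (not (lookup Z a)) * (𝟙 (not (lookup U a)) * 𝟙 (early (phases Y Z U) e)) * worst (rel Y) (restrict agentOf (rel Y) Z) e
        ≡ lower (phases Y Z U) e
      integrand Z U = cong₂ _*_
          (sym (ℝ-Ring.*-assoc _ _ _) ■ cong (_* 𝟙 (early (phases Y Z U) e)) (sym (cong 𝟙 (last-phase Z U) ■ 𝟙-∧ (not (lookup Z a)) (not (lookup U a)))))
          (sym (cong₂ (λ Y′ X → worst (rel Y′) X e) (at-inY Y Z U) (E₀-≡ Z U)))
        ■ sym (cong (λ b → if b then chanceOf (phases Y Z U) e else 0#) (cong (λ Y′ → does (G? e Y′)) (at-inY Y Z U) ■ g?))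

    edge-bound : ∀ Y e → c₀ * 𝟙 (does (G? e Y)) ≤ Coins q n (λ Z → Coins ½ n (λ U → lower (phases Y Z U) e))
    edge-bound Y e = by (does (G? e Y)) refl
      where
      by : ∀ b → does (G? e Y) ≡ b → c₀ * 𝟙 b ≤ Coins q n (λ Z → Coins ½ n (λ U → lower (phases Y Z U) e))
      by true  eq = good-edge-bound Y e eq
      by false _  = ≤-trans (≤-reflexive (ℝ-Ring.zeroʳ c₀))
                    (Coins-nonNeg 0≤q q≤1 n λ Z → Coins-nonNeg 0≤½ ½≤1 n λ U → 0≤lower (phases Y Z U) e)

    utility : (T : Ω → Subset m) → (∀ ω → T ω ≡ run (phasesAt ω) (order ω) (bits ω)) →
      c₀ * Coins p n (λ Y → ∑ (allFin m) (λ e → w e * 𝟙 (does (G? e Y)))) ≤ 𝔼 space w T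
    utility T T≡ = ≤-trans (≤-trans averaged (≤-reflexive (sym (∑-mass n (λ c → ∑ (allFin m) (λ e → w e * lower c e))))))
      (𝔼-lower w 0≤w T (λ c ρ → run c (orderOf ρ)) (λ c ρ → run-measurable c (orderOf ρ))
        (λ ω → T≡ ω ■ cong (process (decide (bits ω) (reveal w (E₀ (phasesAt ω)))) [] ∅)
          (plan-cong (phasesAt ω) λ i i≤m → sym (orderOf-tabulate (order ω) i i≤m)))
        lower (λ c ρ ρ-perm e → lower≤ℙ c (orderOf-↭ ρ-perm) e))
      where
      averaged : c₀ * Coins p n (λ Y → ∑ (allFin m) (λ e → w e * 𝟙 (does (G? e Y)))) ≤
        Coins p n (λ Y → Coins q n (λ Z → Coins ½ n (λ U → ∑ (allFin m) (λ e → w e * lower (phases Y Z U) e))))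
      averaged = ≤-trans (≤-reflexive (sym (Coins-*ˡ p n c₀ _))) (Coins-mono 0≤p p≤1 n λ Y →
        ≤-trans (≤-reflexive (sym (∑-*ˡ (allFin m) c₀ _)))
          (≤-trans (∑-mono (allFin m) λ e → ≤-trans
              (≤-reflexive (solve 3 (λ c w x → c :* (w :* x) := w :* (c :* x)) refl c₀ (w e) (𝟙 (does (G? e Y)))))
              (*-monoˡ-≤ (w e) (0≤w e) (edge-bound Y e)))
            (≤-reflexive (sym (exchange Y)))))
        where
        exchange : ∀ Y → Coins q n (λ Z → Coins ½ n (λ U → ∑ (allFin m) (λ e → w e * lower (phases Y Z U) e))) ≡
          ∑ (allFin m) (λ e → w e * Coins q n (λ Z → Coins ½ n (λ U → lower (phases Y Z U) e)))
        exchange Y = Coins-cong q n (λ Z → Coins-∑ ½ n (allFin m) (λ e U → w e * lower (phases Y Z U) e)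
              ■ ∑-cong (allFin m) (λ e → Coins-*ˡ ½ n (w e) (λ U → lower (phases Y Z U) e)))
          ■ Coins-∑ q n (allFin m) (λ e Z → w e * Coins ½ n (λ U → lower (phases Y Z U) e))
          ■ ∑-cong (allFin m) (λ e → Coins-*ˡ q n (w e) (λ Z → Coins ½ n (λ U → lower (phases Y Z U) e)))

module _ ⦃ ℛ : RealNumbers ⦄ where

  fromℕ-∑ : ∀ {I : Set} (f : I → ℕ) xs → fromℕ (foldr ℕ._+_ 0 (map f xs)) ≡ ∑ xs (fromℕ ∘ f)
  fromℕ-∑ f []       = refl
  fromℕ-∑ f (x ∷ xs) = fromℕ-+ (f x) _ ■ cong (fromℕ (f x) +_) (fromℕ-∑ f xs)

  fromℕ-parts∋ : ∀ {n} (C : Combination n) (κ : Fin (size C) → ℕ) e →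
    fromℕ (foldr ℕ._+_ 0 (map κ (parts∋ C e))) ≡ ∑ (allFin (size C)) (λ j → 𝟙 (lookup (ground (part C j)) e) * fromℕ (κ j))
  fromℕ-parts∋ C κ e = fromℕ-∑ κ (parts∋ C e) ■ ∑-filter (λ j → e ∈? ground (part C j)) (allFin (size C)) (fromℕ ∘ κ)
    ■ ∑-cong (allFin (size C)) (λ j → cong (λ b → 𝟙 b * fromℕ (κ j)) (does-∈? e (ground (part C j))))

  module WindowSets {p q : ℝ} (0≤p : 0# ≤ p) (p≤1 : p ≤ 1#) (0≤q : 0# ≤ q) (q≤1 : q ≤ 1#)
    {n : ℕ} (t : Fin n → ℝ) (t-range : ∀ a → 0# < t a × t a < 1#) where

    open Phases 0≤p p≤1 0≤q q≤1

    private
      c : Vec Phase n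
      c = tabulate (phaseOf ∘ t)

      window : ∀ {a} x → lookup c a ≡ x → lo x ≤ t a × t a < hi x
      window {a} x eq = subst (λ x → lo x ≤ t a × t a < hi x) (sym (Vec.lookup∘tabulate (phaseOf ∘ t) a) ■ eq)
        (phaseOf-window (proj₁ (t-range a)) (proj₂ (t-range a)))

      phase-at : ∀ {a} x → lo x ≤ t a → t a < hi x → lookup c a ≡ x
      phase-at {a} x lo≤ <hi = Vec.lookup∘tabulate (phaseOf ∘ t) a
        ■ phaseOf-unique x (proj₁ (t-range a)) (proj₂ (t-range a)) lo≤ <hi

      at-≡ : ∀ {P : Pred (Fin n) 0ℓ} (P? : Decidable P) x → (∀ {a} → P a → lo x ≤ t a × t a < hi x) →
        (∀ {a} → lo x ≤ t a → t a < hi x → P a) → comprehension P? ≡ at x c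
      at-≡ P? x ⇒ ⇐ = subset-≡
        (λ a∈ → let lo≤ , <hi = ⇒ (comprehension⁻ P? a∈) in ∈-at⁺ {c = c} (phase-at x lo≤ <hi))
        (λ a∈ → let lo≤ , <hi = window x (∈-at⁻ {c = c} a∈) in comprehension⁺ P? (⇐ lo≤ <hi))

    -- The algorithm uses an open left end at zero and a closed right end at one, whereas the
    -- windows are half-open. Times strictly between zero and one make the two agree.
    Y≡ : comprehension (λ a → (0# <? t a) ×-dec (t a <? p)) ≡ at inY c
    Y≡ = at-≡ (λ a → (0# <? t a) ×-dec (t a <? p)) inY (λ (0<t , t<p) → <⇒≤ 0<t , t<p) (λ {a} _ t<p → proj₁ (t-range a) , t<p)

    S₀≡ : comprehension (λ a → (p ≤? t a) ×-dec (t a <? p₂)) ≡ at inS₀ c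
    S₀≡ = at-≡ (λ a → (p ≤? t a) ×-dec (t a <? p₂)) inS₀ id _,_

    S₁≡ : comprehension (λ a → (p₂ ≤? t a) ×-dec (t a <? p₃)) ≡ at inS₁ c
    S₁≡ = at-≡ (λ a → (p₂ ≤? t a) ×-dec (t a <? p₃)) inS₁ id _,_

    S₂≡ : comprehension (λ a → (p₃ ≤? t a) ×-dec (t a ≤? 1#)) ≡ at inS₂ c
    S₂≡ = at-≡ (λ a → (p₃ ≤? t a) ×-dec (t a ≤? 1#)) inS₂ (λ {a} (p₃≤t , _) → p₃≤t , proj₂ (t-range a)) (λ p₃≤t t<1 → p₃≤t , <⇒≤ t<1)

record BlockingHulls ⦃ ℛ : RealNumbers ⦄ {m n : ℕ} (𝒢 : GreedySystem m n) (𝒞 : GrowthComponents 𝒢) (ℋ : HullSystem 𝒢) : Set where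
  open GreedySystem 𝒢
  open GrowthComponents 𝒞
  open HullSystem ℋ
  field
    hull⇒Blocked  : ∀ {X e} → (∀ {x y} → x ∈ X → y ∈ X → agentOf x ≡ agentOf y → x ≡ y) → agentOf e ∉ image agentOf X →
      agentOf e ∈ hull (image agentOf X) → Any (λ j → Blocked (sys j) X e) js
    hullB         : Subset m → Subset m
    hullB⇒Blocked : ∀ {X e} → e ∈ hullB X → e ∉ X → Any (λ j → Blocked (sys j) X e) js

module Ratio ⦃ ℛ : RealNumbers ⦄ {m n : ℕ} (𝒢 : GreedySystem m n) (𝒞 : GrowthComponents 𝒢) (ℋ : HullSystem 𝒢)
  (ℬ : BlockingHulls 𝒢 𝒞 ℋ) (𝒪 : ItemAlgorithm 𝒢 ℋ)
  {p q α : ℝ} (0≤p : 0# ≤ p) (p≤1 : p ≤ 1#) (0≤q : 0# ≤ q) (q≤1 : q ≤ 1#)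
  (α≤ : ∀ {X e} → e ∈ X → e ∉ BlockingHulls.hullB ℬ (above (GreedySystem.w 𝒢) X e) →
    α ≤ ∑ (filter (_⊆? (X ─ ⁅ e ⁆)) (allSubsets m))
      (λ Y → ∏ (elements (X ─ ⁅ e ⁆)) (λ x → if does (x ∈? Y) then q else 1# - q) * ItemAlgorithm.worst 𝒪 X Y e))
  (source : RandomSource n (OnlineAlgorithm.seeds (ItemAlgorithm.𝒜 𝒪))) where

  open ℝ-Solver using (solve; con; _:+_; _:*_; _:-_; :-_; _:=_)
  open GreedySystem 𝒢
  open GrowthComponents 𝒞
  open HullSystem ℋ
  open BlockingHulls ℬ
  open RandomSource source using (Ω; space; order; bits)
  open Relevance 𝒢
  open Pathwise 𝒢 𝒞 using (Bad; good?; good-weight; optimum-average; bad-average; bad-average-matroid)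
  open Utility 𝒢 ℋ 𝒪 using (run; utility)
  open Discretise 0≤p p≤1 0≤q q≤1 source (suc m) using (phasesAt)

  Core-good : Fin m → Subset n → Set
  Core-good e Y = e ∈ rel Y × agentOf e ∉ hull (image agentOf (above w (rel Y) e)) × e ∉ hullB (above w (rel Y) e)

  core-good? : ∀ e Y → Dec (Core-good e Y)
  core-good? e Y = (e ∈? rel Y) ×-dec ¬? (agentOf e ∈? hull (image agentOf (above w (rel Y) e)))
    ×-dec ¬? (e ∈? hullB (above w (rel Y) e))

  -- Membership in either hull yields blocking in a single component, which goodness excludes. On
  -- the agent side this needs one relevant edge per agent, supplied by `Top-unique`.
  good⇒core-good : ∀ {e Y} → (agentOf e ∉ Y × Top e Y) × ¬ Bad e Y → Core-good e Y
  good⇒core-good {e} {Y} ((a∉Y , top) , ¬bad) = rel⁺ a∉Y top ,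
    (¬bad ∘ hull⇒Blocked (λ x∈ y∈ → Top-unique {Y = Y} (topOf x∈) (topOf y∈)) fresh) ,
    (λ e∈Hull → ¬bad (hullB⇒Blocked e∈Hull e∉above))
    where
    e∉above : e ∉ above w (rel Y) e
    e∉above e∈ = <-irrefl (proj₂ (∈-above⁻ w {rel Y} e∈))
    topOf : ∀ {f} → f ∈ above w (rel Y) e → Top f Y
    topOf f∈ = proj₂ (rel⁻ {Y = Y} (proj₁ (∈-above⁻ w {rel Y} f∈)))
    fresh : agentOf e ∉ image agentOf (above w (rel Y) e)
    fresh a∈ with f , f∈ , f≡e ← ∈-image⁻ agentOf a∈ =
      e∉above (subst (_∈ above w (rel Y) e) (Top-unique {Y = Y} (topOf f∈) top f≡e) f∈)

  ET EB : ℝ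
  ET = Pathwise.ET 𝒢 𝒞 0≤p p≤1
  EB = Pathwise.EB 𝒢 𝒞 0≤p p≤1

  module _ (output : Ω → Subset m) (output≡ : ∀ ω → output ω ≡ run (phasesAt ω) (order ω) (bits ω)) where

    -- The utility bound is applied to the empty class of good edges, which avoids a separate
    -- argument about the events in `𝔼`.
    0≤𝔼 : 0# ≤ 𝔼 space w output
    0≤𝔼 = ≤-trans (≤-reflexive (sym (cong ((1# - q) * (½ * ½) * 0# *_)
          (Coins-cong p n (λ Y → ∑-cong (allFin m) (λ e → ℝ-Ring.zeroʳ (w e)) ■ ∑-zero (allFin m)) ■ Coins-const p n 0#)
        ■ ℝ-Ring.zeroʳ _)))
      (utility {α = 0#} 0≤p p≤1 0≤q q≤1 (λ _ _ → Empty) (λ _ _ → no id) Empty-elim Empty-elim Empty-elim source output output≡)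

    expected : (1# - q) * (½ * ½) * α * Coins p n (λ Y → ∑ (allFin m) (λ e → w e * 𝟙 (does (core-good? e Y)))) ≤ 𝔼 space w output
    expected = utility 0≤p p≤1 0≤q q≤1 Core-good core-good? proj₁ (proj₁ ∘ proj₂)
      (λ (e∈ , _ , e∉Hull) → α≤ e∈ e∉Hull) source output output≡

    -- Only arithmetic is left to `ratio`: it receives the bound on the optimum and both bounds on
    -- the bad weight, and each case of the theorem picks the bad-weight bound that it can use.
    utility-ratio : ∀ {γ : ℝ} → 0# ≤ γ →
      (∀ {W : ℝ} → p * W ≤ fromℕ k * (p * ET) → p * EB ≤ fromℕ k * ((1# - p) * ET) →
        ((∀ j → κ j ≡ 1) → EB ≤ fromℕ k * ((1# - p) * ET)) → γ * W ≤ (1# - p) * (ET - EB)) →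
      ∀ T → F T → α * (1# - q) * (½ * ½) * γ * weight w T ≤ 𝔼 space w output
    utility-ratio {γ} 0≤γ ratio T fT = by-sign (0# ≤? α)
      where
      0≤wT : 0# ≤ weight w T
      0≤wT = ∑-nonNeg (elements T) 0≤w

      γwT≤ : γ * weight w T ≤ Coins p n (λ Y → ∑ (allFin m) (λ e → w e * 𝟙 (does (core-good? e Y))))
      γwT≤ = ≤-trans (ratio (optimum-average 0≤p p≤1 T fT) (bad-average 0≤p p≤1) (bad-average-matroid 0≤p p≤1))
        (≤-trans (≤-reflexive (sym (good-weight 0≤p p≤1)))
          (Coins-mono 0≤p p≤1 n λ Y → ∑-mono (allFin m) λ e → *-monoˡ-≤ (w e) (0≤w e)
            (𝟙-≤ (λ good → does⁺ (core-good? e Y) (good⇒core-good (does⁻ (good? e Y) good))))))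

      by-sign : Dec (0# ≤ α) → α * (1# - q) * (½ * ½) * γ * weight w T ≤ 𝔼 space w output
      by-sign (yes 0≤α) = ≤-trans
        (≤-reflexive (solve 5 (λ a q h g x → a :* q :* h :* g :* x := q :* h :* a :* (g :* x)) refl α (1# - q) (½ * ½) γ (weight w T)))
        (≤-trans (*-monoˡ-≤ ((1# - q) * (½ * ½) * α) (*-nonNeg (*-nonNeg (0≤-≤ q≤1) (*-nonNeg 0≤½ 0≤½)) 0≤α) γwT≤) expected)
      -- For negative α the claimed bound is at most zero, and nonnegativity of the expected weight
      -- suffices.
      by-sign (no 0≰α) = ≤-trans
        (≤-from (*-nonNeg (*-nonNeg (*-nonNeg (0≤-≤ (<⇒≤ (≰⇒> 0≰α))) (0≤-≤ q≤1)) (*-nonNeg 0≤½ 0≤½)) (*-nonNeg 0≤γ 0≤wT))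
          (solve 5 (λ a q h g x → con (ℤ.+ 0) := a :* q :* h :* g :* x :+ (con (ℤ.+ 0) :- a) :* q :* h :* (g :* x)) refl α (1# - q) (½ * ½) γ (weight w T)))
        0≤𝔼

-- The two ratios

module _ ⦃ ℛ : RealNumbers ⦄ where
  open ℝ-Solver using (solve; con; _:+_; _:*_; _:-_; :-_; _:=_)

  inverse-unique : ∀ {x y : ℝ} → 0# < x → x * y ≡ 1# → x ⁻¹ ≡ y
  inverse-unique {x} {y} 0<x xy≡1 = sym (ℝ-Ring.*-identityʳ _) ■ cong (x ⁻¹ *_) (sym xy≡1)
    ■ solve 3 (λ z x y → z :* (x :* y) := (x :* z) :* y) refl (x ⁻¹) x y
    ■ cong (_* y) (*-inverseʳ 0<x) ■ ℝ-Ring.*-identityˡ y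

  nonNeg-sqrt-1 : ∀ {x : ℝ} → 0# ≤ x → x * x ≡ 1# → x ≡ 1#
  nonNeg-sqrt-1 {x} 0≤x xx≡1 = ≤-antisym (*-cancelˡ-≤ 0<x+1 (≤-reflexive eq)) (*-cancelˡ-≤ 0<x+1 (≤-reflexive (sym eq)))
    where
    0<x+1 : 0# < x + 1#
    0<x+1 = subst (0# <_) (ℝ-Ring.+-comm 1# x) (+-pos-nonNeg 0<1 0≤x)
    eq : (x + 1#) * x ≡ (x + 1#) * 1#
    eq = solve 1 (λ x → (x :+ con (ℤ.+ 1)) :* x := x :* x :+ x) refl x ■ cong (_+ x) xx≡1
      ■ solve 1 (λ x → con (ℤ.+ 1) :+ x := (x :+ con (ℤ.+ 1)) :* con (ℤ.+ 1)) refl x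

  sqrt≤1 : ∀ {x : ℝ} → 0# ≤ x → x * x ≤ 1# → x ≤ 1#
  sqrt≤1 {x} 0≤x xx≤1 with x ≤? 1#
  ... | yes x≤1 = x≤1
  ... | no x≰1  = contradiction (≤-trans (subst (_≤ x * x) (ℝ-Ring.*-identityʳ x) (*-monoˡ-≤ x 0≤x (<⇒≤ (≰⇒> x≰1)))) xx≤1) x≰1

  2½ : fromℕ 2 * ½ ≡ 1#
  2½ = *-inverseʳ (0<fromℕ 2)

  ¼ : 1# / fromℕ 4 ≡ ½ * ½
  ¼ = ℝ-Ring.*-identityˡ _ ■ inverse-unique (0<fromℕ 4)
    (cong (_* (½ * ½)) (fromℕ-* 2 2)
      ■ solve 2 (λ t h → t :* t :* (h :* h) := (t :* h) :* (t :* h)) refl (fromℕ 2) ½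
      ■ cong₂ _*_ 2½ 2½ ■ ℝ-Ring.*-identityˡ 1#)

  module _ (k : ℕ) .⦃ _ : NonZero k ⦄ where

    private
      K x : ℝ
      K = fromℕ k
      x = K ⁻¹

      Kx≡1 : K * x ≡ 1#
      Kx≡1 = *-inverseʳ (0<fromℕ k)

    1/k≡ : 1# / K ≡ x
    1/k≡ = ℝ-Ring.*-identityˡ x

    1/2k : 1# / fromℕ (2 ℕ.* k) ≡ ½ * x
    1/2k = ℝ-Ring.*-identityˡ _ ■ inverse-unique (0<fromℕ (2 ℕ.* k) ⦃ ℕ.m*n≢0 2 k ⦄)
      (cong (_* (½ * x)) (fromℕ-* 2 k)
        ■ solve 4 (λ t h k x → t :* k :* (h :* x) := (t :* h) :* (k :* x)) refl (fromℕ 2) ½ K x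
        ■ cong₂ _*_ 2½ Kx≡1 ■ ℝ-Ring.*-identityˡ 1#)

    1/16k² : 1# / fromℕ (16 ℕ.* k ℕ.^ 2) ≡ ½ * ½ * (½ * x * (½ * x))
    1/16k² = ℝ-Ring.*-identityˡ _ ■ inverse-unique (0<fromℕ (16 ℕ.* k ℕ.^ 2) ⦃ ℕ.m*n≢0 16 (k ℕ.^ 2) ⦃ _ ⦄ ⦃ ℕ.m^n≢0 k 2 ⦄ ⦄)
      (cong (_* (½ * ½ * (½ * x * (½ * x)))) (fromℕ-* 16 (k ℕ.^ 2)
          ■ cong₂ _*_ (fromℕ-* 4 4 ■ cong₂ _*_ (fromℕ-* 2 2) (fromℕ-* 2 2)) (cong (λ z → fromℕ (k ℕ.* z)) (ℕ.*-identityʳ k) ■ fromℕ-* k k))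
        ■ solve 4 (λ t h k x → t :* t :* (t :* t) :* (k :* k) :* (h :* h :* (h :* x :* (h :* x)))
            := (t :* h) :* (t :* h) :* ((t :* h) :* (t :* h)) :* ((k :* x) :* (k :* x))) refl (fromℕ 2) ½ K x
        ■ cong₂ (λ u v → u * u * (u * u) * (v * v)) 2½ Kx≡1
        ■ solve 0 (con (ℤ.+ 1) :* con (ℤ.+ 1) :* (con (ℤ.+ 1) :* con (ℤ.+ 1)) :* (con (ℤ.+ 1) :* con (ℤ.+ 1)) := con (ℤ.+ 1)) refl)

    1/32k³ : 1# / fromℕ (32 ℕ.* k ℕ.^ 3) ≡ ½ * ½ * (½ * x * (½ * x) * (½ * x))
    1/32k³ = ℝ-Ring.*-identityˡ _ ■ inverse-unique (0<fromℕ (32 ℕ.* k ℕ.^ 3) ⦃ ℕ.m*n≢0 32 (k ℕ.^ 3) ⦃ _ ⦄ ⦃ ℕ.m^n≢0 k 3 ⦄ ⦄)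
      (cong₂ _*_ (cong fromℕ (sym (ℕ.[m*n]*[o*p]≡[m*o]*[n*p] 2 k 16 (k ℕ.^ 2))) ■ fromℕ-* (2 ℕ.* k) (16 ℕ.* k ℕ.^ 2))
          (solve 2 (λ h y → h :* (y :* y :* y) := y :* (h :* (y :* y))) refl (½ * ½) (½ * x) ■ cong₂ _*_ (sym 1/2k) (sym 1/16k²))
        ■ solve 4 (λ a b c d → a :* b :* (con (ℤ.+ 1) :* c :* (con (ℤ.+ 1) :* d)) := (a :* c) :* (b :* d)) refl a b (a ⁻¹) (b ⁻¹)
        ■ cong₂ _*_ (*-inverseʳ (0<fromℕ (2 ℕ.* k) ⦃ ℕ.m*n≢0 2 k ⦄))
            (*-inverseʳ (0<fromℕ (16 ℕ.* k ℕ.^ 2) ⦃ ℕ.m*n≢0 16 (k ℕ.^ 2) ⦃ _ ⦄ ⦃ ℕ.m^n≢0 k 2 ⦄ ⦄))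
        ■ ℝ-Ring.*-identityˡ 1#)
      where
      a b : ℝ
      a = fromℕ (2 ℕ.* k)
      b = fromℕ (16 ℕ.* k ℕ.^ 2)

    -- The good edges give (1 - p)(1/k - (1 - p)/p), which is maximal where p² = k/(k + 1). There s
    -- is the inverse of p, and the maximum 2 - 2s + 1/k equals (s - 1)².
    module GrowthBound {p s : ℝ} (p√ : IsSqrt p (1# - 1# / fromℕ (k ℕ.+ 1))) (s√ : IsSqrt s (1# + 1# / K)) where

      private
        u : ℝ
        u = fromℕ (k ℕ.+ 1) ⁻¹

        0<k+1 : 0# < fromℕ (k ℕ.+ 1)
        0<k+1 = subst (λ n → 0# < fromℕ n) (ℕ.+-comm 1 k) (0<fromℕ (suc k))

        u+Ku≡1 : u + K * u ≡ 1#
        u+Ku≡1 = solve 2 (λ u k → u :+ k :* u := (k :+ (con (ℤ.+ 1) :+ con (ℤ.+ 0))) :* u) refl u K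
          ■ cong (_* u) (sym (fromℕ-+ k 1)) ■ *-inverseʳ 0<k+1

        ss≡ : s * s ≡ 1# + x
        ss≡ = proj₂ s√ ■ cong (1# +_) 1/k≡

        pp≡ : p * p ≡ 1# - u
        pp≡ = proj₂ p√ ■ cong (λ z → 1# - z) (ℝ-Ring.*-identityˡ u)

      ps≡1 : p * s ≡ 1#
      ps≡1 = nonNeg-sqrt-1 (*-nonNeg (proj₁ p√) (proj₁ s√)) (begin
        p * s * (p * s)       ≡⟨ solve 2 (λ p s → p :* s :* (p :* s) := p :* p :* (s :* s)) refl p s ⟩
        p * p * (s * s)       ≡⟨ cong₂ _*_ pp≡ ss≡ ⟩
        (1# - u) * (1# + x)   ≡⟨ solve 2 (λ u x → (con (ℤ.+ 1) :- u) :* (con (ℤ.+ 1) :+ x) := con (ℤ.+ 1) :+ (x :- (con (ℤ.+ 1) :* u :+ u :* x))) refl u x ⟩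
        1# + (x - (1# * u + u * x)) ≡⟨ cong (λ z → 1# + (x - (z * u + u * x))) Kx≡1 ⟨
        1# + (x - (K * x * u + u * x)) ≡⟨ solve 3 (λ u k x → con (ℤ.+ 1) :+ (x :- (k :* x :* u :+ u :* x)) := con (ℤ.+ 1) :+ (x :- x :* (u :+ k :* u))) refl u K x ⟩
        1# + (x - x * (u + K * u)) ≡⟨ cong (λ z → 1# + (x - x * z)) u+Ku≡1 ⟩
        1# + (x - x * 1#)     ≡⟨ solve 1 (λ x → con (ℤ.+ 1) :+ (x :- x :* con (ℤ.+ 1)) := con (ℤ.+ 1)) refl x ⟩
        1#                    ∎)
        where open ≡-Reasoning

      0≤p : 0# ≤ p
      0≤p = proj₁ p√

      p≤1 : p ≤ 1#
      p≤1 = sqrt≤1 0≤p (≤-from (<⇒≤ (0<⁻¹ 0<k+1)) (solve 1 (λ u → con (ℤ.+ 1) := con (ℤ.+ 1) :- u :+ u) refl u ■ cong (_+ u) (sym pp≡)))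

      0<p : 0# < p
      0<p = 0≤p , λ { refl → 0≢1 (sym (ℝ-Ring.zeroˡ s) ■ ps≡1) }

      γ : ℝ
      γ = fromℕ 2 - fromℕ 2 * s + 1# / K

      γ≡ : γ ≡ (s - 1#) * (s - 1#)
      γ≡ = cong (fromℕ 2 - fromℕ 2 * s +_) (1/k≡ ■ solve 1 (λ x → x := con (ℤ.+ 1) :+ x :- con (ℤ.+ 1)) refl x ■ cong (_- 1#) (sym ss≡))
        ■ solve 1 (λ s → con (ℤ.+ 2) :- con (ℤ.+ 2) :* s :+ (s :* s :- con (ℤ.+ 1)) := (s :- con (ℤ.+ 1)) :* (s :- con (ℤ.+ 1))) refl s

      0≤γ : 0# ≤ γ
      0≤γ = subst (0# ≤_) (sym γ≡) (0≤x*x (s - 1#))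

      private
        K[ss-1]≡1 : K * (s * s - 1#) ≡ 1#
        K[ss-1]≡1 = cong (λ z → K * (z - 1#)) ss≡ ■ solve 2 (λ k x → k :* (con (ℤ.+ 1) :+ x :- con (ℤ.+ 1)) := k :* x) refl K x ■ Kx≡1

        loss : ∀ (t : ℝ) → p * t - K * ((1# - p) * t) ≡ p * (s * (s - 1#) * (K * t))
        loss t = begin
          p * t - K * ((1# - p) * t)
            ≡⟨ solve 3 (λ p k t → p :* t :- k :* ((con (ℤ.+ 1) :- p) :* t) := (p :* con (ℤ.+ 1) :- k :* (con (ℤ.+ 1) :- p)) :* t) refl p K t ⟩
          (p * 1# - K * (1# - p)) * t
            -- Two ones are traded in: the first for k(s² - 1), the second for ps. What remains is a
            -- polynomial identity.
            ≡⟨ cong₂ (λ a b → (p * a - K * (b - p)) * t) (sym K[ss-1]≡1) (sym ps≡1) ⟩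
          (p * (K * (s * s - 1#)) - K * (p * s - p)) * t
            ≡⟨ solve 4 (λ p k s t → (p :* (k :* (s :* s :- con (ℤ.+ 1))) :- k :* (p :* s :- p)) :* t := p :* (s :* (s :- con (ℤ.+ 1)) :* (k :* t))) refl p K s t ⟩
          p * (s * (s - 1#) * (K * t)) ∎
          where open ≡-Reasoning

        gain : ∀ (y : ℝ) → (s - 1#) * (s - 1#) * y ≡ (1# - p) * (s * (s - 1#) * y)
        gain y = sym (solve 3 (λ p s y → (con (ℤ.+ 1) :- p) :* (s :* (s :- con (ℤ.+ 1)) :* y) := (s :- p :* s) :* (s :- con (ℤ.+ 1)) :* y) refl p s y
          ■ cong (λ z → (s - z) * (s - 1#) * y) ps≡1)

      growth-ratio : ∀ {W ET EB : ℝ} → p * W ≤ K * (p * ET) → p * EB ≤ K * ((1# - p) * ET) → γ * W ≤ (1# - p) * (ET - EB)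
      growth-ratio {W} {ET} {EB} opt bad = subst₂ _≤_ (cong (_* W) (sym γ≡)) refl
        (≤-trans (*-monoˡ-≤ ((s - 1#) * (s - 1#)) (0≤x*x (s - 1#)) W≤)
          (≤-trans (≤-reflexive (gain (K * ET))) (*-monoˡ-≤ (1# - p) (0≤-≤ p≤1) ET-EB≥)))
        where
        W≤ : W ≤ K * ET
        W≤ = *-cancelˡ-≤ 0<p (subst (p * W ≤_) (solve 3 (λ k p t → k :* (p :* t) := p :* (k :* t)) refl K p ET) opt)

        ET-EB≥ : s * (s - 1#) * (K * ET) ≤ ET - EB
        ET-EB≥ = *-cancelˡ-≤ 0<p (subst (_≤ p * (ET - EB)) (loss ET) (≤-from (0≤-≤ bad)
          (solve 4 (λ p t b z → p :* (t :- b) := p :* t :- z :+ (z :- p :* b)) refl p ET EB (K * ((1# - p) * ET)))))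

      -- With u = s − 1 and y = ½ (s² − 1) = u (½ u + 1), the difference of
      -- the two sides is ¼ (u² − y² + y³).
      strict : 1# / fromℕ (16 ℕ.* k ℕ.^ 2) - 1# / fromℕ (32 ℕ.* k ℕ.^ 3) < 1# / fromℕ 4 * γ
      strict = <-from positive (cong₂ _*_ ¼ γ≡ ■ sym (cong₂ (λ a b → a - b + ½ * ½ * (v * v * rest)) 1/16k² 1/32k³
          ■ cong (λ y → ½ * ½ * (y * y) - ½ * ½ * (y * y * y) + ½ * ½ * (v * v * rest)) y≡
          ■ solve 2 (λ h v →
              let y = v :* (h :* v :+ con (ℤ.+ 1))
                  r = (con (ℤ.+ 2) :* h :+ h :* (con (ℤ.+ 1) :- h)) :* (v :* v) :+ (con (ℤ.+ 3) :* (h :* h) :* (v :* v :* v) :+ h :* h :* h :* (v :* v :* (v :* v)))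
              in h :* h :* (y :* y) :- h :* h :* (y :* y :* y) :+ h :* h :* (v :* v :* r)
                 := h :* h :* (v :* v) :+ h :* h :* (v :* v :* (v :* (con (ℤ.+ 2) :* h :- con (ℤ.+ 1))))) refl ½ v
          ■ cong (λ z → ½ * ½ * (v * v) + ½ * ½ * (v * v * (v * (z - 1#)))) 2½
          ■ solve 2 (λ h v → h :* h :* (v :* v) :+ h :* h :* (v :* v :* (v :* (con (ℤ.+ 1) :- con (ℤ.+ 1)))) := h :* h :* (v :* v)) refl ½ v))
        where
        v rest : ℝ
        v = s - 1#
        -- The bracket divided by v², that is (5/4)v² + (3/4)v³ + (1/8)v⁴, where the linear terms
        -- have cancelled and all coefficients are positive.
        rest = (fromℕ 2 * ½ + ½ * (1# - ½)) * (v * v) + (fromℕ 3 * (½ * ½) * (v * v * v) + ½ * ½ * ½ * (v * v * (v * v)))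

        y≡ : ½ * x ≡ v * (½ * v + 1#)
        y≡ = cong (½ *_) (solve 1 (λ x → x := con (ℤ.+ 1) :+ x :- con (ℤ.+ 1)) refl x ■ cong (_- 1#) (sym ss≡))
          ■ solve 2 (λ h s → h :* (s :* s :- con (ℤ.+ 1)) := (s :- con (ℤ.+ 1)) :* (h :* (s :- con (ℤ.+ 1)) :+ con (ℤ.+ 2) :* h)) refl ½ s
          ■ cong (λ z → v * (½ * v + z)) 2½

        0<v : 0# < v
        0<v = 0<-< (≰⇒> λ s≤1 → <⇒≱ (<-from (0<⁻¹ (0<fromℕ k)) ss≡)
          (≤-trans (*-monoˡ-≤ s (proj₁ s√) s≤1) (≤-trans (≤-reflexive (ℝ-Ring.*-identityʳ s)) s≤1)))

        0<½ : 0# < ½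
        0<½ = 0<⁻¹ (0<fromℕ 2)

        0<rest : 0# < rest
        0<rest = +-pos-nonNeg (*-pos (+-pos-nonNeg (*-pos (0<fromℕ 2) 0<½) (*-nonNeg 0≤½ (0≤-≤ ½≤1))) (*-pos 0<v 0<v))
          (0≤+ (<⇒≤ (*-pos (*-pos (0<fromℕ 3) (*-pos 0<½ 0<½)) (*-pos (*-pos 0<v 0<v) 0<v)))
               (<⇒≤ (*-pos (*-pos (*-pos 0<½ 0<½) 0<½) (*-pos (*-pos 0<v 0<v) (*-pos 0<v 0<v)))))

        positive : 0# < ½ * ½ * (v * v * rest)
        positive = *-pos (*-pos 0<½ 0<½) (*-pos (*-pos 0<v 0<v) 0<rest)

    -- Here the factor is (1 - p)(1/k - (1 - p)), maximal at 1 - p = 1/(2k) with value `γ`, the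
    -- square of 1/(2k).
    module MatroidBound where

      p : ℝ
      p = 1# - 1# / fromℕ (2 ℕ.* k)

      γ : ℝ
      γ = ½ * x * (½ * x)

      0≤γ : 0# ≤ γ
      0≤γ = 0≤x*x (½ * x)

      private
        0≤½x : 0# ≤ ½ * x
        0≤½x = *-nonNeg 0≤½ (<⇒≤ (0<⁻¹ (0<fromℕ k)))

        1-p≡ : 1# - p ≡ ½ * x
        1-p≡ = solve 1 (λ d → con (ℤ.+ 1) :- (con (ℤ.+ 1) :- d) := d) refl (1# / fromℕ (2 ℕ.* k)) ■ 1/2k

        p≡ : p ≡ 1# - ½ * x
        p≡ = cong (λ z → 1# - z) 1/2k

        x≤1 : x ≤ 1#
        x≤1 = *-cancelˡ-≤ (0<fromℕ k) (subst₂ _≤_ (ℝ-Ring.+-identityʳ 1# ■ sym Kx≡1) (sym (ℝ-Ring.*-identityʳ K))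
          (fromℕ-mono-≤ (ℕ.>-nonZero⁻¹ k)))

        ½≤p : ½ ≤ p
        ½≤p = subst (½ ≤_) (sym p≡) (≤-from (*-nonNeg 0≤½ (0≤-≤ x≤1))
          (cong (_- ½ * x) (sym ½+½) ■ solve 2 (λ h x → h :+ h :- h :* x := h :+ h :* (con (ℤ.+ 1) :- x)) refl ½ x))

      0≤p : 0# ≤ p
      0≤p = ≤-trans 0≤½ ½≤p

      p≤1 : p ≤ 1#
      p≤1 = subst (_≤ 1#) (sym p≡) (≤-from 0≤½x (solve 1 (λ d → con (ℤ.+ 1) := con (ℤ.+ 1) :- d :+ d) refl (½ * x)))

      matroid-ratio : ∀ {W ET EB : ℝ} → p * W ≤ K * (p * ET) → EB ≤ K * ((1# - p) * ET) → γ * W ≤ (1# - p) * (ET - EB)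
      matroid-ratio {W} {ET} {EB} opt bad = ≤-trans
        (*-monoˡ-≤ γ 0≤γ (*-cancelˡ-≤ {x = W} {K * ET} (<-≤-trans (0<⁻¹ (0<fromℕ 2)) ½≤p)
          (subst (p * W ≤_) (solve 3 (λ k p t → k :* (p :* t) := p :* (k :* t)) refl K p ET) opt)))
        (≤-trans (≤-reflexive (solve 4 (λ h x k t → h :* x :* (h :* x) :* (k :* t) := (k :* x) :* (h :* x :* (h :* t))) refl ½ x K ET
            ■ cong (_* (½ * x * (½ * ET))) Kx≡1 ■ ℝ-Ring.*-identityˡ _))
          (subst (λ d → ½ * x * (½ * ET) ≤ d * (ET - EB)) (sym 1-p≡) (*-monoˡ-≤ (½ * x) 0≤½x
            (≤-from (0≤-≤ bad) (begin
              ET - EB ≡⟨ cong (_- EB) (sym (ℝ-Ring.*-identityˡ ET) ■ cong (_* ET) (sym ½+½)) ⟩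
              (½ + ½) * ET - EB ≡⟨ solve 3 (λ h t b → (h :+ h) :* t :- b := h :* t :+ (h :* t :- b)) refl ½ ET EB ⟩
              ½ * ET + (½ * ET - EB) ≡⟨ cong (λ z → ½ * ET + (z - EB)) ½ET≡ ⟩
              ½ * ET + (K * ((1# - p) * ET) - EB) ∎)))))
        where
        open ≡-Reasoning
        -- For this `p` the product k(1 - p) is one half, so the bad edges cost at most half of
        -- `ET`.
        ½ET≡ : ½ * ET ≡ K * ((1# - p) * ET)
        ½ET≡ = sym (cong (λ d → K * (d * ET)) 1-p≡ ■ solve 4 (λ k h x t → k :* (h :* x :* t) := (k :* x) :* (h :* t)) refl K ½ x ET
          ■ cong (_* (½ * ET)) Kx≡1 ■ ℝ-Ring.*-identityˡ _)

-- Instantiating the analysis for a market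

module Analysis ⦃ ℛ : RealNumbers ⦄ (M : Market)
  (kA : Fin (size (FA M)) → ℕ) (ℓB : Fin (size (FB M)) → ℕ)
  (growthA : ∀ j → IsGrowth (part (FAE M) j) (kA j)) (growthB : ∀ j → IsGrowth (part (FBE M) j) (ℓB j))
  (k : ℕ) (1≤k : 1 ℕ.≤ k) (load≤k : ∀ e → load M kA ℓB e ℕ.≤ k)
  (w : Weight (#E M)) (admissible : Admissible w) where

  private
    m n : ℕ
    m = #E M
    n = #A M
    0≤w : ∀ e → 0# ≤ w e
    0≤w = proj₁ admissible
    w-injective : Injective _≡_ _≡_ w
    w-injective = proj₂ admissible

    Part : Set
    Part = Fin (size (FA M)) ⊎ Fin (size (FB M))

    parts : List Part
    parts = map inj₁ (allFin (size (FA M))) ++ map inj₂ (allFin (size (FB M)))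

    system : Part → IndependenceSystem m
    system (inj₁ j) = part (FAE M) j
    system (inj₂ j) = part (FBE M) j

    growthOf : Part → ℕ
    growthOf (inj₁ j) = kA j
    growthOf (inj₂ j) = ℓB j

    growth : ∀ j → IsGrowth (system j) (growthOf j)
    growth (inj₁ j) = growthA j
    growth (inj₂ j) = growthB j

    ∈-parts₁ : ∀ j → inj₁ j ∈ˡ parts
    ∈-parts₁ j = Mem.∈-++⁺ˡ (Mem.∈-map⁺ inj₁ (Mem.∈-allFin j))

    ∈-parts₂ : ∀ j → inj₂ j ∈ˡ parts
    ∈-parts₂ j = Mem.∈-++⁺ʳ (map inj₁ (allFin (size (FA M)))) (Mem.∈-map⁺ inj₂ (Mem.∈-allFin j))

    feasible⇒indep : ∀ {X} → Feasible M X → ∀ j → Indep (system j) (X ∩ ground (system j))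
    feasible⇒indep (iA , iB) (inj₁ j) = iA j
    feasible⇒indep (iA , iB) (inj₂ j) = iB j

    infeasible⇒dep : ∀ {X} → ¬ Feasible M X → Any (λ j → ¬ Indep (system j) (X ∩ ground (system j))) parts
    infeasible⇒dep {X} ¬f with indep? (combined (FAE M)) X
    ... | no ¬iA with j , dep ← ¬∀⟶∃¬ _ _ (λ j → indep? (part (FAE M) j) (X ∩ ground (part (FAE M) j))) ¬iA =
      lose (∈-parts₁ j) dep
    ... | yes iA with j , dep ← ¬∀⟶∃¬ _ _ (λ j → indep? (part (FBE M) j) (X ∩ ground (part (FBE M) j))) (λ iB → ¬f (iA , iB)) =
      lose (∈-parts₂ j) dep

    ∑-load : ∀ e → ∑ parts (λ j → 𝟙 (lookup (ground (system j)) e) * fromℕ (growthOf j)) ≤ fromℕ k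
    ∑-load e = ≤-trans (≤-reflexive (
        ∑-++ (map inj₁ (allFin (size (FA M)))) _ _
        ■ cong₂ _+_ (∑-map inj₁ (allFin (size (FA M))) _ ■ sym (fromℕ-parts∋ (FAE M) kA e))
                    (∑-map inj₂ (allFin (size (FB M))) _ ■ sym (fromℕ-parts∋ (FBE M) ℓB e))
        ■ sym (fromℕ-+ (foldr ℕ._+_ 0 (map kA (parts∋ (FAE M) e))) (foldr ℕ._+_ 0 (map ℓB (parts∋ (FBE M) e))))))
      (fromℕ-mono-≤ (load≤k e))

    extend : ∀ {X e} → Feasible M X → Indep (combined (FBE M)) (X ∪ ⁅ e ⁆) → (∀ {x} → x ∈ X → agent M x ≢ agent M e) →
      agent M e ∉ Hull (FA M) (image (agent M) X) → Feasible M (X ∪ ⁅ e ⁆)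
    extend (iA , _) iB fresh a∉ = parallel-extend (agent M) (FA M) iA fresh a∉ , iB

    hullA⇒Blocked : ∀ {X e} → (∀ {x y} → x ∈ X → y ∈ X → agent M x ≡ agent M y → x ≡ y) → agent M e ∉ image (agent M) X →
      agent M e ∈ Hull (FA M) (image (agent M) X) → Any (λ j → Blocked (system j) X e) parts
    hullA⇒Blocked injective fresh a∈ = let j , blocked = Hull-lift (agent M) (FA M) injective fresh a∈ in lose (∈-parts₁ j) blocked

    hullB⇒Blocked : ∀ {X e} → e ∈ Hull (FBE M) X → e ∉ X → Any (λ j → Blocked (system j) X e) parts
    hullB⇒Blocked {X} e∈ e∉ = let j , blocked = Hull⇒Blocked (FBE M) e∈ e∉ in
      lose (∈-parts₂ j) (Blocked-mono (part (FBE M) j) (p∩q⊆p X (ground (part (FBE M) j))) blocked)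

  module _ {p q α : ℝ} (0≤p : 0# ≤ p) (p≤1 : p ≤ 1#) (𝒜 : OnlineAlgorithm m) (oocs : IsOOCS (FBE M) q α 𝒜)
    (source : RandomSource n (OnlineAlgorithm.seeds 𝒜)) where

    open IsOOCS oocs using (0≤q; q≤1; worstCase)
    open OnlineAlgorithm 𝒜 using (seeds; Seed; ALG)
    open RandomSource source using (Ω; space; time; order; bits; time-range)

    private
      0≤worst : ∀ X Y e → 0# ≤ worstCase w X Y e
      0≤worst X Y e = 0≤foldr₁-min (λ σ → ProbabilitySpace.ℙ seeds (λ r → does (e ∈? ALG r w Y σ))) (orderings (elements (X ─ Y)))
        λ σ → ProbabilitySpace.ℙ-≥0 seeds (accepted-measurable 𝒜 w (reveal w Y) [] σ (λ X → does (e ∈? X)))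

      worst≤ : ∀ X Y e σ → σ ↭ elements (X ─ Y) →
        worstCase w X Y e ≤ ProbabilitySpace.ℙ seeds (λ r → does (e ∈? ALG r w Y σ))
      worst≤ X Y e σ σ↭ = foldr₁-min≤ (λ σ → ProbabilitySpace.ℙ seeds (λ r → does (e ∈? ALG r w Y σ)))
        (orderings (elements (X ─ Y))) (∈-orderings⁺ (elements (X ─ Y)) σ↭)

    private
      𝒢 : GreedySystem m n
      𝒢 = record
        { agentOf = agent M ; w = w ; w-injective = w-injective ; 0≤w = 0≤w
        ; F = Feasible M ; F? = feasible? M ; F-mono = Feasible-mono M ; F-∅ = ∅-feasible M ; F-agent = Feasible-agent M
        ; add = addIfFeasible M ; add-view = addIfFeasible-view M
        }

      𝒞 : GrowthComponents 𝒢
      𝒞 = record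
        { js = parts ; sys = system ; κ = growthOf ; k = k ; 1≤k = 1≤k ; growth = growth
        ; F⇒indep = feasible⇒indep ; ¬F⇒dep = infeasible⇒dep ; load≤k = ∑-load
        }

      ℋ : HullSystem 𝒢
      ℋ = record
        { hull = Hull (FA M) ; hull-mono = Hull-mono (FA M) ; hull-∅ = λ f → indep⇒∉Hull∅ (agent M) (FA M) (proj₁ f)
        ; Item = Indep (combined (FBE M)) ; Item-mono = λ {X} {Y} → downward (combined (FBE M)) {Y} {X} ; extend = extend
        }

      ℬ : BlockingHulls 𝒢 𝒞 ℋ
      ℬ = record { hull⇒Blocked = hullA⇒Blocked ; hullB = Hull (FBE M) ; hullB⇒Blocked = hullB⇒Blocked }

      𝒪 : ItemAlgorithm 𝒢 ℋ
      𝒪 = record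
        { 𝒜 = 𝒜 ; accepted-Item = IsOOCS.feasible oocs w admissible
        ; worst = worstCase w ; 0≤worst = 0≤worst ; worst≤ = worst≤
        }

    module Bound = Ratio 𝒢 𝒞 ℋ ℬ 𝒪 0≤p p≤1 0≤q q≤1
      (λ {X} {e} e∈ e∉Hull → IsOOCS.selects oocs w admissible X e (Core⁺ (FBE M) w e∈ e∉Hull))
      source

    private
      module Run (ω : Ω) = FreeOrder M p q 𝒜 w (time ω) (order ω) (bits ω)
      module D = Discretise 0≤p p≤1 0≤q q≤1 source (suc m)

    output : Ω → Subset m
    output = Run.output

    private
      runFrom : Subset n → Subset n → Subset n → Subset n → (ℕ → List (Fin n)) → Seed → Subset m
      runFrom Y S₀ S₁ S₂ ord r = Proc.process (OnlineAlgorithm.decide 𝒜 r (reveal w (Rel M w Y ∩ δ M S₀))) [] ∅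
        (Proc.present (λ a → toprel M w a Y) (Sch.schedule ord 0 ∅ (sortDecreasing w (elements (Rel M w Y ∩ δ M S₁))) S₂))
        where
        module Proc = Process (agent M) w (Feasible M) (addIfFeasible M) (addIfFeasible-view M)
        module Sch = Schedule (agent M) (Hull (FA M))

      output≡run : ∀ ω → output ω ≡ runFrom (at inY (D.phasesAt ω)) (at inS₀ (D.phasesAt ω)) (at inS₁ (D.phasesAt ω)) (at inS₂ (D.phasesAt ω))
        (order ω) (bits ω)
      output≡run ω = output≡process M p q 𝒜 w (time ω) (order ω) (bits ω)
        ■ cong₂ (λ Y S₀ → runFrom Y S₀ (Run.S₁ ω) (Run.S₂ ω) (order ω) (bits ω)) W.Y≡ W.S₀≡
        ■ cong₂ (λ S₁ S₂ → runFrom (at inY (D.phasesAt ω)) (at inS₀ (D.phasesAt ω)) S₁ S₂ (order ω) (bits ω)) W.S₁≡ W.S₂≡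
        where module W = WindowSets 0≤p p≤1 0≤q q≤1 (time ω) (time-range ω)

    utility-ratio : ∀ {γ : ℝ} → 0# ≤ γ →
      (∀ {W : ℝ} → p * W ≤ fromℕ k * (p * Bound.ET) → p * Bound.EB ≤ fromℕ k * ((1# - p) * Bound.ET) →
        ((∀ j → growthOf j ≡ 1) → Bound.EB ≤ fromℕ k * ((1# - p) * Bound.ET)) → γ * W ≤ (1# - p) * (Bound.ET - Bound.EB)) →
      ∀ T → IsOPT M w T → α * (1# - q) * (½ * ½) * γ * weight w T ≤ 𝔼 space w output
    utility-ratio 0≤γ ratio T (fT , _) = Bound.utility-ratio output output≡run 0≤γ ratio T fT

module _ ⦃ ℛ : RealNumbers ⦄ where
  open ℝ-Solver using (solve; con; _:+_; _:*_; _:-_; :-_; _:=_)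

  ≤-maximum : ∀ {I : Set} (f : I → ℕ) {xs x} → x ∈ˡ xs → f x ℕ.≤ foldr ℕ._⊔_ 0 (map f xs)
  ≤-maximum f {x ∷ xs} (here refl) = ℕ.m≤m⊔n (f x) _
  ≤-maximum f {y ∷ xs} (there x∈)  = ℕ.≤-trans (≤-maximum f x∈) (ℕ.m≤n⊔m (f y) _)

  ≤-sum : ∀ {I : Set} (f : I → ℕ) {xs x} → x ∈ˡ xs → f x ℕ.≤ foldr ℕ._+_ 0 (map f xs)
  ≤-sum f {x ∷ xs} (here refl) = ℕ.m≤m+n (f x) _
  ≤-sum f {y ∷ xs} (there x∈)  = ℕ.≤-trans (≤-sum f x∈) (ℕ.m≤n+m _ (f y))

  sum-ones : ∀ {I : Set} (f : I → ℕ) → (∀ x → f x ≡ 1) → ∀ xs → foldr ℕ._+_ 0 (map f xs) ≡ length xs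
  sum-ones f f≡1 []       = refl
  sum-ones f f≡1 (x ∷ xs) = cong₂ ℕ._+_ (f≡1 x) (sum-ones f f≡1 xs)

  -- An edge exists, some agent-side component covers it, and growth constants are at least one;
  -- this makes division by k meaningful.
  1≤maxLoad : (M : Market) (kA : Fin (size (FA M)) → ℕ) (ℓB : Fin (size (FB M)) → ℕ) →
    (∀ j → IsGrowth (part (FAE M) j) (kA j)) → NonZero (#E M) → 1 ℕ.≤ maxLoad M kA ℓB
  1≤maxLoad M kA ℓB growthA #E≢0 = ℕ.≤-trans (proj₁ (growthA j)) (ℕ.≤-trans
    (≤-sum kA (Mem.∈-filter⁺ (λ j → e ∈? ground (part (FAE M) j)) (Mem.∈-allFin j) e∈))
    (ℕ.≤-trans (ℕ.m≤m+n _ (foldr ℕ._+_ 0 (map ℓB (parts∋ (FBE M) e)))) (≤-maximum (load M kA ℓB) (Mem.∈-allFin e))))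
    where
    e : Fin (#E M)
    e = fromℕ< (ℕ.>-nonZero⁻¹ (#E M) ⦃ #E≢0 ⦄)
    j = proj₁ (Combination.cover (FAE M) e)
    e∈ = proj₂ (Combination.cover (FAE M) e)

theorem7 :
    ⦃ ℛ : RealNumbers ⦄ (M : Market)
    (kA : Fin (size (FA M)) → ℕ) (ℓB : Fin (size (FB M)) → ℕ) →
    (∀ j → IsGrowth (part (FAE M) j) (kA j)) →
    (∀ j → IsGrowth (part (FBE M) j) (ℓB j)) →
    (q α : ℝ) (𝒜 : OnlineAlgorithm (#E M)) → IsOOCS (FBE M) q α 𝒜 →
    (NonZero (#E M) → (k : ℕ) → k ≡ maxLoad M kA ℓB →
      (p s : ℝ) →
      IsSqrt p (1# - 1# / fromℕ (k ℕ.+ 1)) →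
      IsSqrt s (1# + 1# / fromℕ k) →
      HasUtilityRatio M p q 𝒜
        (α * (1# - q) / fromℕ 4 * (fromℕ 2 - fromℕ 2 * s + 1# / fromℕ k))
      ×
      1# / fromℕ (16 ℕ.* k ℕ.^ 2) - 1# / fromℕ (32 ℕ.* k ℕ.^ 3)
        < 1# / fromℕ 4 * (fromℕ 2 - fromℕ 2 * s + 1# / fromℕ k))
    ×
    ((∀ j → kA j ≡ 1) → (∀ j → ℓB j ≡ 1) → (k : ℕ) → NonZero k →
      (∀ e → length (parts∋ (FAE M) e) ℕ.+ length (parts∋ (FBE M) e) ℕ.≤ k) →
      HasUtilityRatio M (1# - 1# / fromℕ (2 ℕ.* k)) q 𝒜
        (α * (1# - q) / fromℕ (16 ℕ.* k ℕ.^ 2)))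
theorem7 M kA ℓB growthA growthB q α 𝒜 oocs = growth-case , matroid-case
  where
  open ℝ-Solver using (solve; con; _:+_; _:*_; _:-_; :-_; _:=_)

  growth-case : NonZero (#E M) → (k : ℕ) → k ≡ maxLoad M kA ℓB → (p s : ℝ) →
    IsSqrt p (1# - 1# / fromℕ (k ℕ.+ 1)) → IsSqrt s (1# + 1# / fromℕ k) →
    HasUtilityRatio M p q 𝒜 (α * (1# - q) / fromℕ 4 * (fromℕ 2 - fromℕ 2 * s + 1# / fromℕ k)) ×
    1# / fromℕ (16 ℕ.* k ℕ.^ 2) - 1# / fromℕ (32 ℕ.* k ℕ.^ 3) < 1# / fromℕ 4 * (fromℕ 2 - fromℕ 2 * s + 1# / fromℕ k)
  growth-case #E≢0 k k≡ p s p√ s√ =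
    (λ w adm source →
      (λ ω → output-feasible M p q 𝒜 w (RandomSource.time source ω) (RandomSource.order source ω) (RandomSource.bits source ω)) ,
      λ T opt → ≤-trans (≤-reflexive (cong (_* weight w T) ratio≡))
        (Analysis.utility-ratio M kA ℓB growthA growthB k 1≤k load≤k w adm G.0≤p G.p≤1 𝒜 oocs source
          G.0≤γ (λ W≤ bad _ → G.growth-ratio W≤ bad) T opt)) ,
    G.strict
    where
    1≤k : 1 ℕ.≤ k
    1≤k = subst (1 ℕ.≤_) (sym k≡) (1≤maxLoad M kA ℓB growthA #E≢0)
    instance
      k≢0 : NonZero k
      k≢0 = ℕ.>-nonZero 1≤k
    module G = GrowthBound k {p} {s} p√ s√
    load≤k : ∀ e → load M kA ℓB e ℕ.≤ k
    load≤k e = subst (load M kA ℓB e ℕ.≤_) (sym k≡) (≤-maximum (load M kA ℓB) (Mem.∈-allFin e))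
    ratio≡ : α * (1# - q) / fromℕ 4 * G.γ ≡ α * (1# - q) * (½ * ½) * G.γ
    ratio≡ = cong (λ z → α * (1# - q) * z * G.γ) (sym (ℝ-Ring.*-identityˡ _) ■ ¼)

  matroid-case : (∀ j → kA j ≡ 1) → (∀ j → ℓB j ≡ 1) → (k : ℕ) → NonZero k →
    (∀ e → length (parts∋ (FAE M) e) ℕ.+ length (parts∋ (FBE M) e) ℕ.≤ k) →
    HasUtilityRatio M (1# - 1# / fromℕ (2 ℕ.* k)) q 𝒜 (α * (1# - q) / fromℕ (16 ℕ.* k ℕ.^ 2))
  matroid-case kA≡1 ℓB≡1 k k≢0 count≤k w adm source =
    (λ ω → output-feasible M B.p q 𝒜 w (RandomSource.time source ω) (RandomSource.order source ω) (RandomSource.bits source ω)) ,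
    λ T opt → ≤-trans (≤-reflexive (cong (_* weight w T) ratio≡))
      (Analysis.utility-ratio M kA ℓB growthA growthB k (ℕ.>-nonZero⁻¹ k ⦃ k≢0 ⦄) load≤k w adm B.0≤p B.p≤1 𝒜 oocs source
        B.0≤γ (λ W≤ _ bad → B.matroid-ratio W≤ (bad λ { (inj₁ j) → kA≡1 j ; (inj₂ j) → ℓB≡1 j })) T opt)
    where
    module B = MatroidBound k ⦃ k≢0 ⦄
    load≤k : ∀ e → load M kA ℓB e ℕ.≤ k
    load≤k e = subst (ℕ._≤ k) (sym (cong₂ ℕ._+_ (sum-ones kA kA≡1 (parts∋ (FAE M) e)) (sum-ones ℓB ℓB≡1 (parts∋ (FBE M) e)))) (count≤k e)
    ratio≡ : α * (1# - q) / fromℕ (16 ℕ.* k ℕ.^ 2) ≡ α * (1# - q) * (½ * ½) * B.γ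
    ratio≡ = cong (α * (1# - q) *_) (sym (ℝ-Ring.*-identityˡ _) ■ 1/16k² k ⦃ k≢0 ⦄) ■ sym (ℝ-Ring.*-assoc _ _ _)
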